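{- Let $G(M(C_4))$ denote the final graph of the $C_4$-free process on $n$ vertices. There exists a constant $\kappa>0$ such that, with probability tending to $1$ as $n\to\infty$, the maximum degree satisfies $\Delta(G(M(C_4))) \le \kappa\, (n \log n)^{1/3}$.
   Context: The $C_4$-free process on vertex set $[n]=\{1,\dots,n\}$: start with the graph $G(0)$ with no edges; given $G(i-1)$, form $G(i)=G(i-1)+e_i$ where $e_i$ is chosen uniformly at random among all pairs of vertices that are not edges of $G(i-1)$ and whose addition does not create a copy of the $4$-cycle $C_4$. The process stops when no such pair exists; the final graph is the maximal $C_4$-free graph $G(M(C_4))$, where $M(C_4)$ is its (random) number of edges. -}

module Defs where

open import Data.Bool using (Bool; true; false; _∧_; _∨_; not; if_then_else_)
open import Data.Nat as ℕ using (ℕ; zero; suc; _⊔_)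
open import Data.Fin using (Fin; toℕ)
open import Data.Fin.Properties using () renaming (_≟_ to _≟ᶠ_)
open import Data.Nat.Properties using () renaming (_<?_ to _<?ⁿ_)
open import Data.Bool.ListAction using (any)
open import Data.List using (List; []; _∷_; allFin; concatMap; filterᵇ; length; foldr; map)
open import Data.Product using (_×_; _,_)
open import Data.Integer using (+_)
open import Data.Rational using (ℚ; _/_; _+_; _*_; 0ℚ; 1ℚ)
open import Relation.Nullary.Decidable using (isYes)

-- A graph on vertex set Fin n is given by its list of edges;
-- an edge {i,j} is stored as a pair (i , j) with toℕ i < toℕ j.
Graph : ℕ → Set
Graph n = List (Fin n × Fin n)

_==_ : ∀ {n} → Fin n → Fin n → Bool
i == j = isYes (i ≟ᶠ j)

adj : ∀ {n} → Graph n → Fin n → Fin n → Bool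
adj G x y = any (λ { (a , b) → ((a == x) ∧ (b == y)) ∨ ((a == y) ∧ (b == x)) }) G

hasC4 : ∀ {n} → Graph n → Bool
hasC4 {n} G =
  any (λ a → any (λ b → any (λ c → any (λ d →
    not (a == b) ∧ not (a == c) ∧ not (a == d) ∧
    not (b == c) ∧ not (b == d) ∧ not (c == d) ∧
    adj G a b ∧ adj G b c ∧ adj G c d ∧ adj G d a)
    (allFin n)) (allFin n)) (allFin n)) (allFin n)

allPairs : ∀ n → List (Fin n × Fin n)
allPairs n = concatMap (λ i → map (λ j → (i , j))
               (filterᵇ (λ j → isYes (toℕ i <?ⁿ toℕ j)) (allFin n))) (allFin n)

admissible : ∀ {n} → Graph n → List (Fin n × Fin n)
admissible {n} G =
  filterᵇ (λ { (i , j) → not (adj G i j) ∧ not (hasC4 ((i , j) ∷ G)) }) (allPairs n)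

indicator : Bool → ℚ
indicator true  = 1ℚ
indicator false = 0ℚ

sumℚ : List ℚ → ℚ
sumℚ = foldr _+_ 0ℚ

-- Probability (exact, rational) that the final graph of the C₄-free process,
-- started from G, satisfies P.  Each step picks uniformly among admissible pairs.
-- The fuel argument only guarantees termination: every step adds an edge and there
-- are fewer than n*n pairs, so with fuel n*n from the empty graph it never runs out.
finalProb : ∀ {n} → ℕ → (Graph n → Bool) → Graph n → ℚ
finalProb zero    P G = indicator (P G)
finalProb (suc f) P G with admissible G
... | []     = indicator (P G)
... | e ∷ es = sumℚ (map (λ e′ → finalProb f P (e′ ∷ G)) (e ∷ es))
               * (+ 1 / length (e ∷ es))

processProb : (n : ℕ) → (Graph n → Bool) → ℚ
processProb n P = finalProb (n ℕ.* n) P []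

degree : ∀ {n} → Graph n → Fin n → ℕ
degree G v = length (filterᵇ (λ { (a , b) → (a == v) ∨ (b == v) }) G)

maxDegree : ∀ {n} → Graph n → ℕ
maxDegree {n} G = foldr (λ v m → degree G v ⊔ m) 0 (allFin n)

-- During the first m = 2LSn steps, where S ≈ n^{1/3} and L ≈ c (log n)^{1/3}, the
-- process follows its expected trajectory: the degrees, the numbers of open pairs at a vertex, and for each
-- pair x, y the numbers of vertices b for which xb, by are both open, or xb is an edge and by is open, stay
-- within a factor 1 ± ε of their targets, while the numbers of walks of length 3 stay polylogarithmic. The
-- proof uses one potential, the sum of the K-th powers of all squared normalised deviations with K ≈ log n:
-- since the next edge is uniform among the open pairs and ε grows at a suitable rate, its average over the
-- next edge increases by at most a negligible amount, and while it is below 1 all counts are within tolerance.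
-- In particular all degrees are O(LS) after m steps. The edges added at a vertex v later join v to vertices
-- that pairwise have no common neighbour in the graph after m steps, as the final graph is C₄-free. But during
-- the last m/2 of the m steps each u-tuple of vertices without common neighbours acquires a pair
-- with a common neighbour at every step with probability at least r, and r m/2 exceeds u log n for
-- u = M L S; so a union bound over the n^u tuples excludes such tuples, and v gains at most u further edges.

module Submission where

open import Defs

-- The law of the process is an exact rational given by the recursion `finalProb`, so stopping times
-- and martingale inequalities are replaced by induction on the fuel: a potential Ψ whose average
-- over the next edge does not exceed its value, as long as it is below 1, bounds the probability of
-- success from below by 1 - Ψ, and this bound is trivial wherever Ψ ≥ 1. The obstacle is that the
-- errors of the counts feed one another: a pair xy is closed at a rate that is a sum of mixed
-- counts `Nm` over neighbours, `Nm` gains from `Cm`, and `Cm` decays at the closing rates. No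
-- self-correction is exploited. The tolerance ε just grows by the factor 1 + 256ρ per step, with ρ
-- of order L²S²/n², hence by exp(O(L³)) over m = 2LSn steps. This is a small power of n when L³ is
-- a small multiple of log n, which fixes the length of the run. Walks of length 3 are followed
-- because otherwise one edge might change `Nm`, which is only of order n^{1/3}, by as much as its
-- own size.

module Development where
  open import Data.Bool as Bool using (Bool; true; false; _∧_; _∨_; not)
  open import Data.Bool.ListAction using (any)
  open import Data.Nat as ℕ using (ℕ; zero; suc)
  import Data.Nat.DivMod as ℕD
  import Data.Nat.Properties as ℕP
  open import Data.Nat.Logarithm using (⌊log₂_⌋; ⌊log₂⌋-mono-≤; ⌊log₂[2^n]⌋≡n)
  open import Data.Nat.Tactic.RingSolver using () renaming (solve-∀ to solveℕ)
  open import Data.Fin using (Fin; zero; suc; toℕ)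
  open import Data.Fin.Properties using (toℕ-injective) renaming (_≟_ to _≟ᶠ_)
  import Data.Integer as ℤ
  import Data.Integer.Properties as ℤP
  open import Data.Rational using (ℚ; mkℚ; _/_; _+_; _*_; _-_; -_; 0ℚ; 1ℚ; ½; _≤_; _<_; toℚᵘ; 1/_; positive; nonNegative; ≢-nonZero; Positive)
  open import Data.Rational.Properties as ℚP using (≤-refl; ≤-trans; ≤-reflexive; _≟_)
  import Data.Rational.Unnormalised as ℚᵘ
  import Data.Rational.Unnormalised.Properties as ℚᵘP
  open import Data.List using (List; []; _∷_; _++_; map; concatMap; filterᵇ; length; allFin; tabulate; foldr)
  open import Data.List.Membership.Propositional using (_∈_)
  open import Data.List.Membership.Propositional.Properties using (∈-allFin)
  open import Data.List.Relation.Unary.Any using (here; there)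
  open import Data.Vec using (Vec; []; _∷_)
  open import Data.Vec.Relation.Unary.All using (All; []; _∷_)
  open import Data.Maybe using (Maybe; just; nothing)
  open import Data.Product using (_×_; _,_; proj₁; proj₂; Σ; ∃)
  open import Data.Sum using (_⊎_; inj₁; inj₂; [_,_]′)
  open import Data.Empty using (⊥; ⊥-elim)
  open import Level using (0ℓ)
  open import Relation.Binary.Definitions using (tri<; tri≈; tri>)
  open import Relation.Binary.PropositionalEquality hiding (J)
  open import Relation.Nullary using (yes; no; ¬_)
  open import Relation.Nullary.Decidable using (isYes)
  open import Tactic.RingSolver.Core.AlmostCommutativeRing using (AlmostCommutativeRing; fromCommutativeRing)

  -- Rational arithmetic

  isZero? : ∀ x → Maybe (0ℚ ≡ x)
  isZero? x with 0ℚ ≟ x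
  ... | yes p = just p
  ... | no _ = nothing

  ℚring : AlmostCommutativeRing 0ℓ 0ℓ
  ℚring = fromCommutativeRing ℚP.+-*-commutativeRing isZero?

  open import Tactic.RingSolver.NonReflective ℚring using (Expr; Κ; _⊕_; _⊗_; ⊝_; _⊜_; solve)

  infixl 6 _⊖_

  _⊖_ : ∀ {n} → Expr ℚ n → Expr ℚ n → Expr ℚ n
  a ⊖ b = a ⊕ ⊝ b

  ι : ℕ → ℚ
  ι k = ℤ.+ k / 1

  0≤ι : ∀ k → 0ℚ ≤ ι k
  0≤ι k = ℚP.nonNegative⁻¹ (ι k) {{ℚP.normalize-nonNeg k 1}}

  toℚᵘ-ι : ∀ k → toℚᵘ (ι k) ℚᵘ.≃ ((ℤ.+ k) ℚᵘ./ 1)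
  toℚᵘ-ι k = ℚP.toℚᵘ-fromℚᵘ (ℚᵘ.mkℚᵘ (ℤ.+ k) 0)

  ι-+ : ∀ a b → ι (a ℕ.+ b) ≡ ι a + ι b
  ι-+ a b = ℚP.toℚᵘ-injective (ℚᵘP.≃-trans (toℚᵘ-ι (a ℕ.+ b)) (ℚᵘP.≃-trans lem
    (ℚᵘP.≃-sym (ℚᵘP.≃-trans (ℚP.toℚᵘ-homo-+ (ι a) (ι b)) (ℚᵘP.+-cong (toℚᵘ-ι a) (toℚᵘ-ι b))))))
    where
    lem : ((ℤ.+ (a ℕ.+ b)) ℚᵘ./ 1) ℚᵘ.≃ ((ℤ.+ a) ℚᵘ./ 1) ℚᵘ.+ ((ℤ.+ b) ℚᵘ./ 1)
    lem = ℚᵘ.*≡* (cong (ℤ._* (ℤ.+ 1)) (cong₂ ℤ._+_ (sym (ℤP.*-identityʳ (ℤ.+ a))) (sym (ℤP.*-identityʳ (ℤ.+ b)))))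

  ι-* : ∀ a b → ι (a ℕ.* b) ≡ ι a * ι b
  ι-* a b = ℚP.toℚᵘ-injective (ℚᵘP.≃-trans (toℚᵘ-ι (a ℕ.* b)) (ℚᵘP.≃-trans lem
    (ℚᵘP.≃-sym (ℚᵘP.≃-trans (ℚP.toℚᵘ-homo-* (ι a) (ι b)) (ℚᵘP.*-cong (toℚᵘ-ι a) (toℚᵘ-ι b))))))
    where
    lem : ((ℤ.+ (a ℕ.* b)) ℚᵘ./ 1) ℚᵘ.≃ ((ℤ.+ a) ℚᵘ./ 1) ℚᵘ.* ((ℤ.+ b) ℚᵘ./ 1)
    lem = ℚᵘ.*≡* (cong (ℤ._* (ℤ.+ 1)) (ℤP.pos-* a b))

  ι-suc : ∀ a → ι (suc a) ≡ 1ℚ + ι a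
  ι-suc a = ι-+ 1 a

  infixl 6 _⊞_
  infixl 7 _⊠_

  _⊞_ : ∀ {a b} → 0ℚ ≤ a → 0ℚ ≤ b → 0ℚ ≤ a + b
  _⊞_ {a} {b} p q = ≤-trans (≤-reflexive refl) (ℚP.+-mono-≤ p q)

  mulˡ : ∀ {a b c} → 0ℚ ≤ c → a ≤ b → c * a ≤ c * b
  mulˡ {c = c} h p = ℚP.*-monoˡ-≤-nonNeg c {{nonNegative h}} p

  mulʳ : ∀ {a b c} → 0ℚ ≤ c → a ≤ b → a * c ≤ b * c
  mulʳ {c = c} h p = ℚP.*-monoʳ-≤-nonNeg c {{nonNegative h}} p

  _⊠_ : ∀ {a b} → 0ℚ ≤ a → 0ℚ ≤ b → 0ℚ ≤ a * b
  _⊠_ {a} {b} p q = ≤-trans (≤-reflexive (sym (ℚP.*-zeroʳ a))) (mulˡ p q)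

  -- Most inequalities below are certificates: `e` is a visibly nonnegative combination of the
  -- hypotheses, and the ring solver checks the identity.
  cert : ∀ {a b e} → 0ℚ ≤ e → b ≡ a + e → a ≤ b
  cert {a} {b} {e} p eq = ≤-trans (≤-reflexive (sym (ℚP.+-identityʳ a)))
    (≤-trans (ℚP.+-monoʳ-≤ a p) (≤-reflexive (sym eq)))

  sub : ∀ {a b} → a ≤ b → 0ℚ ≤ b - a
  sub {a} {b} p = ≤-trans (≤-reflexive (sym (ℚP.+-inverseʳ a))) (ℚP.+-monoˡ-≤ (- a) p)

  unsub : ∀ {a b} → 0ℚ ≤ b - a → a ≤ b
  unsub {a} {b} p = cert p (lem a b)
    where lem : ∀ a b → b ≡ a + (b - a)
          lem = solve 2 (λ a b → (b) ⊜ (a ⊕ (b ⊖ a))) refl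

  mul≤ : ∀ {a b c d} → 0ℚ ≤ a → a ≤ b → 0ℚ ≤ c → c ≤ d → a * c ≤ b * d
  mul≤ a0 ab c0 cd = ≤-trans (mulʳ c0 ab) (mulˡ (≤-trans a0 ab) cd)

  add≤ : ∀ {a b c d} → a ≤ b → c ≤ d → a + c ≤ b + d
  add≤ = ℚP.+-mono-≤

  neg≤ : ∀ {a b} → a ≤ b → - b ≤ - a
  neg≤ = ℚP.neg-antimono-≤

  0≤1 : 0ℚ ≤ 1ℚ
  0≤1 = 0≤ι 1

  total : ∀ a b → (a ≤ b) ⊎ (b ≤ a)
  total = ℚP.≤-total

  sq≥0 : ∀ x → 0ℚ ≤ x * x
  sq≥0 x with total 0ℚ x
  ... | inj₁ p = p ⊠ p
  ... | inj₂ p = ≤-trans (neg≤ p ⊠ neg≤ p) (≤-reflexive (lem x))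
    where lem : ∀ x → (- x) * (- x) ≡ x * x
          lem = solve 1 (λ x → ((⊝ x) ⊗ (⊝ x)) ⊜ (x ⊗ x)) refl

  cancel-* : ∀ {a b c} → 0ℚ < c → a * c ≤ b * c → a ≤ b
  cancel-* {c = c} h = ℚP.*-cancelʳ-≤-pos c {{positive h}}

  ι-mono : ∀ {a b} → a ℕ.≤ b → ι a ≤ ι b
  ι-mono {a} {b} p = cert (0≤ι (b ℕ.∸ a)) (trans (cong ι (sym (ℕP.m+[n∸m]≡n p))) (ι-+ a (b ℕ.∸ a)))

  0<1 : 0ℚ < 1ℚ
  0<1 = ℚP.positive⁻¹ 1ℚ

  ι-pos : ∀ k → 0ℚ < ι (suc k)
  ι-pos k = ℚP.<-≤-trans 0<1 (ι-mono {1} {suc k} (ℕ.s≤s ℕ.z≤n))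

  <⇒≤ : ∀ {a b} → a < b → a ≤ b
  <⇒≤ = ℚP.<⇒≤

  *-pos : ∀ {a b} → 0ℚ < a → 0ℚ < b → 0ℚ < a * b
  *-pos {a} {b} p q = ℚP.positive⁻¹ (a * b) {{ℚP.pos*pos⇒pos a {{positive p}} b {{positive q}}}}

  opaque
    -- inv 0 = 0
    inv : ℚ → ℚ
    inv x with x ≟ 0ℚ
    ... | yes _ = 0ℚ
    ... | no p = (1/ x) {{≢-nonZero p}}

    inv-* : ∀ {x} → 0ℚ < x → x * inv x ≡ 1ℚ
    inv-* {x} p with x ≟ 0ℚ
    ... | yes e = ⊥-elim (ℚP.<⇒≢ p (sym e))
    ... | no q = ℚP.*-inverseʳ x {{_}}

    inv-pos : ∀ {x} → 0ℚ < x → 0ℚ < inv x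
    inv-pos {x} p with x ≟ 0ℚ
    ... | yes e = ⊥-elim (ℚP.<⇒≢ p (sym e))
    ... | no q = ℚP.positive⁻¹ _ {{ℚP.1/pos⇒pos x {{positive p}}}}

    inv-uniq : ∀ {x y} → 0ℚ < x → x * y ≡ 1ℚ → y ≡ inv x
    inv-uniq {x} {y} p e = trans (lem1 y) (trans (cong (λ u → y * u) (sym (inv-* p))) (trans (lem2 x y (inv x)) (trans (cong (λ u → inv x * u) e) (ℚP.*-identityʳ (inv x)))))
      where
      lem1 : ∀ y → y ≡ y * 1ℚ
      lem1 = solve 1 (λ y → (y) ⊜ (y ⊗ Κ 1ℚ)) refl
      lem2 : ∀ x y i → y * (x * i) ≡ i * (x * y)
      lem2 = solve 3 (λ x y i → (y ⊗ (x ⊗ i)) ⊜ (i ⊗ (x ⊗ y))) refl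

  pow : ℚ → ℕ → ℚ
  pow x zero = 1ℚ
  pow x (suc k) = x * pow x k

  pow-nonneg : ∀ {x} k → 0ℚ ≤ x → 0ℚ ≤ pow x k
  pow-nonneg zero h = 0≤1
  pow-nonneg (suc k) h = h ⊠ pow-nonneg k h

  pow-pos : ∀ {x} k → 0ℚ < x → 0ℚ < pow x k
  pow-pos zero h = 0<1
  pow-pos (suc k) h = *-pos h (pow-pos k h)

  pow-mono : ∀ {x y} k → 0ℚ ≤ x → x ≤ y → pow x k ≤ pow y k
  pow-mono zero h p = ≤-refl
  pow-mono (suc k) h p = mul≤ h p (pow-nonneg k h) (pow-mono k h p)

  pow-* : ∀ x y k → pow (x * y) k ≡ pow x k * pow y k
  pow-* x y zero = refl
  pow-* x y (suc k) = trans (cong (x * y *_) (pow-* x y k)) (lem x y (pow x k) (pow y k))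
    where lem : ∀ x y a b → x * y * (a * b) ≡ x * a * (y * b)
          lem = solve 4 (λ x y a b → (x ⊗ y ⊗ (a ⊗ b)) ⊜ (x ⊗ a ⊗ (y ⊗ b))) refl

  pow-+ : ∀ x j k → pow x (j ℕ.+ k) ≡ pow x j * pow x k
  pow-+ x zero k = sym (ℚP.*-identityˡ _)
  pow-+ x (suc j) k = trans (cong (x *_) (pow-+ x j k)) (sym (ℚP.*-assoc x _ _))

  pow-1 : ∀ k → pow 1ℚ k ≡ 1ℚ
  pow-1 zero = refl
  pow-1 (suc k) = trans (ℚP.*-identityˡ _) (pow-1 k)

  pow-≤1 : ∀ {x} k → 0ℚ ≤ x → x ≤ 1ℚ → pow x k ≤ 1ℚ
  pow-≤1 k h p = ≤-trans (pow-mono k h p) (≤-reflexive (pow-1 k))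

  pow-≥1 : ∀ {x} k → 1ℚ ≤ x → 1ℚ ≤ pow x k
  pow-≥1 k p = ≤-trans (≤-reflexive (sym (pow-1 k))) (pow-mono k 0≤1 p)

  -- The value `x` may be negative down to -1; this is what later bounds powers of 1 - x from below.
  bernoulli : ∀ {x} k → 0ℚ ≤ 1ℚ + x → 1ℚ + ι k * x ≤ pow (1ℚ + x) k
  bernoulli {x} zero h = ≤-reflexive (lem x)
    where lem : ∀ x → 1ℚ + ι 0 * x ≡ 1ℚ
          lem = solve 1 (λ x → (Κ 1ℚ ⊕ Κ (ι 0) ⊗ x) ⊜ (Κ 1ℚ)) refl
  bernoulli {x} (suc k) h = ≤-trans (cert (0≤ι k ⊠ sq≥0 x)
      (trans (lem x (ι k)) (cong (λ u → 1ℚ + u * x + ι k * (x * x)) (sym (ι-suc k)))))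
      (mulˡ h (bernoulli k h))
    where lem : ∀ x j → (1ℚ + x) * (1ℚ + j * x) ≡ 1ℚ + (1ℚ + j) * x + j * (x * x)
          lem = solve 2 (λ x j → ((Κ 1ℚ ⊕ x) ⊗ (Κ 1ℚ ⊕ j ⊗ x)) ⊜ (Κ 1ℚ ⊕ (Κ 1ℚ ⊕ j) ⊗ x ⊕ j ⊗ (x ⊗ x))) refl

  ⟦_⟧ : Bool → ℚ
  ⟦_⟧ = indicator

  ⟦⟧≥0 : ∀ b → 0ℚ ≤ ⟦ b ⟧
  ⟦⟧≥0 true = 0≤1
  ⟦⟧≥0 false = ≤-refl

  ⟦⟧≤1 : ∀ b → ⟦ b ⟧ ≤ 1ℚ
  ⟦⟧≤1 true = ≤-refl
  ⟦⟧≤1 false = 0≤1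

  -- Finite sums

  opaque
    ∑ : ∀ {n} → (Fin n → ℚ) → ℚ
    ∑ {zero} f = 0ℚ
    ∑ {suc n} f = f zero + ∑ (λ i → f (suc i))

    ∑-cong : ∀ {n} {f g : Fin n → ℚ} → (∀ i → f i ≡ g i) → ∑ f ≡ ∑ g
    ∑-cong {zero} h = refl
    ∑-cong {suc n} h = cong₂ _+_ (h zero) (∑-cong (λ i → h (suc i)))

    ∑-mono : ∀ {n} {f g : Fin n → ℚ} → (∀ i → f i ≤ g i) → ∑ f ≤ ∑ g
    ∑-mono {zero} h = ≤-refl
    ∑-mono {suc n} h = add≤ (h zero) (∑-mono (λ i → h (suc i)))

    ∑-+ : ∀ {n} (f g : Fin n → ℚ) → ∑ (λ i → f i + g i) ≡ ∑ f + ∑ g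
    ∑-+ {zero} f g = refl
    ∑-+ {suc n} f g = trans (cong (f zero + g zero +_) (∑-+ (λ i → f (suc i)) (λ i → g (suc i)))) (lem (f zero) (g zero) _ _)
      where lem : ∀ a b c d → a + b + (c + d) ≡ a + c + (b + d)
            lem = solve 4 (λ a b c d → (a ⊕ b ⊕ (c ⊕ d)) ⊜ (a ⊕ c ⊕ (b ⊕ d))) refl

    ∑-*ˡ : ∀ {n} c (f : Fin n → ℚ) → ∑ (λ i → c * f i) ≡ c * ∑ f
    ∑-*ˡ {zero} c f = sym (ℚP.*-zeroʳ c)
    ∑-*ˡ {suc n} c f = trans (cong (c * f zero +_) (∑-*ˡ c (λ i → f (suc i)))) (sym (ℚP.*-distribˡ-+ c _ _))

    ∑-*ʳ : ∀ {n} c (f : Fin n → ℚ) → ∑ (λ i → f i * c) ≡ ∑ f * c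
    ∑-*ʳ c f = trans (∑-cong (λ i → ℚP.*-comm (f i) c)) (trans (∑-*ˡ c f) (ℚP.*-comm c _))

    ∑-neg : ∀ {n} (f : Fin n → ℚ) → ∑ (λ i → - f i) ≡ - ∑ f
    ∑-neg {zero} f = refl
    ∑-neg {suc n} f = trans (cong (- f zero +_) (∑-neg (λ i → f (suc i)))) (sym (ℚP.neg-distrib-+ (f zero) _))

    ∑-const : ∀ {n} c → ∑ {n} (λ _ → c) ≡ ι n * c
    ∑-const {zero} c = sym (ℚP.*-zeroˡ c)
    ∑-const {suc n} c = trans (cong (c +_) (∑-const {n} c)) (trans (lem c (ι n)) (cong (_* c) (sym (ι-suc n))))
      where lem : ∀ c k → c + k * c ≡ (1ℚ + k) * c
            lem = solve 2 (λ c k → (c ⊕ k ⊗ c) ⊜ ((Κ 1ℚ ⊕ k) ⊗ c)) refl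

    ∑-0 : ∀ {n} {f : Fin n → ℚ} → (∀ i → f i ≡ 0ℚ) → ∑ f ≡ 0ℚ
    ∑-0 {n} h = trans (∑-cong h) (trans (∑-const {n} 0ℚ) (ℚP.*-zeroʳ (ι n)))

    ∑-nonneg : ∀ {n} {f : Fin n → ℚ} → (∀ i → 0ℚ ≤ f i) → 0ℚ ≤ ∑ f
    ∑-nonneg {n} h = ≤-trans (≤-reflexive (sym (∑-0 {n} (λ _ → refl)))) (∑-mono h)

    ∑-bound : ∀ {n} {f : Fin n → ℚ} c → (∀ i → f i ≤ c) → ∑ f ≤ ι n * c
    ∑-bound {n} c h = ≤-trans (∑-mono h) (≤-reflexive (∑-const {n} c))

    ∑-swap : ∀ {n m} (f : Fin n → Fin m → ℚ) → ∑ (λ i → ∑ (f i)) ≡ ∑ (λ j → ∑ (λ i → f i j))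
    ∑-swap {zero} {m} f = sym (∑-0 {m} (λ _ → refl))
    ∑-swap {suc n} f = trans (cong (∑ (f zero) +_) (∑-swap (λ i → f (suc i)))) (sym (∑-+ (f zero) (λ j → ∑ (λ i → f (suc i) j))))

    ∑-term : ∀ {n} {f : Fin n → ℚ} → (∀ i → 0ℚ ≤ f i) → ∀ i → f i ≤ ∑ f
    ∑-term {suc n} {f} h zero = cert (∑-nonneg (λ i → h (suc i))) refl
    ∑-term {suc n} {f} h (suc i) = ≤-trans (∑-term (λ i → h (suc i)) i) (cert (h zero) (ℚP.+-comm (f zero) _))

  -- Averages over pairs and the moment lemma

  opaque
    S : ∀ {n} → (Fin n → Fin n → Bool) → (Fin n → Fin n → ℚ) → ℚ
    S w φ = ∑ λ s → ∑ λ t → ⟦ w s t ⟧ * φ s t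

  module _ {n} (w : Fin n → Fin n → Bool) where
    opaque
      unfolding S

      S-mono : ∀ {φ ψ : Fin n → Fin n → ℚ} → (∀ s t → w s t ≡ true → φ s t ≤ ψ s t) → S w φ ≤ S w ψ
      S-mono {φ} {ψ} h = ∑-mono λ s → ∑-mono λ t → pt s t (w s t) refl
        where
        pt : ∀ s t b → w s t ≡ b → ⟦ b ⟧ * φ s t ≤ ⟦ b ⟧ * ψ s t
        pt s t true e = mulˡ 0≤1 (h s t e)
        pt s t false e = ≤-reflexive (trans (ℚP.*-zeroˡ (φ s t)) (sym (ℚP.*-zeroˡ (ψ s t))))

      S-cong : ∀ {φ ψ : Fin n → Fin n → ℚ} → (∀ s t → φ s t ≡ ψ s t) → S w φ ≡ S w ψ
      S-cong h = ∑-cong λ s → ∑-cong λ t → cong (⟦ w s t ⟧ *_) (h s t)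

      S-+ : ∀ (φ ψ : Fin n → Fin n → ℚ) → S w (λ s t → φ s t + ψ s t) ≡ S w φ + S w ψ
      S-+ φ ψ = trans (∑-cong λ s → trans (∑-cong λ t → ℚP.*-distribˡ-+ ⟦ w s t ⟧ (φ s t) (ψ s t)) (∑-+ (λ t → ⟦ w s t ⟧ * φ s t) (λ t → ⟦ w s t ⟧ * ψ s t)))
                      (∑-+ (λ s → ∑ λ t → ⟦ w s t ⟧ * φ s t) (λ s → ∑ λ t → ⟦ w s t ⟧ * ψ s t))

      S-* : ∀ c (φ : Fin n → Fin n → ℚ) → S w (λ s t → c * φ s t) ≡ c * S w φ
      S-* c φ = trans (∑-cong λ s → trans (∑-cong λ t → lem ⟦ w s t ⟧ c (φ s t)) (∑-*ˡ c (λ t → ⟦ w s t ⟧ * φ s t))) (∑-*ˡ c (λ s → ∑ λ t → ⟦ w s t ⟧ * φ s t))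
        where lem : ∀ a b c → a * (b * c) ≡ b * (a * c)
              lem = solve 3 (λ a b c → (a ⊗ (b ⊗ c)) ⊜ (b ⊗ (a ⊗ c))) refl

      S-neg : ∀ (φ : Fin n → Fin n → ℚ) → S w (λ s t → - φ s t) ≡ - S w φ
      S-neg φ = trans (S-cong (λ s t → lem (φ s t))) (trans (S-* (- 1ℚ) φ) (sym (lem (S w φ))))
        where lem : ∀ a → - a ≡ (- 1ℚ) * a
              lem = solve 1 (λ a → (⊝ a) ⊜ ((⊝ Κ 1ℚ) ⊗ a)) refl

      S-nonneg : ∀ {φ : Fin n → Fin n → ℚ} → (∀ s t → w s t ≡ true → 0ℚ ≤ φ s t) → 0ℚ ≤ S w φ
      S-nonneg h = ≤-trans (≤-reflexive (sym (trans (S-cong (λ s t → refl)) (trans (S-* 0ℚ (λ _ _ → 0ℚ)) (ℚP.*-zeroˡ (S w (λ _ _ → 0ℚ))))))) (S-mono h)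

      S-∑ : ∀ {m} (φ : Fin m → Fin n → Fin n → ℚ) → S w (λ s t → ∑ λ b → φ b s t) ≡ ∑ λ b → S w (φ b)
      S-∑ φ = trans (∑-cong λ s → trans (∑-cong λ t → sym (∑-*ˡ ⟦ w s t ⟧ (λ b → φ b s t))) (∑-swap (λ t b → ⟦ w s t ⟧ * φ b s t)))
                    (∑-swap (λ s b → ∑ λ t → ⟦ w s t ⟧ * φ b s t))

    -- The number of pairs in `w`, so that `S w φ` is `W w` times an average. Bounds on averages are
    -- stated in this multiplied form, which avoids dividing by a possibly zero `W w`.
    W : ℚ
    W = S w (λ _ _ → 1ℚ)

    S-const : ∀ c → S w (λ _ _ → c) ≡ c * W
    S-const c = trans (S-cong (λ _ _ → sym (ℚP.*-identityʳ c))) (S-* c _)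

  -- With x = y/z this is (1 + x)^M ≤ 1 + Mx + M²x² for -1 ≤ x and Mx ≤ 1, made homogeneous to avoid
  -- the quotient. In the induction step the two sides differ by z^M y² (M(z - My) + z).
  pow-binom : ∀ M z y → 0ℚ ≤ z → 0ℚ ≤ z + y → ι M * y ≤ z →
    z * z * pow (z + y) M ≤ pow z M * (z * z + ι M * z * y + ι M * ι M * (y * y))
  pow-binom zero z y z0 zy0 h = ≤-reflexive (lem z y)
    where lem : ∀ z y → z * z * 1ℚ ≡ 1ℚ * (z * z + ι 0 * z * y + ι 0 * ι 0 * (y * y))
          lem = solve 2 (λ z y → (z ⊗ z ⊗ Κ 1ℚ) ⊜ (Κ 1ℚ ⊗ (z ⊗ z ⊕ Κ (ι 0) ⊗ z ⊗ y ⊕ Κ (ι 0) ⊗ Κ (ι 0) ⊗ (y ⊗ y)))) refl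
  pow-binom (suc M) z y z0 zy0 h = ≤-trans (≤-reflexive (lem1 z (z + y) (pow (z + y) M)))
     (≤-trans (mulˡ zy0 (pow-binom M z y z0 zy0 My≤z))
       (subst (λ m → (z + y) * (pow z M * (z * z + ι M * z * y + ι M * ι M * (y * y))) ≤ z * pow z M * (z * z + m * z * y + m * m * (y * y))) (sym (ι-suc M))
         (cert (pow-nonneg M z0 ⊠ sq≥0 y ⊠ ((0≤ι M ⊠ sub My≤z) ⊞ z0)) (lem2 z y (ι M) (pow z M)))))
    where
    M≥0 = 0≤ι M
    My≤z : ι M * y ≤ z
    My≤z with total 0ℚ y
    ... | inj₁ y0 = ≤-trans (cert y0 (trans (cong (_* y) (ι-suc M)) (l y (ι M)))) h
      where l : ∀ y m → (1ℚ + m) * y ≡ m * y + y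
            l = solve 2 (λ y m → ((Κ 1ℚ ⊕ m) ⊗ y) ⊜ (m ⊗ y ⊕ y)) refl
    ... | inj₂ y0 = ≤-trans (cert (M≥0 ⊠ neg≤ y0) (l y (ι M))) z0
      where l : ∀ y m → 0ℚ ≡ m * y + m * (- y)
            l = solve 2 (λ y m → (Κ 0ℚ) ⊜ (m ⊗ y ⊕ m ⊗ (⊝ y))) refl
    lem1 : ∀ z u p → z * z * (u * p) ≡ u * (z * z * p)
    lem1 = solve 3 (λ z u p → (z ⊗ z ⊗ (u ⊗ p)) ⊜ (u ⊗ (z ⊗ z ⊗ p))) refl
    lem2 : ∀ z y m p → z * p * (z * z + (1ℚ + m) * z * y + (1ℚ + m) * (1ℚ + m) * (y * y))
         ≡ (z + y) * (p * (z * z + m * z * y + m * m * (y * y))) + p * (y * y) * (m * (z - m * y) + z)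
    lem2 = solve 4 (λ z y m p → (z ⊗ p ⊗ (z ⊗ z ⊕ (Κ 1ℚ ⊕ m) ⊗ z ⊗ y ⊕ (Κ 1ℚ ⊕ m) ⊗ (Κ 1ℚ ⊕ m) ⊗ (y ⊗ y)))
        ⊜ ((z ⊕ y) ⊗ (p ⊗ (z ⊗ z ⊕ m ⊗ z ⊗ y ⊕ m ⊗ m ⊗ (y ⊗ y))) ⊕ p ⊗ (y ⊗ y) ⊗ (m ⊗ (z ⊖ m ⊗ y) ⊕ z))) refl

  sqpow : ∀ x K → pow (x * x) K ≡ pow x (K ℕ.+ K)
  sqpow x K = trans (pow-* x x K) (sym (pow-+ x K K))

  ¼ : ℚ
  ¼ = ½ * ½

  -- The even power (z²)ᴷ acts as a truncated exponential: for |z| ≥ ¼ the shrinking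
  -- factor g = 1/(1+γ) absorbs drift and variance, and for |z| ≤ ¼ the new value is
  -- at most 4⁻ᴷ anyway.
  module Moment {n} (w : Fin n → Fin n → Bool) (K : ℕ) (γ g β v : ℚ) (y u : Fin n → Fin n → ℚ)
    (γ0 : 0ℚ ≤ γ) (g0 : 0ℚ ≤ g) (gγ : (1ℚ + γ) * g ≡ 1ℚ) (β0 : 0ℚ ≤ β)
    (y≤u : ∀ s t → w s t ≡ true → y s t ≤ u s t) (-u≤y : ∀ s t → w s t ≡ true → - u s t ≤ y s t)
    (u≤β : ∀ s t → w s t ≡ true → u s t ≤ β)
    (drift+ : S w y ≤ ½ * ¼ * γ * W w) (drift- : - (½ * ¼ * γ * W w) ≤ S w y)
    (var : S w u ≤ v * W w)
    (β4 : β ≤ ¼) (Kβ : ι (K ℕ.+ K) * β ≤ ¼) (Kβv : ι (K ℕ.+ K) * β * v ≤ ½ * ¼ * ¼ * γ) where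

    private
      M = K ℕ.+ K

    W0 : 0ℚ ≤ W w
    W0 = S-nonneg w (λ _ _ _ → 0≤1)

    g≤1 : g ≤ 1ℚ
    g≤1 = ≤-trans (cert (γ0 ⊠ g0) (lem g γ)) (≤-reflexive gγ)
      where lem : ∀ g γ → (1ℚ + γ) * g ≡ g + γ * g
            lem = solve 2 (λ g γ → ((Κ 1ℚ ⊕ γ) ⊗ g) ⊜ (g ⊕ γ ⊗ g)) refl

    shrink : 1ℚ + ι M * γ ≤ pow (1ℚ + γ) M
    shrink = bernoulli M (0≤1 ⊞ γ0)

    -- Expanding by `pow-binom` leaves a drift term and a variance term. Against the gain (1 + γ)^M
    -- ≥ 1 + Mγ each of them costs at most half of Mγz², because z ≥ ¼; the rest is the factor (z -
    -- ¼)(z + ⅛) of the certificate.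
    big : ∀ z (x : Fin n → Fin n → ℚ) → ¼ ≤ z → (∀ s t → w s t ≡ true → x s t ≤ u s t) →
      (∀ s t → w s t ≡ true → - u s t ≤ x s t) → S w x ≤ ½ * ¼ * γ * W w →
      S w (λ s t → pow ((z + x s t) * g) M) ≤ W w * pow z M
    big z x qz x≤u u≤x dr = cancel-* (*-pos z>0 z>0) (≤-trans (≤-reflexive (trans (cong (_* (z * z)) step0) (lem0 (pow g M) (S w (λ s t → pow (z + x s t) M)) z)))
        (≤-trans (mulˡ (pow-nonneg M g0) step3) (≤-reflexive final)))
      where
      z>0 : 0ℚ < z
      z>0 = ℚP.<-≤-trans (ℚP.positive⁻¹ ¼) qz
      z0 = <⇒≤ z>0
      step0 : S w (λ s t → pow ((z + x s t) * g) M) ≡ pow g M * S w (λ s t → pow (z + x s t) M)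
      step0 = trans (S-cong w (λ s t → trans (pow-* (z + x s t) g M) (ℚP.*-comm (pow (z + x s t) M) (pow g M)))) (S-* w (pow g M) _)
      lem0 : ∀ p s z → p * s * (z * z) ≡ p * (z * z * s)
      lem0 = solve 3 (λ p s z → (p ⊗ s ⊗ (z ⊗ z)) ⊜ (p ⊗ (z ⊗ z ⊗ s))) refl
      step1 : S w (λ s t → z * z * pow (z + x s t) M) ≤ S w (λ s t → pow z M * (z * z + ι M * z * x s t + ι M * ι M * β * u s t))
      step1 = S-mono w pt
        where
        pt : ∀ s t → w s t ≡ true → z * z * pow (z + x s t) M ≤ pow z M * (z * z + ι M * z * x s t + ι M * ι M * β * u s t)
        pt s t e = ≤-trans (pow-binom M z (x s t) z0 zx0 (≤-trans (mulˡ (0≤ι M) (≤-trans (x≤u s t e) ub)) (≤-trans Kβ qz)))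
                     (mulˡ (pow-nonneg M z0) (cert (0≤ι M ⊠ 0≤ι M ⊠ sub x²) (l z (ι M) (x s t) β (u s t))))
          where
          ub = u≤β s t e
          u0 : 0ℚ ≤ u s t
          u0 = half (u s t) (≤-trans (u≤x s t e) (x≤u s t e))
            where
            half : ∀ a → - a ≤ a → 0ℚ ≤ a
            half a p = ≤-trans (0≤ι 1 ⊠ sub p ⊠ <⇒≤ (ℚP.positive⁻¹ ½)) (≤-reflexive (hl a))
              where hl : ∀ a → ι 1 * (a - - a) * ½ ≡ a
                    hl = solve 1 (λ a → (Κ (ι 1) ⊗ (a ⊖ ⊝ a) ⊗ Κ ½) ⊜ (a)) refl
          zx0 : 0ℚ ≤ z + x s t
          zx0 = ≤-trans (sub (≤-trans ub (≤-trans β4 qz))) (≤-trans (ℚP.+-monoʳ-≤ z (u≤x s t e)) ≤-refl)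
          -- Since |x| ≤ u ≤ β, the second moment is controlled by β times the mean of `u`.
          x² : x s t * x s t ≤ β * u s t
          x² = ≤-trans (cert (sub (x≤u s t e) ⊠ sub (u≤x s t e)) (l1 (x s t) (u s t))) (mulʳ u0 ub)
            where l1 : ∀ x u → u * u ≡ x * x + (u - x) * (x - - u)
                  l1 = solve 2 (λ x u → (u ⊗ u) ⊜ (x ⊗ x ⊕ (u ⊖ x) ⊗ (x ⊖ ⊝ u))) refl
          l : ∀ z m x b u → z * z + m * z * x + m * m * b * u ≡ z * z + m * z * x + m * m * (x * x) + m * m * (b * u - x * x)
          l = solve 5 (λ z m x b u → (z ⊗ z ⊕ m ⊗ z ⊗ x ⊕ m ⊗ m ⊗ b ⊗ u) ⊜ (z ⊗ z ⊕ m ⊗ z ⊗ x ⊕ m ⊗ m ⊗ (x ⊗ x) ⊕ m ⊗ m ⊗ (b ⊗ u ⊖ x ⊗ x))) refl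
      bound : z * z * W w + ι M * z * S w x + ι M * ι M * β * S w u ≤ z * z * (W w * pow (1ℚ + γ) M)
      bound = cert ((z² ⊠ W0 ⊠ sub shrink) ⊞ (ι0 ⊠ z0 ⊠ sub dr) ⊞ (ι0 ⊠ ι0 ⊠ β0 ⊠ sub var) ⊞ (ι0 ⊠ W0 ⊠ sub Kβv)
                 ⊞ (ι0 ⊠ W0 ⊠ γ0 ⊠ sub qz ⊠ (z0 ⊞ <⇒≤ (ℚP.positive⁻¹ (½ * ¼)))))
               (l z (W w) (ι M) (S w x) β (S w u) (pow (1ℚ + γ) M) γ v)
        where
        ι0 = 0≤ι M
        z² = sq≥0 z
        l : ∀ z W m X β U P γ v → z * z * (W * P) ≡ z * z * W + m * z * X + m * m * β * U
              + (z * z * W * (P - (1ℚ + m * γ)) + m * z * (½ * ¼ * γ * W - X) + m * m * β * (v * W - U)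
                 + m * W * (½ * ¼ * ¼ * γ - m * β * v) + m * W * γ * (z - ¼) * (z + ½ * ¼))
        l = solve 9 (λ z W m X β U P γ v → (z ⊗ z ⊗ (W ⊗ P))
            ⊜ (z ⊗ z ⊗ W ⊕ m ⊗ z ⊗ X ⊕ m ⊗ m ⊗ β ⊗ U ⊕ (z ⊗ z ⊗ W ⊗ (P ⊖ (Κ 1ℚ ⊕ m ⊗ γ)) ⊕ m ⊗ z ⊗ (Κ ½ ⊗ Κ ¼ ⊗ γ ⊗ W ⊖ X) ⊕ m ⊗ m ⊗ β ⊗ (v ⊗ W ⊖ U) ⊕ m ⊗ W ⊗ (Κ ½ ⊗ Κ ¼ ⊗ Κ ¼ ⊗ γ ⊖ m ⊗ β ⊗ v) ⊕ m ⊗ W ⊗ γ ⊗ (z ⊖ Κ ¼) ⊗ (z ⊕ Κ ½ ⊗ Κ ¼)))) refl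
      step3 : z * z * S w (λ s t → pow (z + x s t) M) ≤ pow z M * (z * z * (W w * pow (1ℚ + γ) M))
      step3 = ≤-trans (≤-reflexive (sym (S-* w (z * z) _))) (≤-trans step1 (≤-trans (≤-reflexive eq) (mulˡ (pow-nonneg M z0) bound)))
        where
        eq : S w (λ s t → pow z M * (z * z + ι M * z * x s t + ι M * ι M * β * u s t)) ≡ pow z M * (z * z * W w + ι M * z * S w x + ι M * ι M * β * S w u)
        eq = trans (S-* w (pow z M) _) (cong (pow z M *_) (trans (S-+ w (λ s t → z * z + ι M * z * x s t) (λ s t → ι M * ι M * β * u s t))
               (cong₂ _+_ (trans (S-+ w (λ s t → z * z) (λ s t → ι M * z * x s t)) (cong₂ _+_ (S-const w (z * z)) (S-* w (ι M * z) x))) (S-* w (ι M * ι M * β) u))))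
      final : pow g M * (pow z M * (z * z * (W w * pow (1ℚ + γ) M))) ≡ W w * pow z M * (z * z)
      final = trans (l (pow g M) (pow z M) z (W w) (pow (1ℚ + γ) M)) (trans (cong (W w * pow z M * (z * z) *_)
                (trans (sym (pow-* (1ℚ + γ) g M)) (trans (cong (λ a → pow a M) gγ) (pow-1 M)))) (ℚP.*-identityʳ _))
        where l : ∀ a b z W p → a * (b * (z * z * (W * p))) ≡ W * b * (z * z) * (p * a)
              l = solve 5 (λ a b z W p → (a ⊗ (b ⊗ (z ⊗ z ⊗ (W ⊗ p)))) ⊜ (W ⊗ b ⊗ (z ⊗ z) ⊗ (p ⊗ a))) refl

    floor : ℚ
    floor = pow ¼ K

    -- Both z and the step are at most ¼ in absolute value, so the square of their sum is at most ¼,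
    -- and g ≤ 1 does not increase it.
    small : ∀ z → z ≤ ¼ → - ¼ ≤ z → S w (λ s t → pow ((z + y s t) * g * ((z + y s t) * g)) K) ≤ W w * floor
    small z h1 h2 = ≤-trans (S-mono w pt) (≤-reflexive (trans (S-const w floor) (ℚP.*-comm floor _)))
      where
      pt : ∀ s t → w s t ≡ true → pow ((z + y s t) * g * ((z + y s t) * g)) K ≤ floor
      pt s t e = pow-mono K (sq≥0 ((z + y s t) * g)) (≤-trans (≤-reflexive (l1 (z + y s t) g))
          (≤-trans (mul≤ (sq≥0 (z + y s t)) sq (sq≥0 g) (≤-trans (mul≤ g0 g≤1 g0 g≤1) (≤-reflexive (ℚP.*-identityˡ 1ℚ)))) (≤-reflexive (ℚP.*-identityʳ ¼))))
        where
        up : y s t ≤ ¼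
        up = ≤-trans (y≤u s t e) (≤-trans (u≤β s t e) β4)
        lo : - ¼ ≤ y s t
        lo = ≤-trans (neg≤ (≤-trans (u≤β s t e) β4)) (-u≤y s t e)
        l1 : ∀ a g → a * g * (a * g) ≡ a * a * (g * g)
        l1 = solve 2 (λ a g → (a ⊗ g ⊗ (a ⊗ g)) ⊜ (a ⊗ a ⊗ (g ⊗ g))) refl
        sq : (z + y s t) * (z + y s t) ≤ ¼
        sq = cert ((sub h1 ⊞ sub up) ⊠ (sub h2 ⊞ sub lo)) (l2 z (y s t))
          where l2 : ∀ z y → ¼ ≡ (z + y) * (z + y) + (¼ - z + (¼ - y)) * (z - - ¼ + (y - - ¼))
                l2 = solve 2 (λ z y → (Κ ¼) ⊜ ((z ⊕ y) ⊗ (z ⊕ y) ⊕ (Κ ¼ ⊖ z ⊕ (Κ ¼ ⊖ y)) ⊗ (z ⊖ ⊝ Κ ¼ ⊕ (y ⊖ ⊝ Κ ¼)))) refl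

    -- The power is even, so z ≤ -¼ is the case of `big` for -z and -y.
    moment : ∀ z → S w (λ s t → pow ((z + y s t) * g * ((z + y s t) * g)) K) ≤ W w * (pow (z * z) K + floor)
    moment z with total ¼ z
    ... | inj₁ p = ≤-trans (≤-reflexive (S-cong w (λ s t → sqpow _ K))) (≤-trans (big z y p y≤u -u≤y drift+)
                     (≤-trans (≤-reflexive (cong (W w *_) (sym (sqpow z K)))) (mulˡ W0 (cert (pow-nonneg K (<⇒≤ (ℚP.positive⁻¹ ¼))) refl))))
    ... | inj₂ p with total z (- ¼)
    ...   | inj₂ q = ≤-trans (small z p q) (mulˡ W0 (cert (pow-nonneg K (sq≥0 z)) (ℚP.+-comm (pow (z * z) K) floor)))
    ...   | inj₁ q = ≤-trans (≤-reflexive (S-cong w (λ s t → trans (cong (λ a → pow a K) (l1 z (y s t) g)) (sqpow _ K))))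
                     (≤-trans (big (- z) (λ s t → - y s t) (neg≤ q) (λ s t e → ≤-trans (neg≤ (-u≤y s t e)) (≤-reflexive (nn (u s t)))) (λ s t e → neg≤ (y≤u s t e))
                          (≤-trans (≤-reflexive (S-neg w y)) (≤-trans (neg≤ drift-) (≤-reflexive (nn _)))))
                       (≤-trans (≤-reflexive (cong (W w *_) (trans (sym (sqpow (- z) K)) (cong (λ a → pow a K) (l2 z))))) (mulˡ W0 (cert (pow-nonneg K (<⇒≤ (ℚP.positive⁻¹ ¼))) refl))))
      where
      nn : ∀ a → - - a ≡ a
      nn = solve 1 (λ a → (⊝ ⊝ a) ⊜ (a)) refl
      l1 : ∀ z y g → (z + y) * g * ((z + y) * g) ≡ (- z + - y) * g * ((- z + - y) * g)
      l1 = solve 3 (λ z y g → ((z ⊕ y) ⊗ g ⊗ ((z ⊕ y) ⊗ g)) ⊜ ((⊝ z ⊕ ⊝ y) ⊗ g ⊗ ((⊝ z ⊕ ⊝ y) ⊗ g))) refl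
      l2 : ∀ z → - z * - z ≡ z * z
      l2 = solve 1 (λ z → (⊝ z ⊗ ⊝ z) ⊜ (z ⊗ z)) refl

  -- Open pairs

  ∧-left : ∀ {a b} → a ∧ b ≡ true → a ≡ true
  ∧-left {true} _ = refl

  ∧-right : ∀ {a b} → a ∧ b ≡ true → b ≡ true
  ∧-right {true} p = p

  ∧-intro : ∀ {a b} → a ≡ true → b ≡ true → a ∧ b ≡ true
  ∧-intro refl refl = refl

  ∨-elim : ∀ {a b} → a ∨ b ≡ true → (a ≡ true) ⊎ (b ≡ true)
  ∨-elim {true} _ = inj₁ refl
  ∨-elim {false} p = inj₂ p

  ∨-introˡ : ∀ {a b} → a ≡ true → a ∨ b ≡ true
  ∨-introˡ refl = refl

  ∨-introʳ : ∀ {a b} → b ≡ true → a ∨ b ≡ true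
  ∨-introʳ {true} _ = refl
  ∨-introʳ {false} p = p

  not-true : ∀ {a} → not a ≡ true → a ≡ false
  not-true {false} _ = refl

  true≢false : ∀ {a} → a ≡ true → a ≡ false → ⊥
  true≢false refl ()

  ¬true⇒false : ∀ {a} → (a ≡ true → ⊥) → a ≡ false
  ¬true⇒false {true} h = ⊥-elim (h refl)
  ¬true⇒false {false} _ = refl

  bool-ext : ∀ {a b} → (a ≡ true → b ≡ true) → (b ≡ true → a ≡ true) → a ≡ b
  bool-ext {true} f g = sym (f refl)
  bool-ext {false} {true} f g = g refl
  bool-ext {false} {false} f g = refl

  bool-dec : ∀ a → (a ≡ true) ⊎ (a ≡ false)
  bool-dec true = inj₁ refl
  bool-dec false = inj₂ refl

  ==-sound : ∀ {n} {x y : Fin n} → (x == y) ≡ true → x ≡ y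
  ==-sound {x = x} {y} h with x ≟ᶠ y
  ... | yes p = p
  ==-sound {x = x} {y} () | no _

  ==-refl : ∀ {n} (x : Fin n) → (x == x) ≡ true
  ==-refl x with x ≟ᶠ x
  ... | yes _ = refl
  ... | no q = ⊥-elim (q refl)

  ==-false : ∀ {n} {x y : Fin n} → ¬ x ≡ y → (x == y) ≡ false
  ==-false h = ¬true⇒false (λ e → h (==-sound e))

  fin-dec : ∀ {n} (x y : Fin n) → (x ≡ y) ⊎ (¬ x ≡ y)
  fin-dec x y with x ≟ᶠ y
  ... | yes e = inj₁ e
  ... | no p = inj₂ p

  ex : ∀ {n} → (Fin n → Bool) → Bool
  ex {n} p = any p (allFin n)

  any-intro : ∀ {X : Set} (p : X → Bool) {x xs} → x ∈ xs → p x ≡ true → any p xs ≡ true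
  any-intro p (here refl) h = ∨-introˡ h
  any-intro p {xs = y ∷ ys} (there m) h = ∨-introʳ {p y} (any-intro p m h)

  any-elim : ∀ {X : Set} (p : X → Bool) xs → any p xs ≡ true → ∃ λ x → (x ∈ xs) × p x ≡ true
  any-elim p (x ∷ xs) h with ∨-elim {p x} h
  ... | inj₁ e = x , here refl , e
  ... | inj₂ e = let y , m , q = any-elim p xs e in y , there m , q

  ex-intro : ∀ {n} (p : Fin n → Bool) i → p i ≡ true → ex p ≡ true
  ex-intro p i = any-intro p (∈-allFin i)

  ex-elim : ∀ {n} (p : Fin n → Bool) → ex p ≡ true → ∃ λ i → p i ≡ true
  ex-elim {n} p h = let x , _ , q = any-elim p (allFin n) h in x , q

  opaque
    -- Walks may repeat vertices. In a loopless graph a walk of length 3 between distinct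
    -- non-adjacent vertices is a path anyway, so for such pairs this is exactly the obstruction to
    -- adding xy.
    w3 : ∀ {n} → (Fin n → Fin n → Bool) → Fin n → Fin n → Bool
    w3 A x y = ex λ a → ex λ b → A x a ∧ A a b ∧ A b y

    op : ∀ {n} → (Fin n → Fin n → Bool) → Fin n → Fin n → Bool
    op A x y = not (x == y) ∧ not (A x y) ∧ not (w3 A x y)

    eb : ∀ {n} → Fin n → Fin n → Fin n → Fin n → Bool
    eb s t x y = ((s == x) ∧ (t == y)) ∨ ((s == y) ∧ (t == x))

    add : ∀ {n} → (Fin n → Fin n → Bool) → Fin n → Fin n → Fin n → Fin n → Bool
    add A s t x y = eb s t x y ∨ A x y

  module _ {n} {A : Fin n → Fin n → Bool} where
    opaque
      unfolding w3 op eb add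

      w3-intro : ∀ {x y} a b → A x a ≡ true → A a b ≡ true → A b y ≡ true → w3 A x y ≡ true
      w3-intro {x} {y} a b p q r = ex-intro (λ a → ex λ b → A x a ∧ A a b ∧ A b y) a (ex-intro (λ b → A x a ∧ A a b ∧ A b y) b (∧-intro p (∧-intro q r)))

      w3-elim : ∀ {x y} → w3 A x y ≡ true → ∃ λ a → ∃ λ b → A x a ≡ true × A a b ≡ true × A b y ≡ true
      w3-elim {x} {y} h with ex-elim (λ a → ex λ b → A x a ∧ A a b ∧ A b y) h
      ... | a , h′ with ex-elim (λ b → A x a ∧ A a b ∧ A b y) h′
      ... | b , e = a , b , ∧-left {A x a} e , ∧-left {A a b} (∧-right {A x a} e) , ∧-right {A a b} (∧-right {A x a} e)

      op⇒≢ : ∀ {x y} → op A x y ≡ true → ¬ x ≡ y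
      op⇒≢ {x} h refl = true≢false (==-refl x) (not-true (∧-left h))

      op⇒nadj : ∀ {x y} → op A x y ≡ true → A x y ≡ false
      op⇒nadj {x} {y} h = not-true (∧-left {not (A x y)} (∧-right {not (x == y)} h))

      op⇒nw3 : ∀ {x y} → op A x y ≡ true → w3 A x y ≡ false
      op⇒nw3 {x} {y} h = not-true (∧-right {not (A x y)} (∧-right {not (x == y)} h))

      op-intro : ∀ {x y} → ¬ x ≡ y → A x y ≡ false → w3 A x y ≡ false → op A x y ≡ true
      op-intro p q r rewrite ==-false p | q | r = refl

      op-walk : ∀ {x y} a b → op A x y ≡ true → A x a ≡ true → A a b ≡ true → A b y ≡ true → ⊥
      op-walk a b h p q r = true≢false (w3-intro a b p q r) (op⇒nw3 h)

      ¬op : ∀ {x y} → op A x y ≡ false → (x ≡ y) ⊎ ((A x y ≡ true) ⊎ (w3 A x y ≡ true))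
      ¬op {x} {y} h with fin-dec x y | bool-dec (A x y) | bool-dec (w3 A x y)
      ... | inj₁ e | _ | _ = inj₁ e
      ... | inj₂ _ | inj₁ e | _ = inj₂ (inj₁ e)
      ... | inj₂ _ | inj₂ _ | inj₁ e = inj₂ (inj₂ e)
      ... | inj₂ p | inj₂ q | inj₂ r = ⊥-elim (true≢false (op-intro p q r) h)

      walk⇒¬op : ∀ {x y} a b → A x a ≡ true → A a b ≡ true → A b y ≡ true → op A x y ≡ false
      walk⇒¬op a b p q r = ¬true⇒false (λ h → op-walk a b h p q r)

  module _ {n} {s t : Fin n} where
    opaque
      unfolding w3 op eb add

      eb-elim : ∀ {x y} → eb s t x y ≡ true → (s ≡ x × t ≡ y) ⊎ (s ≡ y × t ≡ x)
      eb-elim {x} {y} h with ∨-elim {(s == x) ∧ (t == y)} h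
      ... | inj₁ e = inj₁ (==-sound (∧-left e) , ==-sound (∧-right {s == x} e))
      ... | inj₂ e = inj₂ (==-sound (∧-left e) , ==-sound (∧-right {s == y} e))

      add-elim : ∀ {A : Fin n → Fin n → Bool} {x y} → add A s t x y ≡ true →
        ((s ≡ x × t ≡ y) ⊎ (s ≡ y × t ≡ x)) ⊎ (A x y ≡ true)
      add-elim {x = x} {y} h with ∨-elim {eb s t x y} h
      ... | inj₁ e = inj₁ (eb-elim e)
      ... | inj₂ e = inj₂ e

      add-split : ∀ {A : Fin n → Fin n → Bool} {x y} → add A s t x y ≡ true → (eb s t x y ≡ true) ⊎ (A x y ≡ true)
      add-split {x = x} {y} h = ∨-elim {eb s t x y} h

      add-old : ∀ {A : Fin n → Fin n → Bool} {x y} → A x y ≡ true → add A s t x y ≡ true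
      add-old {x = x} {y} h = ∨-introʳ {eb s t x y} h

      add-st : ∀ {A : Fin n → Fin n → Bool} → add A s t s t ≡ true
      add-st = ∨-introˡ (∨-introˡ (∧-intro (==-refl s) (==-refl t)))

      add-ts : ∀ {A : Fin n → Fin n → Bool} → add A s t t s ≡ true
      add-ts = ∨-introˡ (∨-introʳ {(s == t) ∧ (t == s)} (∧-intro (==-refl s) (==-refl t)))

  -- A 4-cycle consists of two distinct vertices with two common neighbours, so its absence is
  -- recorded as codegree at most 1, the form in which it is always used.
  record C4Free {n} (A : Fin n → Fin n → Bool) : Set where
    field
      adj-sym : ∀ {x y} → A x y ≡ true → A y x ≡ true
      adj-irr : ∀ {x} → A x x ≡ true → ⊥
      unique : ∀ {x y a b} → ¬ x ≡ y → A x a ≡ true → A a y ≡ true → A x b ≡ true → A b y ≡ true → a ≡ b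

  -- The ways in which adding the edge st closes the open pair xy, up to exchanging s and t.
  data Closes {n} (A : Fin n → Fin n → Bool) (s t x y : Fin n) : Set where
    itself : s ≡ x → t ≡ y → Closes A s t x y
    middle : A x s ≡ true → A t y ≡ true → Closes A s t x y
    at-x : s ≡ x → ∀ b → A t b ≡ true → A b y ≡ true → Closes A s t x y
    at-y : s ≡ y → ∀ b → A t b ≡ true → A b x ≡ true → Closes A s t x y

  module _ {n} {A : Fin n → Fin n → Bool} (C : C4Free A) where
    open C4Free C

    op-sym : ∀ {x y} → op A x y ≡ true → op A y x ≡ true
    op-sym {x} {y} h = op-intro (λ e → op⇒≢ {A = A} h (sym e)) (¬true⇒false (λ e → true≢false (adj-sym e) (op⇒nadj {A = A} h)))
      (¬true⇒false λ e → let a , b , p , q , r = w3-elim {A = A} e in op-walk {A = A} b a h (adj-sym r) (adj-sym q) (adj-sym p))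

    -- A new walk of length 3 from x to y has st as its first, middle or last edge. It cannot use st
    -- twice: that would identify s with t or x with y, or make the walk contain xy itself.
    closes : ∀ {s t x y} → op A s t ≡ true → op A x y ≡ true → op (add A s t) x y ≡ false → Closes A s t x y ⊎ Closes A t s x y
    closes {s} {t} {x} {y} hst hxy h with bool-dec (eb s t x y)
    ... | inj₁ e with eb-elim e
    ...   | inj₁ (p , q) = inj₁ (itself p q)
    ...   | inj₂ (p , q) = inj₂ (itself q p)
    closes {s} {t} {x} {y} hst hxy h | inj₂ ne with ¬op {A = add A s t} h
    ... | inj₁ e = ⊥-elim (op⇒≢ {A = A} hxy e)
    ... | inj₂ (inj₁ e) with add-split {A = A} e
    ...   | inj₁ e′ = ⊥-elim (true≢false e′ ne)
    ...   | inj₂ e′ = ⊥-elim (true≢false e′ (op⇒nadj {A = A} hxy))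
    closes {s} {t} {x} {y} hst hxy h | inj₂ ne | inj₂ (inj₂ w) with w3-elim {A = add A s t} w
    ... | a , b , p , q , r = go (add-elim {A = A} p) (add-elim {A = A} q) (add-elim {A = A} r)
      where
      s≢t : ¬ s ≡ t
      s≢t = op⇒≢ {A = A} hst
      nxy : add A s t x y ≡ true → ⊥
      nxy e with add-split {A = A} e
      ... | inj₁ e′ = true≢false e′ ne
      ... | inj₂ e′ = true≢false e′ (op⇒nadj {A = A} hxy)
      b≢x : ¬ b ≡ x
      b≢x refl = nxy r
      a≢y : ¬ a ≡ y
      a≢y refl = nxy p
      x≢y : ¬ x ≡ y
      x≢y = op⇒≢ {A = A} hxy
      E : Fin n → Fin n → Set
      E u v = (s ≡ u × t ≡ v) ⊎ (s ≡ v × t ≡ u)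
      go : E x a ⊎ (A x a ≡ true) → E a b ⊎ (A a b ≡ true) → E b y ⊎ (A b y ≡ true) → Closes A s t x y ⊎ Closes A t s x y
      go (inj₂ p) (inj₂ q) (inj₂ r) = ⊥-elim (op-walk {A = A} a b hxy p q r)
      go (inj₁ (inj₁ (refl , refl))) (inj₂ q) (inj₂ r) = inj₁ (at-x refl b q r)
      go (inj₁ (inj₂ (refl , refl))) (inj₂ q) (inj₂ r) = inj₂ (at-x refl b q r)
      go (inj₂ p) (inj₁ (inj₁ (refl , refl))) (inj₂ r) = inj₁ (middle p r)
      go (inj₂ p) (inj₁ (inj₂ (refl , refl))) (inj₂ r) = inj₂ (middle p r)
      go (inj₂ p) (inj₂ q) (inj₁ (inj₁ (refl , refl))) = inj₂ (at-y refl a (adj-sym q) (adj-sym p))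
      go (inj₂ p) (inj₂ q) (inj₁ (inj₂ (refl , refl))) = inj₁ (at-y refl a (adj-sym q) (adj-sym p))
      go (inj₁ (inj₁ (refl , refl))) (inj₁ (inj₁ (e , _))) _ = ⊥-elim (s≢t e)
      go (inj₁ (inj₁ (refl , refl))) (inj₁ (inj₂ (e , _))) _ = ⊥-elim (b≢x (sym e))
      go (inj₁ (inj₂ (refl , refl))) (inj₁ (inj₁ (_ , e))) _ = ⊥-elim (b≢x (sym e))
      go (inj₁ (inj₂ (refl , refl))) (inj₁ (inj₂ (_ , e))) _ = ⊥-elim (s≢t (sym e))
      go (inj₁ (inj₁ (refl , refl))) (inj₂ q) (inj₁ (inj₁ (e , _))) = ⊥-elim (b≢x (sym e))
      go (inj₁ (inj₁ (refl , refl))) (inj₂ q) (inj₁ (inj₂ (e , _))) = ⊥-elim (x≢y e)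
      go (inj₁ (inj₂ (refl , refl))) (inj₂ q) (inj₁ (inj₁ (_ , e))) = ⊥-elim (x≢y e)
      go (inj₁ (inj₂ (refl , refl))) (inj₂ q) (inj₁ (inj₂ (_ , e))) = ⊥-elim (b≢x (sym e))
      go (inj₂ p) (inj₁ (inj₁ (refl , refl))) (inj₁ (inj₁ (e , _))) = ⊥-elim (s≢t e)
      go (inj₂ p) (inj₁ (inj₁ (refl , refl))) (inj₁ (inj₂ (e , _))) = ⊥-elim (a≢y e)
      go (inj₂ p) (inj₁ (inj₂ (refl , refl))) (inj₁ (inj₁ (_ , e))) = ⊥-elim (a≢y e)
      go (inj₂ p) (inj₁ (inj₂ (refl , refl))) (inj₁ (inj₂ (_ , e))) = ⊥-elim (s≢t (sym e))

    op-mono : ∀ {s t x y} → op (add A s t) x y ≡ true → op A x y ≡ true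
    op-mono {s} {t} {x} {y} h = op-intro (op⇒≢ {A = add A s t} h)
      (¬true⇒false λ e → true≢false (add-old {A = A} e) (op⇒nadj {A = add A s t} h))
      (¬true⇒false λ e → let a , b , p , q , r = w3-elim {A = A} e in
         op-walk {A = add A s t} a b h (add-old {A = A} p) (add-old {A = A} q) (add-old {A = A} r))

    -- If exactly one side of a 4-cycle is new, the other three form a walk of length 3 between s
    -- and t, which openness forbids (`bad`). Two new sides are the same edge st, and neither
    -- adjacent nor opposite sides of a 4-cycle can coincide (`same`, `cross`).
    add-C4Free : ∀ {s t} → op A s t ≡ true → C4Free (add A s t)
    add-C4Free {s} {t} hst = record
      { adj-sym = λ {x} {y} e → sy (add-elim {A = A} e)
      ; adj-irr = λ {x} e → ir (add-elim {A = A} e)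
      ; unique = λ {x} {y} {a} {b} ne p q r u → un x y a b ne (add-elim {A = A} p) (add-elim {A = A} q) (add-elim {A = A} r) (add-elim {A = A} u) }
      where
      s≢t : ¬ s ≡ t
      s≢t = op⇒≢ {A = A} hst
      E : Fin n → Fin n → Set
      E u v = (s ≡ u × t ≡ v) ⊎ (s ≡ v × t ≡ u)
      sy : ∀ {x y} → E x y ⊎ (A x y ≡ true) → add A s t y x ≡ true
      sy (inj₁ (inj₁ (refl , refl))) = add-ts {A = A}
      sy (inj₁ (inj₂ (refl , refl))) = add-st {A = A}
      sy (inj₂ e) = add-old {A = A} (adj-sym e)
      ir : ∀ {x} → E x x ⊎ (A x x ≡ true) → ⊥
      ir (inj₁ (inj₁ (refl , e))) = s≢t (sym e)
      ir (inj₁ (inj₂ (refl , e))) = s≢t (sym e)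
      ir (inj₂ e) = adj-irr e
      bad : ∀ {u v c d} → E u v → A u c ≡ true → A c d ≡ true → A d v ≡ true → ⊥
      bad (inj₁ (refl , refl)) p q r = op-walk {A = A} _ _ hst p q r
      bad (inj₂ (refl , refl)) p q r = op-walk {A = A} _ _ hst (adj-sym r) (adj-sym q) (adj-sym p)
      same : ∀ {u v w} → E u v → E u w → v ≡ w
      same (inj₁ (refl , refl)) (inj₁ (_ , e)) = e
      same (inj₁ (refl , refl)) (inj₂ (refl , e)) = ⊥-elim (s≢t (sym e))
      same (inj₂ (refl , refl)) (inj₁ (e , refl)) = ⊥-elim (s≢t e)
      same (inj₂ (refl , refl)) (inj₂ (e , _)) = e
      flip : ∀ {u v} → E u v → E v u
      flip (inj₁ (p , q)) = inj₂ (p , q)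
      flip (inj₂ (p , q)) = inj₁ (p , q)
      un : ∀ x y a b → ¬ x ≡ y → E x a ⊎ (A x a ≡ true) → E a y ⊎ (A a y ≡ true) → E x b ⊎ (A x b ≡ true) → E b y ⊎ (A b y ≡ true) → a ≡ b
      un x y a b ne (inj₂ p) (inj₂ q) (inj₂ r) (inj₂ u) = unique ne p q r u
      un x y a b ne (inj₁ p) (inj₁ q) _ _ = ⊥-elim (ne (same (flip p) q))
      un x y a b ne _ _ (inj₁ p) (inj₁ q) = ⊥-elim (ne (same (flip p) q))
      un x y a b ne (inj₁ p) _ (inj₁ r) _ = same p r
      un x y a b ne _ (inj₁ q) _ (inj₁ u) = same (flip q) (flip u)
      un x y a b ne (inj₁ p) (inj₂ q) (inj₂ r) (inj₂ u) = ⊥-elim (bad p r u (adj-sym q))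
      un x y a b ne (inj₂ p) (inj₁ q) (inj₂ r) (inj₂ u) = ⊥-elim (bad q (adj-sym p) r u)
      un x y a b ne (inj₂ p) (inj₂ q) (inj₁ r) (inj₂ u) = ⊥-elim (bad r p q (adj-sym u))
      un x y a b ne (inj₂ p) (inj₂ q) (inj₂ r) (inj₁ u) = ⊥-elim (bad u (adj-sym r) p q)
      un x y a b ne (inj₁ p) (inj₂ q) (inj₂ r) (inj₁ u) = ⊥-elim (cross p u)
        where
        cross : E x a → E b y → ⊥
        cross (inj₁ (refl , refl)) (inj₁ (refl , refl)) = adj-irr r
        cross (inj₁ (refl , refl)) (inj₂ (e , _)) = ne e
        cross (inj₂ (refl , refl)) (inj₁ (_ , e)) = ne e
        cross (inj₂ (refl , refl)) (inj₂ (_ , refl)) = adj-irr r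
      un x y a b ne (inj₂ p) (inj₁ q) (inj₁ r) (inj₂ u) = ⊥-elim (cross r q)
        where
        cross : E x b → E a y → ⊥
        cross (inj₁ (refl , refl)) (inj₁ (refl , refl)) = adj-irr p
        cross (inj₁ (refl , refl)) (inj₂ (e , _)) = ne e
        cross (inj₂ (refl , refl)) (inj₁ (_ , e)) = ne e
        cross (inj₂ (refl , refl)) (inj₂ (_ , refl)) = adj-irr p

  -- Counting variables

  δ : ∀ {n} → Fin n → Fin n → ℚ
  δ x y = ⟦ x == y ⟧

  ν : ∀ {n} → Fin n → Fin n → ℚ
  ν x y = ⟦ not (x == y) ⟧

  δ-refl : ∀ {n} (x : Fin n) → δ x x ≡ 1ℚ
  δ-refl x = cong ⟦_⟧ (==-refl x)

  δ-≢ : ∀ {n} {x y : Fin n} → ¬ x ≡ y → δ x y ≡ 0ℚ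
  δ-≢ h = cong ⟦_⟧ (==-false h)

  ν-refl : ∀ {n} (x : Fin n) → ν x x ≡ 0ℚ
  ν-refl x = cong (λ b → ⟦ not b ⟧) (==-refl x)

  ν-≢ : ∀ {n} {x y : Fin n} → ¬ x ≡ y → ν x y ≡ 1ℚ
  ν-≢ h = cong (λ b → ⟦ not b ⟧) (==-false h)

  ⟦⟧-∧ : ∀ a b → ⟦ a ∧ b ⟧ ≡ ⟦ a ⟧ * ⟦ b ⟧
  ⟦⟧-∧ true b = sym (ℚP.*-identityˡ ⟦ b ⟧)
  ⟦⟧-∧ false b = sym (ℚP.*-zeroˡ ⟦ b ⟧)

  ⟦⟧-true : ∀ {b} → b ≡ true → ⟦ b ⟧ ≡ 1ℚ
  ⟦⟧-true = cong ⟦_⟧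

  ⟦⟧-false : ∀ {b} → b ≡ false → ⟦ b ⟧ ≡ 0ℚ
  ⟦⟧-false = cong ⟦_⟧

  opaque
    unfolding ∑
    ∑-δ : ∀ {n} x (f : Fin n → ℚ) → ∑ (λ t → δ x t * f t) ≡ f x
    ∑-δ {suc n} zero f = trans (cong₂ _+_ (trans (cong (_* f zero) (δ-refl {suc n} zero)) (ℚP.*-identityˡ (f zero)))
        (∑-0 (λ i → trans (cong (_* f (suc i)) (δ-≢ {suc n} {zero} {suc i} (λ ()))) (ℚP.*-zeroˡ (f (suc i)))))) (ℚP.+-identityʳ (f zero))
    ∑-δ {suc n} (suc x) f = trans (cong₂ _+_ (trans (cong (_* f zero) (δ-≢ {suc n} {suc x} {zero} (λ ()))) (ℚP.*-zeroˡ (f zero)))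
        (trans (∑-cong (λ i → cong (_* f (suc i)) (shift x i))) (∑-δ x (λ i → f (suc i))))) (ℚP.+-identityˡ (f (suc x)))
      where
      shift : ∀ {n} (x i : Fin n) → δ (suc x) (suc i) ≡ δ x i
      shift x i with fin-dec x i
      ... | inj₁ refl = trans (δ-refl (suc x)) (sym (δ-refl x))
      ... | inj₂ p = trans (δ-≢ (λ e → p (sucinj e))) (sym (δ-≢ p))
        where
        sucinj : ∀ {n} {a b : Fin n} → Fin.suc a ≡ suc b → a ≡ b
        sucinj refl = refl

    ∑-unique : ∀ {n} (p : Fin n → Bool) → (∀ i j → p i ≡ true → p j ≡ true → i ≡ j) → ∑ (λ i → ⟦ p i ⟧) ≤ 1ℚ
    ∑-unique {zero} p h = 0≤1
    ∑-unique {suc n} p h with bool-dec (p zero)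
    ... | inj₂ e = ≤-trans (≤-reflexive (trans (cong (_+ ∑ (λ i → ⟦ p (suc i) ⟧)) (⟦⟧-false e)) (ℚP.+-identityˡ (∑ (λ i → ⟦ p (suc i) ⟧))))) (∑-unique (λ i → p (suc i)) (λ i j a b → inj (h (suc i) (suc j) a b)))
      where
      inj : ∀ {n} {a b : Fin n} → Fin.suc a ≡ suc b → a ≡ b
      inj refl = refl
    ... | inj₁ e = ≤-reflexive (trans (cong₂ _+_ (⟦⟧-true e) (∑-0 (λ i → ⟦⟧-false (¬true⇒false λ q → noc (h zero (suc i) e q))))) (ℚP.+-identityʳ 1ℚ))
      where
      noc : ∀ {n} {a : Fin n} → zero ≡ Fin.suc a → ⊥
      noc ()

  ∑-witness : ∀ {n} (p : Fin n → Bool) i → p i ≡ true → 1ℚ ≤ ∑ (λ i → ⟦ p i ⟧)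
  ∑-witness p i e = ≤-trans (≤-reflexive (sym (⟦⟧-true e))) (∑-term (λ j → ⟦⟧≥0 (p j)) i)

  ∑-none : ∀ {n} (p : Fin n → Bool) → (∀ i → p i ≡ true → ⊥) → ∑ (λ i → ⟦ p i ⟧) ≡ 0ℚ
  ∑-none p h = ∑-0 (λ i → ⟦⟧-false (¬true⇒false (h i)))

  δ-sym : ∀ {n} (x y : Fin n) → δ x y ≡ δ y x
  δ-sym x y = cong ⟦_⟧ (bool-ext (λ e → trans (cong (y ==_) (==-sound e)) (==-refl y)) (λ e → trans (cong (x ==_) (==-sound e)) (==-refl x)))

  ∑-δ′ : ∀ {n} x (f : Fin n → ℚ) → ∑ (λ t → δ t x * f t) ≡ f x
  ∑-δ′ x f = trans (∑-cong (λ t → cong (_* f t) (δ-sym t x))) (∑-δ x f)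

  lt : ∀ {n} → Fin n → Fin n → Bool
  lt i j = isYes (toℕ i ℕP.<? toℕ j)

  lt-yes : ∀ {n} {i j : Fin n} → toℕ i ℕ.< toℕ j → lt i j ≡ true
  lt-yes {i = i} {j} h with toℕ i ℕP.<? toℕ j
  ... | yes _ = refl
  ... | no q = ⊥-elim (q h)

  lt-no : ∀ {n} {i j : Fin n} → ¬ toℕ i ℕ.< toℕ j → lt i j ≡ false
  lt-no {i = i} {j} h with toℕ i ℕP.<? toℕ j
  ... | yes q = ⊥-elim (h q)
  ... | no _ = refl

  opaque
    valid : ∀ {n} → (Fin n → Fin n → Bool) → Fin n → Fin n → Bool
    valid A s t = lt s t ∧ op A s t

    valid⇒op : ∀ {n} {A : Fin n → Fin n → Bool} {s t} → valid A s t ≡ true → op A s t ≡ true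
    valid⇒op {s = s} {t} h = ∧-right {lt s t} h

  -- In a C₄-free graph cl x y is, up to an error O(deg x + deg y), the number of open pairs
  -- whose addition closes the open pair xy.
  module Quantities {n} (A : Fin n → Fin n → Bool) where
    α ω : Fin n → Fin n → ℚ
    α x y = ⟦ A x y ⟧
    ω x y = ⟦ op A x y ⟧

    deg opdeg : Fin n → ℚ
    deg x = ∑ λ b → α x b
    opdeg x = ∑ λ b → ω x b

    -- The factors `ν` in `Pm` discard the walks x y b y and x a x y. If xy is an edge, these alone
    -- number about deg x + deg y, while the remaining walks stay polylogarithmic.
    Nm Cm cd Pm : Fin n → Fin n → ℚ
    Nm x y = ∑ λ b → α x b * ω b y
    Cm x y = ∑ λ b → ω x b * ω b y
    cd x y = ∑ λ b → α x b * α b y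
    Pm x y = ∑ λ a → ∑ λ b → α x a * α a b * α b y * (ν a y * ν b x)

    cod : Fin n → Fin n → Bool
    cod x y = ex λ z → A x z ∧ A z y

    cl : Fin n → Fin n → ℚ
    cl x y = (∑ λ a → α x a * (Nm y a + Nm a y)) + (∑ λ b → α y b * Nm b x)

    SA : (Fin n → Fin n → ℚ) → ℚ
    SA = S (valid A)

    WA : ℚ
    WA = W (valid A)

    α≥0 : ∀ x y → 0ℚ ≤ α x y
    α≥0 x y = ⟦⟧≥0 (A x y)

    ω≥0 : ∀ x y → 0ℚ ≤ ω x y
    ω≥0 x y = ⟦⟧≥0 (op A x y)

    cd≥0 : ∀ x y → 0ℚ ≤ cd x y
    cd≥0 x y = ∑-nonneg λ b → α≥0 x b ⊠ α≥0 b y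

    cd≡ : ∀ x y → cd x y ≡ ∑ λ b → ⟦ A x b ∧ A b y ⟧
    cd≡ x y = ∑-cong λ b → sym (⟦⟧-∧ (A x b) (A b y))

  module Facts {n} (A : Fin n → Fin n → Bool) (C : C4Free A) where
    open Quantities A public
    open C4Free C public

    α-sym : ∀ x y → α x y ≡ α y x
    α-sym x y = cong ⟦_⟧ (bool-ext adj-sym adj-sym)

    ω-sym : ∀ x y → ω x y ≡ ω y x
    ω-sym x y = cong ⟦_⟧ (bool-ext (op-sym C) (op-sym C))

    ω-irr : ∀ x → ω x x ≡ 0ℚ
    ω-irr x = ⟦⟧-false (¬true⇒false λ e → op⇒≢ {A = A} e refl)

    α-irr : ∀ x → α x x ≡ 0ℚ
    α-irr x = ⟦⟧-false (¬true⇒false adj-irr)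

    cd≤1 : ∀ {x y} → ¬ x ≡ y → cd x y ≤ 1ℚ
    cd≤1 {x} {y} ne = ≤-trans (≤-reflexive (cd≡ x y)) (∑-unique (λ b → A x b ∧ A b y)
      (λ i j p q → unique ne (∧-left p) (∧-right {A x i} p) (∧-left q) (∧-right {A x j} q)))

    cd-witness : ∀ {x y} b → A x b ≡ true → A b y ≡ true → 1ℚ ≤ cd x y
    cd-witness {x} {y} b p q = ≤-trans (∑-witness (λ b → A x b ∧ A b y) b (∧-intro p q)) (≤-reflexive (sym (cd≡ x y)))

    cd-none : ∀ {x y} → (∀ b → A x b ≡ true → A b y ≡ true → ⊥) → cd x y ≡ 0ℚ
    cd-none {x} {y} h = trans (cd≡ x y) (∑-none (λ b → A x b ∧ A b y) (λ b e → h b (∧-left e) (∧-right {A x b} e)))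

    cd-cases : ∀ x y → (cd x y ≡ 0ℚ) ⊎ (∃ λ b → A x b ≡ true × A b y ≡ true)
    cd-cases x y with bool-dec (cod x y)
    ... | inj₁ e = let b , q = ex-elim (λ z → A x z ∧ A z y) e in inj₂ (b , ∧-left q , ∧-right {A x b} q)
    ... | inj₂ e = inj₁ (cd-none (λ b p q → true≢false (ex-intro (λ z → A x z ∧ A z y) b (∧-intro p q)) e))

    opaque
      unfolding valid
      valid-sym : ∀ s t → ⟦ valid A s t ⟧ + ⟦ valid A t s ⟧ ≡ ω s t
      valid-sym s t with ℕP.<-cmp (toℕ s) (toℕ t)
      ... | tri< a _ c rewrite lt-yes {i = s} {t} a | lt-no {i = t} {s} c = ℚP.+-identityʳ (ω s t)
      ... | tri> a _ c rewrite lt-no {i = s} {t} a | lt-yes {i = t} {s} c = trans (ℚP.+-identityˡ (ω t s)) (ω-sym t s)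
      ... | tri≈ a b c rewrite lt-no {i = s} {t} a | lt-no {i = t} {s} c = sym (trans (cong (ω s) (sym (toℕ-injective b))) (ω-irr s))

    opaque
      unfolding S
      -- An unordered open pair is counted once by `valid`, in one of its two orders. Symmetrising
      -- therefore turns an average over the next edge into a sum over ordered open pairs, in which
      -- s and t can be summed separately.
      S-sym : ∀ (ψ : Fin n → Fin n → ℚ) → SA (λ s t → ψ s t + ψ t s) ≡ ∑ λ s → ∑ λ t → ω s t * ψ s t
      S-sym ψ = trans (S-+ (valid A) ψ (λ s t → ψ t s)) (trans (cong (SA ψ +_) (∑-swap (λ s t → ⟦ valid A s t ⟧ * ψ t s)))
         (trans (sym (∑-+ (λ s → ∑ λ t → ⟦ valid A s t ⟧ * ψ s t) (λ t → ∑ λ s → ⟦ valid A s t ⟧ * ψ t s)))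
          (∑-cong λ s → trans (sym (∑-+ (λ t → ⟦ valid A s t ⟧ * ψ s t) (λ t → ⟦ valid A t s ⟧ * ψ s t)))
           (∑-cong λ t → trans (sym (ℚP.*-distribʳ-+ (ψ s t) ⟦ valid A s t ⟧ ⟦ valid A t s ⟧)) (cong (_* ψ s t) (valid-sym s t))))))

    2W : WA + WA ≡ ∑ opdeg
    2W = trans (sym (S-+ (valid A) (λ _ _ → 1ℚ) (λ _ _ → 1ℚ))) (trans (S-sym (λ _ _ → 1ℚ))
          (∑-cong λ s → ∑-cong λ t → ℚP.*-identityʳ (ω s t)))

    kill : Fin n → Fin n → Fin n → Fin n → ℚ
    kill s t x y = ω x y - ⟦ op (add A s t) x y ⟧

    op′≤ : ∀ s t x y → ⟦ op (add A s t) x y ⟧ ≤ ω x y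
    op′≤ s t x y with bool-dec (op (add A s t) x y)
    ... | inj₁ e = ≤-reflexive (trans (⟦⟧-true e) (sym (⟦⟧-true (op-mono C e))))
    ... | inj₂ e = ≤-trans (≤-reflexive (⟦⟧-false e)) (ω≥0 x y)

    kill≥0 : ∀ s t x y → 0ℚ ≤ kill s t x y
    kill≥0 s t x y = sub (op′≤ s t x y)

    kill≤ω : ∀ s t x y → kill s t x y ≤ ω x y
    kill≤ω s t x y = cert (⟦⟧≥0 (op (add A s t) x y)) (l (ω x y) ⟦ op (add A s t) x y ⟧)
      where l : ∀ a b → a ≡ a - b + b
            l = solve 2 (λ a b → (a) ⊜ (a ⊖ b ⊕ b)) refl

    -- The summands follow the constructors of `Closes`, with `cd` counting the possible vertices b
    -- in the last two.
    ψ : Fin n → Fin n → Fin n → Fin n → ℚ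
    ψ x y s t = δ s x * δ t y + α x s * α t y + δ s x * cd t y + δ s y * cd t x

    private
      δ≥0 : ∀ (x y : Fin n) → 0ℚ ≤ δ x y
      δ≥0 x y = ⟦⟧≥0 (x == y)

    ψ≥0 : ∀ x y s t → 0ℚ ≤ ψ x y s t
    ψ≥0 x y s t = (δ≥0 s x ⊠ δ≥0 t y) ⊞ (α≥0 x s ⊠ α≥0 t y) ⊞ (δ≥0 s x ⊠ cd≥0 t y) ⊞ (δ≥0 s y ⊠ cd≥0 t x)

    closes⇒ψ : ∀ {s t x y} → Closes A s t x y → 1ℚ ≤ ψ x y s t
    closes⇒ψ {s} {t} {x} {y} c = go c
      where
      p₁ = δ≥0 s x ⊠ δ≥0 t y
      p₂ = α≥0 x s ⊠ α≥0 t y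
      p₃ = δ≥0 s x ⊠ cd≥0 t y
      p₄ = δ≥0 s y ⊠ cd≥0 t x
      l1 : ∀ a b c d → a + b + c + d ≡ 1ℚ + (a - 1ℚ + b + c + d)
      l1 = solve 4 (λ a b c d → (a ⊕ b ⊕ c ⊕ d) ⊜ (Κ 1ℚ ⊕ (a ⊖ Κ 1ℚ ⊕ b ⊕ c ⊕ d))) refl
      l2 : ∀ a b c d → a + b + c + d ≡ 1ℚ + (b - 1ℚ + a + c + d)
      l2 = solve 4 (λ a b c d → (a ⊕ b ⊕ c ⊕ d) ⊜ (Κ 1ℚ ⊕ (b ⊖ Κ 1ℚ ⊕ a ⊕ c ⊕ d))) refl
      l3 : ∀ a b c d → a + b + c + d ≡ 1ℚ + (c - 1ℚ + b + a + d)
      l3 = solve 4 (λ a b c d → (a ⊕ b ⊕ c ⊕ d) ⊜ (Κ 1ℚ ⊕ (c ⊖ Κ 1ℚ ⊕ b ⊕ a ⊕ d))) refl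
      l4 : ∀ a b c d → a + b + c + d ≡ 1ℚ + (d - 1ℚ + b + c + a)
      l4 = solve 4 (λ a b c d → (a ⊕ b ⊕ c ⊕ d) ⊜ (Κ 1ℚ ⊕ (d ⊖ Κ 1ℚ ⊕ b ⊕ c ⊕ a))) refl
      pick : ∀ a b c d → 0ℚ ≤ a → 0ℚ ≤ b → 0ℚ ≤ c → 0ℚ ≤ d → (1ℚ ≤ a) ⊎ ((1ℚ ≤ b) ⊎ ((1ℚ ≤ c) ⊎ (1ℚ ≤ d))) → 1ℚ ≤ a + b + c + d
      pick a b c d ha hb hc hd (inj₁ h) = cert (sub h ⊞ hb ⊞ hc ⊞ hd) (l1 a b c d)
      pick a b c d ha hb hc hd (inj₂ (inj₁ h)) = cert (sub h ⊞ ha ⊞ hc ⊞ hd) (l2 a b c d)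
      pick a b c d ha hb hc hd (inj₂ (inj₂ (inj₁ h))) = cert (sub h ⊞ hb ⊞ ha ⊞ hd) (l3 a b c d)
      pick a b c d ha hb hc hd (inj₂ (inj₂ (inj₂ h))) = cert (sub h ⊞ hb ⊞ hc ⊞ ha) (l4 a b c d)
      one : ∀ {a b} → 1ℚ ≤ a → 1ℚ ≤ b → 1ℚ ≤ a * b
      one {a} {b} p q = ≤-trans (≤-reflexive (sym (ℚP.*-identityˡ 1ℚ))) (mul≤ 0≤1 p 0≤1 q)
      tr : ∀ {b} → b ≡ true → 1ℚ ≤ ⟦ b ⟧
      tr e = ≤-reflexive (sym (⟦⟧-true e))
      dr : ∀ {u v : Fin n} → u ≡ v → 1ℚ ≤ δ u v
      dr {u} refl = ≤-reflexive (sym (δ-refl u))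
      fin = pick (δ s x * δ t y) (α x s * α t y) (δ s x * cd t y) (δ s y * cd t x) p₁ p₂ p₃ p₄
      go : Closes A s t x y → 1ℚ ≤ ψ x y s t
      go (itself e f) = fin (inj₁ (one (dr e) (dr f)))
      go (middle e f) = fin (inj₂ (inj₁ (one (tr e) (tr f))))
      go (at-x e b f g) = fin (inj₂ (inj₂ (inj₁ (one (dr e) (cd-witness b f g)))))
      go (at-y e b f g) = fin (inj₂ (inj₂ (inj₂ (one (dr e) (cd-witness b f g)))))

    kill≤ψ : ∀ {s t} x y → op A s t ≡ true → kill s t x y ≤ ψ x y s t + ψ x y t s
    kill≤ψ {s} {t} x y hst with bool-dec (op A x y)
    ... | inj₂ e = ≤-trans (kill≤ω s t x y) (≤-trans (≤-reflexive (⟦⟧-false e)) (ψ≥0 x y s t ⊞ ψ≥0 x y t s))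
    ... | inj₁ e with bool-dec (op (add A s t) x y)
    ...   | inj₁ e′ = ≤-trans (≤-reflexive (trans (cong₂ _-_ (⟦⟧-true e) (⟦⟧-true e′)) (ℚP.+-inverseʳ 1ℚ))) (ψ≥0 x y s t ⊞ ψ≥0 x y t s)
    ...   | inj₂ e′ with closes C hst e e′
    ...     | inj₁ c = ≤-trans (kill≤ω s t x y) (≤-trans (⟦⟧≤1 (op A x y)) (≤-trans (closes⇒ψ c) (cert (ψ≥0 x y t s) refl)))
    ...     | inj₂ c = ≤-trans (kill≤ω s t x y) (≤-trans (⟦⟧≤1 (op A x y)) (≤-trans (closes⇒ψ c) (cert (ψ≥0 x y s t) (ℚP.+-comm (ψ x y s t) (ψ x y t s)))))

    -- ψ without the term for the edge itself and without degenerate walks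
    φ : Fin n → Fin n → Fin n → Fin n → ℚ
    φ x y s t = α x s * α t y + δ s x * (ν t y * cd t y) + δ s y * (ν t x * cd t x)

    -- At most one unit is counted on the left. If st meets xy in a single vertex, one codegree term
    -- survives and is at most 1. If st avoids x and y, the two middle terms exclude each other,
    -- since s and t would be two common neighbours of x and y. If st = xy, everything vanishes.
    -- Each unit exhibits a walk through st that closes xy.
    φ≤kill : ∀ {s t x y} → op A s t ≡ true → op A x y ≡ true → φ x y s t + φ x y t s ≤ kill s t x y
    φ≤kill {s} {t} {x} {y} hst hxy = main (fin-dec s x) (fin-dec s y) (fin-dec t x) (fin-dec t y)
      where
      s≢t : ¬ s ≡ t
      s≢t = op⇒≢ {A = A} hst
      x≢y : ¬ x ≡ y
      x≢y = op⇒≢ {A = A} hxy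
      axy : α x y ≡ 0ℚ
      axy = ⟦⟧-false (op⇒nadj {A = A} hxy)
      killed : op (add A s t) x y ≡ false → kill s t x y ≡ 1ℚ
      killed e = trans (cong₂ _-_ (⟦⟧-true hxy) (⟦⟧-false e)) refl
      expand : ∀ {a b c d e f g h i j k l m o p q r} → α x s ≡ a → α t y ≡ b → δ s x ≡ c → ν t y ≡ d → cd t y ≡ e →
        δ s y ≡ f → ν t x ≡ g → cd t x ≡ h → α x t ≡ i → α s y ≡ j → δ t x ≡ k → ν s y ≡ l → cd s y ≡ m →
        δ t y ≡ o → ν s x ≡ p → cd s x ≡ q → (a * b + c * (d * e) + f * (g * h)) + (i * j + k * (l * m) + o * (p * q)) ≡ r →
        r ≤ kill s t x y → φ x y s t + φ x y t s ≤ kill s t x y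
      expand refl refl refl refl refl refl refl refl refl refl refl refl refl refl refl refl e h = ≤-trans (≤-reflexive e) h
      single : ∀ {u v} → ¬ u ≡ v → (∀ b → A u b ≡ true → A b v ≡ true → op (add A s t) x y ≡ false) → cd u v ≤ kill s t x y
      single {u} {v} ne h with cd-cases u v
      ... | inj₁ e = ≤-trans (≤-reflexive e) (kill≥0 s t x y)
      ... | inj₂ (b , p , q) = ≤-trans (cd≤1 ne) (≤-reflexive (sym (killed (h b p q))))
      main : (s ≡ x) ⊎ (¬ s ≡ x) → (s ≡ y) ⊎ (¬ s ≡ y) → (t ≡ x) ⊎ (¬ t ≡ x) → (t ≡ y) ⊎ (¬ t ≡ y) → φ x y s t + φ x y t s ≤ kill s t x y
      main (inj₁ refl) (inj₁ e) _ _ = ⊥-elim (x≢y e)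
      main (inj₁ refl) _ (inj₁ e) _ = ⊥-elim (s≢t (sym e))
      main _ (inj₁ refl) _ (inj₁ e) = ⊥-elim (s≢t (sym e))
      main _ _ (inj₁ refl) (inj₁ e) = ⊥-elim (x≢y e)
      main (inj₁ refl) (inj₂ b) (inj₂ c) (inj₁ refl) =
        expand (α-irr x) refl refl (ν-refl y) refl (δ-≢ x≢y) refl refl refl axy (δ-≢ c) refl refl refl (ν-refl x) refl
          (l (α y y) (δ x x) (cd y y) (ν y x) (cd y x) (α x y) (ν x y) (cd x y) (δ y y) (cd x x)) (kill≥0 s t x y)
        where l : ∀ a b c d e f g h i j → (0ℚ * a + b * (0ℚ * c) + 0ℚ * (d * e)) + (f * 0ℚ + 0ℚ * (g * h) + i * (0ℚ * j)) ≡ 0ℚ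
              l = solve 10 (λ a b c d e f g h i j → ((Κ 0ℚ ⊗ a ⊕ b ⊗ (Κ 0ℚ ⊗ c) ⊕ Κ 0ℚ ⊗ (d ⊗ e)) ⊕ (f ⊗ Κ 0ℚ ⊕ Κ 0ℚ ⊗ (g ⊗ h) ⊕ i ⊗ (Κ 0ℚ ⊗ j)))
                  ⊜ (Κ 0ℚ)) refl
      main (inj₂ a) (inj₁ refl) (inj₁ refl) (inj₂ d) =
        expand axy refl (δ-≢ a) refl refl refl (ν-refl x) refl (α-irr x) refl refl (ν-refl y) refl (δ-≢ d) refl refl
          (l (α x y) (ν x y) (cd x y) (δ y y) (cd x x) (α y y) (δ x x) (cd y y) (ν y x) (cd y x)) (kill≥0 s t x y)
        where l : ∀ a b c d e f g h i j → (0ℚ * a + 0ℚ * (b * c) + d * (0ℚ * e)) + (0ℚ * f + g * (0ℚ * h) + 0ℚ * (i * j)) ≡ 0ℚ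
              l = solve 10 (λ a b c d e f g h i j → ((Κ 0ℚ ⊗ a ⊕ Κ 0ℚ ⊗ (b ⊗ c) ⊕ d ⊗ (Κ 0ℚ ⊗ e)) ⊕ (Κ 0ℚ ⊗ f ⊕ g ⊗ (Κ 0ℚ ⊗ h) ⊕ Κ 0ℚ ⊗ (i ⊗ j)))
                  ⊜ (Κ 0ℚ)) refl
      main (inj₁ refl) (inj₂ b) (inj₂ c) (inj₂ d) =
        expand (α-irr x) refl (δ-refl x) (ν-≢ d) refl (δ-≢ b) refl refl refl axy (δ-≢ c) refl refl (δ-≢ d) refl refl
          (l (α t y) (cd t y) (ν t x) (cd t x) (α x t) (ν x y) (cd x y) (ν x x) (cd x x))
          (single d (λ b p q → walk⇒¬op {A = add A s t} t b (add-st {A = A}) (add-old {A = A} p) (add-old {A = A} q)))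
        where l : ∀ a b c d e f g h i → (0ℚ * a + 1ℚ * (1ℚ * b) + 0ℚ * (c * d)) + (e * 0ℚ + 0ℚ * (f * g) + 0ℚ * (h * i)) ≡ b
              l = solve 9 (λ a b c d e f g h i → ((Κ 0ℚ ⊗ a ⊕ Κ 1ℚ ⊗ (Κ 1ℚ ⊗ b) ⊕ Κ 0ℚ ⊗ (c ⊗ d)) ⊕ (e ⊗ Κ 0ℚ ⊕ Κ 0ℚ ⊗ (f ⊗ g) ⊕ Κ 0ℚ ⊗ (h ⊗ i)))
                  ⊜ (b)) refl
      main (inj₂ a) (inj₁ refl) (inj₂ c) (inj₂ d) =
        expand axy′ refl (δ-≢ a) refl refl (δ-refl y) (ν-≢ c) refl refl (α-irr y) (δ-≢ c) refl refl (δ-≢ d) refl refl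
          (l (α t y) (ν t y) (cd t y) (cd t x) (α x t) (ν y y) (cd y y) (ν y x) (cd y x))
          (single c (λ b p q → walk⇒¬op {A = add A s t} b t (add-old {A = A} (adj-sym q)) (add-old {A = A} (adj-sym p)) (add-ts {A = A})))
        where axy′ = axy
              l : ∀ a b c d e f g h i → (0ℚ * a + 0ℚ * (b * c) + 1ℚ * (1ℚ * d)) + (e * 0ℚ + 0ℚ * (f * g) + 0ℚ * (h * i)) ≡ d
              l = solve 9 (λ a b c d e f g h i → ((Κ 0ℚ ⊗ a ⊕ Κ 0ℚ ⊗ (b ⊗ c) ⊕ Κ 1ℚ ⊗ (Κ 1ℚ ⊗ d)) ⊕ (e ⊗ Κ 0ℚ ⊕ Κ 0ℚ ⊗ (f ⊗ g) ⊕ Κ 0ℚ ⊗ (h ⊗ i)))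
                  ⊜ (d)) refl
      main (inj₂ a) (inj₂ b) (inj₁ refl) (inj₂ d) =
        expand refl axy (δ-≢ a) refl refl (δ-≢ b) refl refl (α-irr x) refl (δ-refl x) (ν-≢ b) refl (δ-≢ d) refl refl
          (l (α x s) (ν x y) (cd x y) (ν x x) (cd x x) (α s y) (cd s y) (ν s x) (cd s x))
          (single b (λ b p q → walk⇒¬op {A = add A s t} s b (add-ts {A = A}) (add-old {A = A} p) (add-old {A = A} q)))
        where l : ∀ a b c d e f g h i → (a * 0ℚ + 0ℚ * (b * c) + 0ℚ * (d * e)) + (0ℚ * f + 1ℚ * (1ℚ * g) + 0ℚ * (h * i)) ≡ g
              l = solve 9 (λ a b c d e f g h i → ((a ⊗ Κ 0ℚ ⊕ Κ 0ℚ ⊗ (b ⊗ c) ⊕ Κ 0ℚ ⊗ (d ⊗ e)) ⊕ (Κ 0ℚ ⊗ f ⊕ Κ 1ℚ ⊗ (Κ 1ℚ ⊗ g) ⊕ Κ 0ℚ ⊗ (h ⊗ i)))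
                  ⊜ (g)) refl
      main (inj₂ a) (inj₂ b) (inj₂ c) (inj₁ refl) =
        expand refl (α-irr y) (δ-≢ a) refl refl (δ-≢ b) refl refl axy refl (δ-≢ c) refl refl (δ-refl y) (ν-≢ a) refl
          (l (α x s) (ν y y) (cd y y) (ν y x) (cd y x) (α s y) (ν s y) (cd s y) (cd s x))
          (single a (λ b p q → walk⇒¬op {A = add A s t} b s (add-old {A = A} (adj-sym q)) (add-old {A = A} (adj-sym p)) (add-st {A = A})))
        where l : ∀ a b c d e f g h i → (a * 0ℚ + 0ℚ * (b * c) + 0ℚ * (d * e)) + (0ℚ * f + 0ℚ * (g * h) + 1ℚ * (1ℚ * i)) ≡ i
              l = solve 9 (λ a b c d e f g h i → ((a ⊗ Κ 0ℚ ⊕ Κ 0ℚ ⊗ (b ⊗ c) ⊕ Κ 0ℚ ⊗ (d ⊗ e)) ⊕ (Κ 0ℚ ⊗ f ⊕ Κ 0ℚ ⊗ (g ⊗ h) ⊕ Κ 1ℚ ⊗ (Κ 1ℚ ⊗ i)))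
                  ⊜ (i)) refl
      main (inj₂ a) (inj₂ b) (inj₂ c) (inj₂ d) =
        expand refl refl (δ-≢ a) refl refl (δ-≢ b) refl refl refl refl (δ-≢ c) refl refl (δ-≢ d) refl refl
          (l (α x s) (α t y) (ν t y) (cd t y) (ν t x) (cd t x) (α x t) (α s y) (ν s y) (cd s y) (ν s x) (cd s x)) two
        where
        l : ∀ a b c d e f g h i j k m → (a * b + 0ℚ * (c * d) + 0ℚ * (e * f)) + (g * h + 0ℚ * (i * j) + 0ℚ * (k * m)) ≡ a * b + g * h
        l = solve 12 (λ a b c d e f g h i j k m → ((a ⊗ b ⊕ Κ 0ℚ ⊗ (c ⊗ d) ⊕ Κ 0ℚ ⊗ (e ⊗ f)) ⊕ (g ⊗ h ⊕ Κ 0ℚ ⊗ (i ⊗ j) ⊕ Κ 0ℚ ⊗ (k ⊗ m)))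
            ⊜ (a ⊗ b ⊕ g ⊗ h)) refl
        two : α x s * α t y + α x t * α s y ≤ kill s t x y
        two with bool-dec (A x s ∧ A t y) | bool-dec (A x t ∧ A s y)
        ... | inj₁ p | inj₁ q = ⊥-elim (s≢t (unique x≢y (∧-left p) (∧-right {A x t} q) (∧-left q) (∧-right {A x s} p)))
        ... | inj₁ p | inj₂ q = ≤-reflexive (trans (cong₂ _+_ (trans (sym (⟦⟧-∧ (A x s) (A t y))) (⟦⟧-true p)) (trans (sym (⟦⟧-∧ (A x t) (A s y))) (⟦⟧-false q)))
                (sym (killed (walk⇒¬op {A = add A s t} s t (add-old {A = A} (∧-left p)) (add-st {A = A}) (add-old {A = A} (∧-right {A x s} p))))))
        ... | inj₂ p | inj₁ q = ≤-reflexive (trans (cong₂ _+_ (trans (sym (⟦⟧-∧ (A x s) (A t y))) (⟦⟧-false p)) (trans (sym (⟦⟧-∧ (A x t) (A s y))) (⟦⟧-true q)))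
                (sym (killed (walk⇒¬op {A = add A s t} t s (add-old {A = A} (∧-left q)) (add-ts {A = A}) (add-old {A = A} (∧-right {A x t} q))))))
        ... | inj₂ p | inj₂ q = ≤-trans (≤-reflexive (cong₂ _+_ (trans (sym (⟦⟧-∧ (A x s) (A t y))) (⟦⟧-false p)) (trans (sym (⟦⟧-∧ (A x t) (A s y))) (⟦⟧-false q)))) (kill≥0 s t x y)

  -- Closures of a pair, summed over all candidates for the next edge

  module Sums {n} (A : Fin n → Fin n → Bool) (C : C4Free A) where
    open Facts A C public

    opsum : (Fin n → Fin n → ℚ) → ℚ
    opsum ψ = ∑ λ s → ∑ λ t → ω s t * ψ s t

    opsum-+ : ∀ f g → opsum (λ s t → f s t + g s t) ≡ opsum f + opsum g
    opsum-+ f g = trans (∑-cong λ s → trans (∑-cong λ t → ℚP.*-distribˡ-+ (ω s t) (f s t) (g s t)) (∑-+ (λ t → ω s t * f s t) (λ t → ω s t * g s t)))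
                    (∑-+ (λ s → ∑ λ t → ω s t * f s t) (λ s → ∑ λ t → ω s t * g s t))

    opsum-mono : ∀ {f g} → (∀ s t → f s t ≤ g s t) → opsum f ≤ opsum g
    opsum-mono h = ∑-mono λ s → ∑-mono λ t → mulˡ (ω≥0 s t) (h s t)

    opsum-δ : ∀ x (f : Fin n → ℚ) → opsum (λ s t → δ s x * f t) ≡ ∑ λ t → ω x t * f t
    opsum-δ x f = trans (∑-cong λ s → trans (∑-cong λ t → l (ω s t) (δ s x) (f t)) (∑-*ˡ (δ s x) (λ t → ω s t * f t))) (∑-δ′ x (λ s → ∑ λ t → ω s t * f t))
      where l : ∀ a b c → a * (b * c) ≡ b * (a * c)
            l = solve 3 (λ a b c → (a ⊗ (b ⊗ c)) ⊜ (b ⊗ (a ⊗ c))) refl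

    opsum-edge : ∀ x y → opsum (λ s t → δ s x * δ t y) ≡ ω x y
    opsum-edge x y = trans (opsum-δ x (λ t → δ t y)) (trans (∑-cong λ t → ℚP.*-comm (ω x t) (δ t y)) (∑-δ′ y (ω x)))

    opsum-mid : ∀ x y → opsum (λ s t → α x s * α t y) ≡ ∑ λ a → α x a * Nm y a
    opsum-mid x y = ∑-cong λ s → trans (∑-cong λ t → trans (cong₂ (λ u v → u * (α x s * v)) (ω-sym s t) (α-sym t y)) (l (ω t s) (α x s) (α y t)))
                                       (∑-*ˡ (α x s) (λ t → α y t * ω t s))
      where l : ∀ a b c → a * (b * c) ≡ b * (c * a)
            l = solve 3 (λ a b c → (a ⊗ (b ⊗ c)) ⊜ (b ⊗ (c ⊗ a))) refl

    opsum-end : ∀ x y → opsum (λ s t → δ s x * cd t y) ≡ ∑ λ b → α y b * Nm b x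
    opsum-end x y = trans (opsum-δ x (λ t → cd t y)) (trans (∑-cong λ t → sym (∑-*ˡ (ω x t) (λ b → α t b * α b y)))
       (trans (∑-swap (λ t b → ω x t * (α t b * α b y)))
         (∑-cong λ b → trans (∑-cong λ t → trans (cong₂ _*_ (ω-sym x t) (cong₂ _*_ (α-sym t b) (α-sym b y))) (l (ω t x) (α b t) (α y b)))
            (∑-*ˡ (α y b) (λ t → α b t * ω t x)))))
      where l : ∀ a b c → a * (b * c) ≡ c * (b * a)
            l = solve 3 (λ a b c → (a ⊗ (b ⊗ c)) ⊜ (c ⊗ (b ⊗ a))) refl

    opsum-ψ : ∀ x y → opsum (ψ x y) ≡ ω x y + cl x y
    opsum-ψ x y = trans (opsum-+ (λ s t → δ s x * δ t y + α x s * α t y + δ s x * cd t y) (λ s t → δ s y * cd t x))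
      (trans (cong₂ _+_ (trans (opsum-+ (λ s t → δ s x * δ t y + α x s * α t y) (λ s t → δ s x * cd t y))
          (cong₂ _+_ (trans (opsum-+ (λ s t → δ s x * δ t y) (λ s t → α x s * α t y)) (cong₂ _+_ (opsum-edge x y) (opsum-mid x y))) (opsum-end x y))) (opsum-end y x))
        (trans (l (ω x y) (∑ λ a → α x a * Nm y a) (∑ λ b → α y b * Nm b x) (∑ λ a → α x a * Nm a y))
          (cong (λ u → ω x y + (u + ∑ λ b → α y b * Nm b x)) (trans (sym (∑-+ (λ a → α x a * Nm y a) (λ a → α x a * Nm a y)))
             (∑-cong λ a → sym (ℚP.*-distribˡ-+ (α x a) (Nm y a) (Nm a y)))))))
      where l : ∀ a b c d → a + b + c + d ≡ a + ((b + d) + c)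
            l = solve 4 (λ a b c d → (a ⊕ b ⊕ c ⊕ d) ⊜ (a ⊕ ((b ⊕ d) ⊕ c))) refl

    S-kill≤ : ∀ x y → SA (λ s t → kill s t x y) ≤ ω x y + cl x y
    S-kill≤ x y = ≤-trans (S-mono (valid A) (λ s t v → kill≤ψ x y (valid⇒op {A = A} v))) (≤-reflexive (trans (S-sym (ψ x y)) (opsum-ψ x y)))

    α-idem : ∀ x y → α x y * α x y ≡ α x y
    α-idem x y = idem (A x y)
      where idem : ∀ b → ⟦ b ⟧ * ⟦ b ⟧ ≡ ⟦ b ⟧
            idem true = refl
            idem false = refl

    cd-diag : ∀ x → cd x x ≡ deg x
    cd-diag x = ∑-cong λ b → trans (cong (α x b *_) (α-sym b x)) (α-idem x b)

    νδ : ∀ (x y : Fin n) → ν x y ≡ 1ℚ - δ x y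
    νδ x y = h (x == y)
      where h : ∀ b → ⟦ not b ⟧ ≡ 1ℚ - ⟦ b ⟧
            h true = refl
            h false = refl

    δcd : ∀ t y → δ t y * cd t y ≡ δ t y * deg y
    δcd t y with fin-dec t y
    ... | inj₁ refl = cong (δ t t *_) (cd-diag t)
    ... | inj₂ ne = trans (cong (_* cd t y) (δ-≢ ne)) (trans (ℚP.*-zeroˡ (cd t y)) (sym (trans (cong (_* deg y) (δ-≢ ne)) (ℚP.*-zeroˡ (deg y)))))

    ψ-φ : ∀ x y s t → ψ x y s t + δ s x * δ t y * (- (1ℚ + deg y)) + δ s y * δ t x * (- deg x) ≡ φ x y s t
    ψ-φ x y s t = trans (l (δ s x) (δ t y) (α x s * α t y) (cd t y) (δ s y) (cd t x) (deg y) (δ t x) (deg x))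
         (trans (cong₂ (λ u v → α x s * α t y + δ s x * (cd t y - u) + δ s y * (cd t x - v)) (sym (δcd t y)) (sym (δcd t x)))
           (cong₂ (λ u v → α x s * α t y + δ s x * u + δ s y * v) (fac t y) (fac t x)))
      where
      l : ∀ a b p c e f g h i → a * b + p + a * c + e * f + a * b * (- (1ℚ + g)) + e * h * (- i) ≡ p + a * (c - b * g) + e * (f - h * i)
      l = solve 9 (λ a b p c e f g h i → (a ⊗ b ⊕ p ⊕ a ⊗ c ⊕ e ⊗ f ⊕ a ⊗ b ⊗ (⊝ (Κ 1ℚ ⊕ g)) ⊕ e ⊗ h ⊗ (⊝ i))
          ⊜ (p ⊕ a ⊗ (c ⊖ b ⊗ g) ⊕ e ⊗ (f ⊖ h ⊗ i))) refl
      fac : ∀ t y → cd t y - δ t y * cd t y ≡ ν t y * cd t y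
      fac t y = trans (l′ (cd t y) (δ t y)) (cong (_* cd t y) (sym (νδ t y)))
        where l′ : ∀ c d → c - d * c ≡ (1ℚ - d) * c
              l′ = solve 2 (λ c d → (c ⊖ d ⊗ c) ⊜ ((Κ 1ℚ ⊖ d) ⊗ c)) refl

    opsum-*ʳ : ∀ c f → opsum (λ s t → f s t * c) ≡ opsum f * c
    opsum-*ʳ c f = trans (∑-cong λ s → trans (∑-cong λ t → sym (ℚP.*-assoc (ω s t) (f s t) c)) (∑-*ʳ c (λ t → ω s t * f s t))) (∑-*ʳ c (λ s → ∑ λ t → ω s t * f s t))

    -- The sums of `ψ` and `φ` differ only where st is xy itself: there `itself` counts once and a
    -- diagonal codegree, which is a degree, appears in each of the two codegree terms.
    opsum-φ : ∀ {x y} → op A x y ≡ true → opsum (φ x y) ≡ cl x y - deg x - deg y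
    opsum-φ {x} {y} h = trans (∑-cong λ s → ∑-cong λ t → cong (ω s t *_) (sym (ψ-φ x y s t)))
      (trans (opsum-+ (λ s t → ψ x y s t + δ s x * δ t y * (- (1ℚ + deg y))) (λ s t → δ s y * δ t x * (- deg x)))
       (trans (cong₂ _+_ (trans (opsum-+ (ψ x y) (λ s t → δ s x * δ t y * (- (1ℚ + deg y)))) (cong₂ _+_ (opsum-ψ x y)
           (trans (opsum-*ʳ (- (1ℚ + deg y)) (λ s t → δ s x * δ t y)) (cong (_* (- (1ℚ + deg y))) (opsum-edge x y)))))
         (trans (opsum-*ʳ (- deg x) (λ s t → δ s y * δ t x)) (cong (_* (- deg x)) (trans (opsum-edge y x) (ω-sym y x)))))
        (trans (cong (λ o → o + cl x y + o * (- (1ℚ + deg y)) + o * (- deg x)) (⟦⟧-true h)) (l (cl x y) (deg x) (deg y)))))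
      where l : ∀ c a b → 1ℚ + c + 1ℚ * (- (1ℚ + b)) + 1ℚ * (- a) ≡ c - a - b
            l = solve 3 (λ c a b → (Κ 1ℚ ⊕ c ⊕ Κ 1ℚ ⊗ (⊝ (Κ 1ℚ ⊕ b)) ⊕ Κ 1ℚ ⊗ (⊝ a)) ⊜ (c ⊖ a ⊖ b)) refl

    S-kill≥ : ∀ {x y} → op A x y ≡ true → cl x y - deg x - deg y ≤ SA (λ s t → kill s t x y)
    S-kill≥ {x} {y} h = ≤-trans (≤-reflexive (sym (trans (S-sym (φ x y)) (opsum-φ h)))) (S-mono (valid A) (λ s t v → φ≤kill (valid⇒op {A = A} v) h))

    -- The worst case is x on st, when everything within distance 2 of the other end may be lost.
    -- This is the jump bound for `opdeg` and `Cm`.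
    kill-row : ∀ {s t} x Δ → op A s t ≡ true → (∀ u → deg u ≤ Δ) → 0ℚ ≤ Δ →
      ∑ (λ b → kill s t x b) ≤ ι 2 * ((1ℚ + Δ) * (1ℚ + Δ))
    kill-row {s} {t} x Δ hst hd Δ0 = ≤-trans (∑-mono λ b → kill≤ψ x b hst) (≤-trans (≤-reflexive (∑-+ (λ b → ψ x b s t) (λ b → ψ x b t s)))
        (≤-trans (add≤ (row s t) (row t s)) (≤-reflexive (l Δ))))
      where
      l : ∀ D → (1ℚ + D) * (1ℚ + D) + (1ℚ + D) * (1ℚ + D) ≡ ι 2 * ((1ℚ + D) * (1ℚ + D))
      l = solve 1 (λ D → ((Κ 1ℚ ⊕ D) ⊗ (Κ 1ℚ ⊕ D) ⊕ (Κ 1ℚ ⊕ D) ⊗ (Κ 1ℚ ⊕ D)) ⊜ (Κ (ι 2) ⊗ ((Κ 1ℚ ⊕ D) ⊗ (Κ 1ℚ ⊕ D)))) refl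
      cdrow : ∀ t → ∑ (λ b → cd t b) ≤ Δ * Δ
      cdrow t = ≤-trans (≤-reflexive (trans (∑-swap (λ b z → α t z * α z b)) (∑-cong λ z → ∑-*ˡ (α t z) (λ b → α z b))))
          (≤-trans (∑-mono λ z → mulˡ (α≥0 t z) (hd z)) (≤-trans (≤-reflexive (∑-*ʳ Δ (α t))) (mulʳ Δ0 (hd t))))
      cdt : ∀ s t → cd t x ≤ Δ
      cdt s t = ≤-trans (∑-mono λ b → ≤-trans (mulˡ (α≥0 t b) (⟦⟧≤1 (A b x))) (≤-reflexive (ℚP.*-identityʳ (α t b)))) (hd t)
      row : ∀ s t → ∑ (λ b → ψ x b s t) ≤ (1ℚ + Δ) * (1ℚ + Δ)
      row s t = ≤-trans (≤-reflexive (trans (∑-+ (λ b → δ s x * δ t b + α x s * α t b + δ s x * cd t b) (λ b → δ s b * cd t x))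
          (cong₂ _+_ (trans (∑-+ (λ b → δ s x * δ t b + α x s * α t b) (λ b → δ s x * cd t b))
             (cong₂ _+_ (trans (∑-+ (λ b → δ s x * δ t b) (λ b → α x s * α t b)) (cong₂ _+_ (trans (∑-cong λ b → ℚP.*-comm (δ s x) (δ t b)) (∑-δ t (λ _ → δ s x))) (∑-*ˡ (α x s) (α t))))
               (∑-*ˡ (δ s x) (cd t)))) (∑-δ s (λ _ → cd t x)))))
         (≤-trans (add≤ (add≤ (add≤ (⟦⟧≤1 (s == x)) (mul≤ (α≥0 x s) (⟦⟧≤1 (A x s)) (∑-nonneg (α≥0 t)) (hd t)))
             (mul≤ (⟦⟧≥0 (s == x)) (⟦⟧≤1 (s == x)) (∑-nonneg (cd≥0 t)) (cdrow t))) (cdt s t)) (≤-reflexive (l′ Δ)))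
        where l′ : ∀ D → 1ℚ + 1ℚ * D + 1ℚ * (D * D) + D ≡ (1ℚ + D) * (1ℚ + D)
              l′ = solve 1 (λ D → (Κ 1ℚ ⊕ Κ 1ℚ ⊗ D ⊕ Κ 1ℚ ⊗ (D ⊗ D) ⊕ D) ⊜ ((Κ 1ℚ ⊕ D) ⊗ (Κ 1ℚ ⊕ D))) refl

  -- Effect of one added edge on the counts

  module Step {n} (A : Fin n → Fin n → Bool) (C : C4Free A) (s t : Fin n) (hst : op A s t ≡ true) where
    open Sums A C public
    module Q′ = Quantities (add A s t)

    s≢t : ¬ s ≡ t
    s≢t = op⇒≢ {A = A} hst

    e : Fin n → Fin n → ℚ
    e x b = δ s x * δ t b + δ t x * δ s b

    δ≥0 : ∀ (x y : Fin n) → 0ℚ ≤ δ x y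
    δ≥0 x y = ⟦⟧≥0 (x == y)

    e≥0 : ∀ x b → 0ℚ ≤ e x b
    e≥0 x b = (δ≥0 s x ⊠ δ≥0 t b) ⊞ (δ≥0 t x ⊠ δ≥0 s b)

    ⟦∨⟧ : ∀ p q → (p ≡ true → q ≡ true → ⊥) → ⟦ p ∨ q ⟧ ≡ ⟦ p ⟧ + ⟦ q ⟧
    ⟦∨⟧ true true h = ⊥-elim (h refl refl)
    ⟦∨⟧ true false h = refl
    ⟦∨⟧ false q h = sym (ℚP.+-identityˡ ⟦ q ⟧)

    opaque
      unfolding eb add
      e-eb : ∀ x b → ⟦ eb s t x b ⟧ ≡ e x b
      e-eb x b = trans (⟦∨⟧ ((s == x) ∧ (t == b)) ((s == b) ∧ (t == x)) disj)
         (cong₂ _+_ (⟦⟧-∧ (s == x) (t == b)) (trans (⟦⟧-∧ (s == b) (t == x)) (ℚP.*-comm (δ s b) (δ t x))))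
        where
        disj : (s == x) ∧ (t == b) ≡ true → (s == b) ∧ (t == x) ≡ true → ⊥
        disj p q = s≢t (trans (==-sound (∧-left p)) (sym (==-sound (∧-right {s == b} q))))

      α′ : ∀ x b → Q′.α x b ≡ α x b + e x b
      α′ x b = trans (⟦∨⟧ (eb s t x b) (A x b) disj) (trans (ℚP.+-comm ⟦ eb s t x b ⟧ (α x b)) (cong (α x b +_) (e-eb x b)))
        where
        disj : eb s t x b ≡ true → A x b ≡ true → ⊥
        disj p q with eb-elim {s = s} {t} {x} {b} p
        ... | inj₁ (refl , refl) = true≢false q (op⇒nadj {A = A} hst)
        ... | inj₂ (refl , refl) = true≢false (adj-sym q) (op⇒nadj {A = A} hst)

    ∑-e : ∀ x (f : Fin n → ℚ) → ∑ (λ b → e x b * f b) ≡ δ s x * f t + δ t x * f s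
    ∑-e x f = trans (∑-cong λ b → l (δ s x) (δ t b) (δ t x) (δ s b) (f b))
      (trans (∑-+ (λ b → δ s x * (δ t b * f b)) (λ b → δ t x * (δ s b * f b)))
        (cong₂ _+_ (trans (∑-*ˡ (δ s x) (λ b → δ t b * f b)) (cong (δ s x *_) (∑-δ t f)))
                   (trans (∑-*ˡ (δ t x) (λ b → δ s b * f b)) (cong (δ t x *_) (∑-δ s f)))))
      where l : ∀ a b c d f → (a * b + c * d) * f ≡ a * (b * f) + c * (d * f)
            l = solve 5 (λ a b c d f → ((a ⊗ b ⊕ c ⊗ d) ⊗ f) ⊜ (a ⊗ (b ⊗ f) ⊕ c ⊗ (d ⊗ f))) refl

    e-sym : ∀ x b → e x b ≡ e b x
    e-sym x b = l (δ s x) (δ t b) (δ t x) (δ s b)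
      where l : ∀ a b c d → a * b + c * d ≡ d * c + b * a
            l = solve 4 (λ a b c d → (a ⊗ b ⊕ c ⊗ d) ⊜ (d ⊗ c ⊕ b ⊗ a)) refl

    deg′ : ∀ x → Q′.deg x ≡ deg x + (δ s x + δ t x)
    deg′ x = trans (∑-cong (α′ x)) (trans (∑-+ (α x) (e x)) (cong (deg x +_)
       (trans (∑-cong λ b → sym (ℚP.*-identityʳ (e x b))) (trans (∑-e x (λ _ → 1ℚ)) (cong₂ _+_ (ℚP.*-identityʳ (δ s x)) (ℚP.*-identityʳ (δ t x)))))))

    K : Fin n → Fin n → ℚ
    K = kill s t

    ω′ : ∀ x y → Q′.ω x y ≡ ω x y - K x y
    ω′ x y = l (Q′.ω x y) (ω x y)
      where l : ∀ a b → a ≡ b - (b - a)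
            l = solve 2 (λ a b → (a) ⊜ (b ⊖ (b ⊖ a))) refl

    opdeg′ : ∀ x → Q′.opdeg x ≡ opdeg x - ∑ (K x)
    opdeg′ x = trans (∑-cong (ω′ x)) (trans (∑-+ (ω x) (λ b → - K x b)) (cong (opdeg x +_) (∑-neg (K x))))

    Cm′ : ∀ x y → Q′.Cm x y ≡ Cm x y - ∑ (λ b → K x b * ω b y) - ∑ (λ b → ω x b * K b y) + ∑ (λ b → K x b * K b y)
    Cm′ x y = trans (∑-cong λ b → trans (cong₂ _*_ (ω′ x b) (ω′ b y)) (l (ω x b) (K x b) (ω b y) (K b y)))
       (trans (∑-+ (λ b → ω x b * ω b y + - (K x b * ω b y) + - (ω x b * K b y)) (λ b → K x b * K b y))
         (cong (_+ ∑ (λ b → K x b * K b y)) (trans (∑-+ (λ b → ω x b * ω b y + - (K x b * ω b y)) (λ b → - (ω x b * K b y)))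
           (cong₂ _+_ (trans (∑-+ (λ b → ω x b * ω b y) (λ b → - (K x b * ω b y))) (cong (Cm x y +_) (∑-neg (λ b → K x b * ω b y))))
              (∑-neg (λ b → ω x b * K b y))))))
      where l : ∀ a k b m → (a - k) * (b - m) ≡ a * b + - (k * b) + - (a * m) + k * m
            l = solve 4 (λ a k b m → ((a ⊖ k) ⊗ (b ⊖ m)) ⊜ (a ⊗ b ⊕ ⊝ (k ⊗ b) ⊕ ⊝ (a ⊗ m) ⊕ k ⊗ m)) refl

    gain : Fin n → Fin n → ℚ
    gain x y = δ s x * ω t y + δ t x * ω s y

    -- Adding xb does not close by, because x and y have no common neighbour.
    no-self : ∀ {x y} → ¬ x ≡ y → cd x y ≡ 0ℚ → ∀ b → e x b * K b y ≡ 0ℚ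
    no-self {x} {y} ne c0 b with bool-dec (eb s t x b) | bool-dec (op A b y)
    ... | inj₂ p | _ = trans (cong (_* K b y) (trans (sym (e-eb x b)) (⟦⟧-false p))) (ℚP.*-zeroˡ (K b y))
    ... | inj₁ _ | inj₂ q = trans (cong (e x b *_) (ℚP.≤-antisym (≤-trans (kill≤ω s t b y) (≤-reflexive (⟦⟧-false q))) (kill≥0 s t b y))) (ℚP.*-zeroʳ (e x b))
    ... | inj₁ p | inj₁ q = trans (cong (e x b *_) (ℚP.≤-antisym (≤-trans (kill≤ψ b y hst) (≤-reflexive (go (eb-elim p)))) (kill≥0 s t b y))) (ℚP.*-zeroʳ (e x b))
      where
      aby : α b y ≡ 0ℚ
      aby = ⟦⟧-false (op⇒nadj {A = A} q)
      b≢y = op⇒≢ {A = A} q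
      l : ∀ dby abx cby cbb axy cxb → (0ℚ * dby + abx * 0ℚ + 0ℚ * cby + 0ℚ * cbb) + (1ℚ * 0ℚ + 0ℚ * axy + 1ℚ * 0ℚ + 0ℚ * cxb) ≡ 0ℚ
      l = solve 6 (λ dby abx cby cbb axy cxb → ((Κ 0ℚ ⊗ dby ⊕ abx ⊗ Κ 0ℚ ⊕ Κ 0ℚ ⊗ cby ⊕ Κ 0ℚ ⊗ cbb) ⊕ (Κ 1ℚ ⊗ Κ 0ℚ ⊕ Κ 0ℚ ⊗ axy ⊕ Κ 1ℚ ⊗ Κ 0ℚ ⊕ Κ 0ℚ ⊗ cxb))
          ⊜ (Κ 0ℚ)) refl
      sub8 : ∀ {a b′ c d e′ f g} → δ x b ≡ a → α b y ≡ b′ → δ x y ≡ c → δ b b ≡ d → α b b ≡ e′ → cd x y ≡ f → δ b y ≡ g →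
        ψ b y x b + ψ b y b x ≡ (a * δ b y + α b x * b′ + a * cd b y + c * cd b b) + (d * c + e′ * α x y + d * f + g * cd x b)
      sub8 refl refl refl refl refl refl refl = refl
      val : ¬ x ≡ b → ψ b y x b + ψ b y b x ≡ 0ℚ
      val x≢b = trans (sub8 (δ-≢ x≢b) aby (δ-≢ ne) (δ-refl b) (α-irr b) c0 (δ-≢ b≢y)) (l (δ b y) (α b x) (cd b y) (cd b b) (α x y) (cd x b))
      go : (s ≡ x × t ≡ b) ⊎ (s ≡ b × t ≡ x) → ψ b y s t + ψ b y t s ≡ 0ℚ
      go (inj₁ (refl , refl)) = val s≢t
      go (inj₂ (refl , refl)) = trans (ℚP.+-comm (ψ b y b x) (ψ b y x b)) (val (λ e → s≢t (sym e)))

    -- The cross term, a neighbour b gained by x in the same step in which by is closed, vanishes by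
    -- `no-self`; gain and loss then simply add.
    Nm′ : ∀ {x y} → ¬ x ≡ y → cd x y ≡ 0ℚ → Q′.Nm x y ≡ Nm x y + gain x y - ∑ (λ b → α x b * K b y)
    Nm′ {x} {y} ne c0 = trans (∑-cong λ b → trans (cong₂ _*_ (α′ x b) (ω′ b y)) (trans (l (α x b) (e x b) (ω b y) (K b y))
          (trans (cong (λ u → α x b * ω b y + e x b * ω b y + - (α x b * K b y) + - u) (no-self ne c0 b)) (ℚP.+-identityʳ (α x b * ω b y + e x b * ω b y + - (α x b * K b y))))))
       (trans (∑-+ (λ b → α x b * ω b y + e x b * ω b y) (λ b → - (α x b * K b y)))
         (cong₂ _+_ (trans (∑-+ (λ b → α x b * ω b y) (λ b → e x b * ω b y)) (cong (Nm x y +_) (∑-e x (λ b → ω b y)))) (∑-neg (λ b → α x b * K b y))))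
      where
      l : ∀ a e w k → (a + e) * (w - k) ≡ a * w + e * w + - (a * k) + - (e * k)
      l = solve 4 (λ a e w k → ((a ⊕ e) ⊗ (w ⊖ k)) ⊜ (a ⊗ w ⊕ e ⊗ w ⊕ ⊝ (a ⊗ k) ⊕ ⊝ (e ⊗ k))) refl

    -- Detects the edges st that give x and y their first common neighbour; see `cod⇒χ`.
    χ : Fin n → Fin n → Fin n → Fin n → ℚ
    χ x y s t = δ s x * α t y + δ s y * α t x

    χ≥0 : ∀ x y s t → 0ℚ ≤ χ x y s t
    χ≥0 x y s t = (⟦⟧≥0 (s == x) ⊠ α≥0 t y) ⊞ (⟦⟧≥0 (s == y) ⊠ α≥0 t x)

    cod-mono : ∀ {x y} → cod x y ≡ true → Q′.cod x y ≡ true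
    cod-mono {x} {y} h with ex-elim (λ z → A x z ∧ A z y) h
    ... | z , q = ex-intro (λ z → add A s t x z ∧ add A s t z y) z (∧-intro (add-old {A = A} (∧-left q)) (add-old {A = A} (∧-right {A x z} q)))

    cod-new : ∀ {x y} → ¬ x ≡ y → cod x y ≡ false → Q′.cod x y ≡ true →
      ((s ≡ x × A t y ≡ true) ⊎ (s ≡ y × A t x ≡ true)) ⊎ ((t ≡ x × A s y ≡ true) ⊎ (t ≡ y × A s x ≡ true))
    cod-new {x} {y} ne h h′ with ex-elim (λ z → add A s t x z ∧ add A s t z y) h′
    ... | z , q = go (add-elim {A = A} (∧-left q)) (add-elim {A = A} (∧-right {add A s t x z} q))
      where
      E : Fin n → Fin n → Set
      E u v = (s ≡ u × t ≡ v) ⊎ (s ≡ v × t ≡ u)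
      go : E x z ⊎ (A x z ≡ true) → E z y ⊎ (A z y ≡ true) → _
      go (inj₂ p) (inj₂ q) = ⊥-elim (true≢false (ex-intro (λ z → A x z ∧ A z y) z (∧-intro p q)) h)
      go (inj₁ (inj₁ (refl , refl))) (inj₂ q) = inj₁ (inj₁ (refl , q))
      go (inj₁ (inj₂ (refl , refl))) (inj₂ q) = inj₂ (inj₁ (refl , q))
      go (inj₂ p) (inj₁ (inj₁ (refl , refl))) = inj₂ (inj₂ (refl , adj-sym p))
      go (inj₂ p) (inj₁ (inj₂ (refl , refl))) = inj₁ (inj₂ (refl , adj-sym p))
      go (inj₁ (inj₁ (refl , refl))) (inj₁ (inj₁ (e , _))) = ⊥-elim (s≢t e)
      go (inj₁ (inj₁ (refl , refl))) (inj₁ (inj₂ (e , _))) = ⊥-elim (ne e)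
      go (inj₁ (inj₂ (refl , refl))) (inj₁ (inj₁ (_ , e))) = ⊥-elim (ne e)
      go (inj₁ (inj₂ (refl , refl))) (inj₁ (inj₂ (_ , e))) = ⊥-elim (s≢t (sym e))

    cod⇒χ : ∀ {x y} → ¬ x ≡ y → cod x y ≡ false → Q′.cod x y ≡ true → 1ℚ ≤ χ x y s t + χ x y t s
    cod⇒χ {x} {y} ne h h′ = go (cod-new ne h h′)
      where
      one : ∀ {u v z w} → u ≡ v → A z w ≡ true → 1ℚ ≤ δ u v * α z w
      one {u} {z = z} {w} refl p = ≤-reflexive (sym (cong₂ _*_ (δ-refl u) (⟦⟧-true p)))
      go : _ → 1ℚ ≤ χ x y s t + χ x y t s
      go (inj₁ (inj₁ (p , q))) = ≤-trans (one p q) (≤-trans (cert (⟦⟧≥0 (s == y) ⊠ α≥0 t x) refl) (cert (χ≥0 x y t s) refl))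
      go (inj₁ (inj₂ (p , q))) = ≤-trans (one p q) (≤-trans (cert (⟦⟧≥0 (s == x) ⊠ α≥0 t y) (ℚP.+-comm (δ s x * α t y) (δ s y * α t x))) (cert (χ≥0 x y t s) refl))
      go (inj₂ (inj₁ (p , q))) = ≤-trans (one p q) (≤-trans (cert (⟦⟧≥0 (t == y) ⊠ α≥0 s x) refl) (cert (χ≥0 x y s t) (ℚP.+-comm (χ x y s t) (χ x y t s))))
      go (inj₂ (inj₂ (p , q))) = ≤-trans (one p q) (≤-trans (cert (⟦⟧≥0 (t == x) ⊠ α≥0 s y) (ℚP.+-comm (δ t x * α s y) (δ t y * α s x))) (cert (χ≥0 x y s t) (ℚP.+-comm (χ x y s t) (χ x y t s))))

    -- A neighbour b of x can lose its open pair by in several ways, and most of them hit a single b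
    -- because codegrees are at most 1. The ways that would hit about deg x vertices require x and y
    -- to have a common neighbour after the step, which is excluded. What remains is st at y, and
    -- there the walk counts give the bound `B`.
    loss≤ : ∀ {x y} B → 1ℚ ≤ B → ¬ x ≡ y → Q′.cod x y ≡ false → (∀ u v → Pm u v ≤ B) →
      ∑ (λ b → α x b * K b y) ≤ ι 2 * (ι 3 + B)
    loss≤ {x} {y} B B1 ne hc hP = ≤-trans (∑-mono λ b → mulˡ (α≥0 x b) (kill≤ψ b y hst))
        (≤-trans (≤-reflexive (trans (∑-cong λ b → ℚP.*-distribˡ-+ (α x b) (ψ b y s t) (ψ b y t s)) (∑-+ (λ b → α x b * ψ b y s t) (λ b → α x b * ψ b y t s))))
          (≤-trans (add≤ (half s t (λ p q → newc (add-st {A = A}) p q) (λ p q → newd (add-ts {A = A}) p q) (λ p q → newe (add-st {A = A}) p q))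
                         (half t s (λ p q → newc (add-ts {A = A}) p q) (λ p q → newd (add-st {A = A}) p q) (λ p q → newe (add-ts {A = A}) p q)))
             (≤-reflexive (l B))))
      where
      l : ∀ B → (ι 3 + B) + (ι 3 + B) ≡ ι 2 * (ι 3 + B)
      l = solve 1 (λ B → ((Κ (ι 3) ⊕ B) ⊕ (Κ (ι 3) ⊕ B)) ⊜ (Κ (ι 2) ⊗ (Κ (ι 3) ⊕ B))) refl
      nocod : ∀ z → add A s t x z ≡ true → add A s t z y ≡ true → ⊥
      nocod z p q = true≢false (ex-intro (λ z → add A s t x z ∧ add A s t z y) z (∧-intro p q)) hc
      newc : ∀ {s′ t′} → add A s t s′ t′ ≡ true → s′ ≡ x → A t′ y ≡ true → ⊥
      newc h refl q = nocod _ h (add-old {A = A} q)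
      newd : ∀ {s′ t′} → add A s t t′ s′ ≡ true → t′ ≡ y → A s′ x ≡ true → ⊥
      newd {s′} {t′} h refl q = nocod s′ (add-old {A = A} (adj-sym q)) (C4Free.adj-sym (add-C4Free C hst) h)
      newe : ∀ {s′ t′} → add A s t s′ t′ ≡ true → s′ ≡ y → A t′ x ≡ true → ⊥
      newe {s′} {t′} h refl q = nocod t′ (add-old {A = A} (adj-sym q)) (C4Free.adj-sym (add-C4Free C hst) h)
      half : ∀ s t → (s ≡ x → A t y ≡ true → ⊥) → (t ≡ y → A s x ≡ true → ⊥) → (s ≡ y → A t x ≡ true → ⊥) →
        ∑ (λ b → α x b * ψ b y s t) ≤ ι 3 + B
      half s t h1 h2 h3 = ≤-trans (≤-reflexive (trans (∑-cong λ b → d4 (α x b) (δ s b) (δ t y) (α b s) (α t y) (cd t y) (δ s y) (cd t b))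
          (trans (∑-+ (λ b → δ s b * (α x b * δ t y) + α x b * α b s * α t y + δ s b * (α x b * cd t y)) (λ b → δ s y * (α x b * cd t b)))
           (cong₂ _+_ (trans (∑-+ (λ b → δ s b * (α x b * δ t y) + α x b * α b s * α t y) (λ b → δ s b * (α x b * cd t y)))
             (cong₂ _+_ (trans (∑-+ (λ b → δ s b * (α x b * δ t y)) (λ b → α x b * α b s * α t y))
                (cong₂ _+_ (∑-δ s (λ b → α x b * δ t y)) (∑-*ʳ (α t y) (λ b → α x b * α b s)))) (∑-δ s (λ b → α x b * cd t y))))
              (∑-*ˡ (δ s y) (λ b → α x b * cd t b))))))
          (add≤ (add≤ (add≤ (≤-trans (mul≤ (α≥0 x s) (⟦⟧≤1 (A x s)) (⟦⟧≥0 (t == y)) (⟦⟧≤1 (t == y))) ≤-refl) mid) end) far)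
        where
        d4 : ∀ a b c d e f g h → a * (b * c + d * e + b * f + g * h) ≡ b * (a * c) + a * d * e + b * (a * f) + g * (a * h)
        d4 = solve 8 (λ a b c d e f g h → (a ⊗ (b ⊗ c ⊕ d ⊗ e ⊕ b ⊗ f ⊕ g ⊗ h)) ⊜ (b ⊗ (a ⊗ c) ⊕ a ⊗ d ⊗ e ⊕ b ⊗ (a ⊗ f) ⊕ g ⊗ (a ⊗ h))) refl
        mid : cd x s * α t y ≤ 1ℚ
        mid with fin-dec s x
        ... | inj₁ p = ≤-trans (≤-reflexive (trans (cong (cd x s *_) (⟦⟧-false (¬true⇒false (h1 p)))) (ℚP.*-zeroʳ (cd x s)))) 0≤1
        ... | inj₂ p = mul≤ (cd≥0 x s) (cd≤1 (λ e → p (sym e))) (α≥0 t y) (⟦⟧≤1 (A t y))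
        end : α x s * cd t y ≤ 1ℚ
        end with fin-dec t y
        ... | inj₁ p = ≤-trans (≤-reflexive (trans (cong (_* cd t y) (⟦⟧-false (¬true⇒false (λ e → h2 p (adj-sym e))))) (ℚP.*-zeroˡ (cd t y)))) 0≤1
        ... | inj₂ p = mul≤ (α≥0 x s) (⟦⟧≤1 (A x s)) (cd≥0 t y) (cd≤1 p)
        -- For s = y the sum counts walks t z b x. None of them is degenerate because tx is not an
        -- edge, so `Pm t x` bounds their number.
        far : δ s y * ∑ (λ b → α x b * cd t b) ≤ B
        far with fin-dec s y
        ... | inj₂ p = ≤-trans (≤-reflexive (trans (cong (_* ∑ (λ b → α x b * cd t b)) (δ-≢ p)) (ℚP.*-zeroˡ (∑ (λ b → α x b * cd t b))))) (≤-trans 0≤1 B1)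
        ... | inj₁ p = ≤-trans (mulʳ (∑-nonneg λ b → α≥0 x b ⊠ cd≥0 t b) (⟦⟧≤1 (s == y))) (≤-trans (≤-reflexive (ℚP.*-identityˡ (∑ λ b → α x b * cd t b)))
             (≤-trans (≤-reflexive (trans (∑-cong λ b → sym (∑-*ˡ (α x b) (λ z → α t z * α z b))) (∑-swap (λ b z → α x b * (α t z * α z b)))))
               (≤-trans (∑-mono λ z → ∑-mono λ b → pt z b) (hP t x))))
          where
          tx : A t x ≡ false
          tx = ¬true⇒false (h3 p)
          pt : ∀ z b → α x b * (α t z * α z b) ≤ α t z * α z b * α b x * (ν z x * ν b t)
          pt z b with fin-dec z x | fin-dec b t
          ... | inj₁ refl | _ = ≤-trans (≤-reflexive (trans (cong (λ u → α z b * (u * α z b)) (⟦⟧-false tx)) (l0 (α z b))))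
                (α≥0 t z ⊠ α≥0 z b ⊠ α≥0 b z ⊠ (⟦⟧≥0 (not (z == z)) ⊠ ⟦⟧≥0 (not (b == t))))
            where l0 : ∀ a → a * (0ℚ * a) ≡ 0ℚ
                  l0 = solve 1 (λ a → (a ⊗ (Κ 0ℚ ⊗ a)) ⊜ (Κ 0ℚ)) refl
          ... | inj₂ _ | inj₁ refl = ≤-trans (≤-reflexive (trans (cong (λ u → u * (α b z * α z b)) (trans (α-sym x b) (⟦⟧-false tx))) (ℚP.*-zeroˡ (α b z * α z b))))
                (α≥0 b z ⊠ α≥0 z b ⊠ α≥0 b x ⊠ (⟦⟧≥0 (not (z == x)) ⊠ ⟦⟧≥0 (not (b == b))))
          ... | inj₂ p1 | inj₂ p2 = ≤-reflexive (trans (cong (λ u → u * (α t z * α z b)) (α-sym x b)) (trans (l1 (α b x) (α t z) (α z b))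
                 (sym (cong₂ (λ u v → α t z * α z b * α b x * (u * v)) (ν-≢ p1) (ν-≢ p2)))))
            where l1 : ∀ a b c → a * (b * c) ≡ b * c * a * (1ℚ * 1ℚ)
                  l1 = solve 3 (λ a b c → (a ⊗ (b ⊗ c)) ⊜ (b ⊗ c ⊗ a ⊗ (Κ 1ℚ ⊗ Κ 1ℚ))) refl

    walk-mono : ∀ x y → Pm x y ≤ Q′.Pm x y
    walk-mono x y = ∑-mono λ a → ∑-mono λ b → mulʳ (⟦⟧≥0 (not (a == y)) ⊠ ⟦⟧≥0 (not (b == x)))
        (mul≤ (α≥0 x a ⊠ α≥0 a b) (mul≤ (α≥0 x a) (g x a) (α≥0 a b) (g a b)) (α≥0 b y) (g b y))
      where
      g : ∀ x y → α x y ≤ Q′.α x y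
      g x y = cert (e≥0 x y) (α′ x y)

    -- A new nondegenerate walk passes through st exactly once, as first, middle or last edge; two
    -- passages would force s = t, a loop, a = y or b = x. The three kinds add up to the same `φ`
    -- that estimates closures, so `φ≤3` and `S-φ` bound the jump and the average growth of `Pm`.
    walk-new : ∀ x y → Q′.Pm x y ≤ Pm x y + (φ x y s t + φ x y t s)
    walk-new x y = ≤-trans (∑-mono λ a → ∑-mono λ b → pt a b) (≤-trans (≤-reflexive split) (≤-trans (ℚP.+-monoʳ-≤ (Pm x y) (add≤ (add≤ first mid) last))
        (≤-reflexive (cong (Pm x y +_) (l (δ s x * (ν t y * cd t y)) (δ t x * (ν s y * cd s y)) (α x s * α t y) (α x t * α s y) (δ s y * (ν t x * cd t x)) (δ t y * (ν s x * cd s x)))))))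
      where
      l : ∀ a b c d e f → a + b + (c + d) + (e + f) ≡ c + a + e + (d + b + f)
      l = solve 6 (λ a b c d e f → (a ⊕ b ⊕ (c ⊕ d) ⊕ (e ⊕ f)) ⊜ (c ⊕ a ⊕ e ⊕ (d ⊕ b ⊕ f))) refl
      N : Fin n → Fin n → ℚ
      N a b = ν a y * ν b x
      N≥0 : ∀ a b → 0ℚ ≤ N a b
      N≥0 a b = ⟦⟧≥0 (not (a == y)) ⊠ ⟦⟧≥0 (not (b == x))
      f1 f2 f3 : Fin n → Fin n → ℚ
      f1 a b = e x a * (ν a y * (α a b * α b y))
      f2 a b = α x a * (e a b * α b y)
      f3 a b = α x a * α a b * (e b y * ν b x)
      E : Fin n → Fin n → Set
      E u v = (s ≡ u × t ≡ v) ⊎ (s ≡ v × t ≡ u)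
      e1 : ∀ {u v} → E u v → e u v ≡ 1ℚ
      e1 {u} {v} h = trans (sym (e-eb u v)) (⟦⟧-true (ebi h))
        where
        opaque
          unfolding eb
          ebi : E u v → eb s t u v ≡ true
          ebi (inj₁ (refl , refl)) = ∨-introˡ (∧-intro (==-refl s) (==-refl t))
          ebi (inj₂ (refl , refl)) = ∨-introʳ {(s == t) ∧ (t == s)} (∧-intro (==-refl s) (==-refl t))
      F1 : ∀ a b → 0ℚ ≤ f1 a b
      F1 a b = e≥0 x a ⊠ (⟦⟧≥0 (not (a == y)) ⊠ (α≥0 a b ⊠ α≥0 b y))
      F2 : ∀ a b → 0ℚ ≤ f2 a b
      F2 a b = α≥0 x a ⊠ (e≥0 a b ⊠ α≥0 b y)
      F3 : ∀ a b → 0ℚ ≤ f3 a b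
      F3 a b = α≥0 x a ⊠ α≥0 a b ⊠ (e≥0 b y ⊠ ⟦⟧≥0 (not (b == x)))
      F0 : ∀ a b → 0ℚ ≤ α x a * α a b * α b y * N a b
      F0 a b = α≥0 x a ⊠ α≥0 a b ⊠ α≥0 b y ⊠ N≥0 a b
      pt : ∀ a b → Q′.α x a * Q′.α a b * Q′.α b y * N a b ≤ α x a * α a b * α b y * N a b + (f1 a b + f2 a b + f3 a b)
      pt a b with fin-dec a y | fin-dec b x | bool-dec (add A s t x a) | bool-dec (add A s t a b) | bool-dec (add A s t b y)
      ... | inj₁ p | _ | _ | _ | _ = ≤-trans (≤-reflexive (trans (cong (λ u → Q′.α x a * Q′.α a b * Q′.α b y * (u * ν b x)) (trans (cong (λ z → ν z y) p) (ν-refl y))) (z0 (Q′.α x a * Q′.α a b * Q′.α b y) (ν b x)))) (F0 a b ⊞ (F1 a b ⊞ F2 a b ⊞ F3 a b))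
        where z0 : ∀ u v → u * (0ℚ * v) ≡ 0ℚ
              z0 = solve 2 (λ u v → (u ⊗ (Κ 0ℚ ⊗ v)) ⊜ (Κ 0ℚ)) refl
      ... | inj₂ _ | inj₁ p | _ | _ | _ = ≤-trans (≤-reflexive (trans (cong (λ u → Q′.α x a * Q′.α a b * Q′.α b y * (ν a y * u)) (trans (cong (λ z → ν z x) p) (ν-refl x))) (z0 (Q′.α x a * Q′.α a b * Q′.α b y) (ν a y)))) (F0 a b ⊞ (F1 a b ⊞ F2 a b ⊞ F3 a b))
        where z0 : ∀ u v → u * (v * 0ℚ) ≡ 0ℚ
              z0 = solve 2 (λ u v → (u ⊗ (v ⊗ Κ 0ℚ)) ⊜ (Κ 0ℚ)) refl
      ... | inj₂ _ | inj₂ _ | inj₂ p | _ | _ = ≤-trans (≤-reflexive (trans (cong (λ u → u * Q′.α a b * Q′.α b y * N a b) (⟦⟧-false p)) (z0 (Q′.α a b) (Q′.α b y) (N a b)))) (F0 a b ⊞ (F1 a b ⊞ F2 a b ⊞ F3 a b))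
        where z0 : ∀ u v w → 0ℚ * u * v * w ≡ 0ℚ
              z0 = solve 3 (λ u v w → (Κ 0ℚ ⊗ u ⊗ v ⊗ w) ⊜ (Κ 0ℚ)) refl
      ... | inj₂ _ | inj₂ _ | inj₁ _ | inj₂ p | _ = ≤-trans (≤-reflexive (trans (cong (λ u → Q′.α x a * u * Q′.α b y * N a b) (⟦⟧-false p)) (z0 (Q′.α x a) (Q′.α b y) (N a b)))) (F0 a b ⊞ (F1 a b ⊞ F2 a b ⊞ F3 a b))
        where z0 : ∀ u v w → u * 0ℚ * v * w ≡ 0ℚ
              z0 = solve 3 (λ u v w → (u ⊗ Κ 0ℚ ⊗ v ⊗ w) ⊜ (Κ 0ℚ)) refl
      ... | inj₂ _ | inj₂ _ | inj₁ _ | inj₁ _ | inj₂ p = ≤-trans (≤-reflexive (trans (cong (λ u → Q′.α x a * Q′.α a b * u * N a b) (⟦⟧-false p)) (z0 (Q′.α x a) (Q′.α a b) (N a b)))) (F0 a b ⊞ (F1 a b ⊞ F2 a b ⊞ F3 a b))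
        where z0 : ∀ u v w → u * v * 0ℚ * w ≡ 0ℚ
              z0 = solve 3 (λ u v w → (u ⊗ v ⊗ Κ 0ℚ ⊗ w) ⊜ (Κ 0ℚ)) refl
      ... | inj₂ a≢y | inj₂ b≢x | inj₁ p | inj₁ q | inj₁ r =
          ≤-trans (≤-reflexive lhs) (go (add-elim {A = A} p) (add-elim {A = A} q) (add-elim {A = A} r))
        where
        lhs : Q′.α x a * Q′.α a b * Q′.α b y * N a b ≡ 1ℚ
        lhs = cong₂ _*_ (cong₂ _*_ (cong₂ _*_ (⟦⟧-true p) (⟦⟧-true q)) (⟦⟧-true r)) (cong₂ _*_ (ν-≢ a≢y) (ν-≢ b≢x))
        R = α x a * α a b * α b y * N a b + (f1 a b + f2 a b + f3 a b)
        c0 : α x a * α a b * α b y * N a b ≡ 1ℚ → 1ℚ ≤ R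
        c0 h = cert (F1 a b ⊞ F2 a b ⊞ F3 a b) (cong (_+ (f1 a b + f2 a b + f3 a b)) h)
        c1 : f1 a b ≡ 1ℚ → 1ℚ ≤ R
        c1 h = cert (F0 a b ⊞ F2 a b ⊞ F3 a b) (trans (cong (λ u → α x a * α a b * α b y * N a b + (u + f2 a b + f3 a b)) h) (m (α x a * α a b * α b y * N a b) (f2 a b) (f3 a b)))
          where m : ∀ p q r → p + (1ℚ + q + r) ≡ 1ℚ + (p + q + r)
                m = solve 3 (λ p q r → (p ⊕ (Κ 1ℚ ⊕ q ⊕ r)) ⊜ (Κ 1ℚ ⊕ (p ⊕ q ⊕ r))) refl
        c2 : f2 a b ≡ 1ℚ → 1ℚ ≤ R
        c2 h = cert (F0 a b ⊞ F1 a b ⊞ F3 a b) (trans (cong (λ u → α x a * α a b * α b y * N a b + (f1 a b + u + f3 a b)) h) (m (α x a * α a b * α b y * N a b) (f1 a b) (f3 a b)))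
          where m : ∀ p q r → p + (q + 1ℚ + r) ≡ 1ℚ + (p + q + r)
                m = solve 3 (λ p q r → (p ⊕ (q ⊕ Κ 1ℚ ⊕ r)) ⊜ (Κ 1ℚ ⊕ (p ⊕ q ⊕ r))) refl
        c3 : f3 a b ≡ 1ℚ → 1ℚ ≤ R
        c3 h = cert (F0 a b ⊞ F1 a b ⊞ F2 a b) (trans (cong (λ u → α x a * α a b * α b y * N a b + (f1 a b + f2 a b + u)) h) (m (α x a * α a b * α b y * N a b) (f1 a b) (f2 a b)))
          where m : ∀ p q r → p + (q + r + 1ℚ) ≡ 1ℚ + (p + q + r)
                m = solve 3 (λ p q r → (p ⊕ (q ⊕ r ⊕ Κ 1ℚ)) ⊜ (Κ 1ℚ ⊕ (p ⊕ q ⊕ r))) refl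
        go : E x a ⊎ (A x a ≡ true) → E a b ⊎ (A a b ≡ true) → E b y ⊎ (A b y ≡ true) → 1ℚ ≤ R
        go (inj₂ p) (inj₂ q) (inj₂ r) = c0 (cong₂ _*_ (cong₂ _*_ (cong₂ _*_ (⟦⟧-true p) (⟦⟧-true q)) (⟦⟧-true r)) (cong₂ _*_ (ν-≢ a≢y) (ν-≢ b≢x)))
        go (inj₁ p) (inj₂ q) (inj₂ r) = c1 (cong₂ _*_ (e1 p) (cong₂ _*_ (ν-≢ a≢y) (cong₂ _*_ (⟦⟧-true q) (⟦⟧-true r))))
        go (inj₂ p) (inj₁ q) (inj₂ r) = c2 (cong₂ _*_ (⟦⟧-true p) (cong₂ _*_ (e1 q) (⟦⟧-true r)))
        go (inj₂ p) (inj₂ q) (inj₁ r) = c3 (cong₂ _*_ (cong₂ _*_ (⟦⟧-true p) (⟦⟧-true q)) (cong₂ _*_ (e1 r) (ν-≢ b≢x)))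
        go (inj₁ (inj₁ (refl , refl))) (inj₁ (inj₁ (h , _))) _ = ⊥-elim (s≢t h)
        go (inj₁ (inj₁ (refl , refl))) (inj₁ (inj₂ (h , _))) _ = ⊥-elim (b≢x (sym h))
        go (inj₁ (inj₂ (refl , refl))) (inj₁ (inj₁ (_ , h))) _ = ⊥-elim (b≢x (sym h))
        go (inj₁ (inj₂ (refl , refl))) (inj₁ (inj₂ (_ , h))) _ = ⊥-elim (s≢t (sym h))
        go _ (inj₁ (inj₁ (refl , refl))) (inj₁ (inj₁ (h , _))) = ⊥-elim (s≢t h)
        go _ (inj₁ (inj₁ (refl , refl))) (inj₁ (inj₂ (h , _))) = ⊥-elim (a≢y h)
        go _ (inj₁ (inj₂ (refl , refl))) (inj₁ (inj₁ (_ , h))) = ⊥-elim (a≢y h)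
        go _ (inj₁ (inj₂ (refl , refl))) (inj₁ (inj₂ (_ , h))) = ⊥-elim (s≢t (sym h))
        go (inj₁ (inj₁ (refl , refl))) (inj₂ q) (inj₁ (inj₁ (h , _))) = ⊥-elim (b≢x (sym h))
        go (inj₁ (inj₁ (refl , refl))) (inj₂ q) (inj₁ (inj₂ (h , h′))) = ⊥-elim (adj-irr (subst (λ z → A t z ≡ true) (sym h′) q))
        go (inj₁ (inj₂ (refl , refl))) (inj₂ q) (inj₁ (inj₁ (h , h′))) = ⊥-elim (adj-irr (subst (λ z → A s z ≡ true) (sym h) q))
        go (inj₁ (inj₂ (refl , refl))) (inj₂ q) (inj₁ (inj₂ (_ , h))) = ⊥-elim (b≢x (sym h))
      split : ∑ (λ a → ∑ λ b → α x a * α a b * α b y * N a b + (f1 a b + f2 a b + f3 a b)) ≡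
        Pm x y + ((∑ λ a → ∑ λ b → f1 a b) + (∑ λ a → ∑ λ b → f2 a b) + (∑ λ a → ∑ λ b → f3 a b))
      split = trans (dd (λ a b → α x a * α a b * α b y * N a b) (λ a b → f1 a b + f2 a b + f3 a b)) (cong (Pm x y +_)
         (trans (dd (λ a b → f1 a b + f2 a b) f3) (cong (_+ ∑ λ a → ∑ λ b → f3 a b) (dd f1 f2))))
        where
        dd : ∀ (f g : Fin n → Fin n → ℚ) → (∑ λ a → ∑ λ b → f a b + g a b) ≡ (∑ λ a → ∑ (f a)) + (∑ λ a → ∑ (g a))
        dd f g = trans (∑-cong λ a → ∑-+ (f a) (g a)) (∑-+ (λ a → ∑ (f a)) (λ a → ∑ (g a)))
      first : (∑ λ a → ∑ λ b → f1 a b) ≤ δ s x * (ν t y * cd t y) + δ t x * (ν s y * cd s y)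
      first = ≤-reflexive (trans (∑-cong λ a → trans (∑-*ˡ (e x a) (λ b → ν a y * (α a b * α b y))) (cong (e x a *_) (∑-*ˡ (ν a y) (λ b → α a b * α b y))))
         (∑-e x (λ a → ν a y * cd a y)))
      mid : (∑ λ a → ∑ λ b → f2 a b) ≤ α x s * α t y + α x t * α s y
      mid = ≤-reflexive (trans (∑-cong λ a → trans (∑-*ˡ (α x a) (λ b → e a b * α b y)) (cong (α x a *_) (∑-e a (λ b → α b y))))
         (trans (∑-cong λ a → m (α x a) (δ s a) (α t y) (δ t a) (α s y)) (trans (∑-+ (λ a → δ s a * (α x a * α t y)) (λ a → δ t a * (α x a * α s y)))
           (cong₂ _+_ (∑-δ s (λ a → α x a * α t y)) (∑-δ t (λ a → α x a * α s y))))))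
        where m : ∀ a b c d e → a * (b * c + d * e) ≡ b * (a * c) + d * (a * e)
              m = solve 5 (λ a b c d e → (a ⊗ (b ⊗ c ⊕ d ⊗ e)) ⊜ (b ⊗ (a ⊗ c) ⊕ d ⊗ (a ⊗ e))) refl
      cd-sym : ∀ u v → cd u v ≡ cd v u
      cd-sym u v = ∑-cong λ b → trans (ℚP.*-comm (α u b) (α b v)) (cong₂ _*_ (α-sym b v) (α-sym u b))
      last : (∑ λ a → ∑ λ b → f3 a b) ≤ δ s y * (ν t x * cd t x) + δ t y * (ν s x * cd s x)
      last = ≤-reflexive (trans (∑-swap f3) (trans (∑-cong λ b → trans (∑-*ʳ (e b y * ν b x) (λ a → α x a * α a b))
           (trans (m (cd x b) (e b y) (ν b x)) (cong₂ (λ u v → u * (ν b x * v)) (e-sym b y) (cd-sym x b))))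
           (∑-e y (λ b → ν b x * cd b x))))
        where m : ∀ c e v → c * (e * v) ≡ e * (v * c)
              m = solve 3 (λ c e v → (c ⊗ (e ⊗ v)) ⊜ (e ⊗ (v ⊗ c))) refl

    φ≤3 : ∀ x y s t → φ x y s t ≤ ι 3
    φ≤3 x y s t = add≤ (add≤ (mul≤ (α≥0 x s) (⟦⟧≤1 (A x s)) (α≥0 t y) (⟦⟧≤1 (A t y))) (νcd s x t y)) (νcd s y t x)
      where
      νcd : ∀ s x t y → δ s x * (ν t y * cd t y) ≤ 1ℚ
      νcd s x t y = ≤-trans (mul≤ (⟦⟧≥0 (s == x)) (⟦⟧≤1 (s == x)) (⟦⟧≥0 (not (t == y)) ⊠ cd≥0 t y) h) (≤-reflexive (ℚP.*-identityˡ 1ℚ))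
        where
        h : ν t y * cd t y ≤ 1ℚ
        h with fin-dec t y
        ... | inj₁ refl = ≤-trans (≤-reflexive (trans (cong (_* cd t t) (ν-refl t)) (ℚP.*-zeroˡ (cd t t)))) 0≤1
        ... | inj₂ p = ≤-trans (≤-reflexive (trans (cong (_* cd t y) (ν-≢ p)) (ℚP.*-identityˡ (cd t y)))) (cd≤1 p)

  -- Totals over the next edge, and simultaneous closures

  module Totals {n} (A : Fin n → Fin n → Bool) (C : C4Free A) where
    open Sums A C public
    private
      module St = Step A C

    χ : Fin n → Fin n → Fin n → Fin n → ℚ
    χ x y s t = δ s x * α t y + δ s y * α t x

    S-deg : ∀ x → SA (λ s t → δ s x + δ t x) ≡ opdeg x
    S-deg x = trans (S-sym (λ s t → δ s x)) (trans (∑-cong λ s → ∑-cong λ t → cong (ω s t *_) (sym (ℚP.*-identityʳ (δ s x))))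
       (trans (opsum-δ x (λ _ → 1ℚ)) (∑-cong λ t → ℚP.*-identityʳ (ω x t))))

    S-gain : ∀ x y → SA (λ s t → δ s x * ω t y + δ t x * ω s y) ≡ Cm x y
    S-gain x y = trans (S-sym (λ s t → δ s x * ω t y)) (opsum-δ x (λ t → ω t y))

    S-χ : ∀ x y → SA (λ s t → χ x y s t + χ x y t s) ≡ Nm y x + Nm x y
    S-χ x y = trans (S-sym (χ x y)) (trans (opsum-+ (λ s t → δ s x * α t y) (λ s t → δ s y * α t x)) (cong₂ _+_ (h x y) (h y x)))
      where
      h : ∀ x y → opsum (λ s t → δ s x * α t y) ≡ Nm y x
      h x y = trans (opsum-δ x (λ t → α t y)) (∑-cong λ t → trans (ℚP.*-comm (ω x t) (α t y)) (cong₂ _*_ (α-sym t y) (ω-sym x t)))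

    φ≤ψ : ∀ x y s t → φ x y s t ≤ ψ x y s t
    φ≤ψ x y s t = ≤-trans (add≤ (add≤ (≤-refl {α x s * α t y}) (mulˡ (⟦⟧≥0 (s == x)) (d t y))) (mulˡ (⟦⟧≥0 (s == y)) (d t x)))
       (cert (⟦⟧≥0 (s == x) ⊠ ⟦⟧≥0 (t == y)) (l (δ s x) (δ t y) (α x s * α t y) (cd t y) (δ s y * cd t x)))
      where
      d : ∀ t y → ν t y * cd t y ≤ cd t y
      d t y = ≤-trans (mulʳ (cd≥0 t y) (⟦⟧≤1 (not (t == y)))) (≤-reflexive (ℚP.*-identityˡ (cd t y)))
      l : ∀ a b p c q → a * b + p + a * c + q ≡ p + a * c + q + a * b
      l = solve 5 (λ a b p c q → (a ⊗ b ⊕ p ⊕ a ⊗ c ⊕ q) ⊜ (p ⊕ a ⊗ c ⊕ q ⊕ a ⊗ b)) refl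

    S-φ : ∀ x y → SA (λ s t → φ x y s t + φ x y t s) ≤ 1ℚ + cl x y
    S-φ x y = ≤-trans (≤-reflexive (S-sym (φ x y))) (≤-trans (opsum-mono (φ≤ψ x y)) (≤-trans (≤-reflexive (opsum-ψ x y)) (ℚP.+-monoˡ-≤ (cl x y) (⟦⟧≤1 (op A x y)))))

    Nm-diag : ∀ x → Nm x x ≡ 0ℚ
    Nm-diag x = ∑-0 λ b → h b (bool-dec (A x b))
      where
      h : ∀ b → (A x b ≡ true) ⊎ (A x b ≡ false) → α x b * ω b x ≡ 0ℚ
      h b (inj₁ p) = trans (cong (α x b *_) (⟦⟧-false (¬true⇒false λ q → true≢false (adj-sym p) (op⇒nadj {A = A} q)))) (ℚP.*-zeroʳ (α x b))
      h b (inj₂ p) = trans (cong (_* ω b x) (⟦⟧-false p)) (ℚP.*-zeroˡ (ω b x))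

    -- A common neighbour z gives every neighbour b of x the walk b x z y, so by is not open.
    Nm-cod : ∀ x y → cod x y ≡ true → Nm x y ≡ 0ℚ
    Nm-cod x y h with ex-elim (λ z → A x z ∧ A z y) h
    ... | z , q = ∑-0 λ b → g b (bool-dec (A x b)) (bool-dec (op A b y))
      where
      g : ∀ b → (A x b ≡ true) ⊎ (A x b ≡ false) → (op A b y ≡ true) ⊎ (op A b y ≡ false) → α x b * ω b y ≡ 0ℚ
      g b (inj₂ p) _ = trans (cong (_* ω b y) (⟦⟧-false p)) (ℚP.*-zeroˡ (ω b y))
      g b _ (inj₂ r) = trans (cong (α x b *_) (⟦⟧-false r)) (ℚP.*-zeroʳ (α x b))
      g b (inj₁ p) (inj₁ r) = ⊥-elim (op-walk {A = A} x z r (adj-sym p) (∧-left q) (∧-right {A x z} q))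

    Nm≥0 : ∀ x y → 0ℚ ≤ Nm x y
    Nm≥0 x y = ∑-nonneg λ b → α≥0 x b ⊠ ω≥0 b y

    Cm≥0 : ∀ x y → 0ℚ ≤ Cm x y
    Cm≥0 x y = ∑-nonneg λ b → ω≥0 x b ⊠ ω≥0 b y

    module Bounded (Δ B : ℚ) (Δ0 : 0ℚ ≤ Δ) (hΔ : ∀ u → deg u ≤ Δ) (hB : ∀ u v → Pm u v ≤ B) where

      cl≤ : ∀ N̄ → 0ℚ ≤ N̄ → (∀ u v → Nm u v ≤ N̄) → ∀ x y → cl x y ≤ ι 3 * (Δ * N̄)
      cl≤ N̄ N0 hN x y = ≤-trans (add≤ (∑-mono λ a → mulˡ (α≥0 x a) (add≤ (hN y a) (hN a y))) (∑-mono λ b → mulˡ (α≥0 y b) (hN b x)))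
         (≤-trans (≤-reflexive (cong₂ _+_ (∑-*ʳ (N̄ + N̄) (α x)) (∑-*ʳ N̄ (α y)))) (≤-trans (add≤ (mulʳ (N0 ⊞ N0) (hΔ x)) (mulʳ N0 (hΔ y))) (≤-reflexive (l Δ N̄))))
        where l : ∀ d m → d * (m + m) + d * m ≡ ι 3 * (d * m)
              l = solve 2 (λ d m → (d ⊗ (m ⊕ m) ⊕ d ⊗ m) ⊜ (Κ (ι 3) ⊗ (d ⊗ m))) refl

      ψψ : Fin n → Fin n → Fin n → Fin n → ℚ
      ψψ x b s t = ψ x b s t + ψ x b t s

      -- For st disjoint from xy, both xb and by can be closed in two ways: b is an end of st and
      -- the other end has common neighbours with x and with y, or b is adjacent to an end of st and
      -- x and y are adjacent to ends of st.
      H : Fin n → Fin n → Fin n → Fin n → Fin n → ℚ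
      H x y s t b = δ s b * (cd t x * cd t y) + α x s * α y s * α t b + α x s * α y t * α t b

      H≥0 : ∀ x y s t b → 0ℚ ≤ H x y s t b
      H≥0 x y s t b = (⟦⟧≥0 (s == b) ⊠ (cd≥0 t x ⊠ cd≥0 t y)) ⊞ (α≥0 x s ⊠ α≥0 y s ⊠ α≥0 t b) ⊞ (α≥0 x s ⊠ α≥0 y t ⊠ α≥0 t b)

      -- Adds to `H` crude bounds for the few edges that meet xy: the linear `row-off` when one end
      -- is shared, the quadratic `kill-row` when st = xy.
      G : Fin n → Fin n → Fin n → Fin n → ℚ
      G x y s t = ∑ (H x y s t) + (δ s x + δ s y) * (ι 2 * Δ + ι 2) + δ s x * δ t y * (ι 2 * ((1ℚ + Δ) * (1ℚ + Δ)))

      G≥0 : ∀ x y s t → 0ℚ ≤ G x y s t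
      G≥0 x y s t = ∑-nonneg (H≥0 x y s t) ⊞ ((⟦⟧≥0 (s == x) ⊞ ⟦⟧≥0 (s == y)) ⊠ (0≤ι 2 ⊠ Δ0 ⊞ 0≤ι 2))
                     ⊞ (⟦⟧≥0 (s == x) ⊠ ⟦⟧≥0 (t == y) ⊠ (0≤ι 2 ⊠ ((0≤1 ⊞ Δ0) ⊠ (0≤1 ⊞ Δ0))))

      module Pair {s t} (hst : op A s t ≡ true) where
        s≢t : ¬ s ≡ t
        s≢t = op⇒≢ {A = A} hst

        kill-sym : ∀ x y → kill s t x y ≡ kill s t y x
        kill-sym x y = cong₂ (λ u v → ⟦ u ⟧ - ⟦ v ⟧) (bool-ext (op-sym C) (op-sym C)) (bool-ext (op-sym (add-C4Free C hst)) (op-sym (add-C4Free C hst)))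

        kill≤1 : ∀ x y → kill s t x y ≤ 1ℚ
        kill≤1 x y = ≤-trans (kill≤ω s t x y) (⟦⟧≤1 (op A x y))

        kψ : ∀ x b → kill s t x b ≤ ψψ x b s t
        kψ x b = kill≤ψ x b hst

        ψ-on : ∀ {s t} x → ¬ s ≡ x → ¬ t ≡ x → op A s t ≡ true → ψψ x s s t ≡ cd t x
        ψ-on {s} {t} x a b h = trans (expand (δ-≢ a) (δ-≢ b) (δ-refl s) (δ-≢ (λ e → op⇒≢ {A = A} h (sym e)))
              (⟦⟧-false (¬true⇒false λ q → true≢false (adj-sym q) (op⇒nadj {A = A} h))) (α-irr s))
            (l (δ t s) (α x s) (cd t s) (α x t) (cd s s) (cd t x) (cd s x))
          where
          l : ∀ a b c d e f g → (0ℚ * 0ℚ + b * 0ℚ + 0ℚ * c + 1ℚ * f) + (0ℚ * 1ℚ + d * 0ℚ + 0ℚ * e + 0ℚ * g) ≡ f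
          l = solve 7 (λ a b c d e f g → ((Κ 0ℚ ⊗ Κ 0ℚ ⊕ b ⊗ Κ 0ℚ ⊕ Κ 0ℚ ⊗ c ⊕ Κ 1ℚ ⊗ f) ⊕ (Κ 0ℚ ⊗ Κ 1ℚ ⊕ d ⊗ Κ 0ℚ ⊕ Κ 0ℚ ⊗ e ⊕ Κ 0ℚ ⊗ g)) ⊜ (f)) refl
          expand : ∀ {p q r u v w} → δ s x ≡ p → δ t x ≡ q → δ s s ≡ r → δ t s ≡ u → α t s ≡ v → α s s ≡ w →
            ψψ x s s t ≡ (p * u + α x s * v + p * cd t s + r * cd t x) + (q * r + α x t * w + q * cd s s + u * cd s x)
          expand refl refl refl refl refl refl = refl

        ψ-off : ∀ x b → ¬ s ≡ x → ¬ t ≡ x → ¬ s ≡ b → ¬ t ≡ b → ψψ x b s t ≡ α x s * α t b + α x t * α s b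
        ψ-off x b p q r u = trans (expand (δ-≢ p) (δ-≢ q) (δ-≢ r) (δ-≢ u)) (l (α x s * α t b) (cd t b) (cd t x) (α x t * α s b) (cd s b) (cd s x))
          where
          l : ∀ a b c d e f → (0ℚ * 0ℚ + a + 0ℚ * b + 0ℚ * c) + (0ℚ * 0ℚ + d + 0ℚ * e + 0ℚ * f) ≡ a + d
          l = solve 6 (λ a b c d e f → ((Κ 0ℚ ⊗ Κ 0ℚ ⊕ a ⊕ Κ 0ℚ ⊗ b ⊕ Κ 0ℚ ⊗ c) ⊕ (Κ 0ℚ ⊗ Κ 0ℚ ⊕ d ⊕ Κ 0ℚ ⊗ e ⊕ Κ 0ℚ ⊗ f)) ⊜ (a ⊕ d)) refl
          expand : ∀ {a b′ c d} → δ s x ≡ a → δ t x ≡ b′ → δ s b ≡ c → δ t b ≡ d →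
            ψψ x b s t ≡ (a * d + α x s * α t b + a * cd t b + c * cd t x) + (b′ * c + α x t * α s b + b′ * cd s b + d * cd s x)
          expand refl refl refl refl = refl

        kill-on : ∀ x → ¬ s ≡ x → ¬ t ≡ x → kill s t x s ≤ cd t x
        kill-on x a b = ≤-trans (kψ x s) (≤-reflexive (ψ-on x a b hst))

        kill-on′ : ∀ x → ¬ s ≡ x → ¬ t ≡ x → kill s t x t ≤ cd s x
        kill-on′ x a b = ≤-trans (kψ x t) (≤-reflexive (trans (ℚP.+-comm (ψ x t s t) (ψ x t t s)) (ψ-on x b a (op-sym C hst))))

        kill-off : ∀ x b → ¬ s ≡ x → ¬ t ≡ x → ¬ s ≡ b → ¬ t ≡ b → kill s t x b ≤ α x s * α t b + α x t * α s b
        kill-off x b p q r u = ≤-trans (kψ x b) (≤-reflexive (ψ-off x b p q r u))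

        double-off : ∀ x y b → ¬ s ≡ x → ¬ t ≡ x → ¬ s ≡ y → ¬ t ≡ y → kill s t x b * kill s t b y ≤ H x y s t b + H x y t s b
        double-off x y b sx tx sy ty = go (fin-dec s b) (fin-dec t b)
          where
          k0 = kill≥0 s t x b
          k0′ = kill≥0 s t b y
          go : (s ≡ b) ⊎ (¬ s ≡ b) → (t ≡ b) ⊎ (¬ t ≡ b) → kill s t x b * kill s t b y ≤ H x y s t b + H x y t s b
          go (inj₁ refl) _ = ≤-trans (mul≤ k0 (kill-on x sx tx) k0′ (≤-trans (≤-reflexive (kill-sym s y)) (kill-on y sy ty)))
             (cert ((α≥0 x s ⊠ α≥0 y s ⊠ α≥0 t s) ⊞ (α≥0 x s ⊠ α≥0 y t ⊠ α≥0 t s) ⊞ H≥0 x y t s s)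
               (trans (cong (λ u → u * (cd t x * cd t y) + α x s * α y s * α t s + α x s * α y t * α t s + H x y t s s) (δ-refl s))
                 (l (cd t x * cd t y) (α x s * α y s * α t s) (α x s * α y t * α t s) (H x y t s s))))
            where l : ∀ a b c d → 1ℚ * a + b + c + d ≡ a + (b + c + d)
                  l = solve 4 (λ a b c d → (Κ 1ℚ ⊗ a ⊕ b ⊕ c ⊕ d) ⊜ (a ⊕ (b ⊕ c ⊕ d))) refl
          go _ (inj₁ refl) = ≤-trans (mul≤ k0 (kill-on′ x sx tx) k0′ (≤-trans (≤-reflexive (kill-sym t y)) (kill-on′ y sy ty)))
             (cert ((α≥0 x t ⊠ α≥0 y t ⊠ α≥0 s t) ⊞ (α≥0 x t ⊠ α≥0 y s ⊠ α≥0 s t) ⊞ H≥0 x y s t t)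
               (trans (cong (λ u → H x y s t t + (u * (cd s x * cd s y) + α x t * α y t * α s t + α x t * α y s * α s t)) (δ-refl t))
                 (l (cd s x * cd s y) (α x t * α y t * α s t) (α x t * α y s * α s t) (H x y s t t))))
            where l : ∀ a b c d → d + (1ℚ * a + b + c) ≡ a + (b + c + d)
                  l = solve 4 (λ a b c d → (d ⊕ (Κ 1ℚ ⊗ a ⊕ b ⊕ c)) ⊜ (a ⊕ (b ⊕ c ⊕ d))) refl
          go (inj₂ r) (inj₂ u) = ≤-trans (mul≤ k0 (kill-off x b sx tx r u) k0′ (≤-trans (≤-reflexive (kill-sym b y)) (kill-off y b sy ty r u)))
              (≤-trans (pt (α x s) (α x t) (α y s) (α y t) (α t b) (α s b) (α≥0 x s) (α≥0 x t) (α≥0 y s) (α≥0 y t) (α≥0 t b) (α≥0 s b)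
                    (⟦⟧≤1 (A t b)) (⟦⟧≤1 (A s b)))
                (cert ((⟦⟧≥0 (s == b) ⊠ (cd≥0 t x ⊠ cd≥0 t y)) ⊞ (⟦⟧≥0 (t == b) ⊠ (cd≥0 s x ⊠ cd≥0 s y)))
                   (l (δ s b * (cd t x * cd t y)) (α x s * α y s * α t b) (α x s * α y t * α t b) (δ t b * (cd s x * cd s y)) (α x t * α y t * α s b) (α x t * α y s * α s b))))
            where
            l : ∀ a b c d e f → a + b + c + (d + e + f) ≡ (b + c + (e + f)) + (a + d)
            l = solve 6 (λ a b c d e f → (a ⊕ b ⊕ c ⊕ (d ⊕ e ⊕ f)) ⊜ ((b ⊕ c ⊕ (e ⊕ f)) ⊕ (a ⊕ d))) refl
            pt : ∀ a b c d e f → 0ℚ ≤ a → 0ℚ ≤ b → 0ℚ ≤ c → 0ℚ ≤ d → 0ℚ ≤ e → 0ℚ ≤ f → e ≤ 1ℚ → f ≤ 1ℚ →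
              (a * e + b * f) * (c * e + d * f) ≤ (a * c * e + a * d * e) + (b * d * f + b * c * f)
            pt a b c d e f a0 b0 c0 d0 e0 f0 e1 f1 = cert ((a0 ⊠ c0 ⊠ e0 ⊠ sub e1) ⊞ (a0 ⊠ d0 ⊠ e0 ⊠ sub f1) ⊞ (b0 ⊠ d0 ⊠ f0 ⊠ sub f1) ⊞ (b0 ⊠ c0 ⊠ f0 ⊠ sub e1))
              (l′ a b c d e f)
              where l′ : ∀ a b c d e f → (a * c * e + a * d * e) + (b * d * f + b * c * f) ≡ (a * e + b * f) * (c * e + d * f)
                           + (a * c * e * (1ℚ - e) + a * d * e * (1ℚ - f) + b * d * f * (1ℚ - f) + b * c * f * (1ℚ - e))
                    l′ = solve 6 (λ a b c d e f → ((a ⊗ c ⊗ e ⊕ a ⊗ d ⊗ e) ⊕ (b ⊗ d ⊗ f ⊕ b ⊗ c ⊗ f))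
                        ⊜ ((a ⊗ e ⊕ b ⊗ f) ⊗ (c ⊗ e ⊕ d ⊗ f) ⊕ (a ⊗ c ⊗ e ⊗ (Κ 1ℚ ⊖ e) ⊕ a ⊗ d ⊗ e ⊗ (Κ 1ℚ ⊖ f) ⊕ b ⊗ d ⊗ f ⊗ (Κ 1ℚ ⊖ f) ⊕ b ⊗ c ⊗ f ⊗ (Κ 1ℚ ⊖ e)))) refl

        -- For x off st, the pair xb is closed only when b is an end of st, with a codegree at most
        -- 1, or when x is adjacent to one end and b to the other. This is linear in Δ, in contrast
        -- with `kill-row`.
        row-off : ∀ x → ¬ s ≡ x → ¬ t ≡ x → ∑ (λ b → kill s t x b) ≤ ι 2 * Δ + ι 2
        row-off x sx tx = ≤-trans (∑-mono λ b → kψ x b) (≤-trans (≤-reflexive (trans (∑-cong pt) (trans (∑-+ (λ b → α x s * α t b + δ s b * cd t x) (λ b → α x t * α s b + δ t b * cd s x))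
             (cong₂ _+_ (part s t) (part t s)))))
            (≤-trans (add≤ (add≤ (mul≤ (α≥0 x s) (⟦⟧≤1 (A x s)) (∑-nonneg (α≥0 t)) (hΔ t)) (cd≤1 tx)) (add≤ (mul≤ (α≥0 x t) (⟦⟧≤1 (A x t)) (∑-nonneg (α≥0 s)) (hΔ s)) (cd≤1 sx)))
              (≤-reflexive (l Δ))))
          where
          l : ∀ d → 1ℚ * d + 1ℚ + (1ℚ * d + 1ℚ) ≡ ι 2 * d + ι 2
          l = solve 1 (λ d → (Κ 1ℚ ⊗ d ⊕ Κ 1ℚ ⊕ (Κ 1ℚ ⊗ d ⊕ Κ 1ℚ)) ⊜ (Κ (ι 2) ⊗ d ⊕ Κ (ι 2))) refl
          part : ∀ s t → ∑ (λ b → α x s * α t b + δ s b * cd t x) ≡ α x s * deg t + cd t x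
          part s t = trans (∑-+ (λ b → α x s * α t b) (λ b → δ s b * cd t x)) (cong₂ _+_ (∑-*ˡ (α x s) (α t)) (∑-δ s (λ _ → cd t x)))
          pt : ∀ b → ψψ x b s t ≡ (α x s * α t b + δ s b * cd t x) + (α x t * α s b + δ t b * cd s x)
          pt b = trans (expand (δ-≢ sx) (δ-≢ tx)) (l′ (δ t b) (α x s * α t b) (cd t b) (δ s b * cd t x) (δ s b) (α x t * α s b) (cd s b) (δ t b * cd s x))
            where
            l′ : ∀ a b c d e f g h → (0ℚ * a + b + 0ℚ * c + d) + (0ℚ * e + f + 0ℚ * g + h) ≡ (b + d) + (f + h)
            l′ = solve 8 (λ a b c d e f g h → ((Κ 0ℚ ⊗ a ⊕ b ⊕ Κ 0ℚ ⊗ c ⊕ d) ⊕ (Κ 0ℚ ⊗ e ⊕ f ⊕ Κ 0ℚ ⊗ g ⊕ h)) ⊜ ((b ⊕ d) ⊕ (f ⊕ h))) refl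
            expand : ∀ {a b′} → δ s x ≡ a → δ t x ≡ b′ →
              ψψ x b s t ≡ (a * δ t b + α x s * α t b + a * cd t b + δ s b * cd t x) + (b′ * δ s b + α x t * α s b + b′ * cd s b + δ t b * cd s x)
            expand refl refl = refl

        double : ∀ x y → ¬ x ≡ y → ∑ (λ b → kill s t x b * kill s t b y) ≤ G x y s t + G x y t s
        double x y ne = go (fin-dec s x) (fin-dec s y) (fin-dec t x) (fin-dec t y)
          where
          c2 = ι 2 * Δ + ι 2
          c2≥0 : 0ℚ ≤ c2
          c2≥0 = 0≤ι 2 ⊠ Δ0 ⊞ 0≤ι 2
          c3 = ι 2 * ((1ℚ + Δ) * (1ℚ + Δ))
          byrow : ∀ z → ∑ (λ b → kill s t z b) ≤ c3
          byrow z = kill-row z Δ hst hΔ Δ0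
          left : ∑ (λ b → kill s t x b * kill s t b y) ≤ ∑ (λ b → kill s t x b)
          left = ∑-mono λ b → ≤-trans (mulˡ (kill≥0 s t x b) (kill≤1 b y)) (≤-reflexive (ℚP.*-identityʳ (kill s t x b)))
          right : ∑ (λ b → kill s t x b * kill s t b y) ≤ ∑ (λ b → kill s t y b)
          right = ∑-mono λ b → ≤-trans (mulʳ (kill≥0 s t b y) (kill≤1 x b)) (≤-reflexive (trans (ℚP.*-identityˡ (kill s t b y)) (kill-sym b y)))
          has3 : ∀ {s t} → s ≡ x → t ≡ y → c3 ≤ G x y s t
          has3 {s} {t} refl refl = cert (∑-nonneg (H≥0 s t s t) ⊞ ((⟦⟧≥0 (s == s) ⊞ ⟦⟧≥0 (s == t)) ⊠ c2≥0))
             (trans (cong₂ (λ u v → ∑ (H s t s t) + (δ s s + δ s t) * c2 + u * v * c3) (δ-refl s) (δ-refl t)) (l (∑ (H s t s t)) ((δ s s + δ s t) * c2) c3))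
            where l : ∀ a b c → a + b + 1ℚ * 1ℚ * c ≡ c + (a + b)
                  l = solve 3 (λ a b c → (a ⊕ b ⊕ Κ 1ℚ ⊗ Κ 1ℚ ⊗ c) ⊜ (c ⊕ (a ⊕ b))) refl
          has2x : ∀ {s} t → s ≡ x → c2 ≤ G x y s t
          has2x {s} t refl = cert (∑-nonneg (H≥0 s y s t) ⊞ (⟦⟧≥0 (s == y) ⊠ c2≥0) ⊞ (⟦⟧≥0 (s == s) ⊠ ⟦⟧≥0 (t == y) ⊠ (0≤ι 2 ⊠ ((0≤1 ⊞ Δ0) ⊠ (0≤1 ⊞ Δ0)))))
             (trans (cong (λ u → ∑ (H s y s t) + (u + δ s y) * c2 + δ s s * δ t y * c3) (δ-refl s)) (l (∑ (H s y s t)) (δ s y) c2 (δ s s * δ t y * c3)))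
            where l : ∀ a b c d → a + (1ℚ + b) * c + d ≡ c + (a + b * c + d)
                  l = solve 4 (λ a b c d → (a ⊕ (Κ 1ℚ ⊕ b) ⊗ c ⊕ d) ⊜ (c ⊕ (a ⊕ b ⊗ c ⊕ d))) refl
          has2y : ∀ {s} t → s ≡ y → c2 ≤ G x y s t
          has2y {s} t refl = cert (∑-nonneg (H≥0 x s s t) ⊞ (⟦⟧≥0 (s == x) ⊠ c2≥0) ⊞ (⟦⟧≥0 (s == x) ⊠ ⟦⟧≥0 (t == s) ⊠ (0≤ι 2 ⊠ ((0≤1 ⊞ Δ0) ⊠ (0≤1 ⊞ Δ0)))))
             (trans (cong (λ u → ∑ (H x s s t) + (δ s x + u) * c2 + δ s x * δ t s * c3) (δ-refl s)) (l (∑ (H x s s t)) (δ s x) c2 (δ s x * δ t s * c3)))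
            where l : ∀ a b c d → a + (b + 1ℚ) * c + d ≡ c + (a + b * c + d)
                  l = solve 4 (λ a b c d → (a ⊕ (b ⊕ Κ 1ℚ) ⊗ c ⊕ d) ⊜ (c ⊕ (a ⊕ b ⊗ c ⊕ d))) refl
          inL : ∀ {c} → c ≤ G x y s t → c ≤ G x y s t + G x y t s
          inL h = ≤-trans h (cert (G≥0 x y t s) refl)
          inR : ∀ {c} → c ≤ G x y t s → c ≤ G x y s t + G x y t s
          inR h = ≤-trans h (cert (G≥0 x y s t) (ℚP.+-comm (G x y s t) (G x y t s)))
          go : (s ≡ x) ⊎ (¬ s ≡ x) → (s ≡ y) ⊎ (¬ s ≡ y) → (t ≡ x) ⊎ (¬ t ≡ x) → (t ≡ y) ⊎ (¬ t ≡ y) →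
            ∑ (λ b → kill s t x b * kill s t b y) ≤ G x y s t + G x y t s
          go (inj₁ p) _ _ (inj₁ q) = ≤-trans left (≤-trans (byrow x) (inL (has3 p q)))
          go _ (inj₁ p) (inj₁ q) _ = ≤-trans left (≤-trans (byrow x) (inR (has3 q p)))
          go (inj₁ p) (inj₁ q) _ _ = ⊥-elim (ne (trans (sym p) q))
          go _ _ (inj₁ p) (inj₁ q) = ⊥-elim (ne (trans (sym p) q))
          go (inj₁ p) (inj₂ q) _ (inj₂ u) = ≤-trans right (≤-trans (row-off y q u) (inL (has2x t p)))
          go (inj₂ p) (inj₁ q) (inj₂ r) _ = ≤-trans left (≤-trans (row-off x p r) (inL (has2y t q)))
          go _ (inj₂ q) (inj₁ r) (inj₂ u) = ≤-trans right (≤-trans (row-off y q u) (inR (has2x s r)))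
          go (inj₂ p) _ (inj₂ r) (inj₁ u) = ≤-trans left (≤-trans (row-off x p r) (inR (has2y s u)))
          go (inj₂ p) (inj₂ q) (inj₂ r) (inj₂ u) = ≤-trans (∑-mono λ b → double-off x y b p r q u)
             (≤-trans (≤-reflexive (∑-+ (H x y s t) (H x y t s))) (add≤ (bare s t) (bare t s)))
            where
            bare : ∀ s t → ∑ (H x y s t) ≤ G x y s t
            bare s t = cert (((⟦⟧≥0 (s == x) ⊞ ⟦⟧≥0 (s == y)) ⊠ c2≥0) ⊞ (⟦⟧≥0 (s == x) ⊠ ⟦⟧≥0 (t == y) ⊠ (0≤ι 2 ⊠ ((0≤1 ⊞ Δ0) ⊠ (0≤1 ⊞ Δ0)))))
               (l (∑ (H x y s t)) ((δ s x + δ s y) * c2) (δ s x * δ t y * c3))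
              where l : ∀ a b c → a + b + c ≡ a + (b + c)
                    l = solve 3 (λ a b c → (a ⊕ b ⊕ c) ⊜ (a ⊕ (b ⊕ c))) refl

      -- The sum counts walks of length 4 from x to y. After the first step to a, at most B
      -- nondegenerate walks of length 3 lead on to y, and about 2Δ degenerate ones exist only when
      -- a is adjacent to y, which happens for at most one neighbour a of x.
      two-step : ∀ {x y} → ¬ x ≡ y → ∑ (λ t → cd t x * cd t y) ≤ Δ * B + ι 2 * Δ
      two-step {x} {y} ne = ≤-trans (≤-reflexive (trans (∑-cong λ t → trans (sym (∑-*ʳ (cd t y) (λ a → α t a * α a x))) (∑-cong λ a → trans (cong₂ (λ u v → u * v * cd t y) (α-sym t a) (α-sym a x)) (l (α a t) (α x a) (cd t y))))
            (trans (∑-swap (λ t a → α x a * (α a t * cd t y))) (∑-cong λ a → ∑-*ˡ (α x a) (λ t → α a t * cd t y)))))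
          (≤-trans (∑-mono λ a → mulˡ (α≥0 x a) (inner a))
            (≤-trans (≤-reflexive (trans (∑-cong λ a → l2 (α x a) B (α a y) (ι 2 * Δ)) (trans (∑-+ (λ a → α x a * B) (λ a → α x a * α a y * (ι 2 * Δ)))
                (cong₂ _+_ (∑-*ʳ B (α x)) (∑-*ʳ (ι 2 * Δ) (λ a → α x a * α a y))))))
              (add≤ (mulʳ B0 (hΔ x)) (≤-trans (mulʳ (0≤ι 2 ⊠ Δ0) (cd≤1 ne)) (≤-reflexive (ℚP.*-identityˡ (ι 2 * Δ)))))))
        where
        l : ∀ a b c → a * b * c ≡ b * (a * c)
        l = solve 3 (λ a b c → (a ⊗ b ⊗ c) ⊜ (b ⊗ (a ⊗ c))) refl
        l2 : ∀ a b c d → a * (b + c * d) ≡ a * b + a * c * d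
        l2 = solve 4 (λ a b c d → (a ⊗ (b ⊕ c ⊗ d)) ⊜ (a ⊗ b ⊕ a ⊗ c ⊗ d)) refl
        walk≥0 : ∀ u v → 0ℚ ≤ Pm u v
        walk≥0 u v = ∑-nonneg λ a → ∑-nonneg λ b → α≥0 u a ⊠ α≥0 a b ⊠ α≥0 b v ⊠ (⟦⟧≥0 (not (a == v)) ⊠ ⟦⟧≥0 (not (b == u)))
        B0 : 0ℚ ≤ B
        B0 = ≤-trans (walk≥0 x x) (hB x x)
        split : ∀ a t b → 1ℚ ≤ ν t y * ν b a + δ t y + δ b a
        split a t b = h (t == y) (b == a)
          where h : ∀ p q → 1ℚ ≤ ⟦ not p ⟧ * ⟦ not q ⟧ + ⟦ p ⟧ + ⟦ q ⟧
                h true q = cert (⟦⟧≥0 q) (trans (cong (λ u → u + 1ℚ + ⟦ q ⟧) (ℚP.*-zeroˡ ⟦ not q ⟧)) (m ⟦ q ⟧))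
                  where m : ∀ q → 0ℚ + 1ℚ + q ≡ 1ℚ + q
                        m = solve 1 (λ q → (Κ 0ℚ ⊕ Κ 1ℚ ⊕ q) ⊜ (Κ 1ℚ ⊕ q)) refl
                h false true = ≤-refl
                h false false = ≤-refl
        inner : ∀ a → ∑ (λ t → α a t * cd t y) ≤ B + α a y * (ι 2 * Δ)
        inner a = ≤-trans (≤-reflexive (∑-cong λ t → sym (∑-*ˡ (α a t) (λ b → α t b * α b y))))
            (≤-trans (∑-mono λ t → ∑-mono λ b → pt t b) (≤-trans (≤-reflexive sums) (≤-trans (add≤ (add≤ (hB a y) (mulˡ (α≥0 a y) (≤-trans (≤-reflexive (cd-diag y)) (hΔ y)))) (mulʳ (α≥0 a y) (≤-trans (≤-reflexive (cd-diag a)) (hΔ a))))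
               (≤-reflexive (m B (α a y) Δ)))))
          where
          m : ∀ b a d → b + a * d + d * a ≡ b + a * (ι 2 * d)
          m = solve 3 (λ b a d → (b ⊕ a ⊗ d ⊕ d ⊗ a) ⊜ (b ⊕ a ⊗ (Κ (ι 2) ⊗ d))) refl
          pt : ∀ t b → α a t * (α t b * α b y) ≤ α a t * α t b * α b y * (ν t y * ν b a) + δ t y * (α a t * (α t b * α b y)) + δ b a * (α a t * α t b * α b y)
          pt t b = cert ((α≥0 a t ⊠ (α≥0 t b ⊠ α≥0 b y)) ⊠ sub (split a t b)) (r (α a t) (α t b) (α b y) (ν t y * ν b a) (δ t y) (δ b a))
            where r : ∀ p q s v d e → p * q * s * v + d * (p * (q * s)) + e * (p * q * s) ≡ p * (q * s) + p * (q * s) * (v + d + e - 1ℚ)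
                  r = solve 6 (λ p q s v d e → (p ⊗ q ⊗ s ⊗ v ⊕ d ⊗ (p ⊗ (q ⊗ s)) ⊕ e ⊗ (p ⊗ q ⊗ s))
                      ⊜ (p ⊗ (q ⊗ s) ⊕ p ⊗ (q ⊗ s) ⊗ (v ⊕ d ⊕ e ⊖ Κ 1ℚ))) refl
          sums : (∑ λ t → ∑ λ b → α a t * α t b * α b y * (ν t y * ν b a) + δ t y * (α a t * (α t b * α b y)) + δ b a * (α a t * α t b * α b y))
               ≡ Pm a y + α a y * cd y y + cd a a * α a y
          sums = trans (∑-cong λ t → trans (∑-+ (λ b → α a t * α t b * α b y * (ν t y * ν b a) + δ t y * (α a t * (α t b * α b y))) (λ b → δ b a * (α a t * α t b * α b y)))
                 (cong₂ _+_ (trans (∑-+ (λ b → α a t * α t b * α b y * (ν t y * ν b a)) (λ b → δ t y * (α a t * (α t b * α b y))))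
                     (cong ((∑ λ b → α a t * α t b * α b y * (ν t y * ν b a)) +_) (trans (∑-*ˡ (δ t y) (λ b → α a t * (α t b * α b y))) (cong (δ t y *_) (∑-*ˡ (α a t) (λ b → α t b * α b y))))))
                   (∑-δ′ a (λ b → α a t * α t b * α b y))))
              (trans (∑-+ (λ t → (∑ λ b → α a t * α t b * α b y * (ν t y * ν b a)) + δ t y * (α a t * cd t y)) (λ t → α a t * α t a * α a y))
                (cong₂ _+_ (trans (∑-+ (λ t → ∑ λ b → α a t * α t b * α b y * (ν t y * ν b a)) (λ t → δ t y * (α a t * cd t y)))
                    (cong (Pm a y +_) (∑-δ′ y (λ t → α a t * cd t y)))) (∑-*ʳ (α a y) (λ t → α a t * α t a))))

      DB : ℚ
      DB = ι n * (Δ * B + ι 2 * Δ) + ι n * Δ + Δ * (Δ * Δ) + ι 2 * ι n * (ι 2 * Δ + ι 2) + ι 2 * ((1ℚ + Δ) * (1ℚ + Δ))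

      -- `Cm` is a sum of products, so its change has a second-order part: vertices b that lose both
      -- open pairs in the same step. The leading term here is of order nΔB; `DB≤` shows that this
      -- is within the allowed error.
      S-double : ∀ {x y} → ¬ x ≡ y → SA (λ s t → ∑ (λ b → kill s t x b * kill s t b y)) ≤ DB
      S-double {x} {y} ne = ≤-trans (S-mono (valid A) (λ s t v → Pair.double (valid⇒op {A = A} v) x y ne))
        (≤-trans (≤-reflexive (trans (S-sym (G x y)) (trans (opsum-+ (λ s t → ∑ (H x y s t) + (δ s x + δ s y) * c2) (λ s t → δ s x * δ t y * c3))
             (cong₂ _+_ (opsum-+ (λ s t → ∑ (H x y s t)) (λ s t → (δ s x + δ s y) * c2)) (trans (opsum-*ʳ c3 (λ s t → δ s x * δ t y)) (cong (_* c3) (opsum-edge x y)))))))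
          (add≤ (add≤ partH part2) (≤-trans (mulʳ c3≥0 (⟦⟧≤1 (op A x y))) (≤-reflexive (ℚP.*-identityˡ c3)))))
        where
        c2 = ι 2 * Δ + ι 2
        c3 = ι 2 * ((1ℚ + Δ) * (1ℚ + Δ))
        c3≥0 : 0ℚ ≤ c3
        c3≥0 = 0≤ι 2 ⊠ ((0≤1 ⊞ Δ0) ⊠ (0≤1 ⊞ Δ0))
        od : ∀ x → opsum (λ s t → δ s x) ≤ ι n
        od x = ≤-trans (≤-reflexive (trans (∑-cong λ s → ∑-cong λ t → cong (ω s t *_) (sym (ℚP.*-identityʳ (δ s x)))) (opsum-δ x (λ _ → 1ℚ))))
           (≤-trans (∑-bound 1ℚ (λ t → ≤-trans (≤-reflexive (ℚP.*-identityʳ (ω x t))) (⟦⟧≤1 (op A x t)))) (≤-reflexive (ℚP.*-identityʳ (ι n))))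
        part2 : opsum (λ s t → (δ s x + δ s y) * c2) ≤ ι 2 * ι n * c2
        part2 = ≤-trans (≤-reflexive (trans (opsum-*ʳ c2 (λ s t → δ s x + δ s y)) (cong (_* c2) (opsum-+ (λ s t → δ s x) (λ s t → δ s y)))))
           (≤-trans (mulʳ (0≤ι 2 ⊠ Δ0 ⊞ 0≤ι 2) (add≤ (od x) (od y))) (≤-reflexive (cong (_* c2) (r (ι n)))))
          where r : ∀ a → a + a ≡ ι 2 * a
                r = solve 1 (λ a → (a ⊕ a) ⊜ (Κ (ι 2) ⊗ a)) refl
        ω1 : ∀ s t {f} → 0ℚ ≤ f → ω s t * f ≤ f
        ω1 s t {f} h = ≤-trans (mulʳ h (⟦⟧≤1 (op A s t))) (≤-reflexive (ℚP.*-identityˡ f))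
        f1 f2 f3 : Fin n → Fin n → ℚ
        f1 s t = cd t x * cd t y
        f2 s t = α x s * α y s * deg t
        f3 s t = α x s * (α y t * deg t)
        deg≥0 : ∀ t → 0ℚ ≤ deg t
        deg≥0 t = ∑-nonneg (α≥0 t)
        partH : opsum (λ s t → ∑ (H x y s t)) ≤ ι n * (Δ * B + ι 2 * Δ) + ι n * Δ + Δ * (Δ * Δ)
        partH = ≤-trans (≤-reflexive (trans (∑-cong λ s → ∑-cong λ t → cong (ω s t *_) (rowH s t)) (trans (opsum-+ (λ s t → f1 s t + f2 s t) f3) (cong (_+ opsum f3) (opsum-+ f1 f2)))))
           (add≤ (add≤ b1 b2) b3)
          where
          rowH : ∀ s t → ∑ (H x y s t) ≡ f1 s t + f2 s t + f3 s t
          rowH s t = trans (∑-+ (λ b → δ s b * (cd t x * cd t y) + α x s * α y s * α t b) (λ b → α x s * α y t * α t b))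
            (cong₂ _+_ (trans (∑-+ (λ b → δ s b * (cd t x * cd t y)) (λ b → α x s * α y s * α t b)) (cong₂ _+_ (∑-δ s (λ _ → cd t x * cd t y)) (∑-*ˡ (α x s * α y s) (α t))))
               (trans (∑-*ˡ (α x s * α y t) (α t)) (ℚP.*-assoc (α x s) (α y t) (deg t))))
          b1 : opsum f1 ≤ ι n * (Δ * B + ι 2 * Δ)
          b1 = ∑-bound (Δ * B + ι 2 * Δ) (λ s → ≤-trans (∑-mono λ t → ω1 s t (cd≥0 t x ⊠ cd≥0 t y)) (two-step ne))
          b2 : opsum f2 ≤ ι n * Δ
          b2 = ≤-trans (∑-mono λ s → ∑-mono λ t → ≤-trans (ω1 s t (α≥0 x s ⊠ α≥0 y s ⊠ deg≥0 t)) (mulˡ (α≥0 x s ⊠ α≥0 y s) (hΔ t)))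
            (≤-trans (≤-reflexive (trans (∑-cong λ s → ∑-const {n} (α x s * α y s * Δ)) (trans (∑-*ˡ (ι n) (λ s → α x s * α y s * Δ)) (cong (ι n *_) (trans (∑-*ʳ Δ (λ s → α x s * α y s)) (cong (_* Δ) (∑-cong λ s → cong (α x s *_) (α-sym y s))))))))
               (≤-trans (mulˡ (0≤ι n) (mulʳ Δ0 (cd≤1 ne))) (≤-reflexive (cong (ι n *_) (ℚP.*-identityˡ Δ)))))
          b3 : opsum f3 ≤ Δ * (Δ * Δ)
          b3 = ≤-trans (∑-mono λ s → ≤-trans (∑-mono λ t → ≤-trans (ω1 s t (α≥0 x s ⊠ (α≥0 y t ⊠ deg≥0 t))) (mulˡ (α≥0 x s) (mulˡ (α≥0 y t) (hΔ t))))
                (≤-trans (≤-reflexive (trans (∑-*ˡ (α x s) (λ t → α y t * Δ)) (cong (α x s *_) (∑-*ʳ Δ (α y))))) (mulˡ (α≥0 x s) (mulʳ Δ0 (hΔ y)))))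
             (≤-trans (≤-reflexive (∑-*ʳ (Δ * Δ) (α x))) (mulʳ (Δ0 ⊠ Δ0) (hΔ x)))

  -- Cherries

  okᵇ : ∀ {n u} → (Fin n → Fin n → Bool) → Fin n → Vec (Fin n) u → Bool
  okᵇ A x [] = true
  okᵇ A x (y ∷ v) = not (x == y) ∧ not (Quantities.cod A x y) ∧ okᵇ A x v

  -- cherry-free families: a cherry is a pair of vertices with a common neighbour
  cf : ∀ {n u} → (Fin n → Fin n → Bool) → Vec (Fin n) u → Bool
  cf A [] = true
  cf A (x ∷ v) = okᵇ A x v ∧ cf A v

  row : ∀ {n u} → (Fin n → Fin n → ℚ) → Fin n → Vec (Fin n) u → ℚ
  row φ x [] = 0ℚ
  row φ x (y ∷ v) = (φ x y + φ y x) + row φ x v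

  pairs : ∀ {n u} → (Fin n → Fin n → ℚ) → Vec (Fin n) u → ℚ
  pairs φ [] = 0ℚ
  pairs φ (x ∷ v) = row φ x v + pairs φ v

  vsum : ∀ {n u} → (Fin n → ℚ) → Vec (Fin n) u → ℚ
  vsum f [] = 0ℚ
  vsum f (x ∷ v) = f x + vsum f v

  module _ {n} {A : Fin n → Fin n → Bool} where
    open Quantities A

    ok-head : ∀ {u x y} {v : Vec (Fin n) u} → okᵇ A x (y ∷ v) ≡ true → ¬ x ≡ y × cod x y ≡ false
    ok-head {x = x} {y} h = (λ { refl → true≢false (==-refl x) (not-true (∧-left {not (x == y)} h)) }) , not-true (∧-left {not (cod x y)} (∧-right {not (x == y)} h))

    ok-tail : ∀ {u x y} {v : Vec (Fin n) u} → okᵇ A x (y ∷ v) ≡ true → okᵇ A x v ≡ true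
    ok-tail {x = x} {y} h = ∧-right {not (cod x y)} (∧-right {not (x == y)} h)

    ok-cons : ∀ {u x y} {v : Vec (Fin n) u} → ¬ x ≡ y → cod x y ≡ false → okᵇ A x v ≡ true → okᵇ A x (y ∷ v) ≡ true
    ok-cons p q r rewrite ==-false p | q = r

    row≥ : ∀ {u} (φ : Fin n → Fin n → ℚ) c x (v : Vec (Fin n) u) → okᵇ A x v ≡ true →
      (∀ x y → ¬ x ≡ y → cod x y ≡ false → c ≤ φ x y + φ y x) → ι u * c ≤ row φ x v
    row≥ φ c x [] h f = ≤-reflexive (ℚP.*-zeroˡ c)
    row≥ {suc u} φ c x (y ∷ v) h f = ≤-trans (≤-reflexive (trans (cong (_* c) (ι-suc u)) (l (ι u) c)))
        (add≤ (f x y (proj₁ (ok-head {v = v} h)) (proj₂ (ok-head {v = v} h))) (row≥ φ c x v (ok-tail {v = v} h) f))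
      where l : ∀ a c → (1ℚ + a) * c ≡ c + a * c
            l = solve 2 (λ a c → ((Κ 1ℚ ⊕ a) ⊗ c) ⊜ (c ⊕ a ⊗ c)) refl

    pairs≥ : ∀ {u} (φ : Fin n → Fin n → ℚ) c (v : Vec (Fin n) u) → cf A v ≡ true →
      (∀ x y → ¬ x ≡ y → cod x y ≡ false → c ≤ φ x y + φ y x) → (ι u * ι u - ι u) * c ≤ ι 2 * pairs φ v
    pairs≥ φ c [] h f = ≤-reflexive (trans (ℚP.*-zeroˡ c) (sym (ℚP.*-zeroʳ (ι 2))))
    pairs≥ {suc u} φ c (x ∷ v) h f = ≤-trans (≤-reflexive (trans (cong (λ a → (a * a - a) * c) (ι-suc u)) (l (ι u) c)))
        (≤-trans (add≤ (mulˡ (0≤ι 2) (row≥ φ c x v (∧-left h) f)) (pairs≥ φ c v (∧-right {okᵇ A x v} h) f)) (≤-reflexive (sym (ℚP.*-distribˡ-+ (ι 2) (row φ x v) (pairs φ v)))))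
      where l : ∀ a c → ((1ℚ + a) * (1ℚ + a) - (1ℚ + a)) * c ≡ ι 2 * (a * c) + (a * a - a) * c
            l = solve 2 (λ a c → (((Κ 1ℚ ⊕ a) ⊗ (Κ 1ℚ ⊕ a) ⊖ (Κ 1ℚ ⊕ a)) ⊗ c) ⊜ (Κ (ι 2) ⊗ (a ⊗ c) ⊕ (a ⊗ a ⊖ a) ⊗ c)) refl

    row≡0 : ∀ {u} (φ : Fin n → Fin n → ℚ) x (v : Vec (Fin n) u) → okᵇ A x v ≡ true →
      (∀ x y → ¬ x ≡ y → cod x y ≡ false → φ x y + φ y x ≡ 0ℚ) → row φ x v ≡ 0ℚ
    row≡0 φ x [] h f = refl
    row≡0 φ x (y ∷ v) h f = cong₂ _+_ (f x y (proj₁ (ok-head {v = v} h)) (proj₂ (ok-head {v = v} h))) (row≡0 φ x v (ok-tail {v = v} h) f)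

    pairs≡0 : ∀ {u} (φ : Fin n → Fin n → ℚ) (v : Vec (Fin n) u) → cf A v ≡ true →
      (∀ x y → ¬ x ≡ y → cod x y ≡ false → φ x y + φ y x ≡ 0ℚ) → pairs φ v ≡ 0ℚ
    pairs≡0 φ [] h f = refl
    pairs≡0 φ (x ∷ v) h f = cong₂ _+_ (row≡0 φ x v (∧-left h) f) (pairs≡0 φ v (∧-right {okᵇ A x v} h) f)

    vsum-ok : ∀ {u} (p : Fin n → Bool) x (v : Vec (Fin n) u) → okᵇ A x v ≡ true → p x ≡ true →
      (∀ x y → p x ≡ true → p y ≡ true → x ≡ y ⊎ cod x y ≡ true) → vsum (λ y → ⟦ p y ⟧) v ≡ 0ℚ
    vsum-ok p x [] h q f = refl
    vsum-ok p x (y ∷ v) h q f = cong₂ _+_ (⟦⟧-false (¬true⇒false λ r → go (f x y q r))) (vsum-ok p x v (ok-tail {v = v} h) q f)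
      where
      go : x ≡ y ⊎ cod x y ≡ true → ⊥
      go (inj₁ e) = proj₁ (ok-head {v = v} h) e
      go (inj₂ e) = true≢false e (proj₂ (ok-head {v = v} h))

    vsum≤1 : ∀ {u} (p : Fin n → Bool) (v : Vec (Fin n) u) → cf A v ≡ true →
      (∀ x y → p x ≡ true → p y ≡ true → x ≡ y ⊎ cod x y ≡ true) → vsum (λ y → ⟦ p y ⟧) v ≤ 1ℚ
    vsum≤1 p [] h f = 0≤1
    vsum≤1 p (x ∷ v) h f with bool-dec (p x)
    ... | inj₁ q = ≤-reflexive (cong₂ _+_ (⟦⟧-true q) (vsum-ok p x v (∧-left h) q f))
    ... | inj₂ q = ≤-trans (≤-reflexive (trans (cong (_+ vsum (λ y → ⟦ p y ⟧) v) (⟦⟧-false q)) (ℚP.+-identityˡ (vsum (λ y → ⟦ p y ⟧) v)))) (vsum≤1 p v (∧-right {okᵇ A x v} h) f)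

    vsum≥0 : ∀ {u} {f : Fin n → ℚ} → (∀ x → 0ℚ ≤ f x) → (v : Vec (Fin n) u) → 0ℚ ≤ vsum f v
    vsum≥0 h [] = ≤-refl
    vsum≥0 h (x ∷ v) = h x ⊞ vsum≥0 h v

    pairs≤vsum : ∀ {u} (f g : Fin n → ℚ) → (∀ x → 0ℚ ≤ f x) → (∀ x → 0ℚ ≤ g x) → (v : Vec (Fin n) u) →
      pairs (λ x y → f x * g y) v ≤ vsum f v * vsum g v
    pairs≤vsum f g f0 g0 [] = ≤-refl
    pairs≤vsum f g f0 g0 (x ∷ v) = ≤-trans (add≤ (≤-reflexive (rw v)) (pairs≤vsum f g f0 g0 v))
        (cert (f0 x ⊠ g0 x) (l (f x) (g x) (vsum f v) (vsum g v)))
      where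
      l : ∀ a b p q → (a + p) * (b + q) ≡ a * q + b * p + p * q + a * b
      l = solve 4 (λ a b p q → ((a ⊕ p) ⊗ (b ⊕ q)) ⊜ (a ⊗ q ⊕ b ⊗ p ⊕ p ⊗ q ⊕ a ⊗ b)) refl
      rw : ∀ {u} (v : Vec (Fin n) u) → row (λ x y → f x * g y) x v ≡ f x * vsum g v + g x * vsum f v
      rw [] = l0 (f x) (g x)
        where l0 : ∀ a b → 0ℚ ≡ a * 0ℚ + b * 0ℚ
              l0 = solve 2 (λ a b → (Κ 0ℚ) ⊜ (a ⊗ Κ 0ℚ ⊕ b ⊗ Κ 0ℚ)) refl
      rw (y ∷ v) = trans (cong (f x * g y + f y * g x +_) (rw v)) (l1 (f x) (g y) (f y) (g x) (vsum g v) (vsum f v))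
        where l1 : ∀ a b c d p q → a * b + c * d + (a * p + d * q) ≡ a * (b + p) + d * (c + q)
              l1 = solve 6 (λ a b c d p q → (a ⊗ b ⊕ c ⊗ d ⊕ (a ⊗ p ⊕ d ⊗ q)) ⊜ (a ⊗ (b ⊕ p) ⊕ d ⊗ (c ⊕ q))) refl

  module Cherries {n} (A : Fin n → Fin n → Bool) (C : C4Free A) where
    open Sums A C

    opsum-row : ∀ {u} (φ : Fin n → Fin n → Fin n → Fin n → ℚ) (ρ : Fin n → Fin n → ℚ) → (∀ x y → opsum (φ x y) ≡ ρ x y) →
      ∀ x (v : Vec (Fin n) u) → opsum (λ s t → row (λ x y → φ x y s t) x v) ≡ row ρ x v
    opsum-row φ ρ h x [] = trans (∑-0 λ s → ∑-0 λ t → ℚP.*-zeroʳ (ω s t)) refl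
    opsum-row φ ρ h x (y ∷ v) = trans (opsum-+ (λ s t → φ x y s t + φ y x s t) (λ s t → row (λ x y → φ x y s t) x v))
       (cong₂ _+_ (trans (opsum-+ (φ x y) (φ y x)) (cong₂ _+_ (h x y) (h y x))) (opsum-row φ ρ h x v))

    opsum-pairs : ∀ {u} (φ : Fin n → Fin n → Fin n → Fin n → ℚ) (ρ : Fin n → Fin n → ℚ) → (∀ x y → opsum (φ x y) ≡ ρ x y) →
      ∀ (v : Vec (Fin n) u) → opsum (λ s t → pairs (λ x y → φ x y s t) v) ≡ pairs ρ v
    opsum-pairs φ ρ h [] = trans (∑-0 λ s → ∑-0 λ t → ℚP.*-zeroʳ (ω s t)) refl
    opsum-pairs φ ρ h (x ∷ v) = trans (opsum-+ (λ s t → row (λ x y → φ x y s t) x v) (λ s t → pairs (λ x y → φ x y s t) v))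
       (cong₂ _+_ (opsum-row φ ρ h x v) (opsum-pairs φ ρ h v))

    -- Counts the ways in which st, with t in the family, joins a member x to the member t through
    -- s.
    ξ : ∀ {u} → Vec (Fin n) u → Fin n → Fin n → ℚ
    ξ v s t = pairs (λ x y → α x s * δ y t) v

    opsum-ξ : ∀ {u} (v : Vec (Fin n) u) → opsum (ξ v) ≡ pairs Nm v
    opsum-ξ = opsum-pairs (λ x y s t → α x s * δ y t) Nm (λ x y → ∑-cong λ s →
        trans (∑-cong λ t → l (ω s t) (α x s) (δ y t)) (trans (∑-*ˡ (α x s) (λ t → δ y t * ω s t)) (cong (α x s *_) (∑-δ y (ω s)))))
      where l : ∀ a b c → a * (b * c) ≡ b * (c * a)
            l = solve 3 (λ a b c → (a ⊗ (b ⊗ c)) ⊜ (b ⊗ (c ⊗ a))) refl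

    -- Two members adjacent to s would already form a cherry, and members equal to t coincide.
    ξ≤1 : ∀ {u} (v : Vec (Fin n) u) → cf A v ≡ true → ∀ s t → ξ v s t ≤ 1ℚ
    ξ≤1 v h s t = ≤-trans (pairs≤vsum {A = A} (λ x → α x s) (λ y → δ y t) (λ x → α≥0 x s) (λ y → ⟦⟧≥0 (y == t)) v)
       (mul≤ (vsum≥0 {A = A} (λ x → α≥0 x s) v) (vsum≤1 {A = A} (λ x → A x s) v h λ x y p q → inj₂ (ex-intro (λ z → A x z ∧ A z y) s (∧-intro p (adj-sym q))))
             (vsum≥0 {A = A} (λ y → ⟦⟧≥0 (y == t)) v) (vsum≤1 {A = A} (λ y → y == t) v h λ x y p q → inj₁ (trans (==-sound p) (sym (==-sound q)))))

    cf-mono : ∀ {u} (v : Vec (Fin n) u) {s t} → op A s t ≡ true → cf (add A s t) v ≡ true → cf A v ≡ true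
    cf-mono [] hst h = refl
    cf-mono (x ∷ v) {s} {t} hst h = ∧-intro (ok v (∧-left h)) (cf-mono v hst (∧-right {okᵇ (add A s t) x v} h))
      where
      ok : ∀ {u} (v : Vec (Fin n) u) → okᵇ (add A s t) x v ≡ true → okᵇ A x v ≡ true
      ok [] h = refl
      ok (y ∷ v) h = ok-cons {A = A} {v = v} (proj₁ (ok-head {A = add A s t} {v = v} h))
         (¬true⇒false λ q → true≢false (Step.cod-mono A C s t hst q) (proj₂ (ok-head {A = add A s t} {v = v} h))) (ok v (ok-tail {A = add A s t} {v = v} h))

    -- If st leaves the family cherry-free, both `ξ` vanish; otherwise each is at most 1. So at
    -- least half of the mixed counts, summed over ordered pairs of the family, are edges that
    -- create a cherry.
    S-cherry : ∀ {u} (v : Vec (Fin n) u) → cf A v ≡ true → ι 2 * SA (λ s t → ⟦ cf (add A s t) v ⟧) + pairs Nm v ≤ ι 2 * WA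
    S-cherry v h = ≤-trans (≤-reflexive (cong₂ _+_ (sym (S-* (valid A) (ι 2) (λ s t → ⟦ cf (add A s t) v ⟧))) (sym (trans (S-sym (ξ v)) (opsum-ξ v)))))
      (≤-trans (≤-reflexive (sym (S-+ (valid A) (λ s t → ι 2 * ⟦ cf (add A s t) v ⟧) (λ s t → ξ v s t + ξ v t s))))
        (≤-trans (S-mono (valid A) pt) (≤-reflexive (S-const (valid A) (ι 2)))))
      where
      pt : ∀ s t → valid A s t ≡ true → ι 2 * ⟦ cf (add A s t) v ⟧ + (ξ v s t + ξ v t s) ≤ ι 2
      pt s t vd with bool-dec (cf (add A s t) v)
      ... | inj₂ q = ≤-trans (add≤ (≤-reflexive (cong (ι 2 *_) (⟦⟧-false q))) (add≤ (ξ≤1 v h s t) (ξ≤1 v h t s))) ≤-refl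
      ... | inj₁ q = ≤-reflexive (cong₂ _+_ (cong (ι 2 *_) (⟦⟧-true q)) (cong₂ _+_ (zero-ξ (add-st {A = A}) (add-ts {A = A})) (zero-ξ (add-ts {A = A}) (add-st {A = A}))))
        where
        C′ = add-C4Free C (valid⇒op {A = A} vd)
        zero-ξ : ∀ {s′ t′} → add A s t s′ t′ ≡ true → add A s t t′ s′ ≡ true → ξ v s′ t′ ≡ 0ℚ
        zero-ξ {s′} {t′} e e′ = pairs≡0 {A = add A s t} (λ x y → α x s′ * δ y t′) v q λ x y ne nc → cong₂ _+_
            (z x y λ p r → true≢false (ex-intro (λ z → add A s t x z ∧ add A s t z y) s′ (∧-intro (add-old {A = A} p) (subst (λ w → add A s t s′ w ≡ true) (sym r) e))) nc)
            (z y x λ p r → true≢false (ex-intro (λ z → add A s t x z ∧ add A s t z y) s′ (∧-intro (subst (λ w → add A s t w s′ ≡ true) (sym r) e′) (C4Free.adj-sym C′ (add-old {A = A} p)))) nc)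
          where
          z : ∀ x y → (A x s′ ≡ true → y ≡ t′ → ⊥) → α x s′ * δ y t′ ≡ 0ℚ
          z x y f with bool-dec (A x s′) | bool-dec (y == t′)
          ... | inj₁ p | inj₁ r = ⊥-elim (f p (==-sound r))
          ... | inj₂ p | _ = trans (cong (_* δ y t′) (⟦⟧-false p)) (ℚP.*-zeroˡ (δ y t′))
          ... | inj₁ _ | inj₂ r = trans (cong (α x s′ *_) (⟦⟧-false r)) (ℚP.*-zeroʳ (α x s′))

  -- One step of the process

  sq : ℚ → ℚ
  sq x = x * x

  ι′ : (k : ℕ) .{{_ : ℕ.NonZero k}} → ℚ
  ι′ k = ℤ.+ 1 / k

  ⅛ : ℚ
  ⅛ = ½ * ¼

  -- One step of a counting variable X with target M·q and tolerance Zε: the change dX of X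
  -- plus the change e of the (rescaled) target.
  module Var {n} (w : Fin n → Fin n → Bool) (K : ℕ) (ρ g θ Z ε e E J : ℚ) (dX L : Fin n → Fin n → ℚ)
    (K1 : 1ℚ ≤ ι K) (ρ0 : 0ℚ ≤ ρ) (g0 : 0ℚ ≤ g) (gγ : (1ℚ + ι 256 * ρ) * g ≡ 1ℚ)
    (θ0 : 0ℚ ≤ θ) (Z0 : 0ℚ ≤ Z) (ε0 : 0ℚ ≤ ε) (ε8 : ε ≤ ⅛) (θZ : θ * (Z * ε) ≤ ι 2)
    (dX≤ : ∀ s t → w s t ≡ true → dX s t ≤ L s t) (≤dX : ∀ s t → w s t ≡ true → - L s t ≤ dX s t)
    (e≤ : e ≤ E) (≤e : - E ≤ e) (LJ : ∀ s t → w s t ≡ true → L s t + E ≤ J) (J0 : 0ℚ ≤ J)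
    (drift+ : S w dX + e * W w ≤ ι 16 * ρ * (Z * ε) * W w) (drift- : - (ι 16 * ρ * (Z * ε) * W w) ≤ S w dX + e * W w)
    (var : S w L + E * W w ≤ ι 12 * ρ * Z * W w) (small : ι 12 * ι K * J ≤ ε * (Z * ε)) where

    y u : Fin n → Fin n → ℚ
    y s t = θ * (dX s t + e)
    u s t = θ * (L s t + E)

    private
      W0 : 0ℚ ≤ W w
      W0 = S-nonneg w (λ _ _ _ → 0≤1)

      r0 : 0ℚ ≤ Z * ε
      r0 = Z0 ⊠ ε0

      Sy : S w y ≡ θ * (S w dX + e * W w)
      Sy = trans (S-* w θ (λ s t → dX s t + e)) (cong (θ *_) (trans (S-+ w dX (λ _ _ → e)) (cong (S w dX +_) (S-const w e))))

      Su : S w u ≡ θ * (S w L + E * W w)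
      Su = trans (S-* w θ (λ s t → L s t + E)) (cong (θ *_) (trans (S-+ w L (λ _ _ → E)) (cong (S w L +_) (S-const w E))))

      -- The growth rate 256ρ comes from here: drift constant 16, factor 2 from `θZ`, factor 8 from
      -- the drift condition of `Moment`.
      up : θ * (ι 16 * ρ * (Z * ε) * W w) ≤ ½ * ¼ * (ι 256 * ρ) * W w
      up = cert (0≤ι 16 ⊠ ρ0 ⊠ W0 ⊠ sub θZ) (l θ ρ (Z * ε) (W w))
        where l : ∀ θ ρ z W → ½ * ¼ * (ι 256 * ρ) * W ≡ θ * (ι 16 * ρ * z * W) + ι 16 * ρ * W * (ι 2 - θ * z)
              l = solve 4 (λ θ ρ z W → (Κ ½ ⊗ Κ ¼ ⊗ (Κ (ι 256) ⊗ ρ) ⊗ W) ⊜ (θ ⊗ (Κ (ι 16) ⊗ ρ ⊗ z ⊗ W) ⊕ Κ (ι 16) ⊗ ρ ⊗ W ⊗ (Κ (ι 2) ⊖ θ ⊗ z))) refl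

      12KθJ : ι 12 * ι K * (θ * J) ≤ ε * (θ * (Z * ε))
      12KθJ = ≤-trans (≤-reflexive (l (ι 12 * ι K) θ J)) (≤-trans (mulˡ θ0 small) (≤-reflexive (l θ ε (Z * ε))))
        where l : ∀ a b c → a * (b * c) ≡ b * (a * c)
              l = solve 3 (λ a b c → (a ⊗ (b ⊗ c)) ⊜ (b ⊗ (a ⊗ c))) refl

      ι2K : ι (K ℕ.+ K) ≡ ι K + ι K
      ι2K = ι-+ K K

      θJ0 : 0ℚ ≤ θ * J
      θJ0 = θ0 ⊠ J0

      -- Indeed 12KθJ ≤ ε·θZε ≤ 2ε ≤ ¼; both bounds on the jump required by `Moment` follow from
      -- this.
      48KθJ : ι 48 * (ι K * (θ * J)) ≤ 1ℚ
      48KθJ = cert (0≤ι 4 ⊠ sub 12KθJ ⊞ (0≤ι 4 ⊠ ε0 ⊠ sub θZ) ⊞ (0≤ι 8 ⊠ sub ε8)) (l′ (ι K) (θ * J) ε (θ * (Z * ε)))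
        where l′ : ∀ k j ε z → 1ℚ ≡ ι 48 * (k * j) + (ι 4 * (ε * z - ι 12 * k * j) + ι 4 * ε * (ι 2 - z) + ι 8 * (⅛ - ε))
              l′ = solve 4 (λ k j ε z → (Κ 1ℚ)
                  ⊜ (Κ (ι 48) ⊗ (k ⊗ j) ⊕ (Κ (ι 4) ⊗ (ε ⊗ z ⊖ Κ (ι 12) ⊗ k ⊗ j) ⊕ Κ (ι 4) ⊗ ε ⊗ (Κ (ι 2) ⊖ z) ⊕ Κ (ι 8) ⊗ (Κ ⅛ ⊖ ε)))) refl

      β4 : θ * J ≤ ¼
      β4 = cert (θJ0 ⊠ sub K1 ⊞ (0≤ι 1 ⊠ sub 48KθJ ⊠ <⇒≤ (ℚP.positive⁻¹ (ι′ 48))) ⊞ (<⇒≤ (ℚP.positive⁻¹ (¼ - ι′ 48)))) (l (θ * J) (ι K))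
        where l : ∀ j k → ¼ ≡ j + (j * (k - 1ℚ) + ι 1 * (1ℚ - ι 48 * (k * j)) * ι′ 48 + (¼ - ι′ 48))
              l = solve 2 (λ j k → (Κ ¼) ⊜ (j ⊕ (j ⊗ (k ⊖ Κ 1ℚ) ⊕ Κ (ι 1) ⊗ (Κ 1ℚ ⊖ Κ (ι 48) ⊗ (k ⊗ j)) ⊗ Κ (ι′ 48) ⊕ (Κ ¼ ⊖ Κ (ι′ 48))))) refl

      Kβ : ι (K ℕ.+ K) * (θ * J) ≤ ¼
      Kβ = ≤-trans (≤-reflexive (cong (_* (θ * J)) ι2K))
            (cert (sub 48KθJ ⊠ <⇒≤ (ℚP.positive⁻¹ (ι′ 24)) ⊞ <⇒≤ (ℚP.positive⁻¹ (¼ - ι′ 24))) (l (θ * J) (ι K)))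
        where l : ∀ j k → ¼ ≡ (k + k) * j + ((1ℚ - ι 48 * (k * j)) * ι′ 24 + (¼ - ι′ 24))
              l = solve 2 (λ j k → (Κ ¼) ⊜ ((k ⊕ k) ⊗ j ⊕ ((Κ 1ℚ ⊖ Κ (ι 48) ⊗ (k ⊗ j)) ⊗ Κ (ι′ 24) ⊕ (Κ ¼ ⊖ Κ (ι′ 24))))) refl

      -- The left side is at most 2ρ(θZε)² ≤ 8ρ, which is exactly the variance allowance for the
      -- rate 256ρ.
      Kβv : ι (K ℕ.+ K) * (θ * J) * (θ * (ι 12 * ρ * Z)) ≤ ½ * ¼ * ¼ * (ι 256 * ρ)
      Kβv = ≤-trans (≤-reflexive (cong (λ a → a * (θ * J) * (θ * (ι 12 * ρ * Z))) ι2K))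
          (cert ((0≤ι 2 ⊠ ρ0 ⊠ θ0 ⊠ Z0 ⊠ sub 12KθJ) ⊞ (0≤ι 2 ⊠ ρ0 ⊠ sub θZ ⊠ (0≤ι 2 ⊞ θ0 ⊠ r0))) (l θ Z ε ρ (ι K) (J)))
        where l : ∀ θ Z ε ρ k j → ½ * ¼ * ¼ * (ι 256 * ρ) ≡ (k + k) * (θ * j) * (θ * (ι 12 * ρ * Z))
                   + (ι 2 * ρ * θ * Z * (ε * (θ * (Z * ε)) - ι 12 * k * (θ * j)) + ι 2 * ρ * (ι 2 - θ * (Z * ε)) * (ι 2 + θ * (Z * ε)))
              l = solve 6 (λ θ Z ε ρ k j → (Κ ½ ⊗ Κ ¼ ⊗ Κ ¼ ⊗ (Κ (ι 256) ⊗ ρ))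
                  ⊜ ((k ⊕ k) ⊗ (θ ⊗ j) ⊗ (θ ⊗ (Κ (ι 12) ⊗ ρ ⊗ Z)) ⊕ (Κ (ι 2) ⊗ ρ ⊗ θ ⊗ Z ⊗ (ε ⊗ (θ ⊗ (Z ⊗ ε)) ⊖ Κ (ι 12) ⊗ k ⊗ (θ ⊗ j)) ⊕ Κ (ι 2) ⊗ ρ ⊗ (Κ (ι 2) ⊖ θ ⊗ (Z ⊗ ε)) ⊗ (Κ (ι 2) ⊕ θ ⊗ (Z ⊗ ε))))) refl

      l : ∀ θ a b → - (θ * (a + b)) ≡ θ * (- a + - b)
      l = solve 3 (λ θ a b → (⊝ (θ ⊗ (a ⊕ b))) ⊜ (θ ⊗ (⊝ a ⊕ ⊝ b))) refl
      l1 : ∀ a b → - (a * b) ≡ a * (- b)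
      l1 = solve 2 (λ a b → (⊝ (a ⊗ b)) ⊜ (a ⊗ (⊝ b))) refl

      module Mo = Moment w K (ι 256 * ρ) g (θ * J) (θ * (ι 12 * ρ * Z)) y u (0≤ι 256 ⊠ ρ0) g0 gγ θJ0
        (λ s t v → mulˡ θ0 (add≤ (dX≤ s t v) e≤))
        (λ s t v → ≤-trans (≤-reflexive (l θ (L s t) E)) (mulˡ θ0 (add≤ (≤dX s t v) ≤e)))
        (λ s t v → mulˡ θ0 (LJ s t v))
        (≤-trans (≤-reflexive Sy) (≤-trans (mulˡ θ0 drift+) up))
        (≤-trans (neg≤ up) (≤-trans (≤-reflexive (l1 θ (ι 16 * ρ * (Z * ε) * W w))) (≤-trans (mulˡ θ0 drift-) (≤-reflexive (sym Sy)))))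
        (≤-trans (≤-reflexive Su) (≤-trans (mulˡ θ0 var) (≤-reflexive (sym (ℚP.*-assoc θ (ι 12 * ρ * Z) (W w))))))
        β4 Kβ Kβv

    step : ∀ z → S w (λ s t → pow ((z + y s t) * g * ((z + y s t) * g)) K) ≤ W w * (pow (z * z) K + pow ¼ K)
    step = Mo.moment

    -- The factor `r` rescales the target, and `e` is what makes the new deviation equal to r times
    -- the old one plus d + e. Here θ is the reciprocal of the new tolerance before its growth and
    -- rθ that of the old one; the growth is the factor `g`.
    shape : ∀ X Mq r Mq′ X′ d → e ≡ X * (1ℚ - r) - (Mq′ - Mq * r) → X′ ≡ X + d →
      (X′ - Mq′) * (θ * g) ≡ ((X - Mq) * (r * θ) + θ * (d + e)) * g
    shape X Mq r Mq′ X′ d refl refl = h X Mq r Mq′ d θ g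
      where h : ∀ X M r M′ d θ g → (X + d - M′) * (θ * g) ≡ ((X - M) * (r * θ) + θ * (d + (X * (1ℚ - r) - (M′ - M * r)))) * g
            h = solve 7 (λ X M r M′ d θ g → ((X ⊕ d ⊖ M′) ⊗ (θ ⊗ g)) ⊜ (((X ⊖ M) ⊗ (r ⊗ θ) ⊕ θ ⊗ (d ⊕ (X ⊗ (Κ 1ℚ ⊖ r) ⊖ (M′ ⊖ M ⊗ r)))) ⊗ g)) refl

    result : ∀ X Mq r Mq′ (F : Fin n → Fin n → ℚ) → e ≡ X * (1ℚ - r) - (Mq′ - Mq * r) →
      (∀ s t → w s t ≡ true → F s t ≤ pow (sq ((X + dX s t - Mq′) * (θ * g))) K) →
      S w F ≤ W w * (pow (sq ((X - Mq) * (r * θ))) K + pow ¼ K)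
    result X Mq r Mq′ F eq h = ≤-trans (S-mono w (λ s t v → ≤-trans (h s t v)
         (≤-reflexive (cong (λ a → pow (sq a) K) (shape X Mq r Mq′ (X + dX s t) (dX s t) eq refl))))) (step ((X - Mq) * (r * θ)))

  -- q is the density of open pairs, κ its relative loss per step, ε the relative tolerance of the
  -- counts, 256ρ the growth rate of ε, and B bounds the number of walks of length 3.
  record Cond (N T D q ε κ ρ B k : ℚ) : Set where
    field
      q0 : 0ℚ < q
      q1 : q ≤ 1ℚ
      ε0 : 0ℚ ≤ ε
      ε8 : ε ≤ ⅛
      D0 : 0ℚ ≤ D
      DT : D ≤ T
      -- An open pair is closed by about 3D²q of the N²q/2 open pairs.
      κeq : κ * (N * N) ≡ ι 6 * (D * D)
      ρeq : ρ * (N * N) ≡ ι 24 * (T * T)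
      NT : N ≤ T * T * T
      TN : T * T ≤ N
      κ0 : 0ℚ ≤ κ
      ρ0 : 0ℚ ≤ ρ
      κε : ι 8 * κ ≤ ε
      Tεq : ι 8 ≤ T * ε * q
      -- `cJ` and `cN` are the smallness condition of `Var`: jumps of 60T² in the counts of open
      -- pairs, jumps of 30B in degrees and mixed counts.
      cJ : ι 12 * k * (ι 60 * (T * T)) ≤ ε * (N * (q * q) * ε)
      cN : ι 12 * k * (ι 30 * B) ≤ ε * (T * q * ε)
      cB : ι 5 * B ≤ T * (ε * (q * q * q))
      B1 : 1ℚ ≤ B
      k1 : 1ℚ ≤ k

  record Good {n} (A : Fin n → Fin n → Bool) (T D q ε B : ℚ) : Set where
    open Quantities A
    private
      N = ι n
    field
      deg≤ : ∀ x → deg x ≤ D + ε * T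
      deg≥ : ∀ x → D - ε * T ≤ deg x
      opdeg≤ : ∀ x → opdeg x ≤ N * q * (1ℚ + ε)
      opdeg≥ : ∀ x → N * q * (1ℚ - ε) ≤ opdeg x
      Cm≤ : ∀ {x y} → ¬ x ≡ y → Cm x y ≤ N * (q * q) * (1ℚ + ε)
      Cm≥ : ∀ {x y} → ¬ x ≡ y → N * (q * q) * (1ℚ - ε) ≤ Cm x y
      Nm≤ : ∀ x y → Nm x y ≤ q * (D + ε * T)
      Nm≥ : ∀ {x y} → ¬ x ≡ y → cod x y ≡ false → q * (D - ε * T) ≤ Nm x y
      Pm≤ : ∀ x y → Pm x y ≤ B

  module CondFacts {N T D q ε κ ρ B k : ℚ} (cond : Cond N T D q ε κ ρ B k) where
    open Cond cond public

    q≥0 : 0ℚ ≤ q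
    q≥0 = <⇒≤ q0

    T0 : 0ℚ ≤ T
    T0 = ≤-trans D0 DT

    1-ε : 0ℚ ≤ 1ℚ - ε
    1-ε = ≤-trans (sub ε8 ⊞ <⇒≤ (ℚP.positive⁻¹ (1ℚ - ⅛))) (≤-reflexive (l ε))
      where l : ∀ e → ⅛ - e + (1ℚ - ⅛) ≡ 1ℚ - e
            l = solve 1 (λ e → (Κ ⅛ ⊖ e ⊕ (Κ 1ℚ ⊖ Κ ⅛)) ⊜ (Κ 1ℚ ⊖ e)) refl

    ε≤1 : ε ≤ 1ℚ
    ε≤1 = unsub 1-ε

    T8 : ι 8 ≤ T
    T8 = ≤-trans Tεq (≤-trans (mul≤ (T0 ⊠ ε0) (≤-trans (mulˡ T0 ε≤1) (≤-reflexive (ℚP.*-identityʳ T))) q≥0 q1) (≤-reflexive (ℚP.*-identityʳ T)))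

    T1 : 1ℚ ≤ T
    T1 = ≤-trans (ι-mono {1} {8} (ℕ.s≤s ℕ.z≤n)) T8

    N1 : 1ℚ ≤ N
    N1 = ≤-trans (mul≤ 0≤1 T1 0≤1 T1) TN

    N0 : 0ℚ ≤ N
    N0 = ≤-trans 0≤1 N1

    NN>0 : 0ℚ < N * N
    NN>0 = *-pos (ℚP.<-≤-trans 0<1 N1) (ℚP.<-≤-trans 0<1 N1)

    κρ : ι 4 * κ ≤ ρ
    κρ = cancel-* NN>0 (cert ((0≤ι 24 ⊠ sub DT ⊠ (T0 ⊞ D0)) ⊞ sub (≤-reflexive (sym ρeq)) ⊞ (0≤ι 4 ⊠ sub (≤-reflexive κeq))) (l κ ρ (N * N) D T))
      where l : ∀ κ ρ M D T → ρ * M ≡ ι 4 * κ * M + (ι 24 * (T - D) * (T + D) + (ρ * M - ι 24 * (T * T)) + ι 4 * (ι 6 * (D * D) - κ * M))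
            l = solve 5 (λ κ ρ M D T → (ρ ⊗ M)
                ⊜ (Κ (ι 4) ⊗ κ ⊗ M ⊕ (Κ (ι 24) ⊗ (T ⊖ D) ⊗ (T ⊕ D) ⊕ (ρ ⊗ M ⊖ Κ (ι 24) ⊗ (T ⊗ T)) ⊕ Κ (ι 4) ⊗ (Κ (ι 6) ⊗ (D ⊗ D) ⊖ κ ⊗ M)))) refl

    Δ≤2T : D + ε * T ≤ ι 2 * T
    Δ≤2T = cert (sub DT ⊞ 1-ε ⊠ T0) (l D ε T)
      where l : ∀ D ε T → ι 2 * T ≡ D + ε * T + (T - D + (1ℚ - ε) * T)
            l = solve 3 (λ D ε T → (Κ (ι 2) ⊗ T) ⊜ (D ⊕ ε ⊗ T ⊕ (T ⊖ D ⊕ (Κ 1ℚ ⊖ ε) ⊗ T))) refl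

    Δ0 : 0ℚ ≤ D + ε * T
    Δ0 = D0 ⊞ ε0 ⊠ T0

    1+ε≤2 : 1ℚ + ε ≤ ι 2
    1+ε≤2 = ℚP.+-monoʳ-≤ 1ℚ ε≤1

    1/N≤ρT : ι 24 ≤ ρ * T * N
    1/N≤ρT = cancel-* (ℚP.<-≤-trans 0<1 N1) (cert ((0≤ι 24 ⊠ sub NT) ⊞ (sub (≤-reflexive (sym ρeq)) ⊠ T0)) (l ρ T N))
      where l : ∀ ρ T N → ρ * T * N * N ≡ ι 24 * N + (ι 24 * (T * T * T - N) + (ρ * (N * N) - ι 24 * (T * T)) * T)
            l = solve 3 (λ ρ T N → (ρ ⊗ T ⊗ N ⊗ N) ⊜ (Κ (ι 24) ⊗ N ⊕ (Κ (ι 24) ⊗ (T ⊗ T ⊗ T ⊖ N) ⊕ (ρ ⊗ (N ⊗ N) ⊖ Κ (ι 24) ⊗ (T ⊗ T)) ⊗ T))) refl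

    κNN≤ : κ * (N * N) ≤ ι 6 * (T * T)
    κNN≤ = ≤-trans (≤-reflexive κeq) (mulˡ (0≤ι 6) (mul≤ D0 DT D0 DT))

  -- The closing rate of an open pair on the trajectory

  module Hazard {n} (A : Fin n → Fin n → Bool) (C : C4Free A) {T D q ε κ ρ B k : ℚ}
    (cond : Cond (ι n) T D q ε κ ρ B k) (good : Good A T D q ε B) where
    open Totals A C public
    open CondFacts cond public
    open Good good public
    open Bounded (D + ε * T) B Δ0 deg≤ Pm≤ public

    N : ℚ
    N = ι n

    Wv : ℚ
    Wv = WA

    W≥0 : 0ℚ ≤ Wv
    W≥0 = S-nonneg (valid A) (λ _ _ _ → 0≤1)

    2W≥ : N * (N * q * (1ℚ - ε)) ≤ Wv + Wv
    2W≥ = ≤-trans (≤-trans (≤-reflexive (sym (∑-const {n} (N * q * (1ℚ - ε))))) (∑-mono opdeg≥)) (≤-reflexive (sym 2W))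

    2W≤ : Wv + Wv ≤ N * (N * q * (1ℚ + ε))
    2W≤ = ≤-trans (≤-reflexive 2W) (∑-bound (N * q * (1ℚ + ε)) opdeg≤)

    16W : ι 7 * (N * N * q) ≤ ι 16 * Wv
    16W = cert ((0≤ι 8 ⊠ sub 2W≥) ⊞ (0≤ι 8 ⊠ N0 ⊠ N0 ⊠ q≥0 ⊠ sub ε8)) (l N q ε Wv)
      where l : ∀ N q ε W → ι 16 * W ≡ ι 7 * (N * N * q) + (ι 8 * (W + W - N * (N * q * (1ℚ - ε))) + ι 8 * N * N * q * (⅛ - ε))
            l = solve 4 (λ N q ε W → (Κ (ι 16) ⊗ W)
                ⊜ (Κ (ι 7) ⊗ (N ⊗ N ⊗ q) ⊕ (Κ (ι 8) ⊗ (W ⊕ W ⊖ N ⊗ (N ⊗ q ⊗ (Κ 1ℚ ⊖ ε))) ⊕ Κ (ι 8) ⊗ N ⊗ N ⊗ q ⊗ (Κ ⅛ ⊖ ε)))) refl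

    T²εq : ι 8 * T ≤ T * T * ε * q
    T²εq = cert (T0 ⊠ sub Tεq) (l T ε q)
      where l : ∀ T ε q → T * T * ε * q ≡ ι 8 * T + T * (T * ε * q - ι 8)
            l = solve 3 (λ T ε q → (T ⊗ T ⊗ ε ⊗ q) ⊜ (Κ (ι 8) ⊗ T ⊕ T ⊗ (T ⊗ ε ⊗ q ⊖ Κ (ι 8)))) refl

    haz : ℚ
    haz = ρ * ε * Wv

    haz≥0 : 0ℚ ≤ haz
    haz≥0 = ρ0 ⊠ ε0 ⊠ W≥0

    SK : Fin n → Fin n → ℚ
    SK x y = SA (λ s t → kill s t x y)

    haz≥ : ι 21 * (T * T * ε * q) ≤ ι 2 * haz
    haz≥ = cert ((⅛≥0 ⊠ ρ0 ⊠ ε0 ⊠ sub 16W) ⊞ (⅛≥0 ⊠ 0≤ι 7 ⊠ ε0 ⊠ q≥0 ⊠ sub (≤-reflexive (sym ρeq)))) (l N q ε Wv ρ T)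
      where
      ⅛≥0 : 0ℚ ≤ ⅛
      ⅛≥0 = <⇒≤ (ℚP.positive⁻¹ ⅛)
      l : ∀ N q ε W ρ T → ι 2 * (ρ * ε * W) ≡ ι 21 * (T * T * ε * q) + (⅛ * ρ * ε * (ι 16 * W - ι 7 * (N * N * q)) + ⅛ * ι 7 * ε * q * (ρ * (N * N) - ι 24 * (T * T)))
      l = solve 6 (λ N q ε W ρ T → (Κ (ι 2) ⊗ (ρ ⊗ ε ⊗ W))
          ⊜ (Κ (ι 21) ⊗ (T ⊗ T ⊗ ε ⊗ q) ⊕ (Κ ⅛ ⊗ ρ ⊗ ε ⊗ (Κ (ι 16) ⊗ W ⊖ Κ (ι 7) ⊗ (N ⊗ N ⊗ q)) ⊕ Κ ⅛ ⊗ Κ (ι 7) ⊗ ε ⊗ q ⊗ (ρ ⊗ (N ⊗ N) ⊖ Κ (ι 24) ⊗ (T ⊗ T))))) refl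

    κW≥ : ι 3 * (D * D) * q * (1ℚ - ε) ≤ κ * Wv
    κW≥ = cert ((½≥0 ⊠ κ0 ⊠ sub 2W≥) ⊞ (½≥0 ⊠ q≥0 ⊠ 1-ε ⊠ sub (≤-reflexive (sym κeq)))) (l N q ε Wv κ D)
      where
      ½≥0 : 0ℚ ≤ ½
      ½≥0 = <⇒≤ (ℚP.positive⁻¹ ½)
      l : ∀ N q ε W κ D → κ * W ≡ ι 3 * (D * D) * q * (1ℚ - ε) + (½ * κ * (W + W - N * (N * q * (1ℚ - ε))) + ½ * q * (1ℚ - ε) * (κ * (N * N) - ι 6 * (D * D)))
      l = solve 6 (λ N q ε W κ D → (κ ⊗ W)
          ⊜ (Κ (ι 3) ⊗ (D ⊗ D) ⊗ q ⊗ (Κ 1ℚ ⊖ ε) ⊕ (Κ ½ ⊗ κ ⊗ (W ⊕ W ⊖ N ⊗ (N ⊗ q ⊗ (Κ 1ℚ ⊖ ε))) ⊕ Κ ½ ⊗ q ⊗ (Κ 1ℚ ⊖ ε) ⊗ (κ ⊗ (N ⊗ N) ⊖ Κ (ι 6) ⊗ (D ⊗ D))))) refl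

    κW≤ : κ * Wv ≤ ι 3 * (D * D) * q * (1ℚ + ε)
    κW≤ = cert ((½≥0 ⊠ κ0 ⊠ sub 2W≤) ⊞ (½≥0 ⊠ q≥0 ⊠ (0≤1 ⊞ ε0) ⊠ sub (≤-reflexive κeq))) (l N q ε Wv κ D)
      where
      ½≥0 : 0ℚ ≤ ½
      ½≥0 = <⇒≤ (ℚP.positive⁻¹ ½)
      l : ∀ N q ε W κ D → ι 3 * (D * D) * q * (1ℚ + ε) ≡ κ * W + (½ * κ * (N * (N * q * (1ℚ + ε)) - (W + W)) + ½ * q * (1ℚ + ε) * (ι 6 * (D * D) - κ * (N * N)))
      l = solve 6 (λ N q ε W κ D → (Κ (ι 3) ⊗ (D ⊗ D) ⊗ q ⊗ (Κ 1ℚ ⊕ ε))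
          ⊜ (κ ⊗ W ⊕ (Κ ½ ⊗ κ ⊗ (N ⊗ (N ⊗ q ⊗ (Κ 1ℚ ⊕ ε)) ⊖ (W ⊕ W)) ⊕ Κ ½ ⊗ q ⊗ (Κ 1ℚ ⊕ ε) ⊗ (Κ (ι 6) ⊗ (D ⊗ D) ⊖ κ ⊗ (N ⊗ N))))) refl

    -- The number of closing edges is at most 1 + 3q(D + εT)², against κW ≥ 3D²q(1 - ε). With D ≤ T
    -- and ε ≤ ⅛ the excess is at most 9.375 T²εq + 1, and T²εq ≥ 8T pays for the 1 out of the
    -- remaining part of `haz`.
    SK≤ : ∀ {x y} → op A x y ≡ true → SK x y ≤ κ * Wv + haz
    SK≤ {x} {y} h = ≤-trans (S-kill≤ x y) (≤-trans (add≤ (≤-reflexive (⟦⟧-true h)) (cl≤ (q * (D + ε * T)) (q≥0 ⊠ Δ0) Nm≤ x y))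
        (≤-trans (cert ((0≤ι 3 ⊠ q≥0 ⊠ ε0 ⊠ sub DT ⊠ (T0 ⊞ D0)) ⊞ (0≤ι 6 ⊠ ε0 ⊠ q≥0 ⊠ T0 ⊠ sub DT) ⊞ (0≤ι 3 ⊠ ε0 ⊠ T0 ⊠ T0 ⊠ q≥0 ⊠ sub ε8)
             ⊞ (<⇒≤ (ℚP.positive⁻¹ (1ℚ + ⅛)) ⊠ sub T²εq) ⊞ (0≤ι 9 ⊠ sub T1) ⊞ 0≤ι 8) (l D T ε q))
          (add≤ κW≥ half)))
      where
      half : (ι 21 * (T * T * ε * q)) * ½ ≤ haz
      half = ≤-trans (mulʳ (<⇒≤ (ℚP.positive⁻¹ ½)) haz≥) (≤-reflexive (r haz))
        where r : ∀ a → ι 2 * a * ½ ≡ a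
              r = solve 1 (λ a → (Κ (ι 2) ⊗ a ⊗ Κ ½) ⊜ (a)) refl
      l : ∀ D T ε q → ι 3 * (D * D) * q * (1ℚ - ε) + (ι 21 * (T * T * ε * q)) * ½ ≡ 1ℚ + ι 3 * ((D + ε * T) * (q * (D + ε * T)))
           + (ι 3 * q * ε * (T - D) * (T + D) + ι 6 * ε * q * T * (T - D) + ι 3 * ε * T * T * q * (⅛ - ε) + (1ℚ + ⅛) * (T * T * ε * q - ι 8 * T) + ι 9 * (T - 1ℚ) + ι 8)
      l = solve 4 (λ D T ε q → (Κ (ι 3) ⊗ (D ⊗ D) ⊗ q ⊗ (Κ 1ℚ ⊖ ε) ⊕ (Κ (ι 21) ⊗ (T ⊗ T ⊗ ε ⊗ q)) ⊗ Κ ½)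
          ⊜ (Κ 1ℚ ⊕ Κ (ι 3) ⊗ ((D ⊕ ε ⊗ T) ⊗ (q ⊗ (D ⊕ ε ⊗ T))) ⊕ (Κ (ι 3) ⊗ q ⊗ ε ⊗ (T ⊖ D) ⊗ (T ⊕ D) ⊕ Κ (ι 6) ⊗ ε ⊗ q ⊗ T ⊗ (T ⊖ D) ⊕ Κ (ι 3) ⊗ ε ⊗ T ⊗ T ⊗ q ⊗ (Κ ⅛ ⊖ ε) ⊕ (Κ 1ℚ ⊕ Κ ⅛) ⊗ (T ⊗ T ⊗ ε ⊗ q ⊖ Κ (ι 8) ⊗ T) ⊕ Κ (ι 9) ⊗ (T ⊖ Κ 1ℚ) ⊕ Κ (ι 8)))) refl

    -- Early on D is below its own tolerance and the bound is not positive. Otherwise, because xy is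
    -- open, a neighbour of x has no common neighbour with y and conversely, so the lower bounds on
    -- `Nm` apply to every term of `cl`.
    cl≥ : ∀ {x y} → op A x y ≡ true → ι 3 * q * (D * D - ι 2 * D * (ε * T)) ≤ cl x y
    cl≥ {x} {y} h with total (ε * T) D
    ... | inj₂ d = ≤-trans (≤-trans (cert ((0≤ι 3 ⊠ q≥0 ⊠ D0 ⊠ sub d) ⊞ (0≤ι 3 ⊠ q≥0 ⊠ D0 ⊠ (ε0 ⊠ T0))) (l D (ε * T) q)) ≤-refl) cl0
      where
      l : ∀ D e q → 0ℚ ≡ ι 3 * q * (D * D - ι 2 * D * e) + (ι 3 * q * D * (e - D) + ι 3 * q * D * e)
      l = solve 3 (λ D e q → (Κ 0ℚ) ⊜ (Κ (ι 3) ⊗ q ⊗ (D ⊗ D ⊖ Κ (ι 2) ⊗ D ⊗ e) ⊕ (Κ (ι 3) ⊗ q ⊗ D ⊗ (e ⊖ D) ⊕ Κ (ι 3) ⊗ q ⊗ D ⊗ e))) refl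
      cl0 : 0ℚ ≤ cl x y
      cl0 = ∑-nonneg (λ a → α≥0 x a ⊠ (Nm≥0 y a ⊞ Nm≥0 a y)) ⊞ ∑-nonneg (λ b → α≥0 y b ⊠ Nm≥0 b x)
    ... | inj₁ d = ≤-trans (cert (0≤ι 3 ⊠ q≥0 ⊠ sq≥0 (ε * T)) (l D (ε * T) q))
        (≤-trans (add≤ (≤-trans (mulʳ (m0 ⊞ m0) (deg≥ x)) (≤-reflexive (sym (∑-*ʳ (m + m) (α x))))) (≤-trans (mulʳ m0 (deg≥ y)) (≤-reflexive (sym (∑-*ʳ m (α y))))))
          (add≤ (∑-mono lx) (∑-mono ly)))
      where
      m = q * (D - ε * T)
      m0 : 0ℚ ≤ m
      m0 = q≥0 ⊠ sub d
      l : ∀ D e q → (D - e) * (q * (D - e) + q * (D - e)) + (D - e) * (q * (D - e)) ≡ ι 3 * q * (D * D - ι 2 * D * e) + ι 3 * q * (e * e)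
      l = solve 3 (λ D e q → ((D ⊖ e) ⊗ (q ⊗ (D ⊖ e) ⊕ q ⊗ (D ⊖ e)) ⊕ (D ⊖ e) ⊗ (q ⊗ (D ⊖ e)))
          ⊜ (Κ (ι 3) ⊗ q ⊗ (D ⊗ D ⊖ Κ (ι 2) ⊗ D ⊗ e) ⊕ Κ (ι 3) ⊗ q ⊗ (e ⊗ e))) refl
      x≢y = op⇒≢ {A = A} h
      nocod : ∀ u v → (∀ z → A u z ≡ true → A z v ≡ true → ⊥) → cod u v ≡ false
      nocod u v f = ¬true⇒false λ e → let z , p = ex-elim (λ z → A u z ∧ A z v) e in f z (∧-left p) (∧-right {A u z} p)
      lx : ∀ a → α x a * (m + m) ≤ α x a * (Nm y a + Nm a y)
      lx a with bool-dec (A x a)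
      ... | inj₂ p = ≤-reflexive (trans (cong (_* (m + m)) (⟦⟧-false p)) (trans (ℚP.*-zeroˡ (m + m)) (sym (trans (cong (_* (Nm y a + Nm a y)) (⟦⟧-false p)) (ℚP.*-zeroˡ (Nm y a + Nm a y))))))
      ... | inj₁ p = mulˡ (α≥0 x a) (add≤ (Nm≥ (λ { refl → true≢false p (op⇒nadj {A = A} h) }) (nocod y a λ z u v → op-walk {A = A} a z h p (adj-sym v) (adj-sym u)))
                                         (Nm≥ (λ { refl → true≢false p (op⇒nadj {A = A} h) }) (nocod a y λ z u v → op-walk {A = A} a z h p u v)))
      ly : ∀ b → α y b * m ≤ α y b * Nm b x
      ly b with bool-dec (A y b)
      ... | inj₂ p = ≤-reflexive (trans (cong (_* m) (⟦⟧-false p)) (trans (ℚP.*-zeroˡ m) (sym (trans (cong (_* Nm b x) (⟦⟧-false p)) (ℚP.*-zeroˡ (Nm b x))))))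
      ... | inj₁ p = mulˡ (α≥0 y b) (Nm≥ (λ { refl → true≢false (adj-sym p) (op⇒nadj {A = A} h) }) (nocod b x λ z u v → op-walk {A = A} z b h (adj-sym v) (adj-sym u) (adj-sym p)))

    -- The degree corrections of `S-kill≥` amount to at most 4T; absorbing them into `haz` uses T²εq
    -- ≥ 8T, that is, the condition `Tεq`.
    SK≥ : ∀ {x y} → op A x y ≡ true → κ * Wv - haz ≤ SK x y
    SK≥ {x} {y} h = ≤-trans (≤-trans (add≤ κW≤ (neg≤ half))
         (cert ((0≤ι 3 ⊠ q≥0 ⊠ ε0 ⊠ sub DT ⊠ (T0 ⊞ D0)) ⊞ (0≤ι 6 ⊠ ε0 ⊠ q≥0 ⊠ T0 ⊠ sub DT) ⊞ (<⇒≤ (ℚP.positive⁻¹ (1ℚ + ½)) ⊠ sub T²εq) ⊞ (0≤ι 2 ⊠ sub DT) ⊞ (0≤ι 2 ⊠ T0 ⊠ 1-ε) ⊞ 0≤ι 8 ⊠ T0) (l D T ε q)))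
        (≤-trans (add≤ (add≤ (cl≥ h) (neg≤ (deg≤ x))) (neg≤ (deg≤ y))) (S-kill≥ h))
      where
      half : (ι 21 * (T * T * ε * q)) * ½ ≤ haz
      half = ≤-trans (mulʳ (<⇒≤ (ℚP.positive⁻¹ ½)) haz≥) (≤-reflexive (r haz))
        where r : ∀ a → ι 2 * a * ½ ≡ a
              r = solve 1 (λ a → (Κ (ι 2) ⊗ a ⊗ Κ ½) ⊜ (a)) refl
      l : ∀ D T ε q → ι 3 * q * (D * D - ι 2 * D * (ε * T)) + - (D + ε * T) + - (D + ε * T) ≡ ι 3 * (D * D) * q * (1ℚ + ε) + - ((ι 21 * (T * T * ε * q)) * ½)
           + (ι 3 * q * ε * (T - D) * (T + D) + ι 6 * ε * q * T * (T - D) + (1ℚ + ½) * (T * T * ε * q - ι 8 * T) + ι 2 * (T - D) + ι 2 * T * (1ℚ - ε) + ι 8 * T)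
      l = solve 4 (λ D T ε q → (Κ (ι 3) ⊗ q ⊗ (D ⊗ D ⊖ Κ (ι 2) ⊗ D ⊗ (ε ⊗ T)) ⊕ ⊝ (D ⊕ ε ⊗ T) ⊕ ⊝ (D ⊕ ε ⊗ T))
          ⊜ (Κ (ι 3) ⊗ (D ⊗ D) ⊗ q ⊗ (Κ 1ℚ ⊕ ε) ⊕ ⊝ ((Κ (ι 21) ⊗ (T ⊗ T ⊗ ε ⊗ q)) ⊗ Κ ½) ⊕ (Κ (ι 3) ⊗ q ⊗ ε ⊗ (T ⊖ D) ⊗ (T ⊕ D) ⊕ Κ (ι 6) ⊗ ε ⊗ q ⊗ T ⊗ (T ⊖ D) ⊕ (Κ 1ℚ ⊕ Κ ½) ⊗ (T ⊗ T ⊗ ε ⊗ q ⊖ Κ (ι 8) ⊗ T) ⊕ Κ (ι 2) ⊗ (T ⊖ D) ⊕ Κ (ι 2) ⊗ T ⊗ (Κ 1ℚ ⊖ ε) ⊕ Κ (ι 8) ⊗ T))) refl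

    SK-ω≤ : ∀ x y → SK x y ≤ (κ * Wv + haz) * ω x y
    SK-ω≤ x y with bool-dec (op A x y)
    ... | inj₁ p = ≤-trans (SK≤ p) (≤-reflexive (sym (trans (cong ((κ * Wv + haz) *_) (⟦⟧-true p)) (ℚP.*-identityʳ (κ * Wv + haz)))))
    ... | inj₂ p = ≤-trans (≤-trans (S-mono (valid A) (λ s t v → ≤-trans (kill≤ω s t x y) (≤-reflexive (⟦⟧-false p)))) (≤-reflexive (trans (S-const (valid A) 0ℚ) (ℚP.*-zeroˡ Wv))))
         (((κ0 ⊠ W≥0) ⊞ haz≥0) ⊠ ω≥0 x y)

    SK-ω≥ : ∀ x y → (κ * Wv - haz) * ω x y ≤ SK x y
    SK-ω≥ x y with bool-dec (op A x y)
    ... | inj₁ p = ≤-trans (≤-reflexive (trans (cong ((κ * Wv - haz) *_) (⟦⟧-true p)) (ℚP.*-identityʳ (κ * Wv - haz)))) (SK≥ p)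
    ... | inj₂ p = ≤-trans (≤-reflexive (trans (cong ((κ * Wv - haz) *_) (⟦⟧-false p)) (ℚP.*-zeroʳ (κ * Wv - haz)))) (S-nonneg (valid A) (λ s t _ → kill≥0 s t x y))

    -- The two-sided rate holds for every open pair separately, hence for any nonnegative weighting
    -- of them; `opdeg`, `Cm` and `Nm` lose vertices in this form.
    SK-sum≤ : ∀ (c : Fin n → ℚ) (u v : Fin n → Fin n) → (∀ b → 0ℚ ≤ c b) →
      SA (λ s t → ∑ λ b → c b * kill s t (u b) (v b)) ≤ (κ * Wv + haz) * ∑ (λ b → c b * ω (u b) (v b))
    SK-sum≤ c u v c0 = ≤-trans (≤-reflexive (trans (S-∑ (valid A) (λ b s t → c b * kill s t (u b) (v b))) (∑-cong λ b → S-* (valid A) (c b) (λ s t → kill s t (u b) (v b)))))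
       (≤-trans (∑-mono λ b → mulˡ (c0 b) (SK-ω≤ (u b) (v b))) (≤-reflexive (trans (∑-cong λ b → l (c b) (κ * Wv + haz) (ω (u b) (v b))) (∑-*ˡ (κ * Wv + haz) (λ b → c b * ω (u b) (v b))))))
      where l : ∀ a b c → a * (b * c) ≡ b * (a * c)
            l = solve 3 (λ a b c → (a ⊗ (b ⊗ c)) ⊜ (b ⊗ (a ⊗ c))) refl

    SK-sum≥ : ∀ (c : Fin n → ℚ) (u v : Fin n → Fin n) → (∀ b → 0ℚ ≤ c b) →
      (κ * Wv - haz) * ∑ (λ b → c b * ω (u b) (v b)) ≤ SA (λ s t → ∑ λ b → c b * kill s t (u b) (v b))
    SK-sum≥ c u v c0 = ≤-trans (≤-reflexive (sym (trans (∑-cong λ b → l (c b) (κ * Wv - haz) (ω (u b) (v b))) (∑-*ˡ (κ * Wv - haz) (λ b → c b * ω (u b) (v b))))))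
       (≤-trans (∑-mono λ b → mulˡ (c0 b) (SK-ω≥ (u b) (v b))) (≤-reflexive (sym (trans (S-∑ (valid A) (λ b s t → c b * kill s t (u b) (v b))) (∑-cong λ b → S-* (valid A) (c b) (λ s t → kill s t (u b) (v b)))))))
      where l : ∀ a b c → a * (b * c) ≡ b * (a * c)
            l = solve 3 (λ a b c → (a ⊗ (b ⊗ c)) ⊜ (b ⊗ (a ⊗ c))) refl

  -- Average change of each count against its target

  module Steps {n} (A : Fin n → Fin n → Bool) (C : C4Free A) {T D q ε κ ρ B : ℚ} (K : ℕ)
    (cond : Cond (ι n) T D q ε κ ρ B (ι K)) (good : Good A T D q ε B)
    (g : ℚ) (g0 : 0ℚ ≤ g) (gγ : (1ℚ + ι 256 * ρ) * g ≡ 1ℚ) (μ : ℚ) (μ0 : 0ℚ ≤ μ) (μN : μ * ι n ≡ ι 2) where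
    open Hazard A C cond good

    w = valid A
    q′ = q * (1ℚ - κ)

    κ≤1 : κ ≤ 1ℚ
    κ≤1 = cert ((<⇒≤ (ℚP.positive⁻¹ ⅛) ⊠ sub κε) ⊞ (<⇒≤ (ℚP.positive⁻¹ ⅛) ⊠ sub ε≤1) ⊞ <⇒≤ (ℚP.positive⁻¹ (1ℚ - ⅛))) (l κ ε)
      where l : ∀ k e → 1ℚ ≡ k + (⅛ * (e - ι 8 * k) + ⅛ * (1ℚ - e) + (1ℚ - ⅛))
            l = solve 2 (λ k e → (Κ 1ℚ) ⊜ (k ⊕ (Κ ⅛ ⊗ (e ⊖ Κ (ι 8) ⊗ k) ⊕ Κ ⅛ ⊗ (Κ 1ℚ ⊖ e) ⊕ (Κ 1ℚ ⊖ Κ ⅛)))) refl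

    1-κ : 0ℚ ≤ 1ℚ - κ
    1-κ = sub κ≤1

    -- The right side is about 12T³q, and N ≤ T³. This is where T must be at least of order n^{1/3}:
    -- an error εNq in the number of open pairs at a vertex is then paid by the growth of the degree
    -- tolerance Tε.
    NqW : ι 10 * (N * q) ≤ ρ * T * Wv
    NqW = cert ((c0 ⊠ ρ0 ⊠ T0 ⊠ sub 16W) ⊞ (c0 ⊠ 0≤ι 7 ⊠ N0 ⊠ q≥0 ⊠ sub 1/N≤ρT) ⊞ (<⇒≤ (ℚP.positive⁻¹ ½) ⊠ N0 ⊠ q≥0)) (l N q ρ T Wv)
      where
      c0 : 0ℚ ≤ ½ * ⅛
      c0 = <⇒≤ (ℚP.positive⁻¹ (½ * ⅛))
      l : ∀ N q ρ T W → ρ * T * W ≡ ι 10 * (N * q) + (½ * ⅛ * ρ * T * (ι 16 * W - ι 7 * (N * N * q)) + ½ * ⅛ * ι 7 * N * q * (ρ * T * N - ι 24) + ½ * N * q)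
      l = solve 5 (λ N q ρ T W → (ρ ⊗ T ⊗ W)
          ⊜ (Κ (ι 10) ⊗ (N ⊗ q) ⊕ (Κ ½ ⊗ Κ ⅛ ⊗ ρ ⊗ T ⊗ (Κ (ι 16) ⊗ W ⊖ Κ (ι 7) ⊗ (N ⊗ N ⊗ q)) ⊕ Κ ½ ⊗ Κ ⅛ ⊗ Κ (ι 7) ⊗ N ⊗ q ⊗ (ρ ⊗ T ⊗ N ⊖ Κ (ι 24)) ⊕ Κ ½ ⊗ N ⊗ q))) refl

    T²qW : ι 10 * (T * T * q) ≤ ρ * Wv
    T²qW = cert ((c0 ⊠ ρ0 ⊠ sub 16W) ⊞ (c0 ⊠ 0≤ι 7 ⊠ q≥0 ⊠ sub (≤-reflexive (sym ρeq))) ⊞ (<⇒≤ (ℚP.positive⁻¹ ½) ⊠ T0 ⊠ T0 ⊠ q≥0)) (l N q ρ T Wv)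
      where
      c0 : 0ℚ ≤ ½ * ⅛
      c0 = <⇒≤ (ℚP.positive⁻¹ (½ * ⅛))
      l : ∀ N q ρ T W → ρ * W ≡ ι 10 * (T * T * q) + (½ * ⅛ * ρ * (ι 16 * W - ι 7 * (N * N * q)) + ½ * ⅛ * ι 7 * q * (ρ * (N * N) - ι 24 * (T * T)) + ½ * T * T * q)
      l = solve 5 (λ N q ρ T W → (ρ ⊗ W)
          ⊜ (Κ (ι 10) ⊗ (T ⊗ T ⊗ q) ⊕ (Κ ½ ⊗ Κ ⅛ ⊗ ρ ⊗ (Κ (ι 16) ⊗ W ⊖ Κ (ι 7) ⊗ (N ⊗ N ⊗ q)) ⊕ Κ ½ ⊗ Κ ⅛ ⊗ Κ (ι 7) ⊗ q ⊗ (ρ ⊗ (N ⊗ N) ⊖ Κ (ι 24) ⊗ (T ⊗ T)) ⊕ Κ ½ ⊗ T ⊗ T ⊗ q))) refl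

    κX≤ : ∀ X → X ≤ ι 2 * N → κ * X ≤ ι 12 * (T * T)
    κX≤ X h = ≤-trans (mulˡ κ0 h) (cert ((0≤ι 2 ⊠ κ0 ⊠ N0 ⊠ sub N1) ⊞ (0≤ι 2 ⊠ sub κNN≤)) (l κ N T))
      where l : ∀ κ N T → ι 12 * (T * T) ≡ κ * (ι 2 * N) + (ι 2 * κ * N * (N - 1ℚ) + ι 2 * (ι 6 * (T * T) - κ * (N * N)))
            l = solve 3 (λ κ N T → (Κ (ι 12) ⊗ (T ⊗ T))
                ⊜ (κ ⊗ (Κ (ι 2) ⊗ N) ⊕ (Κ (ι 2) ⊗ κ ⊗ N ⊗ (N ⊖ Κ 1ℚ) ⊕ Κ (ι 2) ⊗ (Κ (ι 6) ⊗ (T ⊗ T) ⊖ κ ⊗ (N ⊗ N))))) refl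

    opdeg2 : ∀ x → opdeg x ≤ N * q * ι 2
    opdeg2 x = ≤-trans (opdeg≤ x) (mulˡ (N0 ⊠ q≥0) 1+ε≤2)

    Nq≤N : N * q ≤ N
    Nq≤N = ≤-trans (mulˡ N0 q1) (≤-reflexive (ℚP.*-identityʳ N))

    opdeg≥0 : ∀ x → 0ℚ ≤ opdeg x
    opdeg≥0 x = ∑-nonneg (ω≥0 x)

    18T² : ι 2 * ((1ℚ + (D + ε * T)) * (1ℚ + (D + ε * T))) ≤ ι 18 * (T * T)
    18T² = ≤-trans (mulˡ (0≤ι 2) (mul≤ (0≤1 ⊞ Δ0) h (0≤1 ⊞ Δ0) h)) (≤-reflexive (l T))
      where
      h : 1ℚ + (D + ε * T) ≤ ι 3 * T
      h = ≤-trans (add≤ T1 Δ≤2T) (≤-reflexive (r T))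
        where r : ∀ T → T + ι 2 * T ≡ ι 3 * T
              r = solve 1 (λ T → (T ⊕ Κ (ι 2) ⊗ T) ⊜ (Κ (ι 3) ⊗ T)) refl
      l : ∀ T → ι 2 * ((ι 3 * T) * (ι 3 * T)) ≡ ι 18 * (T * T)
      l = solve 1 (λ T → (Κ (ι 2) ⊗ ((Κ (ι 3) ⊗ T) ⊗ (Κ (ι 3) ⊗ T))) ⊜ (Κ (ι 18) ⊗ (T ⊗ T))) refl

    haz≤ρW : haz ≤ ρ * Wv
    haz≤ρW = mulʳ W≥0 (≤-trans (mulˡ ρ0 ε≤1) (≤-reflexive (ℚP.*-identityʳ ρ)))

    module _ (θ : ℚ) (θ0 : 0ℚ ≤ θ) where

      -- The loss totals (κW ± haz)·opdeg x while the target shrinks by 1 - κ; with opdeg x ≤ 2Nq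
      -- the discrepancy is at most 2Nq·haz, inside the allowance 16ρ(Nqε)W.
      stepO : θ * (N * q * ε) ≤ ι 2 → ∀ x →
        SA (λ s t → pow (sq ((Quantities.opdeg (add A s t) x - N * q′) * (θ * g))) K)
          ≤ Wv * (pow (sq ((opdeg x - N * q) * ((1ℚ - κ) * θ))) K + pow ¼ K)
      stepO hθ x = V.result X (N * q) (1ℚ - κ) (N * q′) _ (l0 κ X N q) (λ s t v → ≤-reflexive (cong (λ a → pow (sq ((a - N * q′) * (θ * g))) K) (Step.opdeg′ A C s t (valid⇒op {A = A} v) x)))
        where
        X = opdeg x
        L : Fin n → Fin n → ℚ
        L s t = ∑ (kill s t x)
        L≥0 : ∀ s t → 0ℚ ≤ L s t
        L≥0 s t = ∑-nonneg (kill≥0 s t x)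
        l0 : ∀ κ X N q → κ * X ≡ X * (1ℚ - (1ℚ - κ)) - (N * (q * (1ℚ - κ)) - N * q * (1ℚ - κ))
        l0 = solve 4 (λ κ X N q → (κ ⊗ X) ⊜ (X ⊗ (Κ 1ℚ ⊖ (Κ 1ℚ ⊖ κ)) ⊖ (N ⊗ (q ⊗ (Κ 1ℚ ⊖ κ)) ⊖ N ⊗ q ⊗ (Κ 1ℚ ⊖ κ)))) refl
        κX0 : 0ℚ ≤ κ * X
        κX0 = κ0 ⊠ opdeg≥0 x
        neg0 : ∀ {a b} → 0ℚ ≤ a → 0ℚ ≤ b → - a ≤ b
        neg0 {a} {b} p r = cert (p ⊞ r) (m a b)
          where m : ∀ a b → b ≡ - a + (a + b)
                m = solve 2 (λ a b → (b) ⊜ (⊝ a ⊕ (a ⊕ b))) refl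
        ones : ∀ (f : Fin n → ℚ) → ∑ (λ b → 1ℚ * f b) ≡ ∑ f
        ones f = ∑-cong λ b → ℚP.*-identityˡ (f b)
        SL≤ : SA L ≤ (κ * Wv + haz) * X
        SL≤ = ≤-trans (≤-reflexive (S-cong w (λ s t → sym (ones (kill s t x))))) (≤-trans (SK-sum≤ (λ _ → 1ℚ) (λ _ → x) (λ b → b) (λ _ → 0≤1)) (≤-reflexive (cong ((κ * Wv + haz) *_) (ones (ω x)))))
        SL≥ : (κ * Wv - haz) * X ≤ SA L
        SL≥ = ≤-trans (≤-reflexive (cong ((κ * Wv - haz) *_) (sym (ones (ω x))))) (≤-trans (SK-sum≥ (λ _ → 1ℚ) (λ _ → x) (λ b → b) (λ _ → 0≤1)) (≤-reflexive (S-cong w (λ s t → ones (kill s t x)))))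
        X2 = opdeg2 x
        SdX : SA (λ s t → - L s t) ≡ - SA L
        SdX = S-neg w L
        hX : 0ℚ ≤ haz
        hX = haz≥0
        dr+ : SA (λ s t → - L s t) + κ * X * Wv ≤ ι 16 * ρ * (N * q * ε) * Wv
        dr+ = ≤-trans (≤-reflexive (cong (_+ κ * X * Wv) SdX)) (cert (sub SL≥ ⊞ (hX ⊠ sub X2) ⊞ (0≤ι 14 ⊠ hX ⊠ N0 ⊠ q≥0)) (l (SA L) κ X Wv ρ ε N q))
          where l : ∀ S κ X W ρ ε N q → ι 16 * ρ * (N * q * ε) * W ≡ - S + κ * X * W + ((S - (κ * W - ρ * ε * W) * X) + ρ * ε * W * (N * q * ι 2 - X) + ι 14 * (ρ * ε * W) * N * q)
                l = solve 8 (λ S κ X W ρ ε N q → (Κ (ι 16) ⊗ ρ ⊗ (N ⊗ q ⊗ ε) ⊗ W)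
                    ⊜ (⊝ S ⊕ κ ⊗ X ⊗ W ⊕ ((S ⊖ (κ ⊗ W ⊖ ρ ⊗ ε ⊗ W) ⊗ X) ⊕ ρ ⊗ ε ⊗ W ⊗ (N ⊗ q ⊗ Κ (ι 2) ⊖ X) ⊕ Κ (ι 14) ⊗ (ρ ⊗ ε ⊗ W) ⊗ N ⊗ q))) refl
        dr- : - (ι 16 * ρ * (N * q * ε) * Wv) ≤ SA (λ s t → - L s t) + κ * X * Wv
        dr- = ≤-trans (cert (sub SL≤ ⊞ (hX ⊠ sub X2) ⊞ (0≤ι 14 ⊠ hX ⊠ N0 ⊠ q≥0)) (l (SA L) κ X Wv ρ ε N q)) (≤-reflexive (cong (_+ κ * X * Wv) (sym SdX)))
          where l : ∀ S κ X W ρ ε N q → - S + κ * X * W ≡ - (ι 16 * ρ * (N * q * ε) * W) + (((κ * W + ρ * ε * W) * X - S) + ρ * ε * W * (N * q * ι 2 - X) + ι 14 * (ρ * ε * W) * N * q)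
                l = solve 8 (λ S κ X W ρ ε N q → (⊝ S ⊕ κ ⊗ X ⊗ W)
                    ⊜ (⊝ (Κ (ι 16) ⊗ ρ ⊗ (N ⊗ q ⊗ ε) ⊗ W) ⊕ (((κ ⊗ W ⊕ ρ ⊗ ε ⊗ W) ⊗ X ⊖ S) ⊕ ρ ⊗ ε ⊗ W ⊗ (N ⊗ q ⊗ Κ (ι 2) ⊖ X) ⊕ Κ (ι 14) ⊗ (ρ ⊗ ε ⊗ W) ⊗ N ⊗ q))) refl
        vr : SA L + κ * X * Wv ≤ ι 12 * ρ * (N * q) * Wv
        vr = cert (sub SL≤ ⊞ (½≥ ⊠ W≥0 ⊠ opdeg≥0 x ⊠ sub κρ) ⊞ (sub haz≤ρW ⊠ opdeg≥0 x) ⊞ (3/2 ⊠ ρ0 ⊠ W≥0 ⊠ sub X2) ⊞ (0≤ι 9 ⊠ ρ0 ⊠ W≥0 ⊠ N0 ⊠ q≥0))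
               (l (SA L) κ X Wv ρ ε N q)
          where
          ½≥ : 0ℚ ≤ ½
          ½≥ = <⇒≤ (ℚP.positive⁻¹ ½)
          3/2 : 0ℚ ≤ 1ℚ + ½
          3/2 = <⇒≤ (ℚP.positive⁻¹ (1ℚ + ½))
          l : ∀ S κ X W ρ ε N q → ι 12 * ρ * (N * q) * W ≡ S + κ * X * W + (((κ * W + ρ * ε * W) * X - S) + ½ * W * X * (ρ - ι 4 * κ) + (ρ * W - ρ * ε * W) * X
                 + (1ℚ + ½) * ρ * W * (N * q * ι 2 - X) + ι 9 * ρ * W * N * q)
          l = solve 8 (λ S κ X W ρ ε N q → (Κ (ι 12) ⊗ ρ ⊗ (N ⊗ q) ⊗ W)
              ⊜ (S ⊕ κ ⊗ X ⊗ W ⊕ (((κ ⊗ W ⊕ ρ ⊗ ε ⊗ W) ⊗ X ⊖ S) ⊕ Κ ½ ⊗ W ⊗ X ⊗ (ρ ⊖ Κ (ι 4) ⊗ κ) ⊕ (ρ ⊗ W ⊖ ρ ⊗ ε ⊗ W) ⊗ X ⊕ (Κ 1ℚ ⊕ Κ ½) ⊗ ρ ⊗ W ⊗ (N ⊗ q ⊗ Κ (ι 2) ⊖ X) ⊕ Κ (ι 9) ⊗ ρ ⊗ W ⊗ N ⊗ q))) refl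
        LJ : ∀ s t → w s t ≡ true → L s t + κ * X ≤ ι 60 * (T * T)
        LJ s t v = ≤-trans (add≤ (≤-trans (kill-row x (D + ε * T) (valid⇒op {A = A} v) deg≤ Δ0) 18T²)
              (κX≤ X (≤-trans X2 (≤-trans (mulʳ (0≤ι 2) Nq≤N) (≤-reflexive (ℚP.*-comm N (ι 2)))))))
            (cert (0≤ι 30 ⊠ (T0 ⊠ T0)) (l T))
          where l : ∀ T → ι 60 * (T * T) ≡ ι 18 * (T * T) + ι 12 * (T * T) + ι 30 * (T * T)
                l = solve 1 (λ T → (Κ (ι 60) ⊗ (T ⊗ T)) ⊜ (Κ (ι 18) ⊗ (T ⊗ T) ⊕ Κ (ι 12) ⊗ (T ⊗ T) ⊕ Κ (ι 30) ⊗ (T ⊗ T))) refl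
        sm : ι 12 * ι K * (ι 60 * (T * T)) ≤ ε * (N * q * ε)
        sm = ≤-trans cJ (mulˡ ε0 (mulʳ ε0 (mulˡ N0 (≤-trans (mulˡ q≥0 q1) (≤-reflexive (ℚP.*-identityʳ q))))))
        module V = Var w K ρ g θ (N * q) ε (κ * X) (κ * X) (ι 60 * (T * T)) (λ s t → - L s t) L
          k1 ρ0 g0 gγ θ0 (N0 ⊠ q≥0) ε0 ε8 hθ (λ s t _ → neg0 (L≥0 s t) (L≥0 s t)) (λ s t _ → ≤-refl) ≤-refl (neg0 κX0 κX0) LJ (0≤ι 60 ⊠ (T0 ⊠ T0)) dr+ dr- vr sm

      -- The next edge meets x in opdeg x of W cases, that is with frequency about Nq/(N²q/2) = 2/N,
      -- which is `μ`.
      stepd : θ * (T * ε) ≤ ι 2 → ∀ x →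
        SA (λ s t → pow (sq ((Quantities.deg (add A s t) x - (D + μ)) * (θ * g))) K)
          ≤ Wv * (pow (sq ((deg x - D) * (1ℚ * θ))) K + pow ¼ K)
      stepd hθ x = V.result X D 1ℚ (D + μ) _ (l0 X D μ) (λ s t v → ≤-reflexive (cong (λ a → pow (sq ((a - (D + μ)) * (θ * g))) K) (Step.deg′ A C s t (valid⇒op {A = A} v) x)))
        where
        X = deg x
        L : Fin n → Fin n → ℚ
        L s t = δ s x + δ t x
        L≥0 : ∀ s t → 0ℚ ≤ L s t
        L≥0 s t = ⟦⟧≥0 (s == x) ⊞ ⟦⟧≥0 (t == x)
        l0 : ∀ X D μ → - μ ≡ X * (1ℚ - 1ℚ) - ((D + μ) - D * 1ℚ)
        l0 = solve 3 (λ X D μ → (⊝ μ) ⊜ (X ⊗ (Κ 1ℚ ⊖ Κ 1ℚ) ⊖ ((D ⊕ μ) ⊖ D ⊗ Κ 1ℚ))) refl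
        neg0 : ∀ {a b} → 0ℚ ≤ a → 0ℚ ≤ b → - a ≤ b
        neg0 {a} {b} p r = cert (p ⊞ r) (m a b)
          where m : ∀ a b → b ≡ - a + (a + b)
                m = solve 2 (λ a b → (b) ⊜ (⊝ a ⊕ (a ⊕ b))) refl
        μW≤ : μ * Wv ≤ N * q * (1ℚ + ε)
        μW≤ = cert ((½≥ ⊠ μ0 ⊠ sub 2W≤) ⊞ (½≥ ⊠ N0 ⊠ q≥0 ⊠ (0≤1 ⊞ ε0) ⊠ sub (≤-reflexive μN))) (l μ Wv N q ε)
          where
          ½≥ : 0ℚ ≤ ½
          ½≥ = <⇒≤ (ℚP.positive⁻¹ ½)
          l : ∀ μ W N q ε → N * q * (1ℚ + ε) ≡ μ * W + (½ * μ * (N * (N * q * (1ℚ + ε)) - (W + W)) + ½ * N * q * (1ℚ + ε) * (ι 2 - μ * N))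
          l = solve 5 (λ μ W N q ε → (N ⊗ q ⊗ (Κ 1ℚ ⊕ ε))
              ⊜ (μ ⊗ W ⊕ (Κ ½ ⊗ μ ⊗ (N ⊗ (N ⊗ q ⊗ (Κ 1ℚ ⊕ ε)) ⊖ (W ⊕ W)) ⊕ Κ ½ ⊗ N ⊗ q ⊗ (Κ 1ℚ ⊕ ε) ⊗ (Κ (ι 2) ⊖ μ ⊗ N)))) refl
        μW≥ : N * q * (1ℚ - ε) ≤ μ * Wv
        μW≥ = cert ((½≥ ⊠ μ0 ⊠ sub 2W≥) ⊞ (½≥ ⊠ N0 ⊠ q≥0 ⊠ 1-ε ⊠ sub (≤-reflexive (sym μN)))) (l μ Wv N q ε)
          where
          ½≥ : 0ℚ ≤ ½
          ½≥ = <⇒≤ (ℚP.positive⁻¹ ½)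
          l : ∀ μ W N q ε → μ * W ≡ N * q * (1ℚ - ε) + (½ * μ * (W + W - N * (N * q * (1ℚ - ε))) + ½ * N * q * (1ℚ - ε) * (μ * N - ι 2))
          l = solve 5 (λ μ W N q ε → (μ ⊗ W)
              ⊜ (N ⊗ q ⊗ (Κ 1ℚ ⊖ ε) ⊕ (Κ ½ ⊗ μ ⊗ (W ⊕ W ⊖ N ⊗ (N ⊗ q ⊗ (Κ 1ℚ ⊖ ε))) ⊕ Κ ½ ⊗ N ⊗ q ⊗ (Κ 1ℚ ⊖ ε) ⊗ (μ ⊗ N ⊖ Κ (ι 2))))) refl
        SL : SA L ≡ opdeg x
        SL = S-deg x
        dr+ : SA L + (- μ) * Wv ≤ ι 16 * ρ * (T * ε) * Wv
        dr+ = ≤-trans (≤-reflexive (cong (_+ (- μ) * Wv) SL)) (cert (sub (opdeg≤ x) ⊞ sub μW≥ ⊞ (ε0 ⊠ sub NqW) ⊞ (0≤ι 15 ⊠ haz≥0 ⊠ T0) ⊞ (0≤ι 8 ⊠ N0 ⊠ q≥0 ⊠ ε0)) (l (opdeg x) μ Wv ρ ε N q T))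
          where l : ∀ O μ W ρ ε N q T → ι 16 * ρ * (T * ε) * W ≡ O + (- μ) * W + ((N * q * (1ℚ + ε) - O) + (μ * W - N * q * (1ℚ - ε)) + ε * (ρ * T * W - ι 10 * (N * q))
                       + ι 15 * (ρ * ε * W) * T + ι 8 * N * q * ε)
                l = solve 8 (λ O μ W ρ ε N q T → (Κ (ι 16) ⊗ ρ ⊗ (T ⊗ ε) ⊗ W)
                    ⊜ (O ⊕ (⊝ μ) ⊗ W ⊕ ((N ⊗ q ⊗ (Κ 1ℚ ⊕ ε) ⊖ O) ⊕ (μ ⊗ W ⊖ N ⊗ q ⊗ (Κ 1ℚ ⊖ ε)) ⊕ ε ⊗ (ρ ⊗ T ⊗ W ⊖ Κ (ι 10) ⊗ (N ⊗ q)) ⊕ Κ (ι 15) ⊗ (ρ ⊗ ε ⊗ W) ⊗ T ⊕ Κ (ι 8) ⊗ N ⊗ q ⊗ ε))) refl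
        dr- : - (ι 16 * ρ * (T * ε) * Wv) ≤ SA L + (- μ) * Wv
        dr- = ≤-trans (cert (sub (opdeg≥ x) ⊞ sub μW≤ ⊞ (ε0 ⊠ sub NqW) ⊞ (0≤ι 15 ⊠ haz≥0 ⊠ T0) ⊞ (0≤ι 8 ⊠ N0 ⊠ q≥0 ⊠ ε0)) (l (opdeg x) μ Wv ρ ε N q T)) (≤-reflexive (cong (_+ (- μ) * Wv) (sym SL)))
          where l : ∀ O μ W ρ ε N q T → O + (- μ) * W ≡ - (ι 16 * ρ * (T * ε) * W) + ((O - N * q * (1ℚ - ε)) + (N * q * (1ℚ + ε) - μ * W) + ε * (ρ * T * W - ι 10 * (N * q))
                       + ι 15 * (ρ * ε * W) * T + ι 8 * N * q * ε)
                l = solve 8 (λ O μ W ρ ε N q T → (O ⊕ (⊝ μ) ⊗ W)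
                    ⊜ (⊝ (Κ (ι 16) ⊗ ρ ⊗ (T ⊗ ε) ⊗ W) ⊕ ((O ⊖ N ⊗ q ⊗ (Κ 1ℚ ⊖ ε)) ⊕ (N ⊗ q ⊗ (Κ 1ℚ ⊕ ε) ⊖ μ ⊗ W) ⊕ ε ⊗ (ρ ⊗ T ⊗ W ⊖ Κ (ι 10) ⊗ (N ⊗ q)) ⊕ Κ (ι 15) ⊗ (ρ ⊗ ε ⊗ W) ⊗ T ⊕ Κ (ι 8) ⊗ N ⊗ q ⊗ ε))) refl
        vr : SA L + μ * Wv ≤ ι 12 * ρ * T * Wv
        vr = ≤-trans (≤-reflexive (cong (_+ μ * Wv) SL)) (cert (sub (opdeg≤ x) ⊞ sub μW≤ ⊞ (0≤ι 2 ⊠ N0 ⊠ q≥0 ⊠ sub ε≤1) ⊞ (0≤ι 1 ⊠ sub NqW) ⊞ (0≤ι 11 ⊠ ρ0 ⊠ T0 ⊠ W≥0) ⊞ (0≤ι 6 ⊠ N0 ⊠ q≥0)) (l (opdeg x) μ Wv ρ ε N q T))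
          where l : ∀ O μ W ρ ε N q T → ι 12 * ρ * T * W ≡ O + μ * W + ((N * q * (1ℚ + ε) - O) + (N * q * (1ℚ + ε) - μ * W) + ι 2 * N * q * (1ℚ - ε) + ι 1 * (ρ * T * W - ι 10 * (N * q)) + ι 11 * ρ * T * W + ι 6 * N * q)
                l = solve 8 (λ O μ W ρ ε N q T → (Κ (ι 12) ⊗ ρ ⊗ T ⊗ W)
                    ⊜ (O ⊕ μ ⊗ W ⊕ ((N ⊗ q ⊗ (Κ 1ℚ ⊕ ε) ⊖ O) ⊕ (N ⊗ q ⊗ (Κ 1ℚ ⊕ ε) ⊖ μ ⊗ W) ⊕ Κ (ι 2) ⊗ N ⊗ q ⊗ (Κ 1ℚ ⊖ ε) ⊕ Κ (ι 1) ⊗ (ρ ⊗ T ⊗ W ⊖ Κ (ι 10) ⊗ (N ⊗ q)) ⊕ Κ (ι 11) ⊗ ρ ⊗ T ⊗ W ⊕ Κ (ι 6) ⊗ N ⊗ q))) refl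
        μ2 : μ ≤ ι 2
        μ2 = ≤-trans (≤-trans (≤-reflexive (sym (ℚP.*-identityʳ μ))) (mulˡ μ0 N1)) (≤-reflexive μN)
        LJ : ∀ s t → w s t ≡ true → L s t + μ ≤ ι 30 * B
        LJ s t v = ≤-trans (add≤ (add≤ (⟦⟧≤1 (s == x)) (⟦⟧≤1 (t == x))) μ2) (cert ((0≤ι 30 ⊠ sub B1) ⊞ 0≤ι 26) (l B))
          where l : ∀ B → ι 30 * B ≡ 1ℚ + 1ℚ + ι 2 + (ι 30 * (B - 1ℚ) + ι 26)
                l = solve 1 (λ B → (Κ (ι 30) ⊗ B) ⊜ (Κ 1ℚ ⊕ Κ 1ℚ ⊕ Κ (ι 2) ⊕ (Κ (ι 30) ⊗ (B ⊖ Κ 1ℚ) ⊕ Κ (ι 26)))) refl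
        sm : ι 12 * ι K * (ι 30 * B) ≤ ε * (T * ε)
        sm = ≤-trans cN (mulˡ ε0 (mulʳ ε0 (≤-trans (mulˡ T0 q1) (≤-reflexive (ℚP.*-identityʳ T)))))
        module V = Var w K ρ g θ T ε (- μ) μ (ι 30 * B) L L
          k1 ρ0 g0 gγ θ0 T0 ε0 ε8 hθ (λ s t _ → ≤-refl) (λ s t _ → neg0 (L≥0 s t) (L≥0 s t)) (neg0 μ0 μ0) ≤-refl LJ (0≤ι 30 ⊠ ≤-trans 0≤1 B1) dr+ dr- vr sm

      -- `Pm` has no trajectory, only an upper bound. It is treated as a deviation from 0 with Z =
      -- 8B₀ and ε = ⅛, hence tolerance `B₀`. Its average increase is at most 2ρ, and the lower
      -- drift bound is free because walks are never lost.
      stepP : ∀ B₀ → 0ℚ ≤ B₀ → θ * B₀ ≤ 1ℚ → ι 12 * ι K * ι 6 ≤ ⅛ * B₀ → ∀ x y →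
        SA (λ s t → pow (sq ((Quantities.Pm (add A s t) x y - 0ℚ) * (θ * g))) K)
          ≤ Wv * (pow (sq ((Pm x y - 0ℚ) * (1ℚ * θ))) K + pow ¼ K)
      stepP B₀ B0 hθ hB x y = V.result X 0ℚ 1ℚ 0ℚ _ (l0 X) (λ s t v → ≤-reflexive (cong (λ a → pow (sq ((a - 0ℚ) * (θ * g))) K) (m (Quantities.Pm (add A s t) x y) X)))
        where
        X = Pm x y
        m : ∀ a b → a ≡ b + (a - b)
        m = solve 2 (λ a b → (a) ⊜ (b ⊕ (a ⊖ b))) refl
        L : Fin n → Fin n → ℚ
        L s t = Quantities.Pm (add A s t) x y - X
        l0 : ∀ X → 0ℚ ≡ X * (1ℚ - 1ℚ) - (0ℚ - 0ℚ * 1ℚ)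
        l0 = solve 1 (λ X → (Κ 0ℚ) ⊜ (X ⊗ (Κ 1ℚ ⊖ Κ 1ℚ) ⊖ (Κ 0ℚ ⊖ Κ 0ℚ ⊗ Κ 1ℚ))) refl
        L≥0 : ∀ s t → w s t ≡ true → 0ℚ ≤ L s t
        L≥0 s t v = sub (Step.walk-mono A C s t (valid⇒op {A = A} v) x y)
        L≤ : ∀ s t → w s t ≡ true → L s t ≤ φ x y s t + φ x y t s
        L≤ s t v = ≤-trans (add≤ (Step.walk-new A C s t (valid⇒op {A = A} v) x y) (≤-refl { - X})) (≤-reflexive (m′ X (φ x y s t + φ x y t s)))
          where m′ : ∀ a b → a + b + - a ≡ b
                m′ = solve 2 (λ a b → (a ⊕ b ⊕ ⊝ a) ⊜ (b)) refl
        neg0 : ∀ {a b} → 0ℚ ≤ a → 0ℚ ≤ b → - a ≤ b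
        neg0 {a} {b} p r = cert (p ⊞ r) (m₂ a b)
          where m₂ : ∀ a b → b ≡ - a + (a + b)
                m₂ = solve 2 (λ a b → (b) ⊜ (⊝ a ⊕ (a ⊕ b))) refl
        1≤B₀ : 1ℚ ≤ B₀
        1≤B₀ = cert ((0≤ι 8 ⊠ sub hB) ⊞ (0≤ι 576 ⊠ sub k1) ⊞ 0≤ι 575) (l B₀ (ι K))
          where l : ∀ B k → B ≡ 1ℚ + (ι 8 * (⅛ * B - ι 12 * k * ι 6) + ι 576 * (k - 1ℚ) + ι 575)
                l = solve 2 (λ B k → (B) ⊜ (Κ 1ℚ ⊕ (Κ (ι 8) ⊗ (Κ ⅛ ⊗ B ⊖ Κ (ι 12) ⊗ k ⊗ Κ (ι 6)) ⊕ Κ (ι 576) ⊗ (k ⊖ Κ 1ℚ) ⊕ Κ (ι 575)))) refl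
        SL : SA L ≤ ι 2 * (ρ * Wv)
        SL = ≤-trans (S-mono w L≤) (≤-trans (S-φ x y) (≤-trans (ℚP.+-monoʳ-≤ 1ℚ (≤-trans (cl≤ (q * (D + ε * T)) (q≥0 ⊠ Δ0) Nm≤ x y)
             (mulˡ (0≤ι 3) (mul≤ Δ0 Δ≤2T (q≥0 ⊠ Δ0) (mulˡ q≥0 Δ≤2T)))))
           (cert (sub h8 ⊞ (0≤ι 2 ⊠ sub T²qW) ⊞ (0≤ι 7 ⊠ T0 ⊠ T0 ⊠ q≥0)) (l T q (ρ * Wv)))))
          where
          l : ∀ T q r → ι 2 * r ≡ 1ℚ + ι 3 * (ι 2 * T * (q * (ι 2 * T))) + ((T * T * q - 1ℚ) + ι 2 * (r - ι 10 * (T * T * q)) + ι 7 * T * T * q)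
          l = solve 3 (λ T q r → (Κ (ι 2) ⊗ r)
              ⊜ (Κ 1ℚ ⊕ Κ (ι 3) ⊗ (Κ (ι 2) ⊗ T ⊗ (q ⊗ (Κ (ι 2) ⊗ T))) ⊕ ((T ⊗ T ⊗ q ⊖ Κ 1ℚ) ⊕ Κ (ι 2) ⊗ (r ⊖ Κ (ι 10) ⊗ (T ⊗ T ⊗ q)) ⊕ Κ (ι 7) ⊗ T ⊗ T ⊗ q))) refl
          h8 : 1ℚ ≤ T * T * q
          h8 = ≤-trans T1 (≤-trans (cert (sub T²εq ⊞ (0≤ι 7 ⊠ T0)) (l7 T (T * T * ε * q))) (mulʳ q≥0 (≤-trans (mulˡ (T0 ⊠ T0) ε≤1) (≤-reflexive (ℚP.*-identityʳ (T * T))))))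
            where l7 : ∀ T z → z ≡ T + ((z - ι 8 * T) + ι 7 * T)
                  l7 = solve 2 (λ T z → (z) ⊜ (T ⊕ ((z ⊖ Κ (ι 8) ⊗ T) ⊕ Κ (ι 7) ⊗ T))) refl
        rW : 0ℚ ≤ ρ * Wv
        rW = ρ0 ⊠ W≥0
        Zr = ι 8 * B₀
        ⅛≥0 : 0ℚ ≤ ⅛
        ⅛≥0 = <⇒≤ (ℚP.positive⁻¹ ⅛)
        up : SA L + 0ℚ * Wv ≤ ι 16 * ρ * (Zr * ⅛) * Wv
        up = ≤-trans (≤-reflexive (lz (SA L) Wv)) (≤-trans SL (cert ((0≤ι 2 ⊠ rW ⊠ sub 1≤B₀) ⊞ (0≤ι 14 ⊠ rW ⊠ B0)) (l ρ Wv B₀)))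
          where
          lz : ∀ a b → a + 0ℚ * b ≡ a
          lz = solve 2 (λ a b → (a ⊕ Κ 0ℚ ⊗ b) ⊜ (a)) refl
          l : ∀ ρ W B → ι 16 * ρ * (ι 8 * B * ⅛) * W ≡ ι 2 * (ρ * W) + (ι 2 * (ρ * W) * (B - 1ℚ) + ι 14 * (ρ * W) * B)
          l = solve 3 (λ ρ W B → (Κ (ι 16) ⊗ ρ ⊗ (Κ (ι 8) ⊗ B ⊗ Κ ⅛) ⊗ W)
              ⊜ (Κ (ι 2) ⊗ (ρ ⊗ W) ⊕ (Κ (ι 2) ⊗ (ρ ⊗ W) ⊗ (B ⊖ Κ 1ℚ) ⊕ Κ (ι 14) ⊗ (ρ ⊗ W) ⊗ B))) refl
        lo : - (ι 16 * ρ * (Zr * ⅛) * Wv) ≤ SA L + 0ℚ * Wv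
        lo = neg0 (0≤ι 16 ⊠ ρ0 ⊠ (0≤ι 8 ⊠ B0 ⊠ ⅛≥0) ⊠ W≥0) (≤-trans (S-nonneg w L≥0) (≤-reflexive (sym (lz (SA L) Wv))))
          where lz : ∀ a b → a + 0ℚ * b ≡ a
                lz = solve 2 (λ a b → (a ⊕ Κ 0ℚ ⊗ b) ⊜ (a)) refl
        vr : SA L + 0ℚ * Wv ≤ ι 12 * ρ * Zr * Wv
        vr = ≤-trans up (cert (0≤ι 80 ⊠ rW ⊠ B0) (l ρ Wv B₀))
          where l : ∀ ρ W B → ι 12 * ρ * (ι 8 * B) * W ≡ ι 16 * ρ * (ι 8 * B * ⅛) * W + ι 80 * (ρ * W) * B
                l = solve 3 (λ ρ W B → (Κ (ι 12) ⊗ ρ ⊗ (Κ (ι 8) ⊗ B) ⊗ W) ⊜ (Κ (ι 16) ⊗ ρ ⊗ (Κ (ι 8) ⊗ B ⊗ Κ ⅛) ⊗ W ⊕ Κ (ι 80) ⊗ (ρ ⊗ W) ⊗ B)) refl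
        e8 : ι 8 * B₀ * ⅛ ≡ B₀
        e8 = l B₀
          where l : ∀ B → ι 8 * B * ⅛ ≡ B
                l = solve 1 (λ B → (Κ (ι 8) ⊗ B ⊗ Κ ⅛) ⊜ (B)) refl
        LJ : ∀ s t → w s t ≡ true → L s t + 0ℚ ≤ ι 6
        LJ s t v = ≤-trans (≤-reflexive (ℚP.+-identityʳ (L s t))) (≤-trans (L≤ s t v) (add≤ (Step.φ≤3 A C s t (valid⇒op {A = A} v) x y s t) (Step.φ≤3 A C s t (valid⇒op {A = A} v) x y t s)))
        module V = Var w K ρ g θ Zr ⅛ 0ℚ 0ℚ (ι 6) L L
          k1 ρ0 g0 gγ θ0 (0≤ι 8 ⊠ B0) ⅛≥0 ≤-refl (≤-trans (≤-reflexive (cong (θ *_) e8)) (≤-trans hθ (ι-mono {1} {2} (ℕ.s≤s ℕ.z≤n))))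
          (λ s t _ → ≤-refl) (λ s t v → neg0 (L≥0 s t v) (L≥0 s t v)) ≤-refl ≤-refl LJ (0≤ι 6) up lo vr (≤-trans hB (≤-reflexive (cong (⅛ *_) (sym e8))))

  module Steps₂ {n} (A : Fin n → Fin n → Bool) (C : C4Free A) {T D q ε κ ρ B : ℚ} (K : ℕ)
    (cond : Cond (ι n) T D q ε κ ρ B (ι K)) (good : Good A T D q ε B)
    (g : ℚ) (g0 : 0ℚ ≤ g) (gγ : (1ℚ + ι 256 * ρ) * g ≡ 1ℚ) (μ : ℚ) (μ0 : 0ℚ ≤ μ) (μN : μ * ι n ≡ ι 2)
    (θ : ℚ) (θ0 : 0ℚ ≤ θ) where
    open Hazard A C cond good
    open Steps A C K cond good g g0 gγ μ μ0 μN

    private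
      neg0 : ∀ {a b} → 0ℚ ≤ a → 0ℚ ≤ b → - a ≤ b
      neg0 {a} {b} p r = cert (p ⊞ r) (m a b)
        where m : ∀ a b → b ≡ - a + (a + b)
              m = solve 2 (λ a b → (b) ⊜ (⊝ a ⊕ (a ⊕ b))) refl
      ½≥0 : 0ℚ ≤ ½
      ½≥0 = <⇒≤ (ℚP.positive⁻¹ ½)
      ⅛≥0 : 0ℚ ≤ ⅛
      ⅛≥0 = <⇒≤ (ℚP.positive⁻¹ ⅛)

    -- With Δ ≤ 2T all terms together are at most 46NTB. The condition `cB`, 5B ≤ Tεq³, turns this
    -- into at most 9.25 NT²εq³, below the 10.5 of `haz≥`.
    DB≤ : DB ≤ N * (q * q) * haz
    DB≤ = ≤-trans mono (≤-trans (cert ((0≤ι 44 ⊠ N0 ⊠ T0 ⊠ sub B1) ⊞ (0≤ι 4 ⊠ N0 ⊠ sub T1) ⊞ (0≤ι 8 ⊠ T0 ⊠ sub TN) ⊞ (0≤ι 18 ⊠ N0 ⊠ sub T1)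
          ⊞ (0≤ι 18 ⊠ sub TN) ⊞ (0≤ι 2 ⊠ sub T1 ⊠ (0≤1 ⊞ T0)) ⊞ (0≤ι 8 ⊠ T0 ⊠ sub T1)) (l1 N T B))
        (≤-trans (cert ((⅛≥0 ⊠ 0≤ι 74 ⊠ N0 ⊠ T0 ⊠ sub cB) ⊞ (⅛≥0 ⊠ 0≤ι 2 ⊠ N0 ⊠ T0 ⊠ (≤-trans 0≤1 B1))) (l2 N T B (ε * (q * q * q))))
          (≤-trans (cert (⅛≥0 ⊠ 0≤ι 10 ⊠ N0 ⊠ T0 ⊠ T0 ⊠ (ε0 ⊠ (q≥0 ⊠ q≥0 ⊠ q≥0))) (l3 N T ε q)) (≤-trans (mulˡ (½≥0 ⊠ (N0 ⊠ (q≥0 ⊠ q≥0))) haz≥) (≤-reflexive (l4 (N * (q * q)) haz))))))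
      where
      l4 : ∀ a h → ½ * a * (ι 2 * h) ≡ a * h
      l4 = solve 2 (λ a h → (Κ ½ ⊗ a ⊗ (Κ (ι 2) ⊗ h)) ⊜ (a ⊗ h)) refl
      l3 : ∀ N T ε q → ½ * (N * (q * q)) * (ι 21 * (T * T * ε * q)) ≡ ⅛ * ι 74 * (N * T * (T * (ε * (q * q * q)))) + ⅛ * ι 10 * N * T * T * (ε * (q * q * q))
      l3 = solve 4 (λ N T ε q → (Κ ½ ⊗ (N ⊗ (q ⊗ q)) ⊗ (Κ (ι 21) ⊗ (T ⊗ T ⊗ ε ⊗ q)))
          ⊜ (Κ ⅛ ⊗ Κ (ι 74) ⊗ (N ⊗ T ⊗ (T ⊗ (ε ⊗ (q ⊗ q ⊗ q)))) ⊕ Κ ⅛ ⊗ Κ (ι 10) ⊗ N ⊗ T ⊗ T ⊗ (ε ⊗ (q ⊗ q ⊗ q)))) refl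
      l2 : ∀ N T B e → ⅛ * ι 74 * (N * T * (T * e)) ≡ ι 46 * (N * T * B) + (⅛ * ι 74 * N * T * (T * e - ι 5 * B) + ⅛ * ι 2 * N * T * B)
      l2 = solve 4 (λ N T B e → (Κ ⅛ ⊗ Κ (ι 74) ⊗ (N ⊗ T ⊗ (T ⊗ e)))
          ⊜ (Κ (ι 46) ⊗ (N ⊗ T ⊗ B) ⊕ (Κ ⅛ ⊗ Κ (ι 74) ⊗ N ⊗ T ⊗ (T ⊗ e ⊖ Κ (ι 5) ⊗ B) ⊕ Κ ⅛ ⊗ Κ (ι 2) ⊗ N ⊗ T ⊗ B))) refl
      D2 : ℚ
      D2 = ι 2 * T
      l1 : ∀ N T B → ι 46 * (N * T * B) ≡ (N * (ι 2 * T * B + ι 2 * (ι 2 * T)) + N * (ι 2 * T) + ι 2 * T * (ι 2 * T * (ι 2 * T)) + ι 2 * N * (ι 2 * (ι 2 * T) + ι 2) + ι 2 * ((1ℚ + ι 2 * T) * (1ℚ + ι 2 * T)))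
           + (ι 44 * N * T * (B - 1ℚ) + ι 4 * N * (T - 1ℚ) + ι 8 * T * (N - T * T) + ι 18 * N * (T - 1ℚ) + ι 18 * (N - T * T) + ι 2 * (T - 1ℚ) * (1ℚ + T) + ι 8 * T * (T - 1ℚ))
      l1 = solve 3 (λ N T B → (Κ (ι 46) ⊗ (N ⊗ T ⊗ B))
          ⊜ ((N ⊗ (Κ (ι 2) ⊗ T ⊗ B ⊕ Κ (ι 2) ⊗ (Κ (ι 2) ⊗ T)) ⊕ N ⊗ (Κ (ι 2) ⊗ T) ⊕ Κ (ι 2) ⊗ T ⊗ (Κ (ι 2) ⊗ T ⊗ (Κ (ι 2) ⊗ T)) ⊕ Κ (ι 2) ⊗ N ⊗ (Κ (ι 2) ⊗ (Κ (ι 2) ⊗ T) ⊕ Κ (ι 2)) ⊕ Κ (ι 2) ⊗ ((Κ 1ℚ ⊕ Κ (ι 2) ⊗ T) ⊗ (Κ 1ℚ ⊕ Κ (ι 2) ⊗ T))) ⊕ (Κ (ι 44) ⊗ N ⊗ T ⊗ (B ⊖ Κ 1ℚ) ⊕ Κ (ι 4) ⊗ N ⊗ (T ⊖ Κ 1ℚ) ⊕ Κ (ι 8) ⊗ T ⊗ (N ⊖ T ⊗ T) ⊕ Κ (ι 18) ⊗ N ⊗ (T ⊖ Κ 1ℚ) ⊕ Κ (ι 18) ⊗ (N ⊖ T ⊗ T) ⊕ Κ (ι 2) ⊗ (T ⊖ Κ 1ℚ) ⊗ (Κ 1ℚ ⊕ T) ⊕ Κ (ι 8) ⊗ T ⊗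 (T ⊖ Κ 1ℚ)))) refl
      Δ = D + ε * T
      B0 : 0ℚ ≤ B
      B0 = ≤-trans 0≤1 B1
      s2 : 1ℚ + Δ ≤ 1ℚ + D2
      s2 = ℚP.+-monoʳ-≤ 1ℚ Δ≤2T
      mono : DB ≤ N * (D2 * B + ι 2 * D2) + N * D2 + D2 * (D2 * D2) + ι 2 * N * (ι 2 * D2 + ι 2) + ι 2 * ((1ℚ + D2) * (1ℚ + D2))
      mono = add≤ (add≤ (add≤ (add≤ (mulˡ N0 (add≤ (mulʳ B0 Δ≤2T) (mulˡ (0≤ι 2) Δ≤2T))) (mulˡ N0 Δ≤2T)) (mul≤ Δ0 Δ≤2T (Δ0 ⊠ Δ0) (mul≤ Δ0 Δ≤2T Δ0 Δ≤2T)))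
          (mulˡ (0≤ι 2 ⊠ N0) (ℚP.+-monoˡ-≤ (ι 2) (mulˡ (0≤ι 2) Δ≤2T)))) (mulˡ (0≤ι 2) (mul≤ (0≤1 ⊞ Δ0) s2 (0≤1 ⊞ Δ0) s2))

    -- The change consists of two first-order losses, each (κW ± haz)·Cm, and the simultaneous ones,
    -- which `DB≤` keeps below N q² haz. The target shrinks by (1 - κ)², whence 2κ - κ² in the
    -- compensating term.
    stepC : θ * (N * (q * q) * ε) ≤ ι 2 → ∀ {x y} → ¬ x ≡ y →
      SA (λ s t → pow (sq ((Quantities.Cm (add A s t) x y - N * (q′ * q′)) * (θ * g))) K)
        ≤ Wv * (pow (sq ((Cm x y - N * (q * q)) * ((1ℚ - κ) * (1ℚ - κ) * θ))) K + pow ¼ K)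
    stepC hθ {x} {y} ne = V.result X (N * (q * q)) ((1ℚ - κ) * (1ℚ - κ)) (N * (q′ * q′)) _ (l0 κ X N q)
        (λ s t v → ≤-reflexive (cong (λ a → pow (sq ((a - N * (q′ * q′)) * (θ * g))) K) (trans (Step.Cm′ A C s t (valid⇒op {A = A} v) x y) (l9 X (a s t) (b s t) (c s t)))))
      where
      X = Cm x y
      a b c dX L : Fin n → Fin n → ℚ
      a s t = ∑ λ z → kill s t x z * ω z y
      b s t = ∑ λ z → ω x z * kill s t z y
      c s t = ∑ λ z → kill s t x z * kill s t z y
      dX s t = - (a s t + b s t) + c s t
      L s t = a s t + b s t
      l9 : ∀ X a b c → X - a - b + c ≡ X + (- (a + b) + c)
      l9 = solve 4 (λ X a b c → (X ⊖ a ⊖ b ⊕ c) ⊜ (X ⊕ (⊝ (a ⊕ b) ⊕ c))) refl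
      l0 : ∀ κ X N q → (ι 2 * κ - κ * κ) * X ≡ X * (1ℚ - (1ℚ - κ) * (1ℚ - κ)) - (N * (q * (1ℚ - κ) * (q * (1ℚ - κ))) - N * (q * q) * ((1ℚ - κ) * (1ℚ - κ)))
      l0 = solve 4 (λ κ X N q → ((Κ (ι 2) ⊗ κ ⊖ κ ⊗ κ) ⊗ X)
          ⊜ (X ⊗ (Κ 1ℚ ⊖ (Κ 1ℚ ⊖ κ) ⊗ (Κ 1ℚ ⊖ κ)) ⊖ (N ⊗ (q ⊗ (Κ 1ℚ ⊖ κ) ⊗ (q ⊗ (Κ 1ℚ ⊖ κ))) ⊖ N ⊗ (q ⊗ q) ⊗ ((Κ 1ℚ ⊖ κ) ⊗ (Κ 1ℚ ⊖ κ))))) refl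
      a≥0 : ∀ s t → 0ℚ ≤ a s t
      a≥0 s t = ∑-nonneg λ z → kill≥0 s t x z ⊠ ω≥0 z y
      b≥0 : ∀ s t → 0ℚ ≤ b s t
      b≥0 s t = ∑-nonneg λ z → ω≥0 x z ⊠ kill≥0 s t z y
      c≥0 : ∀ s t → 0ℚ ≤ c s t
      c≥0 s t = ∑-nonneg λ z → kill≥0 s t x z ⊠ kill≥0 s t z y
      c≤a : ∀ s t → c s t ≤ a s t
      c≤a s t = ∑-mono λ z → mulˡ (kill≥0 s t x z) (kill≤ω s t z y)
      X0 = Cm≥0 x y
      X2 : X ≤ N * (q * q) * ι 2
      X2 = ≤-trans (Cm≤ ne) (mulˡ (N0 ⊠ (q≥0 ⊠ q≥0)) 1+ε≤2)
      comm-a : ∀ s t → a s t ≡ ∑ λ z → ω z y * kill s t x z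
      comm-a s t = ∑-cong λ z → ℚP.*-comm (kill s t x z) (ω z y)
      comm-X : ∑ (λ z → ω z y * ω x z) ≡ X
      comm-X = ∑-cong λ z → ℚP.*-comm (ω z y) (ω x z)
      Sa≤ : SA a ≤ (κ * Wv + haz) * X
      Sa≤ = ≤-trans (≤-reflexive (S-cong w comm-a)) (≤-trans (SK-sum≤ (λ z → ω z y) (λ _ → x) (λ z → z) (λ z → ω≥0 z y)) (≤-reflexive (cong ((κ * Wv + haz) *_) comm-X)))
      Sa≥ : (κ * Wv - haz) * X ≤ SA a
      Sa≥ = ≤-trans (≤-reflexive (cong ((κ * Wv - haz) *_) (sym comm-X))) (≤-trans (SK-sum≥ (λ z → ω z y) (λ _ → x) (λ z → z) (λ z → ω≥0 z y)) (≤-reflexive (sym (S-cong w comm-a))))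
      Sb≤ : SA b ≤ (κ * Wv + haz) * X
      Sb≤ = SK-sum≤ (λ z → ω x z) (λ z → z) (λ _ → y) (λ z → ω≥0 x z)
      Sb≥ : (κ * Wv - haz) * X ≤ SA b
      Sb≥ = SK-sum≥ (λ z → ω x z) (λ z → z) (λ _ → y) (λ z → ω≥0 x z)
      Sc≤ : SA c ≤ N * (q * q) * haz
      Sc≤ = ≤-trans (S-double ne) DB≤
      Sc≥ : 0ℚ ≤ SA c
      Sc≥ = S-nonneg w (λ s t _ → c≥0 s t)
      SL : SA L ≡ SA a + SA b
      SL = S-+ w a b
      SdX : SA dX ≡ - (SA a + SA b) + SA c
      SdX = trans (S-+ w (λ s t → - L s t) c) (cong (_+ SA c) (trans (S-neg w L) (cong -_ SL)))
      -- The quadratic term of the target is harmless: κ ≤ ρ and κ ≤ ε.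
      κκ : κ * κ ≤ ρ * ε
      κκ = ≤-trans (cert (0≤ι 7 ⊠ κ0 ⊠ κ0) (l κ)) (≤-trans (mulʳ {κ} {ρ} (0≤ι 8 ⊠ κ0) (≤-trans (cert (0≤ι 3 ⊠ κ0) (l3 κ)) κρ)) (mulˡ ρ0 κε))
        where l : ∀ k → k * (ι 8 * k) ≡ k * k + ι 7 * k * k
              l = solve 1 (λ k → (k ⊗ (Κ (ι 8) ⊗ k)) ⊜ (k ⊗ k ⊕ Κ (ι 7) ⊗ k ⊗ k)) refl
              l3 : ∀ k → ι 4 * k ≡ k + ι 3 * k
              l3 = solve 1 (λ k → (Κ (ι 4) ⊗ k) ⊜ (k ⊕ Κ (ι 3) ⊗ k)) refl
      e≥0 : 0ℚ ≤ (ι 2 * κ - κ * κ) * X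
      e≥0 = (κ0 ⊠ (0≤1 ⊞ 1-κ) ⊠ X0) ⇒ l κ X
        where
        _⇒_ : ∀ {a b} → 0ℚ ≤ a → a ≡ b → 0ℚ ≤ b
        p ⇒ refl = p
        l : ∀ κ X → κ * (1ℚ + (1ℚ - κ)) * X ≡ (ι 2 * κ - κ * κ) * X
        l = solve 2 (λ κ X → (κ ⊗ (Κ 1ℚ ⊕ (Κ 1ℚ ⊖ κ)) ⊗ X) ⊜ ((Κ (ι 2) ⊗ κ ⊖ κ ⊗ κ) ⊗ X)) refl
      E = ι 2 * κ * X
      E≥0 : 0ℚ ≤ E
      E≥0 = 0≤ι 2 ⊠ κ0 ⊠ X0
      e≤E : (ι 2 * κ - κ * κ) * X ≤ E
      e≤E = cert (κ0 ⊠ κ0 ⊠ X0) (l κ X)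
        where l : ∀ κ X → ι 2 * κ * X ≡ (ι 2 * κ - κ * κ) * X + κ * κ * X
              l = solve 2 (λ κ X → (Κ (ι 2) ⊗ κ ⊗ X) ⊜ ((Κ (ι 2) ⊗ κ ⊖ κ ⊗ κ) ⊗ X ⊕ κ ⊗ κ ⊗ X)) refl
      nqq : 0ℚ ≤ N * (q * q)
      nqq = N0 ⊠ (q≥0 ⊠ q≥0)
      dr+ : SA dX + (ι 2 * κ - κ * κ) * X * Wv ≤ ι 16 * ρ * (N * (q * q) * ε) * Wv
      dr+ = ≤-trans (≤-reflexive (cong (_+ (ι 2 * κ - κ * κ) * X * Wv) SdX))
         (cert (sub Sa≥ ⊞ sub Sb≥ ⊞ sub Sc≤ ⊞ (0≤ι 2 ⊠ haz≥0 ⊠ sub X2) ⊞ (0≤ι 11 ⊠ haz≥0 ⊠ nqq) ⊞ (κ0 ⊠ κ0 ⊠ X0 ⊠ W≥0)) (l (SA a) (SA b) (SA c) κ X Wv ρ ε (N * (q * q))))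
        where l : ∀ a b c κ X W ρ ε Z → ι 16 * ρ * (Z * ε) * W ≡ - (a + b) + c + (ι 2 * κ - κ * κ) * X * W + ((a - (κ * W - ρ * ε * W) * X) + (b - (κ * W - ρ * ε * W) * X)
                   + (Z * (ρ * ε * W) - c) + ι 2 * (ρ * ε * W) * (Z * ι 2 - X) + ι 11 * (ρ * ε * W) * Z + κ * κ * X * W)
              l = solve 9 (λ a b c κ X W ρ ε Z → (Κ (ι 16) ⊗ ρ ⊗ (Z ⊗ ε) ⊗ W)
                  ⊜ (⊝ (a ⊕ b) ⊕ c ⊕ (Κ (ι 2) ⊗ κ ⊖ κ ⊗ κ) ⊗ X ⊗ W ⊕ ((a ⊖ (κ ⊗ W ⊖ ρ ⊗ ε ⊗ W) ⊗ X) ⊕ (b ⊖ (κ ⊗ W ⊖ ρ ⊗ ε ⊗ W) ⊗ X) ⊕ (Z ⊗ (ρ ⊗ ε ⊗ W) ⊖ c) ⊕ Κ (ι 2) ⊗ (ρ ⊗ ε ⊗ W) ⊗ (Z ⊗ Κ (ι 2) ⊖ X) ⊕ Κ (ι 11) ⊗ (ρ ⊗ ε ⊗ W) ⊗ Z ⊕ κ ⊗ κ ⊗ X ⊗ W))) refl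
      dr- : - (ι 16 * ρ * (N * (q * q) * ε) * Wv) ≤ SA dX + (ι 2 * κ - κ * κ) * X * Wv
      dr- = ≤-trans (cert (sub Sa≤ ⊞ sub Sb≤ ⊞ Sc≥ ⊞ (0≤ι 3 ⊠ haz≥0 ⊠ sub X2) ⊞ (0≤ι 10 ⊠ haz≥0 ⊠ nqq) ⊞ (sub κκ ⊠ X0 ⊠ W≥0)) (l (SA a) (SA b) (SA c) κ X Wv ρ ε (N * (q * q))))
          (≤-reflexive (cong (_+ (ι 2 * κ - κ * κ) * X * Wv) (sym SdX)))
        where l : ∀ a b c κ X W ρ ε Z → - (a + b) + c + (ι 2 * κ - κ * κ) * X * W ≡ - (ι 16 * ρ * (Z * ε) * W) + (((κ * W + ρ * ε * W) * X - a) + ((κ * W + ρ * ε * W) * X - b)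
                   + c + ι 3 * (ρ * ε * W) * (Z * ι 2 - X) + ι 10 * (ρ * ε * W) * Z + (ρ * ε - κ * κ) * X * W)
              l = solve 9 (λ a b c κ X W ρ ε Z → (⊝ (a ⊕ b) ⊕ c ⊕ (Κ (ι 2) ⊗ κ ⊖ κ ⊗ κ) ⊗ X ⊗ W)
                  ⊜ (⊝ (Κ (ι 16) ⊗ ρ ⊗ (Z ⊗ ε) ⊗ W) ⊕ (((κ ⊗ W ⊕ ρ ⊗ ε ⊗ W) ⊗ X ⊖ a) ⊕ ((κ ⊗ W ⊕ ρ ⊗ ε ⊗ W) ⊗ X ⊖ b) ⊕ c ⊕ Κ (ι 3) ⊗ (ρ ⊗ ε ⊗ W) ⊗ (Z ⊗ Κ (ι 2) ⊖ X) ⊕ Κ (ι 10) ⊗ (ρ ⊗ ε ⊗ W) ⊗ Z ⊕ (ρ ⊗ ε ⊖ κ ⊗ κ) ⊗ X ⊗ W))) refl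
      vr : SA L + E * Wv ≤ ι 12 * ρ * (N * (q * q)) * Wv
      vr = ≤-trans (≤-reflexive (cong (_+ E * Wv) SL)) (cert (sub Sa≤ ⊞ sub Sb≤ ⊞ (0≤ι 1 ⊠ W≥0 ⊠ X0 ⊠ sub κρ) ⊞ (0≤ι 2 ⊠ sub haz≤ρW ⊠ X0) ⊞ (0≤ι 3 ⊠ ρ0 ⊠ W≥0 ⊠ sub X2) ⊞ (0≤ι 6 ⊠ ρ0 ⊠ W≥0 ⊠ nqq))
          (l (SA a) (SA b) κ X Wv ρ ε (N * (q * q))))
        where l : ∀ a b κ X W ρ ε Z → ι 12 * ρ * Z * W ≡ a + b + ι 2 * κ * X * W + (((κ * W + ρ * ε * W) * X - a) + ((κ * W + ρ * ε * W) * X - b) + ι 1 * W * X * (ρ - ι 4 * κ)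
                   + ι 2 * (ρ * W - ρ * ε * W) * X + ι 3 * ρ * W * (Z * ι 2 - X) + ι 6 * ρ * W * Z)
              l = solve 8 (λ a b κ X W ρ ε Z → (Κ (ι 12) ⊗ ρ ⊗ Z ⊗ W)
                  ⊜ (a ⊕ b ⊕ Κ (ι 2) ⊗ κ ⊗ X ⊗ W ⊕ (((κ ⊗ W ⊕ ρ ⊗ ε ⊗ W) ⊗ X ⊖ a) ⊕ ((κ ⊗ W ⊕ ρ ⊗ ε ⊗ W) ⊗ X ⊖ b) ⊕ Κ (ι 1) ⊗ W ⊗ X ⊗ (ρ ⊖ Κ (ι 4) ⊗ κ) ⊕ Κ (ι 2) ⊗ (ρ ⊗ W ⊖ ρ ⊗ ε ⊗ W) ⊗ X ⊕ Κ (ι 3) ⊗ ρ ⊗ W ⊗ (Z ⊗ Κ (ι 2) ⊖ X) ⊕ Κ (ι 6) ⊗ ρ ⊗ W ⊗ Z))) refl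
      qq≤1 : q * q ≤ 1ℚ
      qq≤1 = ≤-trans (mul≤ q≥0 q1 q≥0 q1) (≤-reflexive (ℚP.*-identityˡ 1ℚ))
      -- Two rows of 18T² and 24T² from the target: this is where the 60 of `cJ` comes from.
      LJ : ∀ s t → w s t ≡ true → L s t + E ≤ ι 60 * (T * T)
      LJ s t v = ≤-trans (add≤ (add≤ rx ry) (≤-trans (≤-reflexive (ℚP.*-assoc (ι 2) κ X)) (mulˡ (0≤ι 2) (κX≤ X (≤-trans X2 (≤-trans (mulʳ (0≤ι 2) (≤-trans (mulˡ N0 qq≤1) (≤-reflexive (ℚP.*-identityʳ N)))) (≤-reflexive (ℚP.*-comm N (ι 2)))))))))
          (≤-reflexive (l T))
        where
        hst = valid⇒op {A = A} v
        l : ∀ T → ι 18 * (T * T) + ι 18 * (T * T) + ι 2 * (ι 12 * (T * T)) ≡ ι 60 * (T * T)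
        l = solve 1 (λ T → (Κ (ι 18) ⊗ (T ⊗ T) ⊕ Κ (ι 18) ⊗ (T ⊗ T) ⊕ Κ (ι 2) ⊗ (Κ (ι 12) ⊗ (T ⊗ T))) ⊜ (Κ (ι 60) ⊗ (T ⊗ T))) refl
        rowb : ∀ x → ∑ (kill s t x) ≤ ι 18 * (T * T)
        rowb x = ≤-trans (kill-row x (D + ε * T) hst deg≤ Δ0) 18T²
        rx : a s t ≤ ι 18 * (T * T)
        rx = ≤-trans (∑-mono λ z → ≤-trans (mulˡ (kill≥0 s t x z) (⟦⟧≤1 (op A z y))) (≤-reflexive (ℚP.*-identityʳ (kill s t x z)))) (rowb x)
        ry : b s t ≤ ι 18 * (T * T)
        ry = ≤-trans (∑-mono λ z → ≤-trans (mulʳ (kill≥0 s t z y) (⟦⟧≤1 (op A x z))) (≤-reflexive (trans (ℚP.*-identityˡ (kill s t z y)) (Pair.kill-sym hst z y)))) (rowb y)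
      module V = Var w K ρ g θ (N * (q * q)) ε ((ι 2 * κ - κ * κ) * X) E (ι 60 * (T * T)) dX L
        k1 ρ0 g0 gγ θ0 nqq ε0 ε8 hθ
        (λ s t _ → ≤-trans (add≤ (neg0 {a s t + b s t} {0ℚ} (a≥0 s t ⊞ b≥0 s t) ≤-refl) (≤-trans (c≤a s t) (cert (b≥0 s t) refl))) (≤-reflexive (ℚP.+-identityˡ (a s t + b s t))))
        (λ s t _ → cert (c≥0 s t) refl) e≤E (neg0 E≥0 e≥0) LJ (0≤ι 60 ⊠ (T0 ⊠ T0)) dr+ dr- vr cJ

    -- The gain averages Cm/W, about 2q/N = μq, and the loss κ·Nm, which together follow the target
    -- Dq. The indicator drops the steps in which x and y acquire a common neighbour; there are at
    -- most 4Tq of them and each would have cost at most Nm ≤ 2Tq, so the neglected 8(Tq)² is at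
    -- most Tq·haz.
    stepN : θ * (T * q * ε) ≤ ι 2 → ∀ {x y} → ¬ x ≡ y → cod x y ≡ false →
      SA (λ s t → ⟦ not (Quantities.cod (add A s t) x y) ⟧ * pow (sq ((Quantities.Nm (add A s t) x y - (D + μ) * q′) * (θ * g))) K)
        ≤ Wv * (pow (sq ((Nm x y - D * q) * ((1ℚ - κ) * θ))) K + pow ¼ K)
    stepN hθ {x} {y} ne hc = V.result X (D * q) (1ℚ - κ) ((D + μ) * q′) F (l0 κ X D μ q) hF
      where
      X = Nm x y
      nc : Fin n → Fin n → Bool
      nc s t = not (Quantities.cod (add A s t) x y)
      F gain loss dX L : Fin n → Fin n → ℚ
      F s t = ⟦ nc s t ⟧ * pow (sq ((Quantities.Nm (add A s t) x y - (D + μ) * q′) * (θ * g))) K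
      gain s t = δ s x * ω t y + δ t x * ω s y
      loss s t = ∑ λ b → α x b * kill s t b y
      -- When x and y acquire a common neighbour, `F` is 0 and the value of `dX` is free. Leaving
      -- out the loss there keeps the change small in every step, since `loss≤` applies only in the
      -- other steps.
      dX s t = gain s t - ⟦ nc s t ⟧ * loss s t
      L s t = gain s t + ⟦ nc s t ⟧ * loss s t
      E = κ * X + μ * q
      l0 : ∀ κ X D μ q → κ * X - μ * (q * (1ℚ - κ)) ≡ X * (1ℚ - (1ℚ - κ)) - ((D + μ) * (q * (1ℚ - κ)) - D * q * (1ℚ - κ))
      l0 = solve 5 (λ κ X D μ q → (κ ⊗ X ⊖ μ ⊗ (q ⊗ (Κ 1ℚ ⊖ κ))) ⊜ (X ⊗ (Κ 1ℚ ⊖ (Κ 1ℚ ⊖ κ)) ⊖ ((D ⊕ μ) ⊗ (q ⊗ (Κ 1ℚ ⊖ κ)) ⊖ D ⊗ q ⊗ (Κ 1ℚ ⊖ κ)))) refl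
      cd0 : cd x y ≡ 0ℚ
      cd0 = cd-none (λ z p r → true≢false (ex-intro (λ z → A x z ∧ A z y) z (∧-intro p r)) hc)
      gain≥0 : ∀ s t → 0ℚ ≤ gain s t
      gain≥0 s t = (⟦⟧≥0 (s == x) ⊠ ω≥0 t y) ⊞ (⟦⟧≥0 (t == x) ⊠ ω≥0 s y)
      loss≥0 : ∀ s t → 0ℚ ≤ loss s t
      loss≥0 s t = ∑-nonneg λ b → α≥0 x b ⊠ kill≥0 s t b y
      ncl≥0 : ∀ s t → 0ℚ ≤ ⟦ nc s t ⟧ * loss s t
      ncl≥0 s t = ⟦⟧≥0 (nc s t) ⊠ loss≥0 s t
      hF : ∀ s t → w s t ≡ true → F s t ≤ pow (sq ((X + dX s t - (D + μ) * q′) * (θ * g))) K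
      hF s t v with bool-dec (nc s t)
      ... | inj₂ p = ≤-trans (≤-reflexive (trans (cong (_* pow (sq ((Quantities.Nm (add A s t) x y - (D + μ) * q′) * (θ * g))) K) (⟦⟧-false p)) (ℚP.*-zeroˡ (pow (sq ((Quantities.Nm (add A s t) x y - (D + μ) * q′) * (θ * g))) K))))
                       (pow-nonneg K (sq≥0 ((X + dX s t - (D + μ) * q′) * (θ * g))))
      ... | inj₁ p = ≤-reflexive (trans (cong₂ (λ u a → u * pow (sq ((a - (D + μ) * q′) * (θ * g))) K) (⟦⟧-true p) eq)
                       (ℚP.*-identityˡ (pow (sq ((X + dX s t - (D + μ) * q′) * (θ * g))) K)))
        where
        eq : Quantities.Nm (add A s t) x y ≡ X + dX s t
        eq = trans (Step.Nm′ A C s t (valid⇒op {A = A} v) ne cd0) (trans (l X (gain s t) (loss s t)) (cong (λ u → X + (gain s t - u * loss s t)) (sym (⟦⟧-true p))))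
          where l : ∀ X g l → X + g - l ≡ X + (g - 1ℚ * l)
                l = solve 3 (λ X g l → (X ⊕ g ⊖ l) ⊜ (X ⊕ (g ⊖ Κ 1ℚ ⊗ l))) refl
      X0 = Nm≥0 x y
      X2 : X ≤ ι 2 * (T * q)
      X2 = ≤-trans (Nm≤ x y) (≤-trans (mulˡ q≥0 Δ≤2T) (≤-reflexive (l q T)))
        where l : ∀ q T → q * (ι 2 * T) ≡ ι 2 * (T * q)
              l = solve 2 (λ q T → (q ⊗ (Κ (ι 2) ⊗ T)) ⊜ (Κ (ι 2) ⊗ (T ⊗ q))) refl
      N2 : ∀ u v → Nm u v ≤ ι 2 * (T * q)
      N2 u v = ≤-trans (Nm≤ u v) (≤-trans (mulˡ q≥0 Δ≤2T) (≤-reflexive (l q T)))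
        where l : ∀ q T → q * (ι 2 * T) ≡ ι 2 * (T * q)
              l = solve 2 (λ q T → (q ⊗ (Κ (ι 2) ⊗ T)) ⊜ (Κ (ι 2) ⊗ (T ⊗ q))) refl
      χχ : Fin n → Fin n → ℚ
      χχ s t = χ x y s t + χ x y t s
      χχ≥0 : ∀ s t → 0ℚ ≤ χχ s t
      χχ≥0 s t = ((⟦⟧≥0 (s == x) ⊠ α≥0 t y) ⊞ (⟦⟧≥0 (s == y) ⊠ α≥0 t x)) ⊞ ((⟦⟧≥0 (t == x) ⊠ α≥0 s y) ⊞ (⟦⟧≥0 (t == y) ⊠ α≥0 s x))
      loss≤X : ∀ s t → loss s t ≤ X
      loss≤X s t = ∑-mono λ b → mulˡ (α≥0 x b) (kill≤ω s t b y)
      Sl≤ : SA loss ≤ (κ * Wv + haz) * X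
      Sl≤ = SK-sum≤ (α x) (λ b → b) (λ _ → y) (α≥0 x)
      Sl≥ : (κ * Wv - haz) * X ≤ SA loss
      Sl≥ = SK-sum≥ (α x) (λ b → b) (λ _ → y) (α≥0 x)
      ncl : Fin n → Fin n → ℚ
      ncl s t = ⟦ nc s t ⟧ * loss s t
      Sn≤ : SA ncl ≤ SA loss
      Sn≤ = S-mono w λ s t _ → ≤-trans (mulʳ (loss≥0 s t) (⟦⟧≤1 (nc s t))) (≤-reflexive (ℚP.*-identityˡ (loss s t)))
      -- The omitted losses: at most X for each edge detected by `χ`, and `S-χ` counts those edges
      -- by mixed counts.
      Sn≥ : SA loss ≤ SA ncl + X * (Nm y x + Nm x y)
      Sn≥ = ≤-trans (S-mono w pt) (≤-reflexive (trans (S-+ w ncl (λ s t → X * χχ s t)) (cong (SA ncl +_) (trans (S-* w X χχ) (cong (X *_) (S-χ x y))))))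
        where
        pt : ∀ s t → w s t ≡ true → loss s t ≤ ncl s t + X * χχ s t
        pt s t v with bool-dec (Quantities.cod (add A s t) x y)
        ... | inj₂ p = cert (X0 ⊠ χχ≥0 s t) (cong (_+ X * χχ s t) (trans (cong (λ u → ⟦ not u ⟧ * loss s t) p) (ℚP.*-identityˡ (loss s t))))
        ... | inj₁ p = ≤-trans (loss≤X s t) (≤-trans (≤-reflexive (sym (ℚP.*-identityʳ X))) (≤-trans (mulˡ X0 (Step.cod⇒χ A C s t (valid⇒op {A = A} v) ne hc p))
                         (cert (ncl≥0 s t) (ℚP.+-comm (ncl s t) (X * χχ s t)))))
      Sg : SA gain ≡ Cm x y
      Sg = S-gain x y
      SdX : SA dX ≡ Cm x y - SA ncl
      SdX = trans (S-+ w gain (λ s t → - ncl s t)) (cong₂ _+_ Sg (S-neg w ncl))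
      SL : SA L ≡ Cm x y + SA ncl
      SL = trans (S-+ w gain ncl) (cong (_+ SA ncl) Sg)
      μW≤ : μ * Wv ≤ N * q * (1ℚ + ε)
      μW≤ = cert ((½≥0 ⊠ μ0 ⊠ sub 2W≤) ⊞ (½≥0 ⊠ N0 ⊠ q≥0 ⊠ (0≤1 ⊞ ε0) ⊠ sub (≤-reflexive μN))) (l μ Wv N q ε)
        where
        l : ∀ μ W N q ε → N * q * (1ℚ + ε) ≡ μ * W + (½ * μ * (N * (N * q * (1ℚ + ε)) - (W + W)) + ½ * N * q * (1ℚ + ε) * (ι 2 - μ * N))
        l = solve 5 (λ μ W N q ε → (N ⊗ q ⊗ (Κ 1ℚ ⊕ ε))
            ⊜ (μ ⊗ W ⊕ (Κ ½ ⊗ μ ⊗ (N ⊗ (N ⊗ q ⊗ (Κ 1ℚ ⊕ ε)) ⊖ (W ⊕ W)) ⊕ Κ ½ ⊗ N ⊗ q ⊗ (Κ 1ℚ ⊕ ε) ⊗ (Κ (ι 2) ⊖ μ ⊗ N)))) refl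
      μW≥ : N * q * (1ℚ - ε) ≤ μ * Wv
      μW≥ = cert ((½≥0 ⊠ μ0 ⊠ sub 2W≥) ⊞ (½≥0 ⊠ N0 ⊠ q≥0 ⊠ 1-ε ⊠ sub (≤-reflexive (sym μN)))) (l μ Wv N q ε)
        where
        l : ∀ μ W N q ε → μ * W ≡ N * q * (1ℚ - ε) + (½ * μ * (W + W - N * (N * q * (1ℚ - ε))) + ½ * N * q * (1ℚ - ε) * (μ * N - ι 2))
        l = solve 5 (λ μ W N q ε → (μ ⊗ W)
            ⊜ (N ⊗ q ⊗ (Κ 1ℚ ⊖ ε) ⊕ (Κ ½ ⊗ μ ⊗ (W ⊕ W ⊖ N ⊗ (N ⊗ q ⊗ (Κ 1ℚ ⊖ ε))) ⊕ Κ ½ ⊗ N ⊗ q ⊗ (Κ 1ℚ ⊖ ε) ⊗ (μ ⊗ N ⊖ Κ (ι 2))))) refl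
      Z = T * q
      Z0 : 0ℚ ≤ Z
      Z0 = T0 ⊠ q≥0
      NN : Nm y x + Nm x y ≤ ι 4 * Z
      NN = ≤-trans (add≤ (N2 y x) (N2 x y)) (≤-reflexive (l Z))
        where l : ∀ z → ι 2 * z + ι 2 * z ≡ ι 4 * z
              l = solve 1 (λ z → (Κ (ι 2) ⊗ z ⊕ Κ (ι 2) ⊗ z) ⊜ (Κ (ι 4) ⊗ z)) refl
      8Z≤haz : ι 8 * Z ≤ haz
      8Z≤haz = ≤-trans (≤-trans (cert ((0≤ι 8 ⊠ T0 ⊠ sub q1) ⊞ (½≥0 ⊠ 0≤ι 21 ⊠ sub T²εq) ⊞ (0≤ι 76 ⊠ T0)) (l T q (T * T * ε * q))) (mulˡ ½≥0 haz≥)) (≤-reflexive (r haz))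
        where
        l : ∀ T q z → ½ * (ι 21 * z) ≡ ι 8 * (T * q) + (ι 8 * T * (1ℚ - q) + ½ * ι 21 * (z - ι 8 * T) + ι 76 * T)
        l = solve 3 (λ T q z → (Κ ½ ⊗ (Κ (ι 21) ⊗ z))
            ⊜ (Κ (ι 8) ⊗ (T ⊗ q) ⊕ (Κ (ι 8) ⊗ T ⊗ (Κ 1ℚ ⊖ q) ⊕ Κ ½ ⊗ Κ (ι 21) ⊗ (z ⊖ Κ (ι 8) ⊗ T) ⊕ Κ (ι 76) ⊗ T))) refl
        r : ∀ h → ½ * (ι 2 * h) ≡ h
        r = solve 1 (λ h → (Κ ½ ⊗ (Κ (ι 2) ⊗ h)) ⊜ (h)) refl
      NqqW : ι 10 * (N * (q * q)) ≤ ρ * Wv * Z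
      NqqW = ≤-trans (≤-trans (≤-reflexive (l N q)) (mulˡ q≥0 NqW)) (≤-reflexive (l′ q ρ T Wv))
        where
        l : ∀ N q → ι 10 * (N * (q * q)) ≡ q * (ι 10 * (N * q))
        l = solve 2 (λ N q → (Κ (ι 10) ⊗ (N ⊗ (q ⊗ q))) ⊜ (q ⊗ (Κ (ι 10) ⊗ (N ⊗ q)))) refl
        l′ : ∀ q ρ T W → q * (ρ * T * W) ≡ ρ * W * (T * q)
        l′ = solve 4 (λ q ρ T W → (q ⊗ (ρ ⊗ T ⊗ W)) ⊜ (ρ ⊗ W ⊗ (T ⊗ q))) refl
      e = κ * X - μ * q′
      dr+ : SA dX + e * Wv ≤ ι 16 * ρ * (T * q * ε) * Wv
      dr+ = ≤-trans (≤-reflexive (cong (_+ e * Wv) SdX))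
         (cert (sub (Cm≤ ne) ⊞ sub Sn≥ ⊞ sub Sl≥ ⊞ (X0 ⊠ sub NN) ⊞ (q≥0 ⊠ 1-κ ⊠ sub μW≥) ⊞ ((haz≥0 ⊞ 0≤ι 4 ⊠ Z0) ⊠ sub X2) ⊞ (Z0 ⊠ sub 8Z≤haz) ⊞ (κ0 ⊠ nqq ⊠ ε0) ⊞ (⅛≥0 ⊠ nqq ⊠ sub κε)
                ⊞ (0≤ι 1 ⊠ ε0 ⊠ sub NqqW) ⊞ (0≤ι 12 ⊠ haz≥0 ⊠ Z0) ⊞ (0≤ι 7 ⊠ nqq ⊠ ε0) ⊞ (⅛≥0 ⊠ 0≤ι 7 ⊠ nqq ⊠ ε0))
            (l (Cm x y) (SA ncl) (SA loss) κ X Wv ρ ε N q T μ (Nm y x + Nm x y)))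
        where
        nqq : 0ℚ ≤ N * (q * q)
        nqq = N0 ⊠ (q≥0 ⊠ q≥0)
        l : ∀ C n S κ X W ρ ε N q T μ M → ι 16 * ρ * (T * q * ε) * W ≡ C - n + (κ * X - μ * (q * (1ℚ - κ))) * W +
             ((N * (q * q) * (1ℚ + ε) - C) + (n + X * M - S) + (S - (κ * W - ρ * ε * W) * X) + X * (ι 4 * (T * q) - M) + q * (1ℚ - κ) * (μ * W - N * q * (1ℚ - ε))
               + (ρ * ε * W + ι 4 * (T * q)) * (ι 2 * (T * q) - X) + T * q * (ρ * ε * W - ι 8 * (T * q)) + κ * (N * (q * q)) * ε
               + ⅛ * (N * (q * q)) * (ε - ι 8 * κ) + ι 1 * ε * (ρ * W * (T * q) - ι 10 * (N * (q * q))) + ι 12 * (ρ * ε * W) * (T * q) + ι 7 * (N * (q * q)) * ε + ⅛ * ι 7 * (N * (q * q)) * ε)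
        l = solve 13 (λ C n S κ X W ρ ε N q T μ M → (Κ (ι 16) ⊗ ρ ⊗ (T ⊗ q ⊗ ε) ⊗ W)
            ⊜ (C ⊖ n ⊕ (κ ⊗ X ⊖ μ ⊗ (q ⊗ (Κ 1ℚ ⊖ κ))) ⊗ W ⊕ ((N ⊗ (q ⊗ q) ⊗ (Κ 1ℚ ⊕ ε) ⊖ C) ⊕ (n ⊕ X ⊗ M ⊖ S) ⊕ (S ⊖ (κ ⊗ W ⊖ ρ ⊗ ε ⊗ W) ⊗ X) ⊕ X ⊗ (Κ (ι 4) ⊗ (T ⊗ q) ⊖ M) ⊕ q ⊗ (Κ 1ℚ ⊖ κ) ⊗ (μ ⊗ W ⊖ N ⊗ q ⊗ (Κ 1ℚ ⊖ ε)) ⊕ (ρ ⊗ ε ⊗ W ⊕ Κ (ι 4) ⊗ (T ⊗ q)) ⊗ (Κ (ι 2) ⊗ (T ⊗ q) ⊖ X) ⊕ T ⊗ q ⊗ (ρ ⊗ ε ⊗ W ⊖ Κ (ι 8) ⊗ (T ⊗ q)) ⊕ κ ⊗ (N ⊗ (q ⊗ q)) ⊗ ε ⊕ Κ ⅛ ⊗ (N ⊗ (q ⊗ q)) ⊗ (ε ⊖ Κ (ι 8) ⊗ κ) ⊕ Κ (ι 1) ⊗ ε ⊗ (ρ ⊗ W ⊗ (T ⊗ q) ⊖ Κ (ι 10) ⊗ (N ⊗ (q ⊗ q))) ⊕ Κ (ι 12) ⊗ (ρ ⊗ ε ⊗ W) ⊗ (T ⊗ q) ⊕ Κ (ι 7)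 ⊗ (N ⊗ (q ⊗ q)) ⊗ ε ⊕ Κ ⅛ ⊗ Κ (ι 7) ⊗ (N ⊗ (q ⊗ q)) ⊗ ε))) refl
      dr- : - (ι 16 * ρ * (T * q * ε) * Wv) ≤ SA dX + e * Wv
      dr- = ≤-trans (cert (sub (Cm≥ ne) ⊞ sub Sn≤ ⊞ sub Sl≤ ⊞ (q≥0 ⊠ sub μW≤) ⊞ (κ0 ⊠ μ0 ⊠ q≥0 ⊠ W≥0) ⊞ (haz≥0 ⊠ sub X2) ⊞ (0≤ι 1 ⊠ ε0 ⊠ sub NqqW) ⊞ (0≤ι 13 ⊠ haz≥0 ⊠ Z0) ⊞ (0≤ι 8 ⊠ nqq ⊠ ε0))
            (l (Cm x y) (SA ncl) (SA loss) κ X Wv ρ ε N q T μ)) (≤-reflexive (cong (_+ e * Wv) (sym SdX)))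
        where
        nqq : 0ℚ ≤ N * (q * q)
        nqq = N0 ⊠ (q≥0 ⊠ q≥0)
        l : ∀ C n S κ X W ρ ε N q T μ → C - n + (κ * X - μ * (q * (1ℚ - κ))) * W ≡ - (ι 16 * ρ * (T * q * ε) * W) +
             ((C - N * (q * q) * (1ℚ - ε)) + (S - n) + ((κ * W + ρ * ε * W) * X - S) + q * (N * q * (1ℚ + ε) - μ * W) + κ * μ * q * W + ρ * ε * W * (ι 2 * (T * q) - X)
               + ι 1 * ε * (ρ * W * (T * q) - ι 10 * (N * (q * q))) + ι 13 * (ρ * ε * W) * (T * q) + ι 8 * (N * (q * q)) * ε)
        l = solve 12 (λ C n S κ X W ρ ε N q T μ → (C ⊖ n ⊕ (κ ⊗ X ⊖ μ ⊗ (q ⊗ (Κ 1ℚ ⊖ κ))) ⊗ W)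
            ⊜ (⊝ (Κ (ι 16) ⊗ ρ ⊗ (T ⊗ q ⊗ ε) ⊗ W) ⊕ ((C ⊖ N ⊗ (q ⊗ q) ⊗ (Κ 1ℚ ⊖ ε)) ⊕ (S ⊖ n) ⊕ ((κ ⊗ W ⊕ ρ ⊗ ε ⊗ W) ⊗ X ⊖ S) ⊕ q ⊗ (N ⊗ q ⊗ (Κ 1ℚ ⊕ ε) ⊖ μ ⊗ W) ⊕ κ ⊗ μ ⊗ q ⊗ W ⊕ ρ ⊗ ε ⊗ W ⊗ (Κ (ι 2) ⊗ (T ⊗ q) ⊖ X) ⊕ Κ (ι 1) ⊗ ε ⊗ (ρ ⊗ W ⊗ (T ⊗ q) ⊖ Κ (ι 10) ⊗ (N ⊗ (q ⊗ q))) ⊕ Κ (ι 13) ⊗ (ρ ⊗ ε ⊗ W) ⊗ (T ⊗ q) ⊕ Κ (ι 8) ⊗ (N ⊗ (q ⊗ q)) ⊗ ε))) refl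
      vr : SA L + E * Wv ≤ ι 12 * ρ * (T * q) * Wv
      vr = ≤-trans (≤-reflexive (cong (_+ E * Wv) SL)) (cert (sub (Cm≤ ne) ⊞ sub Sn≤ ⊞ sub Sl≤ ⊞ (q≥0 ⊠ sub μW≤) ⊞ (½≥0 ⊠ W≥0 ⊠ X0 ⊠ sub κρ) ⊞ (sub haz≤ρW ⊠ X0) ⊞ ((0≤1 ⊞ ½≥0) ⊠ ρ0 ⊠ W≥0 ⊠ sub X2)
             ⊞ (0≤ι 2 ⊠ nqq ⊠ sub ε≤1) ⊞ (0≤ι 1 ⊠ sub NqqW) ⊞ (0≤ι 6 ⊠ nqq) ⊞ (0≤ι 8 ⊠ ρ0 ⊠ W≥0 ⊠ Z0))
           (l (Cm x y) (SA ncl) (SA loss) κ X Wv ρ ε N q T μ))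
        where
        nqq : 0ℚ ≤ N * (q * q)
        nqq = N0 ⊠ (q≥0 ⊠ q≥0)
        l : ∀ C n S κ X W ρ ε N q T μ → ι 12 * ρ * (T * q) * W ≡ C + n + (κ * X + μ * q) * W +
             ((N * (q * q) * (1ℚ + ε) - C) + (S - n) + ((κ * W + ρ * ε * W) * X - S) + q * (N * q * (1ℚ + ε) - μ * W) + ½ * W * X * (ρ - ι 4 * κ) + (ρ * W - ρ * ε * W) * X
               + (1ℚ + ½) * ρ * W * (ι 2 * (T * q) - X) + ι 2 * (N * (q * q)) * (1ℚ - ε) + ι 1 * (ρ * W * (T * q) - ι 10 * (N * (q * q))) + ι 6 * (N * (q * q)) + ι 8 * ρ * W * (T * q))
        l = solve 12 (λ C n S κ X W ρ ε N q T μ → (Κ (ι 12) ⊗ ρ ⊗ (T ⊗ q) ⊗ W)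
            ⊜ (C ⊕ n ⊕ (κ ⊗ X ⊕ μ ⊗ q) ⊗ W ⊕ ((N ⊗ (q ⊗ q) ⊗ (Κ 1ℚ ⊕ ε) ⊖ C) ⊕ (S ⊖ n) ⊕ ((κ ⊗ W ⊕ ρ ⊗ ε ⊗ W) ⊗ X ⊖ S) ⊕ q ⊗ (N ⊗ q ⊗ (Κ 1ℚ ⊕ ε) ⊖ μ ⊗ W) ⊕ Κ ½ ⊗ W ⊗ X ⊗ (ρ ⊖ Κ (ι 4) ⊗ κ) ⊕ (ρ ⊗ W ⊖ ρ ⊗ ε ⊗ W) ⊗ X ⊕ (Κ 1ℚ ⊕ Κ ½) ⊗ ρ ⊗ W ⊗ (Κ (ι 2) ⊗ (T ⊗ q) ⊖ X) ⊕ Κ (ι 2) ⊗ (N ⊗ (q ⊗ q)) ⊗ (Κ 1ℚ ⊖ ε) ⊕ Κ (ι 1) ⊗ (ρ ⊗ W ⊗ (T ⊗ q) ⊖ Κ (ι 10) ⊗ (N ⊗ (q ⊗ q))) ⊕ Κ (ι 6) ⊗ (N ⊗ (q ⊗ q)) ⊕ Κ (ι 8) ⊗ ρ ⊗ W ⊗ (T ⊗ q)))) refl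
      μ2 : μ ≤ ι 2
      μ2 = ≤-trans (≤-trans (≤-reflexive (sym (ℚP.*-identityʳ μ))) (mulˡ μ0 N1)) (≤-reflexive μN)
      κN6 : κ * N ≤ ι 6
      κN6 = cancel-* (ℚP.<-≤-trans 0<1 N1) (≤-trans (≤-reflexive (ℚP.*-assoc κ N N)) (≤-trans κNN≤ (mulˡ (0≤ι 6) TN)))
      κX12 : κ * X ≤ ι 12
      κX12 = ≤-trans (mulˡ κ0 (≤-trans X2 (mulˡ (0≤ι 2) (≤-trans (mulˡ T0 q1) (≤-trans (≤-reflexive (ℚP.*-identityʳ T)) (≤-trans (cert (T0 ⊠ sub T1) (l T)) TN))))))
          (≤-trans (≤-reflexive (l′ κ N)) (≤-trans (mulˡ (0≤ι 2) κN6) (≤-reflexive refl)))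
        where
        l : ∀ T → T * T ≡ T + T * (T - 1ℚ)
        l = solve 1 (λ T → (T ⊗ T) ⊜ (T ⊕ T ⊗ (T ⊖ Κ 1ℚ))) refl
        l′ : ∀ k N → k * (ι 2 * N) ≡ ι 2 * (k * N)
        l′ = solve 2 (λ k N → (k ⊗ (Κ (ι 2) ⊗ N)) ⊜ (Κ (ι 2) ⊗ (k ⊗ N))) refl
      μq2 : μ * q ≤ ι 2
      μq2 = ≤-trans (mulˡ μ0 q1) (≤-trans (≤-reflexive (ℚP.*-identityʳ μ)) μ2)
      ncl≤ : ∀ s t → w s t ≡ true → ncl s t ≤ ι 2 * (ι 3 + B)
      ncl≤ s t v with bool-dec (Quantities.cod (add A s t) x y)
      ... | inj₁ p = ≤-trans (≤-reflexive (trans (cong (λ u → ⟦ not u ⟧ * loss s t) p) (ℚP.*-zeroˡ (loss s t)))) (0≤ι 2 ⊠ (0≤ι 3 ⊞ ≤-trans 0≤1 B1))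
      ... | inj₂ p = ≤-trans (≤-reflexive (trans (cong (λ u → ⟦ not u ⟧ * loss s t) p) (ℚP.*-identityˡ (loss s t)))) (Step.loss≤ A C s t (valid⇒op {A = A} v) B B1 ne p Pm≤)
      gain≤ : ∀ s t → gain s t ≤ ι 2
      gain≤ s t = add≤ (mul≤ (⟦⟧≥0 (s == x)) (⟦⟧≤1 (s == x)) (ω≥0 t y) (⟦⟧≤1 (op A t y))) (mul≤ (⟦⟧≥0 (t == x)) (⟦⟧≤1 (t == x)) (ω≥0 s y) (⟦⟧≤1 (op A s y)))
      LJ : ∀ s t → w s t ≡ true → L s t + E ≤ ι 30 * B
      LJ s t v = ≤-trans (add≤ (add≤ (gain≤ s t) (ncl≤ s t v)) (add≤ κX12 μq2)) (cert ((0≤ι 28 ⊠ sub B1) ⊞ 0≤ι 6) (l B))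
        where l : ∀ B → ι 30 * B ≡ ι 2 + ι 2 * (ι 3 + B) + (ι 12 + ι 2) + (ι 28 * (B - 1ℚ) + ι 6)
              l = solve 1 (λ B → (Κ (ι 30) ⊗ B) ⊜ (Κ (ι 2) ⊕ Κ (ι 2) ⊗ (Κ (ι 3) ⊕ B) ⊕ (Κ (ι 12) ⊕ Κ (ι 2)) ⊕ (Κ (ι 28) ⊗ (B ⊖ Κ 1ℚ) ⊕ Κ (ι 6)))) refl
      e≤E : e ≤ E
      e≤E = cert ((μ0 ⊠ (q≥0 ⊠ 1-κ)) ⊞ (μ0 ⊠ q≥0)) (l κ X μ q)
        where l : ∀ κ X μ q → κ * X + μ * q ≡ κ * X - μ * (q * (1ℚ - κ)) + (μ * (q * (1ℚ - κ)) + μ * q)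
              l = solve 4 (λ κ X μ q → (κ ⊗ X ⊕ μ ⊗ q) ⊜ (κ ⊗ X ⊖ μ ⊗ (q ⊗ (Κ 1ℚ ⊖ κ)) ⊕ (μ ⊗ (q ⊗ (Κ 1ℚ ⊖ κ)) ⊕ μ ⊗ q))) refl
      -E≤e : - E ≤ e
      -E≤e = cert ((0≤ι 2 ⊠ κ0 ⊠ X0) ⊞ (μ0 ⊠ q≥0 ⊠ κ0)) (l κ X μ q)
        where l : ∀ κ X μ q → κ * X - μ * (q * (1ℚ - κ)) ≡ - (κ * X + μ * q) + (ι 2 * κ * X + μ * q * κ)
              l = solve 4 (λ κ X μ q → (κ ⊗ X ⊖ μ ⊗ (q ⊗ (Κ 1ℚ ⊖ κ))) ⊜ (⊝ (κ ⊗ X ⊕ μ ⊗ q) ⊕ (Κ (ι 2) ⊗ κ ⊗ X ⊕ μ ⊗ q ⊗ κ))) refl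
      l₁ : ∀ g n → g + n ≡ g - n + ι 2 * n
      l₁ = solve 2 (λ g n → (g ⊕ n) ⊜ (g ⊖ n ⊕ Κ (ι 2) ⊗ n)) refl
      l₂ : ∀ g n → g - n ≡ - (g + n) + ι 2 * g
      l₂ = solve 2 (λ g n → (g ⊖ n) ⊜ (⊝ (g ⊕ n) ⊕ Κ (ι 2) ⊗ g)) refl
      module V = Var w K ρ g θ (T * q) ε e E (ι 30 * B) dX L
        k1 ρ0 g0 gγ θ0 Z0 ε0 ε8 hθ
        (λ s t _ → cert (0≤ι 2 ⊠ ncl≥0 s t) (l₁ (gain s t) (ncl s t)))
        (λ s t _ → cert (0≤ι 2 ⊠ gain≥0 s t) (l₂ (gain s t) (ncl s t))) e≤E -E≤e LJ (0≤ι 30 ⊠ ≤-trans 0≤1 B1) dr+ dr- vr cN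

  -- The potential

  inv-scale : ∀ {P r} → 0ℚ < P → 0ℚ < r → r * inv (P * r) ≡ inv P
  inv-scale {P} {r} p q = inv-uniq p (trans (l P r (inv (P * r))) (inv-* (*-pos p q)))
    where l : ∀ P r i → P * (r * i) ≡ P * r * i
          l = solve 3 (λ P r i → (P ⊗ (r ⊗ i)) ⊜ (P ⊗ r ⊗ i)) refl

  inv-shrink : ∀ {P c g} → 0ℚ < P → 0ℚ < c → c * g ≡ 1ℚ → inv P * g ≡ inv (P * c)
  inv-shrink {P} {c} {g} p q e = inv-uniq (*-pos p q) (trans (l P c (inv P) g) (trans (cong₂ _*_ (inv-* p) e) (ℚP.*-identityˡ 1ℚ)))
    where l : ∀ P c i g → P * c * (i * g) ≡ (P * i) * (c * g)
          l = solve 4 (λ P c i g → (P ⊗ c ⊗ (i ⊗ g)) ⊜ ((P ⊗ i) ⊗ (c ⊗ g))) refl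

  inv-half : ∀ {P r} → 0ℚ < P → ½ ≤ r → inv (P * r) * P ≤ ι 2
  inv-half {P} {r} p h = ≤-trans (cert (0≤ι 2 ⊠ <⇒≤ (inv-pos Pr) ⊠ <⇒≤ p ⊠ sub h) (l P r (inv (P * r)))) (≤-reflexive (cong (ι 2 *_) (inv-* Pr)))
    where
    Pr : 0ℚ < P * r
    Pr = *-pos p (ℚP.<-≤-trans (ℚP.positive⁻¹ ½) h)
    l : ∀ P r i → ι 2 * (P * r * i) ≡ i * P + ι 2 * i * P * (r - ½)
    l = solve 3 (λ P r i → (Κ (ι 2) ⊗ (P ⊗ r ⊗ i)) ⊜ (i ⊗ P ⊕ Κ (ι 2) ⊗ i ⊗ P ⊗ (r ⊖ Κ ½))) refl

  pow-<1 : ∀ {x} K → pow x K < 1ℚ → x ≤ 1ℚ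
  pow-<1 {x} K h with total x 1ℚ
  ... | inj₁ p = p
  ... | inj₂ p = ⊥-elim (ℚP.<-irrefl refl (ℚP.<-≤-trans h (pow-≥1 K p)))

  sq≤1 : ∀ x → sq x ≤ 1ℚ → (x ≤ 1ℚ) × (- 1ℚ ≤ x)
  sq≤1 x h = up x h , ≤-trans (neg≤ (up (- x) (≤-trans (≤-reflexive (l x)) h))) (≤-reflexive (l′ x))
    where
    l : ∀ x → (- x) * (- x) ≡ x * x
    l = solve 1 (λ x → ((⊝ x) ⊗ (⊝ x)) ⊜ (x ⊗ x)) refl
    l′ : ∀ x → - (- x) ≡ x
    l′ = solve 1 (λ x → (⊝ (⊝ x)) ⊜ (x)) refl
    up : ∀ x → x * x ≤ 1ℚ → x ≤ 1ℚ
    up x h with total x 1ℚ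
    ... | inj₁ p = p
    ... | inj₂ p = ≤-trans (cert (≤-trans 0≤1 p ⊠ sub p) (l2 x)) h
      where l2 : ∀ x → x * x ≡ x + x * (x - 1ℚ)
            l2 = solve 1 (λ x → (x ⊗ x) ⊜ (x ⊕ x ⊗ (x ⊖ Κ 1ℚ))) refl

  within : ∀ {X M s} → 0ℚ < s → ∀ K → pow (sq ((X - M) * inv s)) K < 1ℚ → (X ≤ M + s) × (M - s ≤ X)
  within {X} {M} {s} p K h = ≤-trans (≤-reflexive (l1 X M)) (ℚP.+-monoʳ-≤ M (≤-trans (≤-reflexive (sym eq)) (≤-trans (mulʳ (<⇒≤ p) (proj₁ b)) (≤-reflexive (ℚP.*-identityˡ s)))))
      , ≤-trans (ℚP.+-monoʳ-≤ M (≤-trans (≤-reflexive (l2 s)) (≤-trans (mulʳ (<⇒≤ p) (proj₂ b)) (≤-reflexive eq)))) (≤-reflexive (sym (l1 X M)))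
    where
    b = sq≤1 ((X - M) * inv s) (pow-<1 K h)
    eq : (X - M) * inv s * s ≡ X - M
    eq = trans (l (X - M) (inv s) s) (trans (cong ((X - M) *_) (inv-* p)) (ℚP.*-identityʳ (X - M)))
      where l : ∀ a i s → a * i * s ≡ a * (s * i)
            l = solve 3 (λ a i s → (a ⊗ i ⊗ s) ⊜ (a ⊗ (s ⊗ i))) refl
    l1 : ∀ X M → X ≡ M + (X - M)
    l1 = solve 2 (λ X M → (X) ⊜ (M ⊕ (X ⊖ M))) refl
    l2 : ∀ s → - s ≡ (- 1ℚ) * s
    l2 = solve 1 (λ s → (⊝ s) ⊜ ((⊝ Κ 1ℚ) ⊗ s)) refl

  sumV : ∀ {n} u → (Vec (Fin n) u → ℚ) → ℚ
  sumV zero f = f []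
  sumV (suc u) f = ∑ λ x → sumV u (λ v → f (x ∷ v))

  sumV-mono : ∀ {n} u {f g : Vec (Fin n) u → ℚ} → (∀ v → f v ≤ g v) → sumV u f ≤ sumV u g
  sumV-mono zero h = h []
  sumV-mono (suc u) h = ∑-mono λ x → sumV-mono u (λ v → h (x ∷ v))

  sumV-nonneg : ∀ {n} u {f : Vec (Fin n) u → ℚ} → (∀ v → 0ℚ ≤ f v) → 0ℚ ≤ sumV u f
  sumV-nonneg zero h = h []
  sumV-nonneg (suc u) h = ∑-nonneg λ x → sumV-nonneg u (λ v → h (x ∷ v))

  sumV-term : ∀ {n} {u} {f : Vec (Fin n) u → ℚ} → (∀ v → 0ℚ ≤ f v) → ∀ v → f v ≤ sumV u f
  sumV-term h [] = ≤-refl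
  sumV-term {u = suc u} {f} h (x ∷ v) = ≤-trans (sumV-term (λ v → h (x ∷ v)) v) (∑-term (λ x → sumV-nonneg u (λ v → h (x ∷ v))) x)

  sumV-* : ∀ {n} u c (f : Vec (Fin n) u → ℚ) → sumV u (λ v → c * f v) ≡ c * sumV u f
  sumV-* zero c f = refl
  sumV-* (suc u) c f = trans (∑-cong λ x → sumV-* u c (λ v → f (x ∷ v))) (∑-*ˡ c (λ x → sumV u (λ v → f (x ∷ v))))

  sumV-bound : ∀ {n} u {f : Vec (Fin n) u → ℚ} → (∀ v → f v ≤ 1ℚ) → sumV u f ≤ pow (ι n) u
  sumV-bound zero h = h []
  sumV-bound {n} (suc u) h = ∑-bound (pow (ι n) u) (λ x → sumV-bound u (λ v → h (x ∷ v)))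

  S-sumV : ∀ {n m} (w : Fin n → Fin n → Bool) u (f : Vec (Fin m) u → Fin n → Fin n → ℚ) → S w (λ s t → sumV u (λ v → f v s t)) ≡ sumV u (λ v → S w (f v))
  S-sumV w zero f = refl
  S-sumV w (suc u) f = trans (S-∑ w (λ x s t → sumV u (λ v → f (x ∷ v) s t))) (∑-cong λ x → S-sumV w u (λ v → f (x ∷ v)))

  module Pot {n} (K : ℕ) (T D q ε b : ℚ) (A : Fin n → Fin n → Bool) where
    open Quantities A

    N sO sC sd sN : ℚ
    N = ι n
    sO = N * q * ε
    sC = N * (q * q) * ε
    sd = T * ε
    sN = T * q * ε

    dev : ℚ → ℚ → ℚ → ℚ
    dev X M s = pow (sq ((X - M) * inv s)) K

    Fd FO : Fin n → ℚ
    Fd x = dev (deg x) D sd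
    FO x = dev (opdeg x) (N * q) sO
    FC FN FP : Fin n → Fin n → ℚ
    FC x y = dev (Cm x y) (N * (q * q)) sC
    -- Nm x y jumps when x and y acquire a common neighbour, so it is tracked only before that.
    FN x y = ⟦ not (cod x y) ⟧ * dev (Nm x y) (D * q) sN
    FP x y = dev (Pm x y) 0ℚ b

    opaque
      Φ : ℚ
      Φ = ∑ Fd + ∑ FO + (∑ λ x → ∑ λ y → ν x y * FC x y) + (∑ λ x → ∑ λ y → ν x y * FN x y) + (∑ λ x → ∑ λ y → FP x y)

      Φ-def : Φ ≡ ∑ Fd + ∑ FO + (∑ λ x → ∑ λ y → ν x y * FC x y) + (∑ λ x → ∑ λ y → ν x y * FN x y) + (∑ λ x → ∑ λ y → FP x y)
      Φ-def = refl

    dev≥0 : ∀ X M s → 0ℚ ≤ dev X M s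
    dev≥0 X M s = pow-nonneg K (sq≥0 ((X - M) * inv s))

    FN≥0 : ∀ x y → 0ℚ ≤ FN x y
    FN≥0 x y = ⟦⟧≥0 (not (cod x y)) ⊠ dev≥0 (Nm x y) (D * q) sN

    νF≥0 : ∀ {F : Fin n → Fin n → ℚ} → (∀ x y → 0ℚ ≤ F x y) → ∀ x y → 0ℚ ≤ ν x y * F x y
    νF≥0 p x y = ⟦⟧≥0 (not (x == y)) ⊠ p x y

    ∑∑≥0 : ∀ {F : Fin n → Fin n → ℚ} → (∀ x y → 0ℚ ≤ F x y) → 0ℚ ≤ (∑ λ x → ∑ λ y → F x y)
    ∑∑≥0 p = ∑-nonneg λ x → ∑-nonneg λ y → p x y

    ∑∑-term : ∀ {F : Fin n → Fin n → ℚ} → (∀ x y → 0ℚ ≤ F x y) → ∀ x y → F x y ≤ (∑ λ x → ∑ λ y → F x y)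
    ∑∑-term p x y = ≤-trans (∑-term (p x) y) (∑-term (λ x → ∑-nonneg (p x)) x)

    private
      p₁ : 0ℚ ≤ ∑ Fd
      p₁ = ∑-nonneg λ x → dev≥0 (deg x) D sd
      p₂ : 0ℚ ≤ ∑ FO
      p₂ = ∑-nonneg λ x → dev≥0 (opdeg x) (N * q) sO
      C≥0 : ∀ x y → 0ℚ ≤ ν x y * FC x y
      C≥0 = νF≥0 (λ x y → dev≥0 (Cm x y) (N * (q * q)) sC)
      N≥0 : ∀ x y → 0ℚ ≤ ν x y * FN x y
      N≥0 = νF≥0 FN≥0
      P≥0 : ∀ x y → 0ℚ ≤ FP x y
      P≥0 x y = dev≥0 (Pm x y) 0ℚ b

    Φ≥0 : 0ℚ ≤ Φ
    Φ≥0 = ≤-trans (p₁ ⊞ p₂ ⊞ ∑∑≥0 C≥0 ⊞ ∑∑≥0 N≥0 ⊞ ∑∑≥0 P≥0) (≤-reflexive (sym Φ-def))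

    module Extract (N>0 : 0ℚ < N) (T>0 : 0ℚ < T) (q>0 : 0ℚ < q) (ε>0 : 0ℚ < ε) (b>0 : 0ℚ < b) (D≥0 : 0ℚ ≤ D) (B : ℚ) (b≤B : b ≤ B)
      (C : C4Free A) (Φ1 : Φ < 1ℚ) where
      open Totals A C using (Nm-diag; Nm-cod)

      private
        a₁ = ∑ Fd
        a₂ = ∑ FO
        a₃ = ∑ λ x → ∑ λ y → ν x y * FC x y
        a₄ = ∑ λ x → ∑ λ y → ν x y * FN x y
        a₅ = ∑ λ x → ∑ λ y → FP x y
        p₃ : 0ℚ ≤ a₃
        p₃ = ∑∑≥0 C≥0
        p₄ : 0ℚ ≤ a₄
        p₄ = ∑∑≥0 N≥0
        p₅ : 0ℚ ≤ a₅
        p₅ = ∑∑≥0 P≥0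
        t₁ : a₁ ≤ Φ
        t₁ = cert (p₂ ⊞ p₃ ⊞ p₄ ⊞ p₅) (trans Φ-def (l a₁ a₂ a₃ a₄ a₅))
          where l : ∀ a b c d e → a + b + c + d + e ≡ a + (b + c + d + e)
                l = solve 5 (λ a b c d e → (a ⊕ b ⊕ c ⊕ d ⊕ e) ⊜ (a ⊕ (b ⊕ c ⊕ d ⊕ e))) refl
        t₂ : a₂ ≤ Φ
        t₂ = cert (p₁ ⊞ p₃ ⊞ p₄ ⊞ p₅) (trans Φ-def (l a₁ a₂ a₃ a₄ a₅))
          where l : ∀ a b c d e → a + b + c + d + e ≡ b + (a + c + d + e)
                l = solve 5 (λ a b c d e → (a ⊕ b ⊕ c ⊕ d ⊕ e) ⊜ (b ⊕ (a ⊕ c ⊕ d ⊕ e))) refl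
        t₃ : a₃ ≤ Φ
        t₃ = cert (p₁ ⊞ p₂ ⊞ p₄ ⊞ p₅) (trans Φ-def (l a₁ a₂ a₃ a₄ a₅))
          where l : ∀ a b c d e → a + b + c + d + e ≡ c + (a + b + d + e)
                l = solve 5 (λ a b c d e → (a ⊕ b ⊕ c ⊕ d ⊕ e) ⊜ (c ⊕ (a ⊕ b ⊕ d ⊕ e))) refl
        t₄ : a₄ ≤ Φ
        t₄ = cert (p₁ ⊞ p₂ ⊞ p₃ ⊞ p₅) (trans Φ-def (l a₁ a₂ a₃ a₄ a₅))
          where l : ∀ a b c d e → a + b + c + d + e ≡ d + (a + b + c + e)
                l = solve 5 (λ a b c d e → (a ⊕ b ⊕ c ⊕ d ⊕ e) ⊜ (d ⊕ (a ⊕ b ⊕ c ⊕ e))) refl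
        t₅ : a₅ ≤ Φ
        t₅ = cert (p₁ ⊞ p₂ ⊞ p₃ ⊞ p₄) (trans Φ-def (l a₁ a₂ a₃ a₄ a₅))
          where l : ∀ a b c d e → a + b + c + d + e ≡ e + (a + b + c + d)
                l = solve 5 (λ a b c d e → (a ⊕ b ⊕ c ⊕ d ⊕ e) ⊜ (e ⊕ (a ⊕ b ⊕ c ⊕ d))) refl
        wd : ∀ x → (deg x ≤ D + sd) × (D - sd ≤ deg x)
        wd x = within {deg x} {D} {sd} (*-pos T>0 ε>0) K (ℚP.≤-<-trans (≤-trans (∑-term {f = Fd} (λ x → dev≥0 (deg x) D sd) x) t₁) Φ1)
        wO : ∀ x → (opdeg x ≤ N * q + sO) × (N * q - sO ≤ opdeg x)
        wO x = within {opdeg x} {N * q} {sO} (*-pos (*-pos N>0 q>0) ε>0) K (ℚP.≤-<-trans (≤-trans (∑-term {f = FO} (λ x → dev≥0 (opdeg x) (N * q) sO) x) t₂) Φ1)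
        one* : ∀ {a} b → a ≡ 1ℚ → b ≤ a * b
        one* {a} b e = ≤-reflexive (sym (trans (cong (_* b) e) (ℚP.*-identityˡ b)))
        wC : ∀ {x y} → ¬ x ≡ y → (Cm x y ≤ N * (q * q) + sC) × (N * (q * q) - sC ≤ Cm x y)
        wC {x} {y} ne = within {Cm x y} {N * (q * q)} {sC} (*-pos (*-pos N>0 (*-pos q>0 q>0)) ε>0) K
          (ℚP.≤-<-trans (≤-trans (one* (FC x y) (ν-≢ ne)) (≤-trans (∑∑-term C≥0 x y) t₃)) Φ1)
        wN : ∀ {x y} → ¬ x ≡ y → cod x y ≡ false → (Nm x y ≤ D * q + sN) × (D * q - sN ≤ Nm x y)
        wN {x} {y} ne hc = within {Nm x y} {D * q} {sN} (*-pos (*-pos T>0 q>0) ε>0) K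
          (ℚP.≤-<-trans (≤-trans (≤-trans (one* (dev (Nm x y) (D * q) sN) (cong (λ u → ⟦ not u ⟧) hc)) (one* (FN x y) (ν-≢ ne))) (≤-trans (∑∑-term N≥0 x y) t₄)) Φ1)
        wP : ∀ x y → Pm x y ≤ 0ℚ + b
        wP x y = proj₁ (within {Pm x y} {0ℚ} {b} b>0 K (ℚP.≤-<-trans (≤-trans (∑∑-term P≥0 x y) t₅) Φ1))

      good : Good A T D q ε B
      good = record
        { deg≤ = λ x → ≤-trans (proj₁ (wd x)) (≤-reflexive (cong (D +_) (ℚP.*-comm T ε)))
        ; deg≥ = λ x → ≤-trans (≤-reflexive (cong (λ a → D - a) (ℚP.*-comm ε T))) (proj₂ (wd x))
        ; opdeg≤ = λ x → ≤-trans (proj₁ (wO x)) (≤-reflexive (l1 (N * q) ε))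
        ; opdeg≥ = λ x → ≤-trans (≤-reflexive (l2 (N * q) ε)) (proj₂ (wO x))
        ; Cm≤ = λ ne → ≤-trans (proj₁ (wC ne)) (≤-reflexive (l1 (N * (q * q)) ε))
        ; Cm≥ = λ ne → ≤-trans (≤-reflexive (l2 (N * (q * q)) ε)) (proj₂ (wC ne))
        ; Nm≤ = nm
        ; Nm≥ = λ ne hc → ≤-trans (≤-reflexive (l3 D q T ε)) (proj₂ (wN ne hc))
        ; Pm≤ = λ x y → ≤-trans (wP x y) (≤-trans (≤-reflexive (ℚP.+-identityˡ b)) b≤B) }
        where
        l1 : ∀ a e → a + a * e ≡ a * (1ℚ + e)
        l1 = solve 2 (λ a e → (a ⊕ a ⊗ e) ⊜ (a ⊗ (Κ 1ℚ ⊕ e))) refl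
        l2 : ∀ a e → a * (1ℚ - e) ≡ a - a * e
        l2 = solve 2 (λ a e → (a ⊗ (Κ 1ℚ ⊖ e)) ⊜ (a ⊖ a ⊗ e)) refl
        l3 : ∀ D q T e → q * (D - e * T) ≡ D * q - T * q * e
        l3 = solve 4 (λ D q T e → (q ⊗ (D ⊖ e ⊗ T)) ⊜ (D ⊗ q ⊖ T ⊗ q ⊗ e)) refl
        l4 : ∀ D q T e → D * q + T * q * e ≡ q * (D + e * T)
        l4 = solve 4 (λ D q T e → (D ⊗ q ⊕ T ⊗ q ⊗ e) ⊜ (q ⊗ (D ⊕ e ⊗ T))) refl
        z : 0ℚ ≤ q * (D + ε * T)
        z = <⇒≤ q>0 ⊠ (D≥0 ⊞ <⇒≤ ε>0 ⊠ <⇒≤ T>0)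
        nm : ∀ x y → Nm x y ≤ q * (D + ε * T)
        nm x y with fin-dec x y | bool-dec (cod x y)
        ... | inj₁ refl | _ = ≤-trans (≤-reflexive (Nm-diag x)) z
        ... | inj₂ ne | inj₁ e = ≤-trans (≤-reflexive (Nm-cod x y e)) z
        ... | inj₂ ne | inj₂ e = ≤-trans (proj₁ (wN ne e)) (≤-reflexive (l4 D q T ε))

  module PotNext {n} (A : Fin n → Fin n → Bool) (C : C4Free A) {T D q ε κ ρ B b : ℚ} (K : ℕ)
    (cond : Cond (ι n) T D q ε κ ρ B (ι K)) (good : Good A T D q ε B)
    (γ+1 g : ℚ) (γ-def : γ+1 ≡ 1ℚ + ι 256 * ρ) (g0 : 0ℚ ≤ g) (gγ : γ+1 * g ≡ 1ℚ) (μ : ℚ) (μ0 : 0ℚ ≤ μ) (μN : μ * ι n ≡ ι 2)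
    (ε>0 : 0ℚ < ε) (B₀ : ℚ) (B₀>0 : 0ℚ < B₀) (B₀≤b : B₀ ≤ b) (KB₀ : ι 12 * ι K * ι 6 ≤ ⅛ * B₀) where
    open Hazard A C cond good
    private
      module P = Pot {n} K T D q ε b A
      module P′ (s t : Fin n) = Pot {n} K T (D + μ) (q * (1ℚ - κ)) (ε * γ+1) (b * γ+1) (add A s t)
      w = valid A
      gγ′ : (1ℚ + ι 256 * ρ) * g ≡ 1ℚ
      gγ′ = trans (cong (_* g) (sym γ-def)) gγ
      module S1 = Steps A C K cond good g g0 gγ′ μ μ0 μN
      module S2 = Steps₂ A C K cond good g g0 gγ′ μ μ0 μN
      N>0 : 0ℚ < N
      N>0 = ℚP.<-≤-trans 0<1 N1
      T>0 : 0ℚ < T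
      T>0 = ℚP.<-≤-trans 0<1 T1
      b>0 : 0ℚ < b
      b>0 = ℚP.<-≤-trans B₀>0 B₀≤b

    γ>0 : 0ℚ < γ+1
    γ>0 = ℚP.<-≤-trans 0<1 (≤-trans (cert (0≤ι 256 ⊠ ρ0) refl) (≤-reflexive (sym γ-def)))

    -- Each of the 2N + 3N² summands of Φ may rise by `flo` per step, the price of the case |z| ≤ ¼
    -- in `Moment`.
    flo Λ : ℚ
    flo = pow ¼ K
    Λ = (ι 2 * N + ι 3 * (N * N)) * flo

    flo≥0 : 0ℚ ≤ flo
    flo≥0 = pow-nonneg K (<⇒≤ (ℚP.positive⁻¹ ¼))

    q⁺ ε⁺ : ℚ
    q⁺ = q * (1ℚ - κ)
    ε⁺ = ε * γ+1

    W>0 : 0ℚ < WA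
    W>0 = pos16 (ℚP.<-≤-trans (*-pos (ι-pos 6) (*-pos (*-pos N>0 N>0) q0)) 16W)
      where
      pos16 : 0ℚ < ι 16 * WA → 0ℚ < WA
      pos16 p = ℚP.*-cancelˡ-<-nonNeg (ι 16) (ℚP.≤-<-trans (≤-reflexive (ℚP.*-zeroʳ (ι 16))) p)

    -- One step shrinks a target by at most a factor 2, so θ times the old tolerance is at most 2,
    -- as `Var` requires; see `inv-half`.
    κ½ : ½ ≤ (1ℚ - κ) * (1ℚ - κ)
    κ½ = cert ((0≤ι 1 ⊠ sq≥0 κ) ⊞ (¼≥0 ⊠ sub κε) ⊞ (¼≥0 ⊠ sub ε≤1) ⊞ ¼≥0) (l κ ε)
      where
      ¼≥0 : 0ℚ ≤ ¼
      ¼≥0 = <⇒≤ (ℚP.positive⁻¹ ¼)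
      l : ∀ k e → (1ℚ - k) * (1ℚ - k) ≡ ½ + (ι 1 * (k * k) + ¼ * (e - ι 8 * k) + ¼ * (1ℚ - e) + ¼)
      l = solve 2 (λ k e → ((Κ 1ℚ ⊖ k) ⊗ (Κ 1ℚ ⊖ k)) ⊜ (Κ ½ ⊕ (Κ (ι 1) ⊗ (k ⊗ k) ⊕ Κ ¼ ⊗ (e ⊖ Κ (ι 8) ⊗ k) ⊕ Κ ¼ ⊗ (Κ 1ℚ ⊖ e) ⊕ Κ ¼))) refl

    κ½′ : ½ ≤ 1ℚ - κ
    κ½′ = cert ((⅛≥0 ⊠ sub κε) ⊞ (⅛≥0 ⊠ sub ε≤1) ⊞ <⇒≤ (ℚP.positive⁻¹ (½ - ⅛))) (l κ ε)
      where
      ⅛≥0 : 0ℚ ≤ ⅛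
      ⅛≥0 = <⇒≤ (ℚP.positive⁻¹ ⅛)
      l : ∀ k e → 1ℚ - k ≡ ½ + (⅛ * (e - ι 8 * k) + ⅛ * (1ℚ - e) + (½ - ⅛))
      l = solve 2 (λ k e → (Κ 1ℚ ⊖ k) ⊜ (Κ ½ ⊕ (Κ ⅛ ⊗ (e ⊖ Κ (ι 8) ⊗ k) ⊕ Κ ⅛ ⊗ (Κ 1ℚ ⊖ e) ⊕ (Κ ½ ⊖ Κ ⅛)))) refl

    1-κ>0 : 0ℚ < 1ℚ - κ
    1-κ>0 = ℚP.<-≤-trans (ℚP.positive⁻¹ ½) κ½′

    rC>0 : 0ℚ < (1ℚ - κ) * (1ℚ - κ)
    rC>0 = ℚP.<-≤-trans (ℚP.positive⁻¹ ½) κ½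

    PO = N * q * ε
    PO>0 : 0ℚ < PO
    PO>0 = *-pos (*-pos N>0 q0) ε>0
    PC = N * (q * q) * ε
    PC>0 : 0ℚ < PC
    PC>0 = *-pos (*-pos N>0 (*-pos q0 q0)) ε>0
    Pd = T * ε
    Pd>0 : 0ℚ < Pd
    Pd>0 = *-pos T>0 ε>0
    PN = T * q * ε
    PN>0 : 0ℚ < PN
    PN>0 = *-pos (*-pos T>0 q0) ε>0

    θO = inv (PO * (1ℚ - κ))
    θC = inv (PC * ((1ℚ - κ) * (1ℚ - κ)))
    θN = inv (PN * (1ℚ - κ))
    θd = inv Pd

    θO′ : θO * g ≡ inv (N * q⁺ * ε⁺)
    θO′ = trans (inv-shrink (*-pos PO>0 1-κ>0) γ>0 gγ) (cong inv (l N q ε (1ℚ - κ) γ+1))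
      where l : ∀ N q e k c → N * q * e * k * c ≡ N * (q * k) * (e * c)
            l = solve 5 (λ N q e k c → (N ⊗ q ⊗ e ⊗ k ⊗ c) ⊜ (N ⊗ (q ⊗ k) ⊗ (e ⊗ c))) refl
    θC′ : θC * g ≡ inv (N * (q⁺ * q⁺) * ε⁺)
    θC′ = trans (inv-shrink (*-pos PC>0 rC>0) γ>0 gγ) (cong inv (l N q ε (1ℚ - κ) γ+1))
      where l : ∀ N q e k c → N * (q * q) * e * (k * k) * c ≡ N * (q * k * (q * k)) * (e * c)
            l = solve 5 (λ N q e k c → (N ⊗ (q ⊗ q) ⊗ e ⊗ (k ⊗ k) ⊗ c) ⊜ (N ⊗ (q ⊗ k ⊗ (q ⊗ k)) ⊗ (e ⊗ c))) refl
    θN′ : θN * g ≡ inv (T * q⁺ * ε⁺)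
    θN′ = trans (inv-shrink (*-pos PN>0 1-κ>0) γ>0 gγ) (cong inv (l T q ε (1ℚ - κ) γ+1))
      where l : ∀ N q e k c → N * q * e * k * c ≡ N * (q * k) * (e * c)
            l = solve 5 (λ N q e k c → (N ⊗ q ⊗ e ⊗ k ⊗ c) ⊜ (N ⊗ (q ⊗ k) ⊗ (e ⊗ c))) refl
    θd′ : θd * g ≡ inv (T * ε⁺)
    θd′ = trans (inv-shrink Pd>0 γ>0 gγ) (cong inv (ℚP.*-assoc T ε γ+1))

    next-d : ∀ x → SA (λ s t → P′.Fd s t x) ≤ WA * (P.Fd x + flo)
    next-d x = ≤-trans (≤-reflexive (S-cong w (λ s t → cong₂ (λ a θ → pow (sq ((Quantities.deg (add A s t) x - a) * θ)) K) (refl {x = D + μ}) (sym θd′))))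
      (≤-trans (S1.stepd θd (<⇒≤ (inv-pos Pd>0)) (≤-trans (≤-reflexive (trans (ℚP.*-comm θd Pd) (inv-* Pd>0))) (ι-mono {1} {2} (ℕ.s≤s ℕ.z≤n))) x)
        (≤-reflexive (cong (λ θ → WA * (pow (sq ((deg x - D) * θ)) K + flo)) (ℚP.*-identityˡ θd))))

    next-O : ∀ x → SA (λ s t → P′.FO s t x) ≤ WA * (P.FO x + flo)
    next-O x = ≤-trans (≤-reflexive (S-cong w (λ s t → cong (λ θ → pow (sq ((Quantities.opdeg (add A s t) x - N * q⁺) * θ)) K) (sym θO′))))
      (≤-trans (S1.stepO θO (<⇒≤ (inv-pos (*-pos PO>0 1-κ>0))) (inv-half PO>0 κ½′) x)
        (≤-reflexive (cong (λ θ → WA * (pow (sq ((opdeg x - N * q) * θ)) K + flo)) (inv-scale PO>0 1-κ>0))))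

    next-C : ∀ {x y} → ¬ x ≡ y → SA (λ s t → P′.FC s t x y) ≤ WA * (P.FC x y + flo)
    next-C {x} {y} ne = ≤-trans (≤-reflexive (S-cong w (λ s t → cong (λ θ → pow (sq ((Quantities.Cm (add A s t) x y - N * (q⁺ * q⁺)) * θ)) K) (sym θC′))))
      (≤-trans (S2.stepC θC (<⇒≤ (inv-pos (*-pos PC>0 rC>0))) (inv-half PC>0 κ½) ne)
        (≤-reflexive (cong (λ θ → WA * (pow (sq ((Cm x y - N * (q * q)) * θ)) K + flo)) (inv-scale PC>0 rC>0))))

    next-P : ∀ x y → SA (λ s t → P′.FP s t x y) ≤ WA * (P.FP x y + flo)
    next-P x y = ≤-trans (≤-reflexive (S-cong w (λ s t → cong (λ θ → pow (sq ((Quantities.Pm (add A s t) x y - 0ℚ) * θ)) K) (sym (inv-shrink (b>0) γ>0 gγ)))))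
      (≤-trans (S1.stepP θ (<⇒≤ (inv-pos (b>0))) B₀ (<⇒≤ B₀>0) (≤-trans (mulˡ (<⇒≤ (inv-pos (b>0))) B₀≤b) (≤-reflexive (trans (ℚP.*-comm θ b) (inv-* (b>0))))) KB₀ x y)
        (≤-reflexive (cong (λ θ → WA * (pow (sq ((Pm x y - 0ℚ) * θ)) K + flo)) (ℚP.*-identityˡ θ))))
      where
      θ = inv b

    next-N : ∀ {x y} → ¬ x ≡ y → SA (λ s t → P′.FN s t x y) ≤ WA * (P.FN x y + flo)
    next-N {x} {y} ne with bool-dec (cod x y)
    ... | inj₂ hc = ≤-trans (≤-reflexive (S-cong w (λ s t → cong₂ (λ a θ → ⟦ not (Quantities.cod (add A s t) x y) ⟧ * pow (sq ((Quantities.Nm (add A s t) x y - a * q⁺) * θ)) K) (refl {x = D + μ}) (sym θN′))))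
      (≤-trans (S2.stepN θN (<⇒≤ (inv-pos (*-pos PN>0 1-κ>0))) (inv-half PN>0 κ½′) ne hc)
        (≤-reflexive (trans (cong (λ θ → WA * (pow (sq ((Nm x y - D * q) * θ)) K + flo)) (inv-scale PN>0 1-κ>0))
           (cong (λ a → WA * (a + flo)) (sym (trans (cong (λ a → ⟦ not a ⟧ * pow (sq ((Nm x y - D * q) * inv (PN))) K) hc) (ℚP.*-identityˡ (pow (sq ((Nm x y - D * q) * inv (PN))) K))))))))
    -- A common neighbour is never lost, so the summand stays 0 from now on.
    ... | inj₁ hc = ≤-trans (S-mono w (λ s t v → ≤-reflexive (trans (cong (λ a → ⟦ not a ⟧ * pow (sq ((Quantities.Nm (add A s t) x y - (D + μ) * q⁺) * inv (T * q⁺ * ε⁺))) K) (Step.cod-mono A C s t (valid⇒op {A = A} v) hc))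
            (ℚP.*-zeroˡ (pow (sq ((Quantities.Nm (add A s t) x y - (D + μ) * q⁺) * inv (T * q⁺ * ε⁺))) K)))))
         (≤-trans (≤-reflexive (trans (S-const w 0ℚ) (ℚP.*-zeroˡ WA))) (W≥0 ⊠ (P.FN≥0 x y ⊞ flo≥0)))

    ν-next : ∀ (F : Fin n → Fin n → ℚ) (F′ : Fin n → Fin n → Fin n → Fin n → ℚ) → (∀ x y → ¬ x ≡ y → SA (F′ x y) ≤ WA * (F x y + flo)) → ∀ x y →
      SA (λ s t → ν x y * F′ x y s t) ≤ WA * (ν x y * F x y + flo)
    ν-next F F′ f x y with fin-dec x y
    ... | inj₁ e = ≤-trans (≤-reflexive (trans (S-* w (ν x y) (F′ x y)) (trans (cong (_* SA (F′ x y)) ν0) (ℚP.*-zeroˡ (SA (F′ x y))))))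
           (≤-trans (W≥0 ⊠ flo≥0) (≤-reflexive (cong (WA *_) (sym (trans (cong (λ a → a * F x y + flo) ν0) (l (F x y) flo))))))
      where
      ν0 : ν x y ≡ 0ℚ
      ν0 = trans (cong (λ z → ν z y) e) (ν-refl y)
      l : ∀ a b → 0ℚ * a + b ≡ b
      l = solve 2 (λ a b → (Κ 0ℚ ⊗ a ⊕ b) ⊜ (b)) refl
    ... | inj₂ ne = ≤-trans (≤-reflexive (trans (S-* w (ν x y) (F′ x y)) (trans (cong (_* SA (F′ x y)) (ν-≢ ne)) (ℚP.*-identityˡ (SA (F′ x y))))))
           (≤-trans (f x y ne) (≤-reflexive (cong (λ a → WA * (a + flo)) (sym (trans (cong (_* F x y) (ν-≢ ne)) (ℚP.*-identityˡ (F x y)))))))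

    sum1 : ∀ (F : Fin n → ℚ) (F′ : Fin n → Fin n → Fin n → ℚ) → (∀ x → SA (F′ x) ≤ WA * (F x + flo)) →
      SA (λ s t → ∑ λ x → F′ x s t) ≤ WA * (∑ F + N * flo)
    sum1 F F′ f = ≤-trans (≤-reflexive (S-∑ w F′)) (≤-trans (∑-mono f) (≤-reflexive (trans (∑-*ˡ WA (λ x → F x + flo)) (cong (WA *_) (trans (∑-+ F (λ _ → flo)) (cong (∑ F +_) (∑-const {n} flo)))))))

    sum2 : ∀ (F : Fin n → Fin n → ℚ) (F′ : Fin n → Fin n → Fin n → Fin n → ℚ) → (∀ x y → SA (F′ x y) ≤ WA * (F x y + flo)) →
      SA (λ s t → ∑ λ x → ∑ λ y → F′ x y s t) ≤ WA * ((∑ λ x → ∑ λ y → F x y) + N * (N * flo))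
    sum2 F F′ f = ≤-trans (≤-reflexive (S-∑ w (λ x s t → ∑ λ y → F′ x y s t))) (≤-trans (∑-mono λ x → sum1 (F x) (F′ x) (f x))
       (≤-reflexive (trans (∑-*ˡ WA (λ x → ∑ (F x) + N * flo)) (cong (WA *_) (trans (∑-+ (λ x → ∑ (F x)) (λ _ → N * flo)) (cong ((∑ λ x → ∑ (F x)) +_) (∑-const {n} (N * flo))))))))

    next-Φ : SA (λ s t → P′.Φ s t) ≤ WA * (P.Φ + Λ)
    next-Φ = ≤-trans (≤-reflexive (trans (S-cong w P′.Φ-def) (trans (S-+ w (λ s t → f₁ s t + f₂ s t + f₃ s t + f₄ s t) f₅) (cong (_+ SA f₅) (trans (S-+ w (λ s t → f₁ s t + f₂ s t + f₃ s t) f₄)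
          (cong (_+ SA f₄) (trans (S-+ w (λ s t → f₁ s t + f₂ s t) f₃) (cong (_+ SA f₃) (S-+ w f₁ f₂)))))))))
       (≤-trans (add≤ (add≤ (add≤ (add≤ (sum1 (P.Fd) (λ x s t → P′.Fd s t x) next-d) (sum1 (P.FO) (λ x s t → P′.FO s t x) next-O))
            (sum2 (λ x y → ν x y * P.FC x y) (λ x y s t → ν x y * P′.FC s t x y) (ν-next (P.FC) (λ x y s t → P′.FC s t x y) (λ x y → next-C {x} {y}))))
            (sum2 (λ x y → ν x y * P.FN x y) (λ x y s t → ν x y * P′.FN s t x y) (ν-next (P.FN) (λ x y s t → P′.FN s t x y) (λ x y → next-N {x} {y}))))
            (sum2 (P.FP) (λ x y s t → P′.FP s t x y) next-P))
         (≤-reflexive (trans (l WA (∑ P.Fd) (∑ P.FO) (∑ λ x → ∑ λ y → ν x y * P.FC x y) (∑ λ x → ∑ λ y → ν x y * P.FN x y) (∑ λ x → ∑ λ y → P.FP x y) N flo) (cong (λ a → WA * (a + Λ)) (sym P.Φ-def)))))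
      where
      f₁ f₂ f₃ f₄ f₅ : Fin n → Fin n → ℚ
      f₁ s t = ∑ (P′.Fd s t)
      f₂ s t = ∑ (P′.FO s t)
      f₃ s t = ∑ λ x → ∑ λ y → ν x y * P′.FC s t x y
      f₄ s t = ∑ λ x → ∑ λ y → ν x y * P′.FN s t x y
      f₅ s t = ∑ λ x → ∑ λ y → P′.FP s t x y
      l : ∀ W a b c d e N f → W * (a + N * f) + W * (b + N * f) + W * (c + N * (N * f)) + W * (d + N * (N * f)) + W * (e + N * (N * f))
           ≡ W * (a + b + c + d + e + (ι 2 * N + ι 3 * (N * N)) * f)
      l = solve 8 (λ W a b c d e N f → (W ⊗ (a ⊕ N ⊗ f) ⊕ W ⊗ (b ⊕ N ⊗ f) ⊕ W ⊗ (c ⊕ N ⊗ (N ⊗ f)) ⊕ W ⊗ (d ⊕ N ⊗ (N ⊗ f)) ⊕ W ⊗ (e ⊕ N ⊗ (N ⊗ f)))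
          ⊜ (W ⊗ (a ⊕ b ⊕ c ⊕ d ⊕ e ⊕ (Κ (ι 2) ⊗ N ⊕ Κ (ι 3) ⊗ (N ⊗ N)) ⊗ f))) refl

  module CherryStep {n} (A : Fin n → Fin n → Bool) (C : C4Free A) {T D q ε κ ρ B : ℚ} (K : ℕ)
    (cond : Cond (ι n) T D q ε κ ρ B (ι K)) (good : Good A T D q ε B) {u : ℕ} where
    open Hazard A C cond good

    -- Late in the run every pair of the family has mixed count at least qT/4. By `S-cherry` at
    -- least (u² - u)qT/8 of the next edges destroy the family, out of W ≤ N²q, and q cancels.
    cherry-rate : ∀ r → 0ℚ ≤ r → 0ℚ ≤ ι u * ι u - ι u → r * (N * N) ≤ ⅛ * ((ι u * ι u - ι u) * T) → ¼ * T ≤ D - ε * T →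
      ∀ (v : Vec (Fin n) u) → cf A v ≡ true → SA (λ s t → ⟦ cf (add A s t) v ⟧) ≤ WA * (1ℚ - r)
    cherry-rate r r0 uu rN late v hc = half (≤-trans (add≤ (≤-refl {ι 2 * X}) big) (Cherries.S-cherry A C v hc))
      where
      X = SA (λ s t → ⟦ cf (add A s t) v ⟧)
      c = q * (D - ε * T)
      big0 : (ι u * ι u - ι u) * (ι 2 * c) ≤ ι 2 * pairs Nm v
      big0 = pairs≥ {A = A} Nm (ι 2 * c) v hc (λ x y ne nc → ≤-trans (≤-reflexive (l c)) (add≤ (Nm≥ ne nc) (Nm≥ (λ e → ne (sym e))
               (¬true⇒false λ e → let z , p = ex-elim (λ z → A y z ∧ A z x) e in true≢false (ex-intro (λ z → A x z ∧ A z y) z (∧-intro (adj-sym (∧-right {A y z} p)) (adj-sym (∧-left p)))) nc))))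
        where l : ∀ c → ι 2 * c ≡ c + c
              l = solve 1 (λ c → (Κ (ι 2) ⊗ c) ⊜ (c ⊕ c)) refl
      W2 : WA + WA ≤ N * N * q * ι 2
      W2 = ≤-trans 2W≤ (≤-trans (≤-reflexive (l N q (1ℚ + ε))) (mulˡ (N0 ⊠ N0 ⊠ q≥0) 1+ε≤2))
        where l : ∀ N q e → N * (N * q * e) ≡ N * N * q * e
              l = solve 3 (λ N q e → (N ⊗ (N ⊗ q ⊗ e)) ⊜ (N ⊗ N ⊗ q ⊗ e)) refl
      big : ι 2 * (r * WA) ≤ pairs Nm v
      big = ≤-trans (≤-trans (cert ((r0 ⊠ sub W2) ⊞ (0≤ι 2 ⊠ q≥0 ⊠ sub rN) ⊞ (uu ⊠ q≥0 ⊠ sub late)) (l r WA N q (ι u * ι u - ι u) T (D - ε * T)))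
              (mulʳ (<⇒≤ (ℚP.positive⁻¹ ½)) big0)) (≤-reflexive (l2 (pairs Nm v)))
        where
        l : ∀ r W N q U T d → U * (ι 2 * (q * d)) * ½ ≡ ι 2 * (r * W) + (r * (N * N * q * ι 2 - (W + W)) + ι 2 * q * (⅛ * (U * T) - r * (N * N)) + U * q * (d - ¼ * T))
        l = solve 7 (λ r W N q U T d → (U ⊗ (Κ (ι 2) ⊗ (q ⊗ d)) ⊗ Κ ½)
            ⊜ (Κ (ι 2) ⊗ (r ⊗ W) ⊕ (r ⊗ (N ⊗ N ⊗ q ⊗ Κ (ι 2) ⊖ (W ⊕ W)) ⊕ Κ (ι 2) ⊗ q ⊗ (Κ ⅛ ⊗ (U ⊗ T) ⊖ r ⊗ (N ⊗ N)) ⊕ U ⊗ q ⊗ (d ⊖ Κ ¼ ⊗ T)))) refl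
        l2 : ∀ p → ι 2 * p * ½ ≡ p
        l2 = solve 1 (λ p → (Κ (ι 2) ⊗ p ⊗ Κ ½) ⊜ (p)) refl
      half : ι 2 * X + ι 2 * (r * WA) ≤ ι 2 * WA → X ≤ WA * (1ℚ - r)
      half p = cert (<⇒≤ (ℚP.positive⁻¹ ½) ⊠ sub p) (l X r WA)
        where l : ∀ X r W → W * (1ℚ - r) ≡ X + ½ * (ι 2 * W - (ι 2 * X + ι 2 * (r * W)))
              l = solve 3 (λ X r W → (W ⊗ (Κ 1ℚ ⊖ r)) ⊜ (X ⊕ Κ ½ ⊗ (Κ (ι 2) ⊗ W ⊖ (Κ (ι 2) ⊗ X ⊕ Κ (ι 2) ⊗ (r ⊗ W))))) refl

  -- A factor 1 - r of the cherry potential is spent on each of the steps h ≤ i < h + h.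
  rest : ℕ → ℕ → ℕ
  rest h i = h ℕ.⊓ (h ℕ.+ h ℕ.∸ i)

  rest-early : ∀ {h i} → i ℕ.< h → rest h i ≡ rest h (suc i)
  rest-early {h} {i} p = trans (ℕP.m≤n⇒m⊓n≡m (ge i (ℕP.<⇒≤ p))) (sym (ℕP.m≤n⇒m⊓n≡m (ge (suc i) p)))
    where
    ge : ∀ j → j ℕ.≤ h → h ℕ.≤ h ℕ.+ h ℕ.∸ j
    ge j q = ℕP.≤-trans (ℕP.≤-reflexive (sym (ℕP.m+n∸n≡m h h))) (ℕP.∸-monoʳ-≤ (h ℕ.+ h) q)

  ∸-suc : ∀ {m i} → i ℕ.< m → m ℕ.∸ i ≡ suc (m ℕ.∸ suc i)
  ∸-suc {m} {i} p = ℕP.+-∸-assoc 1 {m} {suc i} p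

  rest-late : ∀ {h i} → h ℕ.≤ i → i ℕ.< h ℕ.+ h → rest h i ≡ suc (rest h (suc i))
  rest-late {h} {i} p i<m = trans (ℕP.m≥n⇒m⊓n≡n (le i p)) (trans (∸-suc i<m) (cong suc (sym (ℕP.m≥n⇒m⊓n≡n (le (suc i) (ℕP.m≤n⇒m≤1+n p))))))
    where
    le : ∀ j → h ℕ.≤ j → h ℕ.+ h ℕ.∸ j ℕ.≤ h
    le j q = ℕP.≤-trans (ℕP.∸-monoʳ-≤ (h ℕ.+ h) q) (ℕP.≤-reflexive (ℕP.m+n∸n≡m h h))

  -- The trajectory and the combined potential

  module Proc (n K u h : ℕ) (T ε₀ ρ γ+1 B₀ r : ℚ) where

    N ν₀ μ : ℚ
    N = ι n
    ν₀ = inv N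
    μ = ι 2 * ν₀

    m : ℕ
    m = h ℕ.+ h

    -- A recurrence instead of a limiting differential equation: D i = 2i/n, and the product `q i`
    -- stands for exp(-8i³/n⁴) without leaving the rationals.
    D κ q ε b : ℕ → ℚ
    D zero = 0ℚ
    D (suc i) = D i + μ
    κ i = ι 6 * (D i * D i) * (ν₀ * ν₀)
    q zero = 1ℚ
    q (suc i) = q i * (1ℚ - κ i)
    ε zero = ε₀
    ε (suc i) = ε i * γ+1
    b zero = B₀
    b (suc i) = b i * γ+1

    Adj : Set
    Adj = Fin n → Fin n → Bool

    Φ : ℕ → Adj → ℚ
    Φ i A = Pot.Φ {n} K T (D i) (q i) (ε i) (b i) A

    opaque
      U : Adj → ℚ
      U A = sumV u (λ v → ⟦ cf A v ⟧)

      U-def : ∀ A → U A ≡ sumV u (λ v → ⟦ cf A v ⟧)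
      U-def A = refl

    pwr : ℕ → ℚ
    pwr i = pow (1ℚ - r) (rest h i)

    flo Λ : ℚ
    flo = pow ¼ K
    Λ = (ι 2 * N + ι 3 * (N * N)) * flo

    -- The second term pays in advance for the floors of all remaining steps. The third bounds the
    -- expected number of tuples that will still be cherry-free after step m, the union bound over
    -- tuples being built into `U`.
    Ψ : ℕ → Adj → ℚ
    Ψ i A = Φ i A + ι (m ℕ.∸ i) * Λ + pwr i * U A

    record Hyps : Set where
      field
        N>0 : 0ℚ < N
        T>0 : 0ℚ < T
        B₀>0 : 0ℚ < B₀
        ρ≥0 : 0ℚ ≤ ρ
        γ-def : γ+1 ≡ 1ℚ + ι 256 * ρ
        q>0 : ∀ i → i ℕ.≤ m → 0ℚ < q i
        ε>0 : 0ℚ < ε₀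
        KB₀ : ι 12 * ι K * ι 6 ≤ ⅛ * B₀
        cond : ∀ i → i ℕ.< m → Cond N T (D i) (q i) (ε i) (κ i) ρ (b m) (ι K)
        r1 : 0ℚ ≤ 1ℚ - r
        r0 : 0ℚ ≤ r
        rN : r * (N * N) ≤ ⅛ * ((ι u * ι u - ι u) * T)
        uu : 0ℚ ≤ ι u * ι u - ι u
        late : ∀ i → h ℕ.≤ i → i ℕ.< m → ¼ * T ≤ D i - ε i * T

    module Run (hyps : Hyps) where
      open Hyps hyps

      γ≥1 : 1ℚ ≤ γ+1
      γ≥1 = ≤-trans (cert (0≤ι 256 ⊠ ρ≥0) refl) (≤-reflexive (sym γ-def))

      γ>0 : 0ℚ < γ+1
      γ>0 = ℚP.<-≤-trans 0<1 γ≥1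

      εi>0 : ∀ i → 0ℚ < ε i
      εi>0 zero = ε>0
      εi>0 (suc i) = *-pos (εi>0 i) γ>0

      bi>0 : ∀ i → 0ℚ < b i
      bi>0 zero = B₀>0
      bi>0 (suc i) = *-pos (bi>0 i) γ>0

      b-suc : ∀ i → b i ≤ b (suc i)
      b-suc i = ≤-trans (≤-reflexive (sym (ℚP.*-identityʳ (b i)))) (mulˡ (<⇒≤ (bi>0 i)) γ≥1)

      b-mono : ∀ i j → b i ≤ b (j ℕ.+ i)
      b-mono i zero = ≤-refl
      b-mono i (suc j) = ≤-trans (b-mono i j) (b-suc (j ℕ.+ i))

      b≤ : ∀ {i} → i ℕ.≤ m → b i ≤ b m
      b≤ {i} p = ≤-trans (b-mono i (m ℕ.∸ i)) (≤-reflexive (cong b (ℕP.m∸n+n≡m p)))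

      B₀≤b : ∀ i → B₀ ≤ b i
      B₀≤b i = ≤-trans (b-mono 0 i) (≤-reflexive (cong b (ℕP.+-identityʳ i)))

      μN : μ * N ≡ ι 2
      μN = trans (l (ι 2) ν₀ N) (trans (cong (ι 2 *_) (inv-* N>0)) (ℚP.*-identityʳ (ι 2)))
        where l : ∀ a b c → a * b * c ≡ a * (c * b)
              l = solve 3 (λ a b c → (a ⊗ b ⊗ c) ⊜ (a ⊗ (c ⊗ b))) refl

      μ0 : 0ℚ ≤ μ
      μ0 = 0≤ι 2 ⊠ <⇒≤ (inv-pos N>0)

      D≥0 : ∀ i → 0ℚ ≤ D i
      D≥0 zero = ≤-refl
      D≥0 (suc i) = D≥0 i ⊞ μ0

      pwr≥0 : ∀ i → 0ℚ ≤ pwr i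
      pwr≥0 i = pow-nonneg (rest h i) r1

      U≥0 : ∀ A → 0ℚ ≤ U A
      U≥0 A = ≤-trans (sumV-nonneg u (λ v → ⟦⟧≥0 (cf A v))) (≤-reflexive (sym (U-def A)))

      Λ≥0 : 0ℚ ≤ Λ
      Λ≥0 = ((0≤ι 2 ⊠ 0≤ι n) ⊞ (0≤ι 3 ⊠ (0≤ι n ⊠ 0≤ι n))) ⊠ pow-nonneg K (<⇒≤ (ℚP.positive⁻¹ ¼))

      Φ≥0 : ∀ i A → 0ℚ ≤ Φ i A
      Φ≥0 i A = Pot.Φ≥0 K T (D i) (q i) (ε i) (b i) A

      Φ≤Ψ : ∀ i A → Φ i A ≤ Ψ i A
      Φ≤Ψ i A = cert ((0≤ι (m ℕ.∸ i) ⊠ Λ≥0) ⊞ (pwr≥0 i ⊠ U≥0 A)) (l (Φ i A) (ι (m ℕ.∸ i) * Λ) (pwr i * U A))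
        where l : ∀ a b c → a + b + c ≡ a + (b + c)
              l = solve 3 (λ a b c → (a ⊕ b ⊕ c) ⊜ (a ⊕ (b ⊕ c))) refl

      U≤Ψ : ∀ i A → pwr i * U A ≤ Ψ i A
      U≤Ψ i A = cert (Φ≥0 i A ⊞ (0≤ι (m ℕ.∸ i) ⊠ Λ≥0)) (ℚP.+-comm (Φ i A + ι (m ℕ.∸ i) * Λ) (pwr i * U A))

      Ψ≥0 : ∀ i A → 0ℚ ≤ Ψ i A
      Ψ≥0 i A = ≤-trans (Φ≥0 i A) (Φ≤Ψ i A)

      good : ∀ i → i ℕ.≤ m → (A : Adj) → C4Free A → Φ i A < 1ℚ → Good A T (D i) (q i) (ε i) (b m)
      good i p A C Φ1 = Pot.Extract.good K T (D i) (q i) (ε i) (b i) A N>0 T>0 (q>0 i p) (εi>0 i) (bi>0 i) (D≥0 i) (b m) (b≤ p) C Φ1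

      module Next (i : ℕ) (i<m : i ℕ.< m) (A : Adj) (C : C4Free A) (Φ1 : Φ i A < 1ℚ) where
        open Quantities A using (SA; WA)
        private
          gd = good i (ℕP.<⇒≤ i<m) A C Φ1
          w = valid A
          W≥0 : 0ℚ ≤ WA
          W≥0 = S-nonneg w (λ _ _ _ → 0≤1)
          module PN = PotNext {n} A C {T} {D i} {q i} {ε i} {κ i} {ρ} {b m} {b i} K (cond i i<m) gd γ+1 (inv γ+1) γ-def (<⇒≤ (inv-pos γ>0)) (inv-* γ>0)
                        μ μ0 μN (εi>0 i) B₀ B₀>0 (B₀≤b i) KB₀

        W>0 : 0ℚ < WA
        W>0 = PN.W>0

        next-Φ : SA (λ s t → Φ (suc i) (add A s t)) ≤ WA * (Φ i A + Λ)
        next-Φ = PN.next-Φ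

        -- A tuple that contains a cherry keeps it. For a cherry-free one nothing is claimed before
        -- step h, where `rest` is constant, and each later step spends one factor 1 - r.
        cf-step : ∀ (v : Vec (Fin n) u) → SA (λ s t → ⟦ cf (add A s t) v ⟧) * pwr (suc i) ≤ WA * (pwr i * ⟦ cf A v ⟧)
        cf-step v with bool-dec (cf A v)
        ... | inj₂ hc = ≤-trans (mulʳ (pwr≥0 (suc i)) (S-mono w (λ s t vd → ≤-reflexive (⟦⟧-false (¬true⇒false λ e → true≢false (Cherries.cf-mono A C v (valid⇒op {A = A} vd) e) hc)))))
             (≤-trans (≤-reflexive (trans (cong (_* pwr (suc i)) (trans (S-const w 0ℚ) (ℚP.*-zeroˡ WA))) (ℚP.*-zeroˡ (pwr (suc i))))) (W≥0 ⊠ (pwr≥0 i ⊠ ⟦⟧≥0 (cf A v))))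
        ... | inj₁ hc = ≤-trans (go (ℕP.≤-total h i)) (≤-reflexive (cong (WA *_) (sym (trans (cong (pwr i *_) (⟦⟧-true hc)) (ℚP.*-identityʳ (pwr i))))))
          where
          X = SA (λ s t → ⟦ cf (add A s t) v ⟧)
          X≤W : X ≤ WA
          X≤W = S-mono w (λ s t _ → ⟦⟧≤1 (cf (add A s t) v))
          lateC : h ℕ.≤ i → X * pwr (suc i) ≤ WA * pwr i
          lateC p = ≤-trans (mulʳ (pwr≥0 (suc i)) (CherryStep.cherry-rate A C K (cond i i<m) gd {u} r r0 uu rN (late i p i<m) v hc))
             (≤-reflexive (trans (ℚP.*-assoc WA (1ℚ - r) (pwr (suc i))) (cong (WA *_) (sym (cong (pow (1ℚ - r)) (rest-late p i<m))))))
          go : (h ℕ.≤ i) ⊎ (i ℕ.≤ h) → X * pwr (suc i) ≤ WA * pwr i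
          go (inj₁ p) = lateC p
          go (inj₂ p) with ℕP.m≤n⇒m<n∨m≡n p
          ... | inj₁ p′ = ≤-trans (mulʳ (pwr≥0 (suc i)) X≤W) (≤-reflexive (cong (λ j → WA * pow (1ℚ - r) j) (sym (rest-early p′))))
          ... | inj₂ e = lateC (ℕP.≤-reflexive (sym e))

        next-Ψ : SA (λ s t → Ψ (suc i) (add A s t)) ≤ WA * Ψ i A
        next-Ψ = ≤-trans (≤-reflexive (trans (S-+ w (λ s t → Φ (suc i) (add A s t) + c) (λ s t → pwr (suc i) * U (add A s t)))
               (cong₂ _+_ (trans (S-+ w (λ s t → Φ (suc i) (add A s t)) (λ _ _ → c)) (cong (SA (λ s t → Φ (suc i) (add A s t)) +_) (S-const w c)))
                 (trans (S-* w (pwr (suc i)) (λ s t → U (add A s t))) (cong (pwr (suc i) *_) (trans (S-cong w (λ s t → U-def (add A s t))) (S-sumV w u (λ v s t → ⟦ cf (add A s t) v ⟧))))))))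
            (≤-trans (add≤ (add≤ next-Φ (≤-refl {c * WA})) uterm) (≤-reflexive (trans (l WA (Φ i A) Λ (ι (m ℕ.∸ suc i)) (pwr i * U A))
               (cong (λ a → WA * (Φ i A + a * Λ + pwr i * U A)) (trans (sym (ι-suc (m ℕ.∸ suc i))) (cong ι (sym (∸-suc i<m))))))))
          where
          c = ι (m ℕ.∸ suc i) * Λ
          l : ∀ W F L k u → W * (F + L) + k * L * W + W * u ≡ W * (F + (1ℚ + k) * L + u)
          l = solve 5 (λ W F L k u → (W ⊗ (F ⊕ L) ⊕ k ⊗ L ⊗ W ⊕ W ⊗ u) ⊜ (W ⊗ (F ⊕ (Κ 1ℚ ⊕ k) ⊗ L ⊕ u))) refl
          uterm : pwr (suc i) * sumV u (λ v → SA (λ s t → ⟦ cf (add A s t) v ⟧)) ≤ WA * (pwr i * U A)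
          uterm = ≤-trans (≤-reflexive (sym (sumV-* u (pwr (suc i)) (λ v → SA (λ s t → ⟦ cf (add A s t) v ⟧)))))
             (≤-trans (sumV-mono u (λ v → ≤-trans (≤-reflexive (ℚP.*-comm (pwr (suc i)) (SA (λ s t → ⟦ cf (add A s t) v ⟧)))) (≤-trans (cf-step v) (≤-reflexive (sym (ℚP.*-assoc WA (pwr i) ⟦ cf A v ⟧))))))
               (≤-reflexive (trans (sumV-* u (WA * pwr i) (λ v → ⟦ cf A v ⟧)) (trans (ℚP.*-assoc WA (pwr i) (sumV u (λ v → ⟦ cf A v ⟧))) (cong (λ a → WA * (pwr i * a)) (sym (U-def A)))))))

  -- The process

  sumf : {X : Set} → (X → ℚ) → List X → ℚ
  sumf φ xs = sumℚ (map φ xs)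

  module _ {X : Set} where
    sumf-++ : ∀ (φ : X → ℚ) xs ys → sumf φ (xs ++ ys) ≡ sumf φ xs + sumf φ ys
    sumf-++ φ [] ys = sym (ℚP.+-identityˡ (sumf φ ys))
    sumf-++ φ (x ∷ xs) ys = trans (cong (φ x +_) (sumf-++ φ xs ys)) (sym (ℚP.+-assoc (φ x) (sumf φ xs) (sumf φ ys)))

    sumf-concatMap : ∀ {Y : Set} (φ : X → ℚ) (f : Y → List X) ys → sumf φ (concatMap f ys) ≡ sumf (λ y → sumf φ (f y)) ys
    sumf-concatMap φ f [] = refl
    sumf-concatMap φ f (y ∷ ys) = trans (sumf-++ φ (f y) (concatMap f ys)) (cong (sumf φ (f y) +_) (sumf-concatMap φ f ys))

    sumf-map : ∀ {Y : Set} (φ : X → ℚ) (g : Y → X) ys → sumf φ (map g ys) ≡ sumf (λ y → φ (g y)) ys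
    sumf-map φ g [] = refl
    sumf-map φ g (y ∷ ys) = cong (φ (g y) +_) (sumf-map φ g ys)

    sumf-filter : ∀ (p : X → Bool) (ψ φ : X → ℚ) → (∀ x → ⟦ p x ⟧ * φ x ≡ ψ x) → ∀ xs → sumf φ (filterᵇ p xs) ≡ sumf ψ xs
    sumf-filter p ψ φ h [] = refl
    sumf-filter p ψ φ h (x ∷ xs) with p x | h x
    ... | true | e = cong₂ _+_ (trans (sym (ℚP.*-identityˡ (φ x))) e) (sumf-filter p ψ φ h xs)
    ... | false | e = trans (sumf-filter p ψ φ h xs) (sym (trans (cong (_+ sumf ψ xs) (trans (sym e) (ℚP.*-zeroˡ (φ x)))) (ℚP.+-identityˡ (sumf ψ xs))))

    sumf-length : ∀ (xs : List X) → sumf (λ _ → 1ℚ) xs ≡ ι (length xs)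
    sumf-length [] = refl
    sumf-length (x ∷ xs) = trans (cong (1ℚ +_) (sumf-length xs)) (sym (ι-suc (length xs)))

  bit : Bool → ℕ
  bit true = 1
  bit false = 0

  ι-bit : ∀ b → ι (bit b) ≡ ⟦ b ⟧
  ι-bit true = refl
  ι-bit false = refl

  degree-cons : ∀ {n} (G : Graph n) s t v → degree ((s , t) ∷ G) v ≡ bit ((s == v) ∨ (t == v)) ℕ.+ degree G v
  degree-cons G s t v with (s == v) ∨ (t == v)
  ... | true = refl
  ... | false = refl

  opaque
    unfolding ∑
    sumf-tabulate : ∀ {n} {X : Set} (φ : X → ℚ) (f : Fin n → X) → sumf φ (tabulate f) ≡ ∑ (λ i → φ (f i))
    sumf-tabulate {zero} φ f = refl
    sumf-tabulate {suc n} φ f = cong (φ (f zero) +_) (sumf-tabulate φ (λ i → f (suc i)))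

  opaque
    unfolding add eb
    adj-cons : ∀ {n} (G : Graph n) s t → adj ((s , t) ∷ G) ≡ add (adj G) s t
    adj-cons G s t = refl

  hasC4-true : ∀ {n} (G : Graph n) a b c d → ¬ a ≡ b → ¬ a ≡ c → ¬ a ≡ d → ¬ b ≡ c → ¬ b ≡ d → ¬ c ≡ d →
    adj G a b ≡ true → adj G b c ≡ true → adj G c d ≡ true → adj G d a ≡ true → hasC4 G ≡ true
  hasC4-true G a b c d p q r u v w e f g h = ex-intro _ a (ex-intro _ b (ex-intro _ c (ex-intro _ d
     (∧-intro (cong not (==-false p)) (∧-intro (cong not (==-false q)) (∧-intro (cong not (==-false r)) (∧-intro (cong not (==-false u)) (∧-intro (cong not (==-false v)) (∧-intro (cong not (==-false w))
       (∧-intro e (∧-intro f (∧-intro g h))))))))))))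

  C4Free⇒¬hasC4 : ∀ {n} (G : Graph n) → C4Free (adj G) → hasC4 G ≡ false
  C4Free⇒¬hasC4 {n} G C = ¬true⇒false λ e → go e
    where
    open C4Free C
    cyc : Fin n → Fin n → Fin n → Fin n → Bool
    cyc a b c d = not (a == b) ∧ not (a == c) ∧ not (a == d) ∧ not (b == c) ∧ not (b == d) ∧ not (c == d) ∧ adj G a b ∧ adj G b c ∧ adj G c d ∧ adj G d a
    ne : ∀ {x y : Fin n} → not (x == y) ≡ true → ¬ x ≡ y
    ne {x} h refl = true≢false (==-refl x) (not-true h)
    go : hasC4 G ≡ true → ⊥
    go e with ex-elim (λ a → ex λ b → ex λ c → ex λ d → cyc a b c d) e
    ... | a , e₁ with ex-elim (λ b → ex λ c → ex λ d → cyc a b c d) e₁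
    ... | b , e₂ with ex-elim (λ c → ex λ d → cyc a b c d) e₂
    ... | c , e₃ with ex-elim (λ d → cyc a b c d) e₃
    ... | d , e₄ = ne bd (unique (ne ac) ab bc (adj-sym da) (adj-sym cd′))
      where
      r1 = ∧-right {not (a == b)} e₄
      ac = ∧-left {not (a == c)} r1
      r2 = ∧-right {not (a == c)} r1
      r3 = ∧-right {not (a == d)} r2
      r4 = ∧-right {not (b == c)} r3
      bd = ∧-left {not (b == d)} r4
      r5 = ∧-right {not (b == d)} r4
      r6 = ∧-right {not (c == d)} r5
      ab = ∧-left {adj G a b} r6
      r7 = ∧-right {adj G a b} r6
      bc = ∧-left {adj G b c} r7
      r8 = ∧-right {adj G b c} r7
      cd′ = ∧-left {adj G c d} r8
      da = ∧-right {adj G c d} r8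

  -- A walk i a b j closes up with ij to a genuine 4-cycle, since i and j are distinct and not
  -- adjacent; conversely an open pair keeps the graph C₄-free by `add-C4Free`.
  permitted : ∀ {n} (G : Graph n) → C4Free (adj G) → ∀ i j → ¬ i ≡ j →
    not (adj G i j) ∧ not (hasC4 ((i , j) ∷ G)) ≡ op (adj G) i j
  permitted G C i j i≢j = bool-ext to from
    where
    open C4Free C
    to : not (adj G i j) ∧ not (hasC4 ((i , j) ∷ G)) ≡ true → op (adj G) i j ≡ true
    to h = op-intro i≢j na (¬true⇒false walk)
      where
      na = not-true (∧-left {not (adj G i j)} h)
      adj′ : ∀ {x y} → add (adj G) i j x y ≡ true → adj ((i , j) ∷ G) x y ≡ true
      adj′ {x} {y} e = subst (λ A → A x y ≡ true) (sym (adj-cons G i j)) e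
      walk : w3 (adj G) i j ≡ true → ⊥
      walk e with w3-elim {A = adj G} e
      ... | a , b , p , q , r = true≢false (hasC4-true ((i , j) ∷ G) i a b j (λ { refl → adj-irr p }) (λ { refl → true≢false r na }) i≢j
             (λ { refl → adj-irr q }) (λ { refl → true≢false p na }) (λ { refl → adj-irr r })
             (adj′ (add-old {A = adj G} p)) (adj′ (add-old {A = adj G} q)) (adj′ (add-old {A = adj G} r)) (adj′ (add-ts {A = adj G})))
           (not-true (∧-right {not (adj G i j)} h))
    from : op (adj G) i j ≡ true → not (adj G i j) ∧ not (hasC4 ((i , j) ∷ G)) ≡ true
    from h = ∧-intro (cong not (op⇒nadj {A = adj G} h)) (cong not (C4Free⇒¬hasC4 ((i , j) ∷ G) (subst C4Free (sym (adj-cons G i j)) (add-C4Free C h))))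

  opaque
    unfolding valid S
    admissible-sum : ∀ {n} (G : Graph n) → C4Free (adj G) → ∀ (φ : Fin n × Fin n → ℚ) → sumf φ (admissible G) ≡ S (valid (adj G)) (λ s t → φ (s , t))
    admissible-sum {n} G C φ = trans (sumf-filter _ χ φ (λ { (i , j) → refl }) (allPairs n)) (trans (sumf-concatMap χ row′ (allFin n)) (trans (sumf-tabulate (λ i → sumf χ (row′ i)) (λ i → i))
        (∑-cong λ i → trans (sumf-map χ (i ,_) (filterᵇ (lt i) (allFin n))) (trans (sumf-filter (lt i) (λ j → ⟦ lt i j ⟧ * χ (i , j)) (λ j → χ (i , j)) (λ _ → refl) (allFin n))
          (trans (sumf-tabulate (λ j → ⟦ lt i j ⟧ * χ (i , j)) (λ j → j)) (∑-cong λ j → pt i j (bool-dec (lt i j))))))))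
      where
      χ : Fin n × Fin n → ℚ
      χ (i , j) = ⟦ not (adj G i j) ∧ not (hasC4 ((i , j) ∷ G)) ⟧ * φ (i , j)
      row′ : Fin n → List (Fin n × Fin n)
      row′ i = map (i ,_) (filterᵇ (lt i) (allFin n))
      pt : ∀ i j → (lt i j ≡ true) ⊎ (lt i j ≡ false) → ⟦ lt i j ⟧ * (⟦ not (adj G i j) ∧ not (hasC4 ((i , j) ∷ G)) ⟧ * φ (i , j)) ≡ ⟦ valid (adj G) i j ⟧ * φ (i , j)
      pt i j (inj₂ e) = trans (cong (λ b → ⟦ b ⟧ * (⟦ not (adj G i j) ∧ not (hasC4 ((i , j) ∷ G)) ⟧ * φ (i , j))) e)
         (trans (ℚP.*-zeroˡ (⟦ not (adj G i j) ∧ not (hasC4 ((i , j) ∷ G)) ⟧ * φ (i , j))) (sym (trans (cong (λ b → ⟦ b ∧ op (adj G) i j ⟧ * φ (i , j)) e) (ℚP.*-zeroˡ (φ (i , j))))))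
      pt i j (inj₁ e) = trans (cong₂ (λ b c → ⟦ b ⟧ * (⟦ c ⟧ * φ (i , j))) e (permitted G C i j i≢j))
         (trans (ℚP.*-identityˡ (⟦ op (adj G) i j ⟧ * φ (i , j))) (sym (cong (λ b → ⟦ b ∧ op (adj G) i j ⟧ * φ (i , j)) e)))
        where
        i≢j : ¬ i ≡ j
        i≢j refl = true≢false e (lt-no {i = i} {i} (ℕP.<-irrefl refl))

  recip : ∀ k → ι (suc k) * (ℤ.+ 1 / suc k) ≡ 1ℚ
  recip k = ℚP.toℚᵘ-injective (ℚᵘP.≃-trans (ℚP.toℚᵘ-homo-* (ι (suc k)) (ℤ.+ 1 / suc k)) (ℚᵘP.≃-trans (ℚᵘP.*-cong (toℚᵘ-ι (suc k)) (ℚP.toℚᵘ-fromℚᵘ (ℚᵘ.mkℚᵘ (ℤ.+ 1) k)))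
      (ℚᵘ.*≡* (trans (ℤP.*-identityʳ _) (trans (ℤP.*-identityʳ _) (sym (trans (ℤP.*-identityˡ _) (cong (λ a → ℤ.+ suc a) (ℕP.+-identityʳ k)))))))))

  module Lower {n} (P : Graph n → Bool) where

    fp : ℕ → Graph n → ℚ
    fp f G = finalProb f P G

    -- One step of `finalProb` with the list of admissible pairs as a parameter, so that the list
    -- can be analysed together with the equation for its length.
    Unfolded : ℕ → Graph n → List (Fin n × Fin n) → ℚ → Set
    Unfolded f G [] x = x ≡ ⟦ P G ⟧
    Unfolded f G (e ∷ es) x = x ≡ sumf (λ e → fp f (e ∷ G)) (e ∷ es) * (ℤ.+ 1 / suc (length es))

    unfolded : ∀ f G → Unfolded f G (admissible G) (fp (suc f) G)
    unfolded f G with admissible G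
    ... | [] = refl
    ... | e ∷ es = refl

    -- If no pair is admissible the process has stopped and no average exists. The disjunction
    -- covers this: either the bound holds for the present graph, or `W` is positive and the case
    -- does not occur.
    avg : ∀ f (G : Graph n) c → C4Free (adj G) → (c ≤ ⟦ P G ⟧ ⊎ 0ℚ < W (valid (adj G))) →
      c * W (valid (adj G)) ≤ S (valid (adj G)) (λ s t → fp f ((s , t) ∷ G)) → c ≤ fp (suc f) G
    avg f G c C h0 h = use (admissible G) refl (unfolded f G)
      where
      len : ∀ xs → admissible G ≡ xs → ι (length xs) ≡ W (valid (adj G))
      len xs e = trans (sym (sumf-length xs)) (trans (cong (sumf (λ _ → 1ℚ)) (sym e)) (admissible-sum G C (λ _ → 1ℚ)))
      base : (c ≤ ⟦ P G ⟧) ⊎ (0ℚ < W (valid (adj G))) → 0ℚ ≡ W (valid (adj G)) → c ≤ ⟦ P G ⟧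
      base (inj₁ p) e = p
      base (inj₂ p) e = ⊥-elim (ℚP.<-irrefl e p)
      use : ∀ xs → admissible G ≡ xs → Unfolded f G xs (fp (suc f) G) → c ≤ fp (suc f) G
      use [] eq e = ≤-trans (base h0 (len [] eq)) (≤-reflexive (sym e))
      use (x ∷ xs) eq e = ≤-trans (≤-reflexive (trans (sym (ℚP.*-identityʳ c)) (trans (cong (c *_) (sym (recip (length xs)))) (sym (ℚP.*-assoc c (ι (suc (length xs))) i)))))
        (≤-trans (mulʳ i≥0 (≤-trans (≤-trans (≤-reflexive (cong (c *_) (len (x ∷ xs) eq))) h) (≤-reflexive (trans (sym (admissible-sum G C (λ e → fp f (e ∷ G)))) (cong (sumf (λ e → fp f (e ∷ G))) eq)))))
          (≤-reflexive (sym e)))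
        where
        i = ℤ.+ 1 / suc (length xs)
        i≥0 : 0ℚ ≤ i
        i≥0 = ℚP.nonNegative⁻¹ i {{ℚP.normalize-nonNeg 1 (suc (length xs))}}

    step-C : ∀ (G : Graph n) {s t : Fin n} → C4Free (adj G) → valid (adj G) s t ≡ true → C4Free (adj ((s , t) ∷ G))
    step-C G {s} {t} C v = subst C4Free (sym (adj-cons G s t)) (add-C4Free C (valid⇒op {A = adj G} v))

    fp≥0 : ∀ f (G : Graph n) → C4Free (adj G) → 0ℚ ≤ fp f G
    fp≥0 zero G C = ⟦⟧≥0 (P G)
    fp≥0 (suc f) G C = avg f G 0ℚ C (inj₁ (⟦⟧≥0 (P G))) (≤-trans (≤-reflexive (ℚP.*-zeroˡ (W (valid (adj G)))))
       (S-nonneg (valid (adj G)) (λ s t v → fp≥0 f ((s , t) ∷ G) (step-C G C v))))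

    -- `degree` counts list entries; along the process this agrees with adjacency because no edge is
    -- listed twice and loops are never added.
    Counted : Graph n → Set
    Counted G = ∀ (v : Fin n) → ι (degree G v) ≡ Quantities.deg (adj G) v

    step-counted : ∀ (G : Graph n) {s t : Fin n} → C4Free (adj G) → valid (adj G) s t ≡ true → Counted G → Counted ((s , t) ∷ G)
    step-counted G {s} {t} C vd cnt v = trans (trans (cong ι (degree-cons G s t v)) (trans (ι-+ (bit ((s == v) ∨ (t == v))) (degree G v)) (cong (_+ ι (degree G v)) (ι-bit ((s == v) ∨ (t == v)))))) (trans (cong₂ _+_ (Step.⟦∨⟧ (adj G) C s t hst (s == v) (t == v) (λ p q → op⇒≢ {A = adj G} hst (trans (==-sound p) (sym (==-sound q))))) (cnt v))
         (trans (ℚP.+-comm (δ s v + δ t v) (Quantities.deg (adj G) v)) (sym (trans (cong (λ (A : Fin n → Fin n → Bool) → Quantities.deg A v) (adj-cons G s t)) (Step.deg′ (adj G) C s t hst v)))))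
      where
      hst = valid⇒op {A = adj G} vd

  -- Greedy choice: each chosen vertex is removed from `p`, so u rounds either fill the vector or
  -- exhaust `p`.
  pick : ∀ {n} (A : Fin n → Fin n → Bool) u (p : Fin n → Bool) → (∀ x y → p x ≡ true → p y ≡ true → ¬ x ≡ y → Quantities.cod A x y ≡ false) →
    (∑ (λ x → ⟦ p x ⟧) ≤ ι u) ⊎ Σ (Vec (Fin n) u) (λ v → All (λ x → p x ≡ true) v × cf A v ≡ true)
  pick A zero p h = inj₂ ([] , [] , refl)
  pick {n} A (suc u) p h with bool-dec (ex p)
  ... | inj₂ e = inj₁ (≤-trans (≤-reflexive (∑-none p (λ i q → true≢false (ex-intro p i q) e))) (0≤ι (suc u)))
  ... | inj₁ e with ex-elim p e
  ... | i , pi with pick A u (λ x → p x ∧ not (i == x)) (λ x y q r → h x y (∧-left q) (∧-left r))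
  ...   | inj₁ le = inj₁ (≤-trans (∑-mono pt) (≤-trans (≤-reflexive (trans (∑-+ (λ x → δ i x * 1ℚ) (λ x → ⟦ p x ∧ not (i == x) ⟧)) (cong (_+ ∑ (λ x → ⟦ p x ∧ not (i == x) ⟧)) (∑-δ i (λ _ → 1ℚ)))))
            (≤-trans (ℚP.+-monoʳ-≤ 1ℚ le) (≤-reflexive (sym (ι-suc u))))))
    where
    pt : ∀ x → ⟦ p x ⟧ ≤ δ i x * 1ℚ + ⟦ p x ∧ not (i == x) ⟧
    pt x = f (p x) (i == x)
      where f : ∀ a b → ⟦ a ⟧ ≤ ⟦ b ⟧ * 1ℚ + ⟦ a ∧ not b ⟧
            f true true = ≤-refl
            f true false = ≤-refl
            f false true = 0≤1
            f false false = ≤-refl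
  ...   | inj₂ (v , a , c) = inj₂ (i ∷ v , pi ∷ weaken a , ∧-intro (ok v a) c)
    where
    weaken : ∀ {k} {v : Vec (Fin n) k} → All (λ x → p x ∧ not (i == x) ≡ true) v → All (λ x → p x ≡ true) v
    weaken [] = []
    weaken (q ∷ a) = ∧-left q ∷ weaken a
    ok : ∀ {k} (v : Vec (Fin n) k) → All (λ x → p x ∧ not (i == x) ≡ true) v → okᵇ A i v ≡ true
    ok [] [] = refl
    ok (x ∷ v) (q ∷ a) = ok-cons {A = A} {v = v} ne (h i x pi (∧-left q) ne) (ok v a)
      where
      ne : ¬ i ≡ x
      ne refl = true≢false (==-refl i) (not-true (∧-right {p i} q))

  -- In a C₄-free extension A′ of A the new neighbours of a vertex form a cherry-free family of A.
  deg-extend : ∀ {n} {A A′ : Fin n → Fin n → Bool} u → C4Free A′ → (∀ x y → A x y ≡ true → A′ x y ≡ true) → (∀ x y → A x y ≡ true → A y x ≡ true) →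
    (∀ (v : Vec (Fin n) u) → cf A v ≡ false) → ∀ w → Quantities.deg A′ w ≤ Quantities.deg A w + ι u
  deg-extend {n} {A} {A′} u C′ ext sy none w = go (pick A u p noc)
    where
    p : Fin n → Bool
    p x = A′ w x ∧ not (A w x)
    noc : ∀ x y → p x ≡ true → p y ≡ true → ¬ x ≡ y → Quantities.cod A x y ≡ false
    noc x y q r ne = ¬true⇒false λ e → let z , f = ex-elim (λ z → A x z ∧ A z y) e in
      true≢false (sy x w (subst (λ z → A x z ≡ true) (C4Free.unique C′ ne (ext x z (∧-left f)) (ext z y (∧-right {A x z} f)) (C4Free.adj-sym C′ (∧-left q)) (∧-left r)) (∧-left f)))
        (not-true (∧-right {A′ w x} q))
    go : _ → Quantities.deg A′ w ≤ Quantities.deg A w + ι u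
    go (inj₂ (v , _ , c)) = ⊥-elim (true≢false c (none v))
    go (inj₁ le) = ≤-trans (∑-mono (λ x → f (A′ w x) (A w x))) (≤-trans (≤-reflexive (∑-+ (λ x → ⟦ A w x ⟧) (λ x → ⟦ p x ⟧))) (ℚP.+-monoʳ-≤ (Quantities.deg A w) le))
      where f : ∀ a b → ⟦ a ⟧ ≤ ⟦ b ⟧ + ⟦ a ∧ not b ⟧
            f true true = ≤-refl
            f true false = ≤-refl
            f false b = ⟦⟧≥0 b ⊞ ≤-refl

  compare : ∀ a b → (a ≤ b) ⊎ (b < a)
  compare a b with a ℚP.≤? b
  ... | yes p = inj₁ p
  ... | no p = inj₂ (ℚP.≰⇒> p)

  -- Lower bound for the probability of success

  module Main (n K u h : ℕ) (T ε₀ ρ γ+1 B₀ r : ℚ) (hyps : Proc.Hyps n K u h T ε₀ ρ γ+1 B₀ r) (P : Graph n → Bool)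
    (hP : ∀ G → (∀ v → ι (degree G v) ≤ (Proc.D n K u h T ε₀ ρ γ+1 B₀ r (h ℕ.+ h) + Proc.ε n K u h T ε₀ ρ γ+1 B₀ r (h ℕ.+ h) * T) + ι u) → P G ≡ true) where
    open Proc n K u h T ε₀ ρ γ+1 B₀ r
    open Run hyps
    open Lower P

    Δm : ℚ
    Δm = D m + ε m * T

    -- After step m nothing random is needed: every C₄-free extension of `A` satisfies `P`, whatever
    -- edges follow and however much fuel is left.
    endgame : ∀ (A : Adj) → C4Free A → (∀ v → Quantities.deg A v ≤ Δm) → (∀ (v : Vec (Fin n) u) → cf A v ≡ false) →
      ∀ f G → C4Free (adj G) → Counted G → (∀ x y → A x y ≡ true → adj G x y ≡ true) → 1ℚ ≤ fp f G
    endgame A C hd none f G CG cnt ext = go f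
      where
      PG : P G ≡ true
      PG = hP G (λ v → ≤-trans (≤-reflexive (cnt v)) (≤-trans (deg-extend u CG ext (λ x y → C4Free.adj-sym C) none v) (ℚP.+-monoˡ-≤ (ι u) (hd v))))
      go : ∀ f → 1ℚ ≤ fp f G
      go zero = ≤-reflexive (sym (⟦⟧-true PG))
      go (suc f) = avg f G 1ℚ CG (inj₁ (≤-reflexive (sym (⟦⟧-true PG)))) (≤-trans (≤-reflexive (ℚP.*-identityˡ (W (valid (adj G)))))
        (S-mono (valid (adj G)) (λ s t v → endgame A C hd none f ((s , t) ∷ G) (step-C G CG v) (step-counted G CG v cnt)
           (λ x y e → subst (λ B → B x y ≡ true) (sym (adj-cons G s t)) (add-old {A = adj G} (ext x y e))))))

    -- At step m the weight `pwr m` is 1, so `U A` is below 1; being a count, it has no nonzero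
    -- term.
    final-step : ∀ (A : Adj) → Ψ m A < 1ℚ → ∀ (v : Vec (Fin n) u) → cf A v ≡ false
    final-step A Ψ1 v = ¬true⇒false λ e → ℚP.<-irrefl refl (ℚP.≤-<-trans (≤-trans (≤-reflexive (sym (⟦⟧-true e)))
          (≤-trans (sumV-term (λ v → ⟦⟧≥0 (cf A v)) v) (≤-trans (≤-reflexive (trans (sym (U-def A)) (trans (sym (ℚP.*-identityˡ (U A))) (cong (_* U A) (sym pm))))) (U≤Ψ m A)))) Ψ1)
      where
      pm : pwr m ≡ 1ℚ
      pm = cong (pow (1ℚ - r)) (trans (cong (h ℕ.⊓_) (ℕP.n∸n≡0 m)) (ℕP.⊓-zeroʳ h))

    SA′ : Adj → (Fin n → Fin n → ℚ) → ℚ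
    SA′ A = S (valid A)

    average : ∀ (A : Adj) {b : ℚ} {f g : Fin n → Fin n → ℚ} → SA′ A g ≤ W (valid A) * b →
      (∀ s t → valid A s t ≡ true → 1ℚ - g s t ≤ f s t) → (1ℚ - b) * W (valid A) ≤ SA′ A f
    average A {b = b} {f} {g} le pt = ≤-trans (≤-trans (≤-reflexive (l b (W (valid A)))) (≤-trans (ℚP.+-monoʳ-≤ (W (valid A)) (neg≤ le))
         (≤-reflexive (sym (trans (S-+ (valid A) (λ _ _ → 1ℚ) (λ s t → - g s t)) (cong (W (valid A) +_) (S-neg (valid A) g))))))) (S-mono (valid A) pt)
      where
      l : ∀ p w → (1ℚ - p) * w ≡ w + - (w * p)
      l = solve 2 (λ p w → ((Κ 1ℚ ⊖ p) ⊗ w) ⊜ (w ⊕ ⊝ (w ⊗ p))) refl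

    -- Induction on the fuel takes the place of a stopping time: where Ψ ≥ 1 the claim is trivial,
    -- and where Ψ < 1 the counts are within tolerance, so the drift bounds of the next step apply.
    -- The condition m ≤ i + f says that the fuel lasts until step m.
    lower : ∀ f i → i ℕ.≤ m → m ℕ.≤ i ℕ.+ f → ∀ (G : Graph n) → C4Free (adj G) → Counted G → 1ℚ - Ψ i (adj G) ≤ fp f G
    cases : ∀ f i → (i ℕ.< m) ⊎ (i ≡ m) → m ℕ.≤ i ℕ.+ f → ∀ (G : Graph n) → C4Free (adj G) → Counted G → Ψ i (adj G) < 1ℚ → 1ℚ - Ψ i (adj G) ≤ fp f G

    lower f i i≤m m≤ G C cnt = [ (λ p → ≤-trans (≤-trans (ℚP.+-monoʳ-≤ 1ℚ (neg≤ p)) (≤-reflexive (ℚP.+-inverseʳ 1ℚ))) (fp≥0 f G C))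
                               , cases f i (ℕP.m≤n⇒m<n∨m≡n i≤m) m≤ G C cnt ]′ (compare 1ℚ (Ψ i (adj G)))

    cases f i (inj₂ refl) m≤ G C cnt Ψ1 = ≤-trans (≤-trans (ℚP.+-monoʳ-≤ 1ℚ (neg≤ (Ψ≥0 m (adj G)))) (≤-reflexive (ℚP.+-identityʳ 1ℚ)))
        (endgame (adj G) C (Good.deg≤ (good m ℕP.≤-refl (adj G) C (ℚP.≤-<-trans (Φ≤Ψ m (adj G)) Ψ1))) (final-step (adj G) Ψ1) f G C cnt (λ _ _ e → e))
    cases zero i (inj₁ i<m) m≤ G C cnt Ψ1 = ⊥-elim (ℕP.<-irrefl refl (ℕP.<-≤-trans i<m (ℕP.≤-trans m≤ (ℕP.≤-reflexive (ℕP.+-identityʳ i)))))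
    cases (suc f′) i (inj₁ i<m) m≤ G C cnt Ψ1 = avg f′ G (1ℚ - Ψ i A) C (inj₂ (Next.W>0 i i<m A C Φ1))
         (average A {b = Ψ i A} {f = λ s t → fp f′ ((s , t) ∷ G)} {g = λ s t → Ψ (suc i) (add A s t)} (Next.next-Ψ i i<m A C Φ1)
           (λ s t v → ≤-trans (≤-reflexive (cong (λ B → 1ℚ - Ψ (suc i) B) (sym (adj-cons G s t))))
              (lower f′ (suc i) i<m (ℕP.≤-trans m≤ (ℕP.≤-reflexive (ℕP.+-suc i f′))) ((s , t) ∷ G) (step-C G C v) (step-counted G C v cnt))))
      where
      A = adj G
      Φ1 = ℚP.≤-<-trans (Φ≤Ψ i A) Ψ1

  -- Choice of parameters

  -- A reverse Bernoulli inequality, by (1 + x)(1 - (k + 1)x) ≤ 1 - kx.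
  pow2-block : ∀ x k → 0ℚ ≤ x → pow (1ℚ + x) k * (1ℚ - ι k * x) ≤ 1ℚ
  pow2-block x zero x0 = ≤-reflexive (l x)
    where l : ∀ x → 1ℚ * (1ℚ - ι 0 * x) ≡ 1ℚ
          l = solve 1 (λ x → (Κ 1ℚ ⊗ (Κ 1ℚ ⊖ Κ (ι 0) ⊗ x)) ⊜ (Κ 1ℚ)) refl
  pow2-block x (suc k) x0 = ≤-trans (≤-trans (≤-reflexive (cong (λ a → (1ℚ + x) * pow (1ℚ + x) k * (1ℚ - a * x)) (ι-suc k)))
      (cert (pow-nonneg k (0≤1 ⊞ x0) ⊠ ((0≤1 ⊞ 0≤ι k) ⊠ sq≥0 x)) (l x (ι k) (pow (1ℚ + x) k)))) (pow2-block x k x0)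
    where l : ∀ x k p → p * (1ℚ - k * x) ≡ (1ℚ + x) * p * (1ℚ - (1ℚ + k) * x) + p * ((1ℚ + k) * (x * x))
          l = solve 3 (λ x k p → (p ⊗ (Κ 1ℚ ⊖ k ⊗ x)) ⊜ ((Κ 1ℚ ⊕ x) ⊗ p ⊗ (Κ 1ℚ ⊖ (Κ 1ℚ ⊕ k) ⊗ x) ⊕ p ⊗ ((Κ 1ℚ ⊕ k) ⊗ (x ⊗ x)))) refl

  pow-pow : ∀ x a b → pow x (a ℕ.* b) ≡ pow (pow x b) a
  pow-pow x zero b = refl
  pow-pow x (suc a) b = trans (pow-+ x b (a ℕ.* b)) (cong (pow x b *_) (pow-pow x a b))

  pow-≤-exp : ∀ {x a b} → 1ℚ ≤ x → a ℕ.≤ b → pow x a ≤ pow x b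
  pow-≤-exp {x} {a} {b} h p = ≤-trans (≤-trans (≤-reflexive (sym (ℚP.*-identityʳ (pow x a)))) (mulˡ (pow-nonneg a (≤-trans 0≤1 h)) (pow-≥1 (b ℕ.∸ a) h)))
      (≤-reflexive (trans (sym (pow-+ x a (b ℕ.∸ a))) (cong (pow x) (ℕP.m+[n∸m]≡n p))))

  pow-≥-exp : ∀ {x a b} → 0ℚ ≤ x → x ≤ 1ℚ → a ℕ.≤ b → pow x b ≤ pow x a
  pow-≥-exp {x} {a} {b} h h1 p = ≤-trans (≤-reflexive (trans (cong (pow x) (sym (ℕP.m+[n∸m]≡n p))) (pow-+ x a (b ℕ.∸ a))))
      (≤-trans (mulˡ (pow-nonneg a h) (pow-≤1 (b ℕ.∸ a) h h1)) (≤-reflexive (ℚP.*-identityʳ (pow x a))))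

  pow-inverse : ∀ {x y} k → x * y ≡ 1ℚ → pow x k * pow y k ≡ 1ℚ
  pow-inverse {x} {y} k e = trans (sym (pow-* x y k)) (trans (cong (λ a → pow a k) e) (pow-1 k))

  ½≥0 : 0ℚ ≤ ½
  ½≥0 = <⇒≤ (ℚP.positive⁻¹ ½)

  -- A product of m factors close to 1 is controlled in J blocks, each contributing at most a factor 2.
  module Blocks (x : ℚ) (x0 : 0ℚ ≤ x) (x¼ : x ≤ ¼) (m J : ℕ) (mx : ι 4 * (ι m * x) ≤ ι J) (J1 : 1ℚ ≤ ι J) where
    private
      nzJ : ℕ.NonZero J
      nzJ = nz J J1
        where
        nz : ∀ J → 1ℚ ≤ ι J → ℕ.NonZero J
        nz zero h = ⊥-elim (ℚP.<-irrefl refl (ℚP.<-≤-trans 0<1 h))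
        nz (suc J) h = record { nonZero = _ }
      d : ℕ
      d = (m ℕD./ J) {{nzJ}}
      m0 : ℕ
      -- Rounding the block length up adds one x ≤ ¼ to dx ≤ ¼, so a block still has m0·x ≤ ½.
      m0 = suc d
      dJ : ι d * ι J ≤ ι m
      dJ = ≤-trans (≤-reflexive (sym (ι-* d J))) (ι-mono (ℕD.m/n*n≤m m J {{nzJ}}))
      m≤ : m ℕ.≤ J ℕ.* m0
      m≤ = ℕP.≤-trans (ℕP.≤-reflexive (ℕD.m≡m%n+[m/n]*n m J {{nzJ}})) (ℕP.≤-trans (ℕP.+-monoˡ-≤ (d ℕ.* J) (ℕP.<⇒≤ (ℕD.m%n<n m J {{nzJ}}))) (ℕP.≤-reflexive (ℕP.*-comm m0 J)))
      J>0 : 0ℚ < ι J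
      J>0 = ℚP.<-≤-trans 0<1 J1
      dx : ι d * x ≤ ¼
      dx = cancel-* J>0 (cert ((¼≥0 ⊠ sub mx) ⊞ (x0 ⊠ sub dJ)) (l (ι d) x (ι J) (ι m)))
        where
        ¼≥0 : 0ℚ ≤ ¼
        ¼≥0 = <⇒≤ (ℚP.positive⁻¹ ¼)
        l : ∀ d x J m → ¼ * J ≡ d * x * J + (¼ * (J - ι 4 * (m * x)) + x * (m - d * J))
        l = solve 4 (λ d x J m → (Κ ¼ ⊗ J) ⊜ (d ⊗ x ⊗ J ⊕ (Κ ¼ ⊗ (J ⊖ Κ (ι 4) ⊗ (m ⊗ x)) ⊕ x ⊗ (m ⊖ d ⊗ J)))) refl
      m0x : ι m0 * x ≤ ½
      m0x = ≤-trans (≤-reflexive (trans (cong (_* x) (ι-suc d)) (l (ι d) x))) (≤-trans (add≤ x¼ dx) (≤-reflexive refl))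
        where l : ∀ d x → (1ℚ + d) * x ≡ x + d * x
              l = solve 2 (λ d x → ((Κ 1ℚ ⊕ d) ⊗ x) ⊜ (x ⊕ d ⊗ x)) refl
    blk : pow (1ℚ + x) m0 ≤ ι 2
    blk = ≤-trans (cert (0≤ι 2 ⊠ pow-nonneg m0 (0≤1 ⊞ x0) ⊠ sub m0x) (l (pow (1ℚ + x) m0) (ι m0 * x))) (≤-trans (mulˡ (0≤ι 2) (pow2-block x m0 x0)) (≤-reflexive refl))
      where l : ∀ p y → ι 2 * (p * (1ℚ - y)) ≡ p + ι 2 * p * (½ - y)
            l = solve 2 (λ p y → (Κ (ι 2) ⊗ (p ⊗ (Κ 1ℚ ⊖ y))) ⊜ (p ⊕ Κ (ι 2) ⊗ p ⊗ (Κ ½ ⊖ y))) refl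
    grow : pow (1ℚ + x) m ≤ pow (ι 2) J
    grow = ≤-trans (pow-≤-exp (cert x0 refl) m≤) (≤-trans (≤-reflexive (pow-pow (1ℚ + x) J m0)) (pow-mono J (pow-nonneg m0 (0≤1 ⊞ x0)) blk))
    1-x : 0ℚ ≤ 1ℚ - x
    1-x = sub (≤-trans x¼ (cert (<⇒≤ (ℚP.positive⁻¹ (1ℚ - ¼))) refl))
    shrink : pow ½ J ≤ pow (1ℚ - x) m
    shrink = ≤-trans (pow-mono J ½≥0 (≤-trans (cert (sub m0x) (l (ι m0) x)) (bernoulli m0 1-x)))
        (≤-trans (≤-reflexive (sym (pow-pow (1ℚ - x) J m0))) (pow-≥-exp 1-x (cert x0 (l1 x)) m≤))
      where
      l : ∀ m x → 1ℚ + m * (- x) ≡ ½ + (½ - m * x)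
      l = solve 2 (λ m x → (Κ 1ℚ ⊕ m ⊗ (⊝ x)) ⊜ (Κ ½ ⊕ (Κ ½ ⊖ m ⊗ x))) refl
      l1 : ∀ x → 1ℚ ≡ 1ℚ - x + x
      l1 = solve 1 (λ x → (Κ 1ℚ) ⊜ (Κ 1ℚ ⊖ x ⊕ x)) refl

  -- With S₀ ≈ n^{1/3} and L₀³ a small multiple of log n, T = 4L₀S₀ is the typical degree after the
  -- m = 2L₀S₀n steps considered. As m·γ is at most J/4 ≤ τ/4, the tolerance grows from t⁻² to at most t⁻¹,
  -- where t = 2^τ is a small power of n.
  module Params (n s L τ K M ℓ h0 : ℕ) where
    S₀ L₀ N ν₀ t t⁻ T ε₀ ρ γ γ+1 B₀ k M₀ r κ̄ : ℚ
    S₀ = ι s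
    L₀ = ι L
    N = ι n
    ν₀ = inv N
    k = ι K
    M₀ = ι M
    t = pow (ι 2) τ
    t⁻ = pow ½ τ
    T = ι 4 * (L₀ * S₀)
    ε₀ = t⁻ * t⁻
    ρ = ι 24 * (T * T) * (ν₀ * ν₀)
    γ = ι 256 * ρ
    γ+1 = 1ℚ + γ
    -- 576 = 12·6·8: the smallness condition of `Var` for the jump 6 of `Pm` at ε = ⅛.
    B₀ = ι 576 * k
    r = inv (ι h0)
    κ̄ = ι 6 * (T * T) * (ν₀ * ν₀)

    J h u w : ℕ
    -- 4mγ equals 1024·768·L³S³/N; `J` rounds this up to 1024²L³.
    J = L ℕ.* 1024 ℕ.* (L ℕ.* 1024) ℕ.* L
    h = L ℕ.* s ℕ.* n
    u = M ℕ.* (L ℕ.* s)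
    -- `h0` is about n/w and r = 1/h0, so h0 steps halve the weight of a tuple, and the h = Lsn late
    -- steps contain Lsw = 2u(ℓ + 1) such blocks.
    w = M ℕ.* suc ℓ ℕ.* 2

    module P = Proc n K u h T ε₀ ρ γ+1 B₀ r

    record Facts₀ : Set where
      field
        sN : S₀ * S₀ * S₀ ≤ N
        Ns : N ≤ ι 8 * (S₀ * S₀ * S₀)
        ts : pow t 12 ≤ S₀
        L1 : 1ℚ ≤ L₀
        Lt : L₀ ≤ t
        K1 : 1ℚ ≤ k
        Kt : k ≤ t
        t0 : ι 1024 ≤ t
        Jτ : J ℕ.≤ τ
        Mℓ : ι 128 * ι (suc ℓ) ≤ M₀ * (L₀ * L₀ * L₀)
        M2 : ι 2 ≤ M₀
        h1 : 1ℚ ≤ ι h0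
        Nw : N ≤ ι 2 * (ι w * ι h0)

    module Derive (facts : Facts₀) where
      open Facts₀ facts

      1024≥ : ∀ {c} → c ℕ.≤ 1024 → ι c ≤ t
      1024≥ p = ≤-trans (ι-mono p) t0

      lit : ∀ c {e : (c ℕ.≤ᵇ 1024) ≡ true} → ι c ≤ t
      lit c {e} = 1024≥ (ℕP.≤ᵇ⇒≤ c 1024 (subst Bool.T (sym e) _))

      t1 : 1ℚ ≤ t
      t1 = lit 1 {refl}
      t≥0 : 0ℚ ≤ t
      t≥0 = ≤-trans 0≤1 t1
      tt : t * t⁻ ≡ 1ℚ
      tt = pow-inverse τ refl
      t⁻≥0 : 0ℚ ≤ t⁻
      t⁻≥0 = pow-nonneg τ ½≥0
      t⁻>0 : 0ℚ < t⁻
      t⁻>0 = pow-pos τ (ℚP.positive⁻¹ ½)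
      t⁻1 : t⁻ ≤ 1ℚ
      t⁻1 = pow-≤1 τ ½≥0 (cert ½≥0 refl)

      -- The conditions are checked with q and ε replaced by the lower bounds 1/t and 1/t²; this
      -- trades those inverse powers for powers of t.
      move : ∀ j {a b} → a * pow t j ≤ b → a ≤ b * pow t⁻ j
      move j {a} {b} h = ≤-trans (≤-reflexive (trans (sym (ℚP.*-identityʳ a)) (trans (cong (a *_) (sym (pow-inverse j tt))) (sym (ℚP.*-assoc a (pow t j) (pow t⁻ j)))))) (mulʳ (pow-nonneg j t⁻≥0) h)

      tS : ∀ j → j ℕ.≤ 12 → pow t j ≤ S₀
      tS j p = ≤-trans (pow-≤-exp t1 p) ts

      S1 : 1ℚ ≤ S₀
      S1 = tS 0 ℕ.z≤n
      S≥0 : 0ℚ ≤ S₀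
      S≥0 = ≤-trans 0≤1 S1
      L≥0 : 0ℚ ≤ L₀
      L≥0 = ≤-trans 0≤1 L1
      k≥0 : 0ℚ ≤ k
      k≥0 = ≤-trans 0≤1 K1
      T≥0 : 0ℚ ≤ T
      T≥0 = 0≤ι 4 ⊠ (L≥0 ⊠ S≥0)

      ST : S₀ ≤ T
      ST = cert ((S≥0 ⊠ sub L1) ⊞ (0≤ι 3 ⊠ (L≥0 ⊠ S≥0))) (l L₀ S₀)
        where l : ∀ L S → ι 4 * (L * S) ≡ S + (S * (L - 1ℚ) + ι 3 * (L * S))
              l = solve 2 (λ L S → (Κ (ι 4) ⊗ (L ⊗ S)) ⊜ (S ⊕ (S ⊗ (L ⊖ Κ 1ℚ) ⊕ Κ (ι 3) ⊗ (L ⊗ S)))) refl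

      S²N : ∀ {a} → a ≤ S₀ → a * (S₀ * S₀) ≤ N
      S²N p = ≤-trans (mulʳ (S≥0 ⊠ S≥0) p) (≤-trans (≤-reflexive (l S₀)) sN)
        where l : ∀ s → s * (s * s) ≡ s * s * s
              l = solve 1 (λ s → (s ⊗ (s ⊗ s)) ⊜ (s ⊗ s ⊗ s)) refl

      T²≤ : T * T ≤ pow t 3 * (S₀ * S₀)
      T²≤ = ≤-trans (≤-reflexive (l L₀ S₀)) (mulʳ (S≥0 ⊠ S≥0) (≤-trans (mul≤ (0≤ι 16) (lit 16 {refl}) (L≥0 ⊠ L≥0) (mul≤ L≥0 Lt L≥0 Lt)) (≤-reflexive (l2 t))))
        where l : ∀ L S → ι 4 * (L * S) * (ι 4 * (L * S)) ≡ ι 16 * (L * L) * (S * S)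
              l = solve 2 (λ L S → (Κ (ι 4) ⊗ (L ⊗ S) ⊗ (Κ (ι 4) ⊗ (L ⊗ S))) ⊜ (Κ (ι 16) ⊗ (L ⊗ L) ⊗ (S ⊗ S))) refl
              l2 : ∀ t → t * (t * t) ≡ t * (t * (t * 1ℚ))
              l2 = solve 1 (λ t → (t ⊗ (t ⊗ t)) ⊜ (t ⊗ (t ⊗ (t ⊗ Κ 1ℚ)))) refl

      TN : T * T ≤ N
      TN = ≤-trans T²≤ (S²N (tS 3 (ℕP.m≤m+n 3 9)))

      NT : N ≤ T * T * T
      NT = ≤-trans Ns (cert ((0≤ι 8 ⊠ S≥0 ⊠ S≥0 ⊠ S≥0 ⊠ sub L3) ⊞ (0≤ι 56 ⊠ (L≥0 ⊠ L≥0 ⊠ L≥0) ⊠ (S≥0 ⊠ S≥0 ⊠ S≥0))) (l L₀ S₀))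
        where
        L3 : 1ℚ ≤ L₀ * L₀ * L₀
        L3 = ≤-trans (mul≤ 0≤1 L1 0≤1 L1) (≤-trans (≤-reflexive (sym (ℚP.*-identityʳ (L₀ * L₀)))) (mulˡ (L≥0 ⊠ L≥0) L1))
        l : ∀ L S → ι 4 * (L * S) * (ι 4 * (L * S)) * (ι 4 * (L * S)) ≡ ι 8 * (S * S * S) + (ι 8 * S * S * S * (L * L * L - 1ℚ) + ι 56 * (L * L * L) * (S * S * S))
        l = solve 2 (λ L S → (Κ (ι 4) ⊗ (L ⊗ S) ⊗ (Κ (ι 4) ⊗ (L ⊗ S)) ⊗ (Κ (ι 4) ⊗ (L ⊗ S)))
            ⊜ (Κ (ι 8) ⊗ (S ⊗ S ⊗ S) ⊕ (Κ (ι 8) ⊗ S ⊗ S ⊗ S ⊗ (L ⊗ L ⊗ L ⊖ Κ 1ℚ) ⊕ Κ (ι 56) ⊗ (L ⊗ L ⊗ L) ⊗ (S ⊗ S ⊗ S)))) refl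

      T1 : 1ℚ ≤ T
      T1 = ≤-trans S1 ST
      T>0 : 0ℚ < T
      T>0 = ℚP.<-≤-trans 0<1 T1

      tN : pow t 12 ≤ N
      tN = ≤-trans ts (≤-trans (≤-trans ST (≤-trans (≤-reflexive (sym (ℚP.*-identityʳ T))) (mulˡ T≥0 T1))) TN)

      N1 : 1ℚ ≤ N
      N1 = ≤-trans (pow-≥1 12 t1) tN
      N>0 : 0ℚ < N
      N>0 = ℚP.<-≤-trans 0<1 N1
      N≥0 : 0ℚ ≤ N
      N≥0 = <⇒≤ N>0
      ν>0 : 0ℚ < ν₀
      ν>0 = inv-pos N>0
      ν≥0 : 0ℚ ≤ ν₀
      ν≥0 = <⇒≤ ν>0
      νN : N * ν₀ ≡ 1ℚ
      νN = inv-* N>0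

      ρ≥0 : 0ℚ ≤ ρ
      ρ≥0 = 0≤ι 24 ⊠ (T≥0 ⊠ T≥0) ⊠ (ν≥0 ⊠ ν≥0)
      γ≥0 : 0ℚ ≤ γ
      γ≥0 = 0≤ι 256 ⊠ ρ≥0

      νν : ∀ a → a * (ν₀ * ν₀) * (N * N) ≡ a
      νν a = trans (l a ν₀ N) (trans (cong (λ e → a * (e * e)) νN) (trans (cong (a *_) (ℚP.*-identityˡ 1ℚ)) (ℚP.*-identityʳ a)))
        where l : ∀ a v N → a * (v * v) * (N * N) ≡ a * (N * v * (N * v))
              l = solve 3 (λ a v N → (a ⊗ (v ⊗ v) ⊗ (N ⊗ N)) ⊜ (a ⊗ (N ⊗ v ⊗ (N ⊗ v)))) refl

      T²ν² : T * T * (ν₀ * ν₀) ≤ pow t⁻ 12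
      T²ν² = ≤-trans (mulʳ (ν≥0 ⊠ ν≥0) TN) (≤-trans (≤-reflexive (trans (sym (ℚP.*-assoc N ν₀ ν₀)) (trans (cong (_* ν₀) νN) (ℚP.*-identityˡ ν₀))))
         (≤-trans (move 12 {ν₀} {1ℚ} (≤-trans (mulˡ ν≥0 tN) (≤-reflexive (trans (ℚP.*-comm ν₀ N) νN)))) (≤-reflexive (ℚP.*-identityˡ (pow t⁻ 12)))))

      ct⁻ : ∀ {c} → c ≤ t → c * t⁻ ≤ 1ℚ
      ct⁻ p = ≤-trans (mulʳ t⁻≥0 p) (≤-reflexive tt)

      t⁻⅛ : t⁻ ≤ ⅛
      t⁻⅛ = ≤-trans (≤-reflexive (l t⁻)) (≤-trans (mulˡ (<⇒≤ (ℚP.positive⁻¹ ⅛)) (ct⁻ {ι 8} (lit 8 {refl}))) (≤-reflexive (ℚP.*-identityʳ ⅛)))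
        where l : ∀ a → a ≡ ⅛ * (ι 8 * a)
              l = solve 1 (λ a → (a) ⊜ (Κ ⅛ ⊗ (Κ (ι 8) ⊗ a))) refl

      absorb : ∀ {c} j → 0ℚ ≤ c → c ≤ t → c * pow t⁻ (suc j) ≤ pow t⁻ j
      absorb {c} j c0 p = ≤-trans (≤-reflexive (sym (ℚP.*-assoc c t⁻ (pow t⁻ j)))) (≤-trans (mulʳ (pow-nonneg j t⁻≥0) (ct⁻ p)) (≤-reflexive (ℚP.*-identityˡ (pow t⁻ j))))

      κ̄≥0 : 0ℚ ≤ κ̄
      κ̄≥0 = 0≤ι 6 ⊠ (T≥0 ⊠ T≥0) ⊠ (ν≥0 ⊠ ν≥0)

      8κ̄ : ι 8 * κ̄ ≤ ε₀
      8κ̄ = ≤-trans (≤-reflexive (l (T * T) (ν₀ * ν₀))) (≤-trans (mulˡ (0≤ι 48) T²ν²) (≤-trans (absorb 11 (0≤ι 48) (lit 48 {refl})) (≤-trans (pow-≥-exp t⁻≥0 t⁻1 (ℕP.m≤m+n 2 9)) (≤-reflexive (cong (t⁻ *_) (ℚP.*-identityʳ t⁻))))))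
        where l : ∀ a b → ι 8 * (ι 6 * a * b) ≡ ι 48 * (a * b)
              l = solve 2 (λ a b → (Κ (ι 8) ⊗ (Κ (ι 6) ⊗ a ⊗ b)) ⊜ (Κ (ι 48) ⊗ (a ⊗ b))) refl

      γ¼ : γ ≤ ¼
      γ¼ = ≤-trans (≤-reflexive (l (ι 256) (ι 24) (T * T) (ν₀ * ν₀))) (≤-trans (mulˡ (0≤ι 256) (mulˡ (0≤ι 24) T²ν²)) (≤-trans (mulˡ (0≤ι 256) (absorb 11 (0≤ι 24) (lit 24 {refl})))
          (≤-trans (absorb 10 (0≤ι 256) (lit 256 {refl})) (≤-trans (pow-≥-exp t⁻≥0 t⁻1 (ℕP.m≤m+n 1 9)) (≤-trans (≤-reflexive (ℚP.*-identityʳ t⁻)) (≤-trans t⁻⅛ (cert (<⇒≤ (ℚP.positive⁻¹ (¼ - ⅛))) refl)))))))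
        where l : ∀ c d a b → c * (d * a * b) ≡ c * (d * (a * b))
              l = solve 4 (λ c d a b → (c ⊗ (d ⊗ a ⊗ b)) ⊜ (c ⊗ (d ⊗ (a ⊗ b)))) refl

      κ̄γ : κ̄ ≤ γ
      κ̄γ = ≤-trans (mulʳ (ν≥0 ⊠ ν≥0) (mulʳ (T≥0 ⊠ T≥0) (ι-mono {6} {24} (ℕP.m≤m+n 6 18)))) (≤-trans (≤-reflexive (sym (ℚP.*-identityˡ ρ))) (mulʳ ρ≥0 (ι-mono {1} {256} (ℕP.m≤m+n 1 255))))

      m : ℕ
      m = P.m

      ιh : ι h ≡ L₀ * S₀ * N
      ιh = trans (ι-* (L ℕ.* s) n) (cong (_* N) (ι-* L s))

      ιJ : ι J ≡ L₀ * ι 1024 * (L₀ * ι 1024) * L₀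
      ιJ = trans (ι-* (L ℕ.* 1024 ℕ.* (L ℕ.* 1024)) L) (cong (_* L₀) (trans (ι-* (L ℕ.* 1024) (L ℕ.* 1024)) (cong₂ _*_ (ι-* L 1024) (ι-* L 1024))))

      mγ : ι 4 * (ι m * γ) ≤ ι J
      mγ = ≤-trans (≤-reflexive (trans (cong (λ a → ι 4 * (a * γ)) (trans (ι-+ h h) (cong₂ _+_ ιh ιh))) (trans (l (ι 4) (ι 256) (ι 24) L₀ S₀ N ν₀) (cong (λ e → ι 4 * ι 256 * ((ι 24 * (ι 4 * ι 4) * ι 2) * (L₀ * L₀ * L₀ * (S₀ * S₀ * S₀ * ν₀) * e))) νN))))
          (≤-trans (mul≤ (0≤ι 1024) ≤-refl (0≤ι 768 ⊠ (L3≥0 ⊠ (S≥0 ⊠ S≥0 ⊠ S≥0 ⊠ ν≥0) ⊠ 0≤1)) (mul≤ (0≤ι 768) (ι-mono {768} {1024} (ℕP.m≤m+n 768 256)) (L3≥0 ⊠ (S≥0 ⊠ S≥0 ⊠ S≥0 ⊠ ν≥0) ⊠ 0≤1)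
                (≤-trans (≤-reflexive (ℚP.*-identityʳ (L₀ * L₀ * L₀ * (S₀ * S₀ * S₀ * ν₀)))) (≤-trans (mulˡ L3≥0 (≤-trans (mulʳ ν≥0 sN) (≤-reflexive νN))) (≤-reflexive (ℚP.*-identityʳ (L₀ * L₀ * L₀)))))))
            (≤-reflexive (trans (l2 (ι 1024) L₀) (sym ιJ))))
        where
        L3≥0 : 0ℚ ≤ L₀ * L₀ * L₀
        L3≥0 = L≥0 ⊠ L≥0 ⊠ L≥0
        l : ∀ c d f L S N v → c * ((L * S * N + L * S * N) * (d * (f * ((ι 4 * (L * S)) * (ι 4 * (L * S))) * (v * v)))) ≡ c * d * ((f * (ι 4 * ι 4) * ι 2) * (L * L * L * (S * S * S * v) * (N * v)))
        l = solve 7 (λ c d f L S N v → (c ⊗ ((L ⊗ S ⊗ N ⊕ L ⊗ S ⊗ N) ⊗ (d ⊗ (f ⊗ ((Κ (ι 4) ⊗ (L ⊗ S)) ⊗ (Κ (ι 4) ⊗ (L ⊗ S))) ⊗ (v ⊗ v)))))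
            ⊜ (c ⊗ d ⊗ ((f ⊗ (Κ (ι 4) ⊗ Κ (ι 4)) ⊗ Κ (ι 2)) ⊗ (L ⊗ L ⊗ L ⊗ (S ⊗ S ⊗ S ⊗ v) ⊗ (N ⊗ v))))) refl
        l2 : ∀ c L → c * (c * (L * L * L)) ≡ L * c * (L * c) * L
        l2 = solve 2 (λ c L → (c ⊗ (c ⊗ (L ⊗ L ⊗ L))) ⊜ (L ⊗ c ⊗ (L ⊗ c) ⊗ L)) refl

      J1 : 1ℚ ≤ ι J
      J1 = ≤-trans (≤-trans (one* (one* (one* L1 1c) (one* L1 1c)) L1) ≤-refl) (≤-reflexive (sym ιJ))
        where
        1c : 1ℚ ≤ ι 1024
        1c = ι-mono {1} {1024} (ℕP.m≤m+n 1 1023)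
        one* : ∀ {a b} → 1ℚ ≤ a → 1ℚ ≤ b → 1ℚ ≤ a * b
        one* {a} {b} p q = ≤-trans (≤-reflexive (sym (ℚP.*-identityˡ 1ℚ))) (mul≤ 0≤1 p 0≤1 q)

      growth : pow γ+1 m ≤ t
      growth = ≤-trans (Blocks.grow γ γ≥0 γ¼ m J mγ J1) (pow-≤-exp (ι-mono {1} {2} (ℕP.m≤m+n 1 1)) Jτ)

      κ̄¼ : κ̄ ≤ ¼
      κ̄¼ = ≤-trans κ̄γ γ¼

      1-κ̄ : 0ℚ ≤ 1ℚ - κ̄
      1-κ̄ = sub (≤-trans κ̄¼ (cert (<⇒≤ (ℚP.positive⁻¹ (1ℚ - ¼))) refl))

      -- Since κ̄ ≤ γ, the blocks counted for the growth of ε also bound the decay of q.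
      decay : t⁻ ≤ pow (1ℚ - κ̄) m
      decay = ≤-trans (pow-≥-exp ½≥0 (cert ½≥0 refl) Jτ) (Blocks.shrink κ̄ κ̄≥0 κ̄¼ m J (≤-trans (mulˡ (0≤ι 4) (mulˡ (0≤ι m) κ̄γ)) mγ) J1)

      D-val : ∀ i → P.D i ≡ ι i * P.μ
      D-val zero = sym (ℚP.*-zeroˡ P.μ)
      D-val (suc i) = trans (cong (_+ P.μ) (D-val i)) (trans (l (ι i) P.μ) (cong (_* P.μ) (sym (ι-suc i))))
        where l : ∀ a m → a * m + m ≡ (1ℚ + a) * m
              l = solve 2 (λ a m → (a ⊗ m ⊕ m) ⊜ ((Κ 1ℚ ⊕ a) ⊗ m)) refl

      μ≥0 : 0ℚ ≤ P.μ
      μ≥0 = 0≤ι 2 ⊠ ν≥0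

      D-h : ι h * P.μ ≡ T * ½
      D-h = trans (cong (_* P.μ) ιh) (trans (l L₀ S₀ N ν₀) (trans (cong (λ e → ι 4 * (L₀ * S₀) * ½ * e) νN) (ℚP.*-identityʳ (T * ½))))
        where l : ∀ L S N v → L * S * N * (ι 2 * v) ≡ ι 4 * (L * S) * ½ * (N * v)
              l = solve 4 (λ L S N v → (L ⊗ S ⊗ N ⊗ (Κ (ι 2) ⊗ v)) ⊜ (Κ (ι 4) ⊗ (L ⊗ S) ⊗ Κ ½ ⊗ (N ⊗ v))) refl

      D-m : P.D m ≡ T
      D-m = trans (D-val m) (trans (cong (_* P.μ) (ι-+ h h)) (trans (ℚP.*-distribʳ-+ P.μ (ι h) (ι h)) (trans (cong₂ _+_ D-h D-h) (l T))))
        where l : ∀ T → T * ½ + T * ½ ≡ T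
              l = solve 1 (λ T → (T ⊗ Κ ½ ⊕ T ⊗ Κ ½) ⊜ (T)) refl

      D-mono : ∀ {i j} → i ℕ.≤ j → P.D i ≤ P.D j
      D-mono {i} {j} p = ≤-trans (≤-reflexive (D-val i)) (≤-trans (mulʳ μ≥0 (ι-mono p)) (≤-reflexive (sym (D-val j))))

      D≥0 : ∀ i → 0ℚ ≤ P.D i
      D≥0 i = D-mono {0} {i} ℕ.z≤n

      D≤T : ∀ {i} → i ℕ.≤ m → P.D i ≤ T
      D≤T p = ≤-trans (D-mono p) (≤-reflexive D-m)

      κ≥0 : ∀ i → 0ℚ ≤ P.κ i
      κ≥0 i = 0≤ι 6 ⊠ (D≥0 i ⊠ D≥0 i) ⊠ (ν≥0 ⊠ ν≥0)

      κ≤κ̄ : ∀ {i} → i ℕ.≤ m → P.κ i ≤ κ̄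
      κ≤κ̄ {i} p = mulʳ (ν≥0 ⊠ ν≥0) (mulˡ (0≤ι 6) (mul≤ (D≥0 i) (D≤T p) (D≥0 i) (D≤T p)))

      q-bounds : ∀ i → i ℕ.≤ m → (pow (1ℚ - κ̄) i ≤ P.q i) × (P.q i ≤ 1ℚ)
      q-bounds zero p = ≤-refl , ≤-refl
      q-bounds (suc i) p = ≤-trans (≤-reflexive (ℚP.*-comm (1ℚ - κ̄) (pow (1ℚ - κ̄) i))) (mul≤ (pow-nonneg i 1-κ̄) (proj₁ ih) 1-κ̄ (ℚP.+-monoʳ-≤ 1ℚ (neg≤ (κ≤κ̄ i≤m))))
          , ≤-trans (mul≤ q0 (proj₂ ih) 1-κ (cert (κ≥0 i) (l (P.κ i)))) (≤-reflexive (ℚP.*-identityˡ 1ℚ))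
        where
        i≤m = ℕP.<⇒≤ p
        ih = q-bounds i i≤m
        q0 : 0ℚ ≤ P.q i
        q0 = ≤-trans (pow-nonneg i 1-κ̄) (proj₁ ih)
        1-κ : 0ℚ ≤ 1ℚ - P.κ i
        1-κ = ≤-trans 1-κ̄ (ℚP.+-monoʳ-≤ 1ℚ (neg≤ (κ≤κ̄ i≤m)))
        l : ∀ k → 1ℚ ≡ 1ℚ - k + k
        l = solve 1 (λ k → (Κ 1ℚ) ⊜ (Κ 1ℚ ⊖ k ⊕ k)) refl

      q≥ : ∀ {i} → i ℕ.≤ m → t⁻ ≤ P.q i
      q≥ {i} p = ≤-trans decay (≤-trans (pow-≥-exp 1-κ̄ (cert κ̄≥0 (l κ̄)) p) (proj₁ (q-bounds i p)))
        where l : ∀ k → 1ℚ ≡ 1ℚ - k + k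
              l = solve 1 (λ k → (Κ 1ℚ) ⊜ (Κ 1ℚ ⊖ k ⊕ k)) refl

      γ+1≥1 : 1ℚ ≤ γ+1
      γ+1≥1 = cert γ≥0 refl

      ε-val : ∀ i → P.ε i ≡ ε₀ * pow γ+1 i
      ε-val zero = sym (ℚP.*-identityʳ ε₀)
      ε-val (suc i) = trans (cong (_* γ+1) (ε-val i)) (l ε₀ (pow γ+1 i) γ+1)
        where l : ∀ e p g → e * p * g ≡ e * (g * p)
              l = solve 3 (λ e p g → (e ⊗ p ⊗ g) ⊜ (e ⊗ (g ⊗ p))) refl

      b-val : ∀ i → P.b i ≡ B₀ * pow γ+1 i
      b-val zero = sym (ℚP.*-identityʳ B₀)
      b-val (suc i) = trans (cong (_* γ+1) (b-val i)) (l B₀ (pow γ+1 i) γ+1)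
        where l : ∀ e p g → e * p * g ≡ e * (g * p)
              l = solve 3 (λ e p g → (e ⊗ p ⊗ g) ⊜ (e ⊗ (g ⊗ p))) refl

      ε₀≥0 : 0ℚ ≤ ε₀
      ε₀≥0 = t⁻≥0 ⊠ t⁻≥0

      ε≤ : ∀ {i} → i ℕ.≤ m → P.ε i ≤ t⁻
      ε≤ {i} p = ≤-trans (≤-reflexive (ε-val i)) (≤-trans (mulˡ ε₀≥0 (≤-trans (pow-≤-exp γ+1≥1 p) growth)) (≤-reflexive (trans (l t⁻ t) (trans (cong (t⁻ *_) tt) (ℚP.*-identityʳ t⁻)))))
        where l : ∀ a t → a * a * t ≡ a * (t * a)
              l = solve 2 (λ a t → (a ⊗ a ⊗ t) ⊜ (a ⊗ (t ⊗ a))) refl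

      ε≥ : ∀ i → ε₀ ≤ P.ε i
      ε≥ i = ≤-trans (≤-reflexive (sym (ℚP.*-identityʳ ε₀))) (≤-trans (mulˡ ε₀≥0 (pow-≥1 i γ+1≥1)) (≤-reflexive (sym (ε-val i))))

      B₀≥1 : 1ℚ ≤ B₀
      B₀≥1 = ≤-trans (ι-mono {1} {576} (ℕP.m≤m+n 1 575)) (≤-trans (≤-reflexive (sym (ℚP.*-identityʳ (ι 576)))) (mulˡ (0≤ι 576) K1))

      B : ℚ
      B = P.b m

      B≤ : B ≤ pow t 3
      B≤ = ≤-trans (≤-reflexive (b-val m)) (≤-trans (mul≤ (≤-trans 0≤1 B₀≥1) (mul≤ (0≤ι 576) (lit 576 {refl}) k≥0 Kt) (pow-nonneg m (≤-trans 0≤1 γ+1≥1)) growth) (≤-reflexive (l t)))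
        where l : ∀ t → t * t * t ≡ t * (t * (t * 1ℚ))
              l = solve 1 (λ t → (t ⊗ t ⊗ t) ⊜ (t ⊗ (t ⊗ (t ⊗ Κ 1ℚ)))) refl

      B≥1 : 1ℚ ≤ B
      B≥1 = ≤-trans B₀≥1 (≤-trans (≤-trans (≤-reflexive (sym (ℚP.*-identityʳ B₀))) (mulˡ (≤-trans 0≤1 B₀≥1) (pow-≥1 m γ+1≥1))) (≤-reflexive (sym (b-val m))))

      B≥0 : 0ℚ ≤ B
      B≥0 = ≤-trans 0≤1 B≥1

      3t : ∀ {a b c d e f} → 0ℚ ≤ a → a ≤ d → 0ℚ ≤ b → b ≤ e → 0ℚ ≤ c → c ≤ f → a * b * c ≤ d * e * f
      3t a0 ad b0 be c0 cf = mul≤ (a0 ⊠ b0) (mul≤ a0 ad b0 be) c0 cf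

      -- Everything is compared with powers of t: numerical constants, K and L are at most t, while
      -- q ≥ 1/t, ε ≥ 1/t² and B ≤ t³. The most demanding condition is `cJ`: it needs t¹²S² ≤ N,
      -- which is the reason for the exponent in `ts`.
      cond : ∀ i → i ℕ.< m → Cond N T (P.D i) (P.q i) (P.ε i) (P.κ i) ρ B k
      cond i p = record
        { q0 = ℚP.<-≤-trans t⁻>0 q⁻
        ; q1 = proj₂ (q-bounds i i≤m)
        ; ε0 = e0
        ; ε8 = ≤-trans (ε≤ i≤m) t⁻⅛
        ; D0 = D≥0 i
        ; DT = D≤T i≤m
        ; κeq = νν (ι 6 * (P.D i * P.D i))
        ; ρeq = νν (ι 24 * (T * T))
        ; NT = NT
        ; TN = TN
        ; κ0 = κ≥0 i
        ; ρ0 = ρ≥0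
        ; κε = ≤-trans (mulˡ (0≤ι 8) (κ≤κ̄ i≤m)) (≤-trans 8κ̄ e⁻)
        ; Tεq = ≤-trans (≤-trans (move 3 (≤-trans (mulʳ (pow-nonneg 3 t≥0) (lit 8 {refl})) (≤-trans (tS 4 (ℕP.m≤m+n 4 8)) ST))) (≤-reflexive (lq T t⁻))) (3t T≥0 ≤-refl ε₀≥0 e⁻ t⁻≥0 q⁻)
        ; cJ = ≤-trans (≤-trans (move 6 cJ′) (≤-reflexive (lJ N t⁻))) (mul≤ ε₀≥0 e⁻ (N≥0 ⊠ (t⁻≥0 ⊠ t⁻≥0) ⊠ ε₀≥0) (3t N≥0 ≤-refl (t⁻≥0 ⊠ t⁻≥0) (mul≤ t⁻≥0 q⁻ t⁻≥0 q⁻) ε₀≥0 e⁻))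
        ; cN = ≤-trans (≤-trans (move 5 cN′) (≤-reflexive (lN T t⁻))) (mul≤ ε₀≥0 e⁻ (T≥0 ⊠ t⁻≥0 ⊠ ε₀≥0) (3t T≥0 ≤-refl t⁻≥0 q⁻ ε₀≥0 e⁻))
        ; cB = ≤-trans (≤-trans (move 5 cB′) (≤-reflexive (lB T t⁻))) (mulˡ T≥0 (mul≤ ε₀≥0 e⁻ (t⁻≥0 ⊠ t⁻≥0 ⊠ t⁻≥0) (3t t⁻≥0 q⁻ t⁻≥0 q⁻ t⁻≥0 q⁻)))
        ; B1 = B≥1
        ; k1 = K1 }
        where
        i≤m = ℕP.<⇒≤ p
        q⁻ = q≥ i≤m
        e⁻ = ε≥ i
        e0 : 0ℚ ≤ P.ε i
        e0 = ≤-trans ε₀≥0 e⁻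
        lq : ∀ T a → T * (a * (a * (a * 1ℚ))) ≡ T * (a * a) * a
        lq = solve 2 (λ T a → (T ⊗ (a ⊗ (a ⊗ (a ⊗ Κ 1ℚ)))) ⊜ (T ⊗ (a ⊗ a) ⊗ a)) refl
        lJ : ∀ N a → N * (a * (a * (a * (a * (a * (a * 1ℚ)))))) ≡ a * a * (N * (a * a) * (a * a))
        lJ = solve 2 (λ N a → (N ⊗ (a ⊗ (a ⊗ (a ⊗ (a ⊗ (a ⊗ (a ⊗ Κ 1ℚ))))))) ⊜ (a ⊗ a ⊗ (N ⊗ (a ⊗ a) ⊗ (a ⊗ a)))) refl
        lN : ∀ T a → T * (a * (a * (a * (a * (a * 1ℚ))))) ≡ a * a * (T * a * (a * a))
        lN = solve 2 (λ T a → (T ⊗ (a ⊗ (a ⊗ (a ⊗ (a ⊗ (a ⊗ Κ 1ℚ)))))) ⊜ (a ⊗ a ⊗ (T ⊗ a ⊗ (a ⊗ a)))) refl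
        lB : ∀ T a → T * (a * (a * (a * (a * (a * 1ℚ))))) ≡ T * (a * a * (a * a * a))
        lB = solve 2 (λ T a → (T ⊗ (a ⊗ (a ⊗ (a ⊗ (a ⊗ (a ⊗ Κ 1ℚ)))))) ⊜ (T ⊗ (a ⊗ a ⊗ (a ⊗ a ⊗ a)))) refl
        cJ′ : ι 12 * k * (ι 60 * (T * T)) * pow t 6 ≤ N
        cJ′ = ≤-trans (mulʳ (pow-nonneg 6 t≥0) (mul≤ (0≤ι 12 ⊠ k≥0) (mul≤ (0≤ι 12) (lit 12 {refl}) k≥0 Kt) (0≤ι 60 ⊠ (T≥0 ⊠ T≥0)) (mul≤ (0≤ι 60) (lit 60 {refl}) (T≥0 ⊠ T≥0) T²≤)))
          (≤-trans (≤-reflexive (l t (S₀ * S₀))) (S²N ts))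
          where l : ∀ t s → t * t * (t * (t * (t * (t * 1ℚ)) * s)) * (t * (t * (t * (t * (t * (t * 1ℚ)))))) ≡ (t * (t * (t * (t * (t * (t * (t * (t * (t * (t * (t * (t * 1ℚ)))))))))))) * s
                l = solve 2 (λ t s → (t ⊗ t ⊗ (t ⊗ (t ⊗ (t ⊗ (t ⊗ Κ 1ℚ)) ⊗ s)) ⊗ (t ⊗ (t ⊗ (t ⊗ (t ⊗ (t ⊗ (t ⊗ Κ 1ℚ)))))))
                    ⊜ ((t ⊗ (t ⊗ (t ⊗ (t ⊗ (t ⊗ (t ⊗ (t ⊗ (t ⊗ (t ⊗ (t ⊗ (t ⊗ (t ⊗ Κ 1ℚ)))))))))))) ⊗ s)) refl
        cN′ : ι 12 * k * (ι 30 * B) * pow t 5 ≤ T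
        cN′ = ≤-trans (mulʳ (pow-nonneg 5 t≥0) (mul≤ (0≤ι 12 ⊠ k≥0) (mul≤ (0≤ι 12) (lit 12 {refl}) k≥0 Kt) (0≤ι 30 ⊠ B≥0) (mul≤ (0≤ι 30) (lit 30 {refl}) B≥0 B≤)))
          (≤-trans (≤-reflexive (l t)) (≤-trans (tS 11 (ℕP.m≤m+n 11 1)) ST))
          where l : ∀ t → t * t * (t * (t * (t * (t * 1ℚ)))) * (t * (t * (t * (t * (t * 1ℚ))))) ≡ t * (t * (t * (t * (t * (t * (t * (t * (t * (t * (t * 1ℚ))))))))))
                l = solve 1 (λ t → (t ⊗ t ⊗ (t ⊗ (t ⊗ (t ⊗ (t ⊗ Κ 1ℚ)))) ⊗ (t ⊗ (t ⊗ (t ⊗ (t ⊗ (t ⊗ Κ 1ℚ))))))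
                    ⊜ (t ⊗ (t ⊗ (t ⊗ (t ⊗ (t ⊗ (t ⊗ (t ⊗ (t ⊗ (t ⊗ (t ⊗ (t ⊗ Κ 1ℚ)))))))))))) refl
        cB′ : ι 5 * B * pow t 5 ≤ T
        cB′ = ≤-trans (mulʳ (pow-nonneg 5 t≥0) (mul≤ (0≤ι 5) (lit 5 {refl}) B≥0 B≤)) (≤-trans (≤-reflexive (l t)) (≤-trans (tS 9 (ℕP.m≤m+n 9 3)) ST))
          where l : ∀ t → t * (t * (t * (t * 1ℚ))) * (t * (t * (t * (t * (t * 1ℚ))))) ≡ t * (t * (t * (t * (t * (t * (t * (t * (t * 1ℚ))))))))
                l = solve 1 (λ t → (t ⊗ (t ⊗ (t ⊗ (t ⊗ Κ 1ℚ))) ⊗ (t ⊗ (t ⊗ (t ⊗ (t ⊗ (t ⊗ Κ 1ℚ))))))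
                    ⊜ (t ⊗ (t ⊗ (t ⊗ (t ⊗ (t ⊗ (t ⊗ (t ⊗ (t ⊗ (t ⊗ Κ 1ℚ)))))))))) refl

      h0>0 : 0ℚ < ι h0
      h0>0 = ℚP.<-≤-trans 0<1 h1

      u₀ : ℚ
      u₀ = M₀ * (L₀ * S₀)

      ιu : ι u ≡ u₀
      ιu = trans (ι-* M (L ℕ.* s)) (cong (M₀ *_) (ι-* L s))

      M≥0 : 0ℚ ≤ M₀
      M≥0 = ≤-trans (0≤ι 2) M2

      u2 : ι 2 ≤ u₀
      u2 = ≤-trans M2 (≤-trans (≤-reflexive (sym (ℚP.*-identityʳ M₀))) (mulˡ M≥0 (≤-trans (≤-reflexive (sym (ℚP.*-identityˡ 1ℚ))) (mul≤ 0≤1 L1 0≤1 S1))))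

      uu : 0ℚ ≤ ι u * ι u - ι u
      uu = ≤-trans (≤-trans (≤-trans (0≤ι 2) u2 ⊠ (sub u2 ⊞ 0≤1)) (≤-reflexive (l u₀))) (≤-reflexive (sym (cong (λ a → a * a - a) ιu)))
        where l : ∀ a → a * (a - ι 2 + 1ℚ) ≡ a * a - a
              l = solve 1 (λ a → (a ⊗ (a ⊖ Κ (ι 2) ⊕ Κ 1ℚ)) ⊜ (a ⊗ a ⊖ a)) refl

      ιw : ι w ≡ M₀ * ι (suc ℓ) * ι 2
      ιw = trans (ι-* (M ℕ.* suc ℓ) 2) (cong (_* ι 2) (ι-* M (suc ℓ)))

      -- Here N²/h0 ≤ 2wN = 4M(ℓ + 1)N ≤ 32M(ℓ + 1)S³, and u² - u ≥ u²/2 makes the right side at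
      -- least ¼M²L³S³. So ML³ ≥ 128(ℓ + 1) suffices, which is `Mℓ`.
      rN : r * (N * N) ≤ ⅛ * ((ι u * ι u - ι u) * T)
      rN = cancel-* h0>0 (≤-trans (≤-reflexive (trans (l1 r (N * N) (ι h0)) (trans (cong (_* (N * N)) (trans (ℚP.*-comm r (ι h0)) (inv-* h0>0))) (ℚP.*-identityˡ (N * N)))))
          (≤-trans (mulˡ N≥0 Nw) (≤-trans (≤-reflexive (trans (cong (λ a → N * (ι 2 * (a * ι h0))) ιw) (l2 N M₀ (ι (suc ℓ)) (ι h0)))) (mulʳ (<⇒≤ h0>0) main))))
        where
        l1 : ∀ r a b → r * a * b ≡ r * b * a
        l1 = solve 3 (λ r a b → (r ⊗ a ⊗ b) ⊜ (r ⊗ b ⊗ a)) refl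
        l2 : ∀ N M e h → N * (ι 2 * (M * e * ι 2 * h)) ≡ ι 4 * M * e * N * h
        l2 = solve 4 (λ N M e h → (N ⊗ (Κ (ι 2) ⊗ (M ⊗ e ⊗ Κ (ι 2) ⊗ h))) ⊜ (Κ (ι 4) ⊗ M ⊗ e ⊗ N ⊗ h)) refl
        s3 : 0ℚ ≤ S₀ * S₀ * S₀
        s3 = S≥0 ⊠ S≥0 ⊠ S≥0
        main : ι 4 * M₀ * ι (suc ℓ) * N ≤ ⅛ * ((ι u * ι u - ι u) * T)
        main = ≤-trans (mulˡ (0≤ι 4 ⊠ M≥0 ⊠ 0≤ι (suc ℓ)) Ns)
            (≤-trans (cert ((¼≥0 ⊠ M≥0 ⊠ s3 ⊠ sub Mℓ) ⊞ (¼≥0 ⊠ (L≥0 ⊠ S≥0) ⊠ (≤-trans (0≤ι 2) u2) ⊠ sub u2)) (l M₀ (ι (suc ℓ)) S₀ L₀))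
               (≤-reflexive (cong (λ a → ⅛ * ((a * a - a) * T)) (sym ιu))))
          where
          ¼≥0 : 0ℚ ≤ ¼
          ¼≥0 = <⇒≤ (ℚP.positive⁻¹ ¼)
          l : ∀ M e S L → ⅛ * ((M * (L * S) * (M * (L * S)) - M * (L * S)) * (ι 4 * (L * S))) ≡ ι 4 * M * e * (ι 8 * (S * S * S))
                + (¼ * M * (S * S * S) * (M * (L * L * L) - ι 128 * e) + ¼ * (L * S) * (M * (L * S)) * (M * (L * S) - ι 2))
          l = solve 4 (λ M e S L → (Κ ⅛ ⊗ ((M ⊗ (L ⊗ S) ⊗ (M ⊗ (L ⊗ S)) ⊖ M ⊗ (L ⊗ S)) ⊗ (Κ (ι 4) ⊗ (L ⊗ S))))
              ⊜ (Κ (ι 4) ⊗ M ⊗ e ⊗ (Κ (ι 8) ⊗ (S ⊗ S ⊗ S)) ⊕ (Κ ¼ ⊗ M ⊗ (S ⊗ S ⊗ S) ⊗ (M ⊗ (L ⊗ L ⊗ L) ⊖ Κ (ι 128) ⊗ e) ⊕ Κ ¼ ⊗ (L ⊗ S) ⊗ (M ⊗ (L ⊗ S)) ⊗ (M ⊗ (L ⊗ S) ⊖ Κ (ι 2))))) refl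

      r≥0 : 0ℚ ≤ r
      r≥0 = <⇒≤ (inv-pos h0>0)

      r≤1 : r ≤ 1ℚ
      r≤1 = ≤-trans (≤-trans (≤-reflexive (sym (ℚP.*-identityˡ r))) (mulʳ r≥0 h1)) (≤-reflexive (inv-* h0>0))

      hyps : P.Hyps
      hyps = record
        { N>0 = N>0
        ; T>0 = T>0
        ; B₀>0 = ℚP.<-≤-trans 0<1 B₀≥1
        ; ρ≥0 = ρ≥0
        ; γ-def = refl
        ; q>0 = λ i p → ℚP.<-≤-trans t⁻>0 (q≥ p)
        ; ε>0 = *-pos t⁻>0 t⁻>0
        ; KB₀ = ≤-reflexive (lk k)
        ; cond = cond
        ; r1 = sub r≤1
        ; r0 = r≥0
        ; rN = rN
        ; uu = uu
        -- From step h on D ≥ T/2, and εT ≤ T/8 leaves more than the required T/4.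
        ; late = λ i p q → cert (sub (half p) ⊞ (⅛≥0 ⊠ T≥0) ⊞ (T≥0 ⊠ sub (≤-trans (ε≤ (ℕP.<⇒≤ q)) t⁻⅛))) (ll (P.D i) (P.ε i) T) }
        where
        ⅛≥0 : 0ℚ ≤ ⅛
        ⅛≥0 = <⇒≤ (ℚP.positive⁻¹ ⅛)
        lk : ∀ k → ι 12 * k * ι 6 ≡ ⅛ * (ι 576 * k)
        lk = solve 1 (λ k → (Κ (ι 12) ⊗ k ⊗ Κ (ι 6)) ⊜ (Κ ⅛ ⊗ (Κ (ι 576) ⊗ k))) refl
        half : ∀ {i} → h ℕ.≤ i → T * ½ ≤ P.D i
        half p = ≤-trans (≤-reflexive (trans (sym D-h) (sym (D-val h)))) (D-mono p)
        ll : ∀ D e T → D - e * T ≡ ¼ * T + ((D - T * ½) + ⅛ * T + T * (⅛ - e))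
        ll = solve 3 (λ D e T → (D ⊖ e ⊗ T) ⊜ (Κ ¼ ⊗ T ⊕ ((D ⊖ T ⊗ Κ ½) ⊕ Κ ⅛ ⊗ T ⊕ T ⊗ (Κ ⅛ ⊖ e)))) refl

  -- Initial value of the potential

  module Start (n s L τ K M ℓ h0 : ℕ) where
    open Params n s L τ K M ℓ h0

    module Bounds (facts : Facts₀) (wh : w ℕ.* h0 ℕ.≤ n) (Nℓ : N ≤ pow (ι 2) (suc ℓ)) (Kℓ : K ≡ suc ℓ ℕ.* 4) where
      open Facts₀ facts
      open Derive facts
      open P using (Φ; Ψ; U; flo; Λ; pwr)

      ∅ : Fin n → Fin n → Bool
      ∅ = adj {n} []

      module Q = Quantities ∅

      ω∅ : ∀ x y → Q.ω x y ≡ ν x y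
      ω∅ x y with fin-dec x y
      ... | inj₁ refl = trans (⟦⟧-false (¬true⇒false λ e → op⇒≢ {A = ∅} {x} {x} e refl)) (sym (ν-refl x))
      ... | inj₂ ne = trans (⟦⟧-true (op-intro {A = ∅} {x} {y} ne refl (¬true⇒false λ e → noedge (w3-elim {A = ∅} {x} {y} e)))) (sym (ν-≢ ne))
        where
        noedge : (∃ λ a → ∃ λ b → ∅ x a ≡ true × ∅ a b ≡ true × ∅ b y ≡ true) → ⊥
        noedge (a , b , () , _)

      ν1 : ∀ (x y : Fin n) → ν x y ≡ 1ℚ - δ x y
      ν1 x y = h′ (x == y)
        where h′ : ∀ b → ⟦ not b ⟧ ≡ 1ℚ - ⟦ b ⟧
              h′ true = refl
              h′ false = refl

      deg∅ : ∀ x → Q.deg x ≡ 0ℚ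
      deg∅ x = ∑-0 {n} (λ _ → refl)

      Nm∅ : ∀ x y → Q.Nm x y ≡ 0ℚ
      Nm∅ x y = ∑-0 {n} (λ b → ℚP.*-zeroˡ (Q.ω b y))

      Pm∅ : ∀ x y → Q.Pm x y ≡ 0ℚ
      Pm∅ x y = ∑-0 {n} (λ a → ∑-0 {n} (λ b → l (ν a y * ν b x)))
        where l : ∀ c → 0ℚ * 0ℚ * 0ℚ * c ≡ 0ℚ
              l = solve 1 (λ c → (Κ 0ℚ ⊗ Κ 0ℚ ⊗ Κ 0ℚ ⊗ c) ⊜ (Κ 0ℚ)) refl

      opdeg∅ : ∀ x → Q.opdeg x ≡ N + (- 1ℚ)
      opdeg∅ x = trans (∑-cong λ b → trans (ω∅ x b) (trans (ν1 x b) (l (δ x b)))) (trans (∑-+ {n} (λ _ → 1ℚ) (λ b → δ x b * (- 1ℚ)))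
          (cong₂ _+_ (trans (∑-const {n} 1ℚ) (ℚP.*-identityʳ N)) (∑-δ x (λ _ → - 1ℚ))))
        where l : ∀ d → 1ℚ - d ≡ 1ℚ + d * (- 1ℚ)
              l = solve 1 (λ d → (Κ 1ℚ ⊖ d) ⊜ (Κ 1ℚ ⊕ d ⊗ (⊝ Κ 1ℚ))) refl

      Cm∅ : ∀ {x y} → ¬ x ≡ y → Q.Cm x y ≡ N + (- ι 2)
      Cm∅ {x} {y} ne = trans (∑-cong λ b → trans (cong₂ _*_ (trans (ω∅ x b) (ν1 x b)) (trans (ω∅ b y) (ν1 b y))) (l (δ x b) (δ b y)))
         (trans (∑-+ {n} (λ b → 1ℚ + δ x b * (- 1ℚ + δ b y)) (λ b → δ b y * (- 1ℚ))) (trans (cong₂ _+_ (trans (∑-+ {n} (λ _ → 1ℚ) (λ b → δ x b * (- 1ℚ + δ b y)))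
             (cong₂ _+_ (trans (∑-const {n} 1ℚ) (ℚP.*-identityʳ N)) (trans (∑-δ x (λ b → - 1ℚ + δ b y)) (cong (- 1ℚ +_) (δ-≢ ne))))) (∑-δ′ y (λ _ → - 1ℚ))) (l2 N)))
        where
        l : ∀ d e → (1ℚ - d) * (1ℚ - e) ≡ 1ℚ + d * (- 1ℚ + e) + e * (- 1ℚ)
        l = solve 2 (λ d e → ((Κ 1ℚ ⊖ d) ⊗ (Κ 1ℚ ⊖ e)) ⊜ (Κ 1ℚ ⊕ d ⊗ (⊝ Κ 1ℚ ⊕ e) ⊕ e ⊗ (⊝ Κ 1ℚ))) refl
        l2 : ∀ N → N + (- 1ℚ + 0ℚ) + - 1ℚ ≡ N + - ι 2
        l2 = solve 1 (λ N → (N ⊕ (⊝ Κ 1ℚ ⊕ Κ 0ℚ) ⊕ ⊝ Κ 1ℚ) ⊜ (N ⊕ ⊝ Κ (ι 2))) refl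

      module P₀ = Pot {n} K T 0ℚ 1ℚ ε₀ B₀ ∅

      -- In the empty graph the counts miss their targets by 0, 1 or 2 and the tolerances are at
      -- least 4, so every normalised square is at most ¼ and its power at most the floor.
      dev≤ : ∀ {X M₁ s₁ d} → X ≡ M₁ + d → d * d ≤ ι 4 → ι 4 ≤ s₁ → P₀.dev X M₁ s₁ ≤ flo
      dev≤ {X} {M₁} {s₁} {d} refl dd s4 = pow-mono K (sq≥0 ((M₁ + d - M₁) * inv s₁)) (≤-trans (≤-reflexive (l M₁ d (inv s₁))) (≤-trans (mul≤ (sq≥0 d) dd (sq≥0 (inv s₁)) (mul≤ i0 i¼ i0 i¼)) (≤-reflexive refl)))
        where
        s0 : 0ℚ < s₁
        s0 = ℚP.<-≤-trans (ι-pos 3) s4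
        i0 : 0ℚ ≤ inv s₁
        i0 = <⇒≤ (inv-pos s0)
        i¼ : inv s₁ ≤ ¼
        i¼ = ≤-trans (cert (<⇒≤ (ℚP.positive⁻¹ ¼) ⊠ i0 ⊠ sub s4) (l1 s₁ (inv s₁))) (≤-trans (mulˡ (<⇒≤ (ℚP.positive⁻¹ ¼)) (≤-reflexive (inv-* s0))) (≤-reflexive (ℚP.*-identityʳ ¼)))
          where l1 : ∀ s i → ¼ * (s * i) ≡ i + ¼ * i * (s - ι 4)
                l1 = solve 2 (λ s i → (Κ ¼ ⊗ (s ⊗ i)) ⊜ (i ⊕ Κ ¼ ⊗ i ⊗ (s ⊖ Κ (ι 4)))) refl
        l : ∀ M d i → sq ((M + d - M) * i) ≡ d * d * (i * i)
        l M d i = l′ M d i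
          where l′ : ∀ M d i → (M + d - M) * i * ((M + d - M) * i) ≡ d * d * (i * i)
                l′ = solve 3 (λ M d i → ((M ⊕ d ⊖ M) ⊗ i ⊗ ((M ⊕ d ⊖ M) ⊗ i)) ⊜ (d ⊗ d ⊗ (i ⊗ i))) refl

      Nε4 : ι 4 ≤ N * 1ℚ * ε₀
      Nε4 = ≤-trans (move 2 (≤-trans (mulʳ (pow-nonneg 2 t≥0) (lit 4 {refl})) (≤-trans (pow-≤-exp t1 (ℕP.m≤m+n 3 9)) tN))) (≤-reflexive (l N t⁻))
        where l : ∀ N a → N * (a * (a * 1ℚ)) ≡ N * 1ℚ * (a * a)
              l = solve 2 (λ N a → (N ⊗ (a ⊗ (a ⊗ Κ 1ℚ))) ⊜ (N ⊗ Κ 1ℚ ⊗ (a ⊗ a))) refl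

      Nε4′ : ι 4 ≤ N * (1ℚ * 1ℚ) * ε₀
      Nε4′ = ≤-trans Nε4 (≤-reflexive (l N ε₀))
        where l : ∀ N e → N * 1ℚ * e ≡ N * (1ℚ * 1ℚ) * e
              l = solve 2 (λ N e → (N ⊗ Κ 1ℚ ⊗ e) ⊜ (N ⊗ (Κ 1ℚ ⊗ Κ 1ℚ) ⊗ e)) refl

      dd0 : 0ℚ * 0ℚ ≤ ι 4
      dd0 = 0≤ι 4

      Tε4 : ι 4 ≤ T * ε₀
      Tε4 = ≤-trans (move 2 (≤-trans (mulʳ (pow-nonneg 2 t≥0) (lit 4 {refl})) (≤-trans (tS 3 (ℕP.m≤m+n 3 9)) ST))) (≤-reflexive (l T t⁻))
        where l : ∀ N a → N * (a * (a * 1ℚ)) ≡ N * (a * a)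
              l = solve 2 (λ N a → (N ⊗ (a ⊗ (a ⊗ Κ 1ℚ))) ⊜ (N ⊗ (a ⊗ a))) refl

      Tε4′ : ι 4 ≤ T * 1ℚ * ε₀
      Tε4′ = ≤-trans Tε4 (≤-reflexive (cong (_* ε₀) (sym (ℚP.*-identityʳ T))))

      B₀4 : ι 4 ≤ B₀
      B₀4 = ≤-trans (ι-mono {4} {576} (ℕP.m≤m+n 4 572)) (≤-trans (≤-reflexive (sym (ℚP.*-identityʳ (ι 576)))) (mulˡ (0≤ι 576) K1))

      flo≥0 : 0ℚ ≤ flo
      flo≥0 = pow-nonneg K (<⇒≤ (ℚP.positive⁻¹ ¼))

      01* : ∀ b {F} → 0ℚ ≤ F → F ≤ flo → ⟦ b ⟧ * F ≤ flo
      01* b {F} F0 h′ = ≤-trans (mulʳ F0 (⟦⟧≤1 b)) (≤-trans (≤-reflexive (ℚP.*-identityˡ F)) h′)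

      Φ₀ : Φ 0 ∅ ≤ Λ
      Φ₀ = ≤-trans (≤-reflexive P₀.Φ-def) (≤-trans (add≤ (add≤ (add≤ (add≤ (∑-bound flo fd) (∑-bound flo fO)) (dbl fC)) (dbl fN)) (dbl fP)) (≤-reflexive (l N flo)))
        where
        l : ∀ N f → N * f + N * f + N * (N * f) + N * (N * f) + N * (N * f) ≡ (ι 2 * N + ι 3 * (N * N)) * f
        l = solve 2 (λ N f → (N ⊗ f ⊕ N ⊗ f ⊕ N ⊗ (N ⊗ f) ⊕ N ⊗ (N ⊗ f) ⊕ N ⊗ (N ⊗ f)) ⊜ ((Κ (ι 2) ⊗ N ⊕ Κ (ι 3) ⊗ (N ⊗ N)) ⊗ f)) refl
        dbl : ∀ {F : Fin n → Fin n → ℚ} → (∀ x y → F x y ≤ flo) → (∑ λ x → ∑ λ y → F x y) ≤ N * (N * flo)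
        dbl h′ = ∑-bound (N * flo) (λ x → ∑-bound flo (h′ x))
        fd : ∀ x → P₀.Fd x ≤ flo
        fd x = dev≤ {M₁ = 0ℚ} {d = 0ℚ} (trans (deg∅ x) (sym (ℚP.+-identityʳ 0ℚ))) dd0 Tε4
        fO : ∀ x → P₀.FO x ≤ flo
        fO x = dev≤ {M₁ = N * 1ℚ} {d = - 1ℚ} (trans (opdeg∅ x) (cong (_+ - 1ℚ) (sym (ℚP.*-identityʳ N)))) (ι-mono {1} {4} (ℕP.m≤m+n 1 3)) Nε4
        fC : ∀ x y → ν x y * P₀.FC x y ≤ flo
        fC x y with fin-dec x y
        ... | inj₁ e = ≤-trans (≤-reflexive (trans (cong (_* P₀.FC x y) (trans (cong (λ z → ν z y) e) (ν-refl y))) (ℚP.*-zeroˡ (P₀.FC x y)))) flo≥0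
        ... | inj₂ ne = 01* (not (x == y)) (P₀.dev≥0 (Q.Cm x y) (N * (1ℚ * 1ℚ)) (N * (1ℚ * 1ℚ) * ε₀))
                (dev≤ {M₁ = N * (1ℚ * 1ℚ)} {d = - ι 2} (trans (Cm∅ ne) (cong (_+ - ι 2) (l′ N))) ≤-refl Nε4′)
          where l′ : ∀ N → N ≡ N * (1ℚ * 1ℚ)
                l′ = solve 1 (λ N → (N) ⊜ (N ⊗ (Κ 1ℚ ⊗ Κ 1ℚ))) refl
        fN : ∀ x y → ν x y * P₀.FN x y ≤ flo
        fN x y = 01* (not (x == y)) (P₀.FN≥0 x y) (01* (not (Q.cod x y)) (P₀.dev≥0 (Q.Nm x y) (0ℚ * 1ℚ) (T * 1ℚ * ε₀))
           (dev≤ {M₁ = 0ℚ * 1ℚ} {d = 0ℚ} (trans (Nm∅ x y) refl) dd0 Tε4′))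
        fP : ∀ x y → P₀.FP x y ≤ flo
        fP x y = dev≤ {M₁ = 0ℚ} {d = 0ℚ} (trans (Pm∅ x y) refl) dd0 B₀4

      TN1 : T ≤ N
      TN1 = ≤-trans (≤-trans (≤-reflexive (sym (ℚP.*-identityʳ T))) (mulˡ T≥0 T1)) TN

      m≤NN : ι m ≤ N * N
      m≤NN = ≤-trans (≤-trans (≤-reflexive (trans (ι-+ h h) (cong₂ _+_ ιh ιh))) (≤-trans (cert (0≤ι 2 ⊠ (L≥0 ⊠ S≥0) ⊠ N≥0) (l L₀ S₀ N)) (mulʳ N≥0 TN1))) ≤-refl
        where l : ∀ L S N → ι 4 * (L * S) * N ≡ L * S * N + L * S * N + ι 2 * (L * S) * N
              l = solve 3 (λ L S N → (Κ (ι 4) ⊗ (L ⊗ S) ⊗ N) ⊜ (L ⊗ S ⊗ N ⊕ L ⊗ S ⊗ N ⊕ Κ (ι 2) ⊗ (L ⊗ S) ⊗ N)) refl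

      N8 : pow N 8 * flo ≤ 1ℚ
      N8 = ≤-trans (mulʳ flo≥0 (pow-mono 8 N≥0 Nℓ)) (≤-reflexive (trans (cong (pow e2 8 *_) flo≡) (pow-inverse {e2} {f2} 8 (pow-inverse {ι 2} {½} (suc ℓ) refl))))
        where
        e2 = pow (ι 2) (suc ℓ)
        f2 = pow ½ (suc ℓ)
        flo≡ : flo ≡ pow f2 8
        flo≡ = trans (cong (pow ¼) Kℓ) (trans (pow-pow ¼ (suc ℓ) 4) (trans (swap (pow ¼ 4) ½ 8 (suc ℓ) refl) refl))
          where
          swap : ∀ a b j e → a ≡ pow b j → pow a e ≡ pow (pow b e) j
          swap a b j e p = trans (cong (λ z → pow z e) p) (trans (sym (pow-pow b e j)) (trans (cong (pow b) (ℕP.*-comm e j)) (pow-pow b j e)))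

      N≤pow : ∀ {j k′} → j ℕ.≤ k′ → pow N j ≤ pow N k′
      N≤pow = pow-≤-exp N1

      -- The floors are paid once for the start and at most m ≤ N² times along the run. With the
      -- outer factor N this is at most 10N⁵·flo, and `N8` leaves room to spare.
      first : N * (Λ + ι m * Λ) ≤ ι 10
      first = ≤-trans (cert ((N≥0 ⊠ flo≥0 ⊠ ((0≤ι 2 ⊠ N≥0) ⊞ (0≤ι 3 ⊠ (N≥0 ⊠ N≥0))) ⊠ sub m≤NN)
                ⊞ (0≤ι 2 ⊠ (N≥0 ⊠ N≥0 ⊠ flo≥0) ⊠ sub (N≤pow {0} {3} ℕ.z≤n)) ⊞ (0≤ι 3 ⊠ (N≥0 ⊠ N≥0 ⊠ N≥0 ⊠ flo≥0) ⊠ sub (N≤pow {0} {2} ℕ.z≤n))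
                ⊞ (0≤ι 2 ⊠ (N≥0 ⊠ N≥0 ⊠ N≥0 ⊠ N≥0 ⊠ flo≥0) ⊠ sub N1)) (l N flo (ι m)))
          (≤-trans (mulˡ (0≤ι 10) (≤-trans (mulʳ flo≥0 (N≤pow {5} {8} (ℕP.m≤m+n 5 3))) N8)) (≤-reflexive (ℚP.*-identityʳ (ι 10))))
        where
        l : ∀ N f m → ι 10 * ((N * (N * (N * (N * (N * 1ℚ))))) * f) ≡ N * ((ι 2 * N + ι 3 * (N * N)) * f + m * ((ι 2 * N + ι 3 * (N * N)) * f))
             + (N * f * (ι 2 * N + ι 3 * (N * N)) * (N * N - m) + ι 2 * (N * N * f) * (N * (N * (N * 1ℚ)) - 1ℚ) + ι 3 * (N * N * N * f) * (N * (N * 1ℚ) - 1ℚ) + ι 2 * (N * N * N * N * f) * (N - 1ℚ))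
        l = solve 3 (λ N f m → (Κ (ι 10) ⊗ ((N ⊗ (N ⊗ (N ⊗ (N ⊗ (N ⊗ Κ 1ℚ))))) ⊗ f))
            ⊜ (N ⊗ ((Κ (ι 2) ⊗ N ⊕ Κ (ι 3) ⊗ (N ⊗ N)) ⊗ f ⊕ m ⊗ ((Κ (ι 2) ⊗ N ⊕ Κ (ι 3) ⊗ (N ⊗ N)) ⊗ f)) ⊕ (N ⊗ f ⊗ (Κ (ι 2) ⊗ N ⊕ Κ (ι 3) ⊗ (N ⊗ N)) ⊗ (N ⊗ N ⊖ m) ⊕ Κ (ι 2) ⊗ (N ⊗ N ⊗ f) ⊗ (N ⊗ (N ⊗ (N ⊗ Κ 1ℚ)) ⊖ Κ 1ℚ) ⊕ Κ (ι 3) ⊗ (N ⊗ N ⊗ N ⊗ f) ⊗ (N ⊗ (N ⊗ Κ 1ℚ) ⊖ Κ 1ℚ) ⊕ Κ (ι 2) ⊗ (N ⊗ N ⊗ N ⊗ N ⊗ f) ⊗ (N ⊖ Κ 1ℚ)))) refl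

      1-r≥0 : 0ℚ ≤ 1ℚ - r
      1-r≥0 = sub r≤1

      -- Bernoulli gives (1 + r)^h0 ≥ 2 because r = 1/h0, and (1 - r)(1 + r) ≤ 1 transfers this to 1
      -- - r.
      halved : pow (1ℚ - r) h0 ≤ ½
      halved = ≤-trans (cert (½≥0 ⊠ p0 ⊠ sub two) (l (pow (1ℚ - r) h0) (pow (1ℚ + r) h0)))
          (≤-trans (mulˡ ½≥0 (≤-trans (≤-reflexive (sym (pow-* (1ℚ - r) (1ℚ + r) h0))) (pow-≤1 h0 (1-r≥0 ⊠ (0≤1 ⊞ r≥0)) (cert (sq≥0 r) (l2 r))))) (≤-reflexive (ℚP.*-identityʳ ½)))
        where
        p0 : 0ℚ ≤ pow (1ℚ - r) h0
        p0 = pow-nonneg h0 1-r≥0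
        two : ι 2 ≤ pow (1ℚ + r) h0
        two = ≤-trans (≤-reflexive (cong (1ℚ +_) (sym (inv-* h0>0)))) (bernoulli h0 (0≤1 ⊞ r≥0))
        l : ∀ p q → ½ * (p * q) ≡ p + ½ * p * (q - ι 2)
        l = solve 2 (λ p q → (Κ ½ ⊗ (p ⊗ q)) ⊜ (p ⊕ Κ ½ ⊗ p ⊗ (q ⊖ Κ (ι 2)))) refl
        l2 : ∀ r → 1ℚ ≡ (1ℚ - r) * (1ℚ + r) + r * r
        l2 = solve 1 (λ r → (Κ 1ℚ) ⊜ ((Κ 1ℚ ⊖ r) ⊗ (Κ 1ℚ ⊕ r) ⊕ r ⊗ r)) refl

      Jc : ℕ
      Jc = u ℕ.* (suc ℓ ℕ.* 2)

      Jc-h : Jc ℕ.* h0 ℕ.≤ h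
      Jc-h = ℕP.≤-trans (ℕP.≤-reflexive eq) (ℕP.*-monoʳ-≤ (L ℕ.* s) wh)
        where
        l : ∀ M a e f → M ℕ.* a ℕ.* (e ℕ.* 2) ℕ.* f ≡ a ℕ.* (M ℕ.* e ℕ.* 2 ℕ.* f)
        l = solveℕ
        eq : Jc ℕ.* h0 ≡ L ℕ.* s ℕ.* (w ℕ.* h0)
        eq = l M (L ℕ.* s) (suc ℓ) h0

      u≥1 : 1 ℕ.≤ u
      u≥1 = go u (≤-trans u2 (≤-reflexive (sym ιu)))
        where
        go : ∀ a → ι 2 ≤ ι a → 1 ℕ.≤ a
        go zero p = ⊥-elim (ℚP.<-irrefl refl (ℚP.<-≤-trans (ι-pos 1) p))
        go (suc a) p = ℕ.s≤s ℕ.z≤n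

      Jc≥ : suc u ℕ.* suc ℓ ℕ.≤ Jc
      Jc≥ = ℕP.≤-trans (ℕP.*-monoˡ-≤ (suc ℓ) (ℕP.+-monoˡ-≤ u u≥1)) (ℕP.≤-reflexive (l u (suc ℓ)))
        where
        l : ∀ u e → (u ℕ.+ u) ℕ.* e ≡ u ℕ.* (e ℕ.* 2)
        l = solveℕ

      -- The union bound: N^{u+1} ≤ 2^{(u+1)(ℓ+1)} is beaten by the 2u(ℓ + 1) halvings counted by
      -- `Jc`.
      second : N * (pow (1ℚ - r) h * pow N u) ≤ 1ℚ
      second = ≤-trans (≤-reflexive (l N (pow (1ℚ - r) h) (pow N u))) (≤-trans (mul≤ (pow-nonneg h 1-r≥0) p1 (pow-nonneg (suc u) N≥0) p2) (≤-reflexive (pow-inverse {½} {ι 2} Jc refl)))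
        where
        l : ∀ N a b → N * (a * b) ≡ a * (N * b)
        l = solve 3 (λ N a b → (N ⊗ (a ⊗ b)) ⊜ (a ⊗ (N ⊗ b))) refl
        p1 : pow (1ℚ - r) h ≤ pow ½ Jc
        p1 = ≤-trans (pow-≥-exp 1-r≥0 (cert r≥0 (l1 r)) Jc-h) (≤-trans (≤-reflexive (pow-pow (1ℚ - r) Jc h0)) (pow-mono Jc (pow-nonneg h0 1-r≥0) halved))
          where l1 : ∀ r → 1ℚ ≡ 1ℚ - r + r
                l1 = solve 1 (λ r → (Κ 1ℚ) ⊜ (Κ 1ℚ ⊖ r ⊕ r)) refl
        p2 : pow N (suc u) ≤ pow (ι 2) Jc
        p2 = ≤-trans (pow-mono (suc u) N≥0 Nℓ) (≤-trans (≤-reflexive (sym (pow-pow (ι 2) (suc u) (suc ℓ)))) (pow-≤-exp (ι-mono {1} {2} (ℕP.m≤m+n 1 1)) Jc≥))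

      U≤ : U ∅ ≤ pow N u
      U≤ = ≤-trans (≤-reflexive (P.U-def ∅)) (sumV-bound u (λ v → ⟦⟧≤1 (cf ∅ v)))

      Ψ₀ : N * Ψ 0 ∅ ≤ ι 11
      Ψ₀ = ≤-trans (≤-trans (mulˡ N≥0 (add≤ (ℚP.+-monoˡ-≤ (ι m * Λ) Φ₀) (mul≤ (pow-nonneg (rest h 0) 1-r≥0) (≤-reflexive (cong (pow (1ℚ - r)) (ℕP.m≤n⇒m⊓n≡m (ℕP.m≤m+n h h)))) U0 U≤)))
             (≤-reflexive (ℚP.*-distribˡ-+ N (Λ + ι m * Λ) (pow (1ℚ - r) h * pow N u)))) (≤-trans (add≤ first second) ≤-refl)
        where
        U0 : 0ℚ ≤ U ∅
        U0 = ≤-trans (sumV-nonneg u (λ v → ⟦⟧≥0 (cf ∅ v))) (≤-reflexive (sym (P.U-def ∅)))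

      -- The tracked degree contributes T = 4LS, its tolerance at most another T, and the endgame u
      -- = MLS.
      degree-cap : P.D m + P.ε m * T + ι u ≤ ι ((8 ℕ.+ M) ℕ.* (L ℕ.* s))
      degree-cap = ≤-trans (add≤ (add≤ (≤-reflexive D-m) (≤-trans (mulʳ T≥0 (≤-trans (ε≤ ℕP.≤-refl) t⁻1)) (≤-reflexive (ℚP.*-identityˡ T)))) (≤-reflexive ιu))
         (≤-reflexive (trans (l L₀ S₀ M₀) (sym (trans (ι-* (8 ℕ.+ M) (L ℕ.* s)) (cong₂ _*_ (ι-+ 8 M) (ι-* L s))))))
        where l : ∀ L S M → ι 4 * (L * S) + ι 4 * (L * S) + M * (L * S) ≡ (ι 8 + M) * (L * S)
              l = solve 3 (λ L S M → (Κ (ι 4) ⊗ (L ⊗ S) ⊕ Κ (ι 4) ⊗ (L ⊗ S) ⊕ M ⊗ (L ⊗ S)) ⊜ ((Κ (ι 8) ⊕ M) ⊗ (L ⊗ S))) refl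

  -- Conclusion

  -- A discrete inverse of `f` found by searching downwards from b, so monotonicity of `f` need not
  -- be proved. It supplies the logarithm, the cube root and the quotients used as parameters.
  bracket : (f : ℕ → ℕ) → ∀ x b → f 0 ℕ.≤ x → x ℕ.< f b → ∃ λ k → (f k ℕ.≤ x) × (x ℕ.< f (suc k))
  bracket f x zero p q = ⊥-elim (ℕP.<-irrefl refl (ℕP.<-≤-trans q p))
  bracket f x (suc b) p q with f b ℕP.≤? x
  ... | yes r = b , r , q
  ... | no r = bracket f x b p (ℕP.≰⇒> r)

  ι-reflect : ∀ {a b} → ι a ≤ ι b → a ℕ.≤ b
  ι-reflect {a} {b} h with a ℕP.≤? b
  ... | yes p = p
  ... | no p = ⊥-elim (ℚP.<-irrefl refl (ℚP.<-≤-trans ltι (≤-trans (ι-mono (ℕP.≰⇒> p)) h)))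
    where
    ltι : ι b < ι (suc b)
    ltι = ℚP.<-respʳ-≡ (sym (ι-suc b)) (ℚP.<-respˡ-≡ (ℚP.+-identityˡ (ι b)) (ℚP.+-monoˡ-< (ι b) 0<1))

  ι-pow : ∀ a b → ι (a ℕ.^ b) ≡ pow (ι a) b
  ι-pow a zero = refl
  ι-pow a (suc b) = trans (ι-* a (a ℕ.^ b)) (cong (ι a *_) (ι-pow a b))

  cube-mono : ∀ {a b} → a ℕ.≤ b → a ℕ.* a ℕ.* a ℕ.≤ b ℕ.* b ℕ.* b
  cube-mono p = ℕP.*-mono-≤ (ℕP.*-mono-≤ p p) p

  cube-reflect-< : ∀ {a b} → a ℕ.* a ℕ.* a ℕ.< b ℕ.* b ℕ.* b → a ℕ.< b
  cube-reflect-< {a} {b} h with b ℕP.≤? a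
  ... | yes p = ⊥-elim (ℕP.<-irrefl refl (ℕP.<-≤-trans h (cube-mono p)))
  ... | no p = ℕP.≰⇒> p

  maxDegree≤ : ∀ {n} (G : Graph n) c → (∀ v → degree G v ℕ.≤ c) → maxDegree G ℕ.≤ c
  maxDegree≤ {n} G c h = go (allFin n)
    where
    go : ∀ xs → foldr (λ v m → degree G v ℕ.⊔ m) 0 xs ℕ.≤ c
    go [] = ℕ.z≤n
    go (x ∷ xs) = ℕP.⊔-lub (h x) (go xs)

  module Conclude (n s L τ K M ℓ h0 : ℕ) (facts : Params.Facts₀ n s L τ K M ℓ h0) (wh : Params.w n s L τ K M ℓ h0 ℕ.* h0 ℕ.≤ n)
      (Nℓ : ι n ≤ pow (ι 2) (suc ℓ)) (Kℓ : K ≡ suc ℓ ℕ.* 4) (s³ : s ℕ.* s ℕ.* s ℕ.≤ n) (L³ : L ℕ.* L ℕ.* L ℕ.≤ ⌊log₂ n ⌋) where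
    open Params n s L τ K M ℓ h0
    open Derive facts
    open Start n s L τ K M ℓ h0
    open Bounds facts wh Nℓ Kℓ

    prop : Graph n → Bool
    prop G = maxDegree G ℕ.^ 3 ℕ.≤ᵇ (8 ℕ.+ M) ℕ.^ 3 ℕ.* (n ℕ.* ⌊log₂ n ⌋)

    prop-holds : ∀ G → (∀ v → ι (degree G v) ≤ (P.D m + P.ε m * T) + ι u) → prop G ≡ true
    prop-holds G h = T⇒true (ℕP.≤⇒≤ᵇ (ℕP.≤-trans (ℕP.≤-reflexive (l₁ (maxDegree G)))
       (ℕP.≤-trans (cube-mono {maxDegree G} {cap} (maxDegree≤ G cap (λ v → ι-reflect {degree G v} {cap} (≤-trans (h v) degree-cap))))
         (ℕP.≤-trans (ℕP.≤-reflexive (l₂ (8 ℕ.+ M) L s)) (ℕP.*-monoʳ-≤ ((8 ℕ.+ M) ℕ.^ 3) (ℕP.*-mono-≤ s³ L³))))))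
      where
      cap = (8 ℕ.+ M) ℕ.* (L ℕ.* s)
      T⇒true : ∀ {b} → Bool.T b → b ≡ true
      T⇒true {true} _ = refl
      l₁ : ∀ a → a ℕ.* (a ℕ.* (a ℕ.* 1)) ≡ a ℕ.* a ℕ.* a
      l₁ = solveℕ
      l₂ : ∀ a L s → a ℕ.* (L ℕ.* s) ℕ.* (a ℕ.* (L ℕ.* s)) ℕ.* (a ℕ.* (L ℕ.* s)) ≡ a ℕ.* (a ℕ.* (a ℕ.* 1)) ℕ.* (s ℕ.* s ℕ.* s ℕ.* (L ℕ.* L ℕ.* L))
      l₂ = solveℕ

    open Main n K u h T ε₀ ρ γ+1 B₀ r hyps prop prop-holds using (lower)

    C4Free-∅ : C4Free ∅
    C4Free-∅ = record { adj-sym = λ (); adj-irr = λ (); unique = λ _ () }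

    -- The failure probability is at most Ψ at the empty graph, hence at most 11/n; the fuel n²
    -- covers the m steps.
    likely : ∀ ε → ι 11 ≤ N * ε → 1ℚ - ε ≤ processProb n prop
    likely ε p = ≤-trans (ℚP.+-monoʳ-≤ 1ℚ (neg≤ {P.Ψ 0 ∅} {ε} (cancel-* {P.Ψ 0 ∅} {ε} N>0 (≤-trans (≤-reflexive (ℚP.*-comm (P.Ψ 0 ∅) N)) (≤-trans (≤-trans Ψ₀ p) (≤-reflexive (ℚP.*-comm N ε)))))))
      (lower (n ℕ.* n) 0 ℕ.z≤n (ι-reflect {m} {n ℕ.* n} (≤-trans m≤NN (≤-reflexive (sym (ι-* n n))))) [] C4Free-∅ (λ v → sym (deg∅ v)))

  -- J₀ L is the number of blocks J of Params.
  J₀ : ℕ → ℕ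
  J₀ a = a ℕ.* 1024 ℕ.* (a ℕ.* 1024) ℕ.* a

  12≤J₀ : 12 ℕ.≤ J₀ 1
  12≤J₀ = ℕP.≤ᵇ⇒≤ 12 1048576 _

  37≤J₀ : 37 ℕ.≤ J₀ 1
  37≤J₀ = ℕP.≤ᵇ⇒≤ 37 1048576 _

  opaque
    -- 128 (k + 1) ≤ M₁ L³, because k + 1 ≤ 36 (τ + 1) ≤ 72 τ and τ < J₀ (L + 1) ≤ 8·1024² L³
    M₁ : ℕ
    M₁ = 1024 ℕ.* 1024 ℕ.* 8 ℕ.* 72 ℕ.* 128

    M₁-def : M₁ ≡ 1024 ℕ.* 1024 ℕ.* 8 ℕ.* 72 ℕ.* 128
    M₁-def = refl

    M₁≥2 : 2 ℕ.≤ M₁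
    M₁≥2 = ℕP.≤ᵇ⇒≤ 2 M₁ _

    M₁≤ : M₁ ℕ.≤ 2 ℕ.^ 37
    M₁≤ = ℕP.≤ᵇ⇒≤ M₁ (2 ℕ.^ 37) _

    -- Large enough that τ = ⌊k/36⌋ is at least `J₀ 1`, which yields L ≥ 1 and all numerical lower
    -- bounds on τ.
    k₀ : ℕ
    k₀ = J₀ 1 ℕ.* 36

    k₀-def : k₀ ≡ J₀ 1 ℕ.* 36
    k₀-def = refl

  n<2^n : ∀ n → n ℕ.< 2 ℕ.^ n
  n<2^n zero = ℕ.s≤s ℕ.z≤n
  n<2^n (suc n) = ℕP.≤-trans (ℕP.+-mono-≤ {1} {2 ℕ.^ n} {suc n} {2 ℕ.^ n} (ℕP.≤-trans (ℕ.s≤s ℕ.z≤n) (n<2^n n)) (n<2^n n)) (ℕP.≤-reflexive (cong (2 ℕ.^ n ℕ.+_) (sym (ℕP.+-identityʳ (2 ℕ.^ n)))))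

  ^-reflect-< : ∀ {a b} → 2 ℕ.^ a ℕ.< 2 ℕ.^ b → a ℕ.< b
  ^-reflect-< {a} {b} h with b ℕP.≤? a
  ... | yes p = ⊥-elim (ℕP.<-irrefl refl (ℕP.<-≤-trans h (ℕP.^-monoʳ-≤ 2 p)))
  ... | no p = ℕP.≰⇒> p

  suc≤double : ∀ {a} → 1 ℕ.≤ a → suc a ℕ.≤ a ℕ.+ a
  suc≤double {a} p = ℕP.+-monoˡ-≤ a p

  linear≤2^-step : ∀ c a → suc a ℕ.* c ℕ.≤ 2 ℕ.^ a → suc (suc a) ℕ.* c ℕ.≤ 2 ℕ.^ suc a
  linear≤2^-step c a p = ℕP.≤-trans (ℕP.*-monoˡ-≤ c (suc≤double {suc a} (ℕ.s≤s ℕ.z≤n))) (ℕP.≤-trans (ℕP.≤-reflexive (ℕP.*-distribʳ-+ c (suc a) (suc a)))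
      (ℕP.≤-trans (ℕP.+-mono-≤ p p) (ℕP.≤-reflexive (cong (2 ℕ.^ a ℕ.+_) (sym (ℕP.+-identityʳ (2 ℕ.^ a)))))))

  -- 144 = 4·36: since k + 1 ≤ 36(τ + 1), the exponent K = 4(k + 1) is at most 144(τ + 1), and from
  -- τ = 12 on this is at most 2^τ = t.
  144≤2^ : ∀ j → suc (j ℕ.+ 12) ℕ.* 144 ℕ.≤ 2 ℕ.^ (j ℕ.+ 12)
  144≤2^ zero = ℕP.≤ᵇ⇒≤ 1872 4096 _
  144≤2^ (suc j) = linear≤2^-step 144 (j ℕ.+ 12) (144≤2^ j)

  J-double : ∀ c L → 1 ℕ.≤ L → suc L ℕ.* c ℕ.* (suc L ℕ.* c) ℕ.* suc L ℕ.≤ (L ℕ.+ L) ℕ.* c ℕ.* ((L ℕ.+ L) ℕ.* c) ℕ.* (L ℕ.+ L)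
  J-double c L p = ℕP.*-mono-≤ (ℕP.*-mono-≤ q q) (suc≤double p)
    where
    q : suc L ℕ.* c ℕ.≤ (L ℕ.+ L) ℕ.* c
    q = ℕP.*-monoˡ-≤ c (suc≤double p)

  -- Here k is the binary logarithm of n and s its cube root, both rounded down. The 36 is 3·12: τ =
  -- ⌊k/36⌋ gives t³⁶ ≤ n, hence t¹² ≤ s. L is determined by J₀ L ≤ τ < J₀ (L + 1), so that L³ is of
  -- order log n with a small constant.
  module Choice (n k τ L s h0 : ℕ)
    (k≥ : k₀ ℕ.≤ k)
    (n≥ : 2 ℕ.^ k ℕ.≤ n) (n< : n ℕ.< 2 ℕ.^ suc k)
    (τ≤ : τ ℕ.* 36 ℕ.≤ k) (τ> : k ℕ.< suc τ ℕ.* 36)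
    (L≤ : J₀ L ℕ.≤ τ) (L> : τ ℕ.< J₀ (suc L))
    (s≤ : s ℕ.* s ℕ.* s ℕ.≤ n) (s> : n ℕ.< suc s ℕ.* suc s ℕ.* suc s)
    (h≤ : h0 ℕ.* (M₁ ℕ.* suc k ℕ.* 2) ℕ.≤ n) (h> : n ℕ.< suc h0 ℕ.* (M₁ ℕ.* suc k ℕ.* 2)) where

    K₁ : ℕ
    K₁ = suc k ℕ.* 4

    open Params n s L τ K₁ M₁ k h0 using (w; t; Facts₀)

    τ≥J : J₀ 1 ℕ.≤ τ
    τ≥J = ℕ.s≤s⁻¹ (ℕP.*-cancelʳ-< 36 (J₀ 1) (suc τ) (ℕP.≤-<-trans (ℕP.≤-trans (ℕP.≤-reflexive (sym k₀-def)) k≥) τ>))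

    τ≥12 : 12 ℕ.≤ τ
    τ≥12 = ℕP.≤-trans 12≤J₀ τ≥J

    τ≥1 : 1 ℕ.≤ τ
    τ≥1 = ℕP.≤-trans (ℕ.s≤s ℕ.z≤n) τ≥12

    L≥1 : 1 ℕ.≤ L
    L≥1 = go L L>
      where
      go : ∀ a → τ ℕ.< J₀ (suc a) → 1 ℕ.≤ a
      go zero p = ⊥-elim (ℕP.<-irrefl refl (ℕP.<-≤-trans p τ≥J))
      go (suc a) p = ℕ.s≤s ℕ.z≤n

    L³≤J : L ℕ.* L ℕ.* L ℕ.≤ J₀ L
    L³≤J = cubes 1024 (ℕ.s≤s ℕ.z≤n)
      where
      cubes : ∀ c → 1 ℕ.≤ c → L ℕ.* L ℕ.* L ℕ.≤ L ℕ.* c ℕ.* (L ℕ.* c) ℕ.* L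
      cubes c p = ℕP.*-monoˡ-≤ L (ℕP.*-mono-≤ (L≤Lc c p) (L≤Lc c p))
        where
        L≤Lc : ∀ c → 1 ℕ.≤ c → L ℕ.≤ L ℕ.* c
        L≤Lc c p = ℕP.≤-trans (ℕP.≤-reflexive (sym (ℕP.*-identityʳ L))) (ℕP.*-monoʳ-≤ L p)

    L≤L³ : L ℕ.≤ L ℕ.* L ℕ.* L
    L≤L³ = ℕP.≤-trans (ℕP.≤-reflexive (sym (ℕP.*-identityˡ L))) (ℕP.*-monoˡ-≤ L (ℕP.*-mono-≤ L≥1 L≥1))

    t₁ : ℕ
    t₁ = 2 ℕ.^ τ

    t₁≡ : ι t₁ ≡ t
    t₁≡ = ι-pow 2 τ

    12τ : ℕ
    12τ = 12 ℕ.* τ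

    t¹²≤s : 2 ℕ.^ 12τ ℕ.≤ s
    t¹²≤s = ℕ.s≤s⁻¹ (cube-reflect-< (ℕP.≤-<-trans (ℕP.≤-trans (ℕP.≤-reflexive (trans (cong (ℕ._* 2 ℕ.^ 12τ) (sym (ℕP.^-distribˡ-+-* 2 12τ 12τ))) (sym (ℕP.^-distribˡ-+-* 2 (12τ ℕ.+ 12τ) 12τ))))
        (ℕP.≤-trans (ℕP.^-monoʳ-≤ 2 (ℕP.≤-trans (ℕP.≤-reflexive (l τ)) τ≤)) n≥)) s>))
      where l : ∀ τ → 12 ℕ.* τ ℕ.+ 12 ℕ.* τ ℕ.+ 12 ℕ.* τ ≡ τ ℕ.* 36
            l = solveℕ

    s≥1 : 1 ℕ.≤ s
    s≥1 = ℕP.≤-trans (ℕP.^-monoʳ-≤ 2 {0} {12τ} ℕ.z≤n) t¹²≤s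

    s≤n : s ℕ.≤ n
    s≤n = ℕP.≤-trans (ℕP.≤-trans (ℕP.≤-reflexive (sym (ℕP.*-identityˡ s))) (ℕP.*-monoˡ-≤ s (ℕP.*-mono-≤ s≥1 s≥1))) s≤

    K≤t₁ : K₁ ℕ.≤ t₁
    K≤t₁ = ℕP.≤-trans (ℕP.*-monoˡ-≤ 4 τ>) (ℕP.≤-trans (ℕP.≤-reflexive (l (suc τ))) (subst (λ a → suc a ℕ.* 144 ℕ.≤ 2 ℕ.^ a) {τ ℕ.∸ 12 ℕ.+ 12} {τ} (ℕP.m∸n+n≡m τ≥12) (144≤2^ (τ ℕ.∸ 12))))
      where l : ∀ a → a ℕ.* 36 ℕ.* 4 ≡ a ℕ.* 144
            l = solveℕ

    M≤t₁ : M₁ ℕ.≤ t₁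
    M≤t₁ = ℕP.≤-trans M₁≤ (ℕP.^-monoʳ-≤ 2 (ℕP.≤-trans 37≤J₀ τ≥J))

    w≤n : w ℕ.≤ n
    w≤n = ℕP.≤-trans (ℕP.≤-reflexive (ℕP.*-assoc M₁ (suc k) 2)) (ℕP.≤-trans (ℕP.*-mono-≤ M≤t₁ (ℕP.≤-trans (ℕP.*-monoʳ-≤ (suc k) {2} {4} (ℕP.m≤m+n 2 2)) K≤t₁))
        (ℕP.≤-trans (ℕP.≤-reflexive (sym (ℕP.^-distribˡ-+-* 2 τ τ))) (ℕP.≤-trans (ℕP.^-monoʳ-≤ 2 2τ) (ℕP.≤-trans t¹²≤s s≤n))))
      where
      2τ : τ ℕ.+ τ ℕ.≤ 12τ
      2τ = ℕP.≤-trans (ℕP.≤-reflexive (cong (τ ℕ.+_) (sym (ℕP.+-identityʳ τ)))) (ℕP.*-monoˡ-≤ τ {2} {12} (ℕP.m≤m+n 2 10))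

    h0≥1 : 1 ℕ.≤ h0
    h0≥1 = go h0 h>
      where
      go : ∀ a → n ℕ.< suc a ℕ.* w → 1 ℕ.≤ a
      go zero p = ⊥-elim (ℕP.<-irrefl refl (ℕP.<-≤-trans p (ℕP.≤-trans (ℕP.≤-reflexive (ℕP.*-identityˡ w)) w≤n)))
      go (suc a) p = ℕ.s≤s ℕ.z≤n

    n≤2wh : n ℕ.≤ 2 ℕ.* (w ℕ.* h0)
    n≤2wh = ℕP.≤-trans (ℕP.<⇒≤ h>) (ℕP.≤-trans (ℕP.*-monoˡ-≤ w (suc≤double h0≥1)) (ℕP.≤-reflexive (l h0 w)))
      where l : ∀ a w → (a ℕ.+ a) ℕ.* w ≡ 2 ℕ.* (w ℕ.* a)
            l = solveℕ

    n≤8s³ : n ℕ.≤ 8 ℕ.* (s ℕ.* s ℕ.* s)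
    n≤8s³ = ℕP.≤-trans (ℕP.<⇒≤ s>) (ℕP.≤-trans (cube-mono (suc≤double s≥1)) (ℕP.≤-reflexive (l s)))
      where l : ∀ a → (a ℕ.+ a) ℕ.* (a ℕ.+ a) ℕ.* (a ℕ.+ a) ≡ 8 ℕ.* (a ℕ.* a ℕ.* a)
            l = solveℕ

    suc-k≤ : suc k ℕ.* 128 ℕ.≤ M₁ ℕ.* (L ℕ.* L ℕ.* L)
    suc-k≤ = ℕP.≤-trans (ℕP.*-monoˡ-≤ 128 (ℕP.≤-trans τ> (ℕP.*-monoˡ-≤ 36 (ℕP.≤-trans (suc≤double τ≥1) (ℕP.+-mono-≤ τ≤J τ≤J)))))
        (ℕP.≤-reflexive (trans (l 1024 8 72 L) (cong (ℕ._* (L ℕ.* L ℕ.* L)) {1024 ℕ.* 1024 ℕ.* 8 ℕ.* 72 ℕ.* 128} {M₁} (sym M₁-def))))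
      where
      Q : ℕ → ℕ
      Q c = (L ℕ.+ L) ℕ.* c ℕ.* ((L ℕ.+ L) ℕ.* c) ℕ.* (L ℕ.+ L)
      τ≤J : τ ℕ.≤ Q 1024
      τ≤J = ℕP.≤-trans (ℕP.<⇒≤ L>) (J-double 1024 L L≥1)
      l : ∀ c d e L → ((L ℕ.+ L) ℕ.* c ℕ.* ((L ℕ.+ L) ℕ.* c) ℕ.* (L ℕ.+ L) ℕ.+ (L ℕ.+ L) ℕ.* c ℕ.* ((L ℕ.+ L) ℕ.* c) ℕ.* (L ℕ.+ L)) ℕ.* 36 ℕ.* 128
          ≡ c ℕ.* c ℕ.* 8 ℕ.* 72 ℕ.* 128 ℕ.* (L ℕ.* L ℕ.* L)
      l = solveℕ

    log≥ : k ℕ.≤ ⌊log₂ n ⌋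
    log≥ = ℕP.≤-trans (ℕP.≤-reflexive (sym (⌊log₂[2^n]⌋≡n k))) (⌊log₂⌋-mono-≤ n≥)

    τ≤k : τ ℕ.≤ k
    τ≤k = ℕP.≤-trans (ℕP.≤-trans (ℕP.≤-reflexive (sym (ℕP.*-identityʳ τ))) (ℕP.*-monoʳ-≤ τ {1} {36} (ℕP.m≤m+n 1 35))) τ≤

    ι³ : ∀ a → ι (a ℕ.* a ℕ.* a) ≡ ι a * ι a * ι a
    ι³ a = trans (ι-* (a ℕ.* a) a) (cong (_* ι a) (ι-* a a))

    facts : Facts₀
    facts = record
      { sN = ≤-trans (≤-reflexive (sym (ι³ s))) (ι-mono s≤)
      ; Ns = ≤-trans (ι-mono n≤8s³) (≤-reflexive (trans (ι-* 8 (s ℕ.* s ℕ.* s)) (cong (ι 8 *_) (ι³ s))))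
      ; ts = ≤-trans (≤-reflexive (trans (sym (pow-pow (ι 2) 12 τ)) (sym (ι-pow 2 12τ)))) (ι-mono t¹²≤s)
      ; L1 = ι-mono L≥1
      ; Lt = ≤-trans (ι-mono (ℕP.≤-trans (ℕP.≤-trans L≤L³ (ℕP.≤-trans L³≤J L≤)) (ℕP.<⇒≤ (n<2^n τ)))) (≤-reflexive t₁≡)
      ; K1 = ι-mono {1} {K₁} (ℕ.s≤s ℕ.z≤n)
      ; Kt = ≤-trans (ι-mono K≤t₁) (≤-reflexive t₁≡)
      ; t0 = ≤-trans (ι-mono (ℕP.^-monoʳ-≤ 2 {10} {τ} (ℕP.≤-trans (ℕP.m≤m+n 10 2) τ≥12))) (≤-reflexive t₁≡)
      ; Jτ = L≤
      ; Mℓ = ≤-trans (≤-reflexive (trans (sym (ι-* 128 (suc k))) (cong ι (ℕP.*-comm 128 (suc k))))) (≤-trans (ι-mono suc-k≤) (≤-reflexive (trans (ι-* M₁ (L ℕ.* L ℕ.* L)) (cong (ι M₁ *_) (ι³ L)))))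
      ; M2 = ι-mono M₁≥2
      ; h1 = ι-mono h0≥1
      ; Nw = ≤-trans (ι-mono n≤2wh) (≤-reflexive (trans (ι-* 2 (w ℕ.* h0)) (cong (ι 2 *_) (ι-* w h0)))) }

    conclusion : ∀ ε → ι 11 ≤ ι n * ε → 1ℚ - ε ≤ processProb n (λ G → maxDegree G ℕ.^ 3 ℕ.≤ᵇ (8 ℕ.+ M₁) ℕ.^ 3 ℕ.* (n ℕ.* ⌊log₂ n ⌋))
    conclusion = Conclude.likely n s L τ K₁ M₁ k h0 facts (ℕP.≤-trans (ℕP.≤-reflexive (ℕP.*-comm w h0)) h≤)
       (≤-trans (ι-mono (ℕP.<⇒≤ n<)) (≤-reflexive (ι-pow 2 (suc k)))) refl s≤ (ℕP.≤-trans L³≤J (ℕP.≤-trans L≤ (ℕP.≤-trans τ≤k log≥)))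

  m≤m*m³ : ∀ a c → 1 ℕ.≤ c → a ℕ.≤ a ℕ.* c ℕ.* (a ℕ.* c) ℕ.* a
  m≤m*m³ zero c p = ℕ.z≤n
  m≤m*m³ (suc a) c p = ℕP.≤-trans (ℕP.≤-reflexive (sym (ℕP.*-identityˡ (suc a)))) (ℕP.*-monoˡ-≤ (suc a) (ℕP.*-mono-≤ ac ac))
    where
    ac : 1 ℕ.≤ suc a ℕ.* c
    ac = ℕP.*-mono-≤ (ℕ.s≤s (ℕ.z≤n {a})) p

  eventually : ∀ n → 2 ℕ.^ k₀ ℕ.≤ n → ∀ ε → ι 11 ≤ ι n * ε → 1ℚ - ε ≤ processProb n (λ G → maxDegree G ℕ.^ 3 ℕ.≤ᵇ (8 ℕ.+ M₁) ℕ.^ 3 ℕ.* (n ℕ.* ⌊log₂ n ⌋))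
  eventually n n≥k₀ = go₁ (bracket (2 ℕ.^_) n n (ℕP.≤-trans (ℕP.^-monoʳ-≤ 2 {0} {k₀} ℕ.z≤n) n≥k₀) (n<2^n n))
    where
    Goal : Set
    Goal = ∀ ε → ι 11 ≤ ι n * ε → 1ℚ - ε ≤ processProb n (λ G → maxDegree G ℕ.^ 3 ℕ.≤ᵇ (8 ℕ.+ M₁) ℕ.^ 3 ℕ.* (n ℕ.* ⌊log₂ n ⌋))
    self : ∀ a {b} → 1 ℕ.≤ b → a ℕ.≤ a ℕ.* b
    self a {b} p = ℕP.≤-trans (ℕP.≤-reflexive (sym (ℕP.*-identityʳ a))) (ℕP.*-monoʳ-≤ a p)
    go₁ : (∃ λ k → (2 ℕ.^ k ℕ.≤ n) × (n ℕ.< 2 ℕ.^ suc k)) → Goal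
    go₁ (k , n≥ , n<) = go₂ (bracket (ℕ._* 36) k (suc k) ℕ.z≤n (self (suc k) (ℕ.s≤s ℕ.z≤n)))
      where
      w≥1 : 1 ℕ.≤ M₁ ℕ.* suc k ℕ.* 2
      w≥1 = ℕP.*-mono-≤ (ℕP.*-mono-≤ (ℕP.≤-trans (ℕP.m≤m+n 1 1) M₁≥2) (ℕ.s≤s (ℕ.z≤n {k}))) (ℕP.m≤m+n 1 1)
      go₂ : (∃ λ τ → (τ ℕ.* 36 ℕ.≤ k) × (k ℕ.< suc τ ℕ.* 36)) → Goal
      go₂ (τ , τ≤ , τ>) = go₃ (bracket J₀ τ (suc τ) ℕ.z≤n (m≤m*m³ (suc τ) 1024 (ℕ.s≤s ℕ.z≤n)))
         (bracket (λ a → a ℕ.* a ℕ.* a) n (suc n) ℕ.z≤n (ℕP.≤-trans (self (suc n) (ℕ.s≤s (ℕ.z≤n {n}))) (self (suc n ℕ.* suc n) (ℕ.s≤s (ℕ.z≤n {n})))))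
         (bracket (ℕ._* (M₁ ℕ.* suc k ℕ.* 2)) n (suc n) ℕ.z≤n (self (suc n) w≥1))
        where
        go₃ : (∃ λ L → (J₀ L ℕ.≤ τ) × (τ ℕ.< J₀ (suc L))) → (∃ λ s → (s ℕ.* s ℕ.* s ℕ.≤ n) × (n ℕ.< suc s ℕ.* suc s ℕ.* suc s))
            → (∃ λ h → (h ℕ.* (M₁ ℕ.* suc k ℕ.* 2) ℕ.≤ n) × (n ℕ.< suc h ℕ.* (M₁ ℕ.* suc k ℕ.* 2))) → Goal
        go₃ (L , L≤ , L>) (s , s≤ , s>) (h0 , h≤ , h>) = Choice.conclusion n k τ L s h0 (ℕ.s≤s⁻¹ (^-reflect-< (ℕP.≤-<-trans n≥k₀ n<))) n≥ n< τ≤ τ> L≤ L> s≤ s> h≤ h>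

  -- A positive rational is at least the reciprocal of its denominator, so 11 times the denominator
  -- is a valid threshold.
  archimedean : ∀ ε → Positive ε → ∃ λ a → ∀ n → a ℕ.≤ n → ι 11 ≤ ι n * ε
  archimedean (mkℚ (ℤ.+ suc a) d c) pos = 11 ℕ.* suc d , λ n p → ≤-trans bound (mulʳ (<⇒≤ (ℚP.positive⁻¹ ε {{pos}})) (ι-mono p))
    where
    ε = mkℚ (ℤ.+ suc a) d c
    r≤ε : (ℤ.+ 1 / suc d) ≤ ε
    r≤ε = ℚP.toℚᵘ-cancel-≤ (ℚᵘP.≤-respˡ-≃ (ℚᵘP.≃-sym (ℚP.toℚᵘ-fromℚᵘ (ℚᵘ.mkℚᵘ (ℤ.+ 1) d))) (ℚᵘ.*≤* (ℤP.*-monoʳ-≤-nonNeg (ℤ.+ suc d) {ℤ.+ 1} {ℤ.+ suc a} (ℤ.+≤+ (ℕ.s≤s ℕ.z≤n)))))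
    bound : ι 11 ≤ ι (11 ℕ.* suc d) * ε
    bound = ≤-trans (≤-reflexive (trans (sym (ℚP.*-identityʳ (ι 11))) (trans (cong (ι 11 *_) (sym (recip d))) (trans (sym (ℚP.*-assoc (ι 11) (ι (suc d)) (ℤ.+ 1 / suc d))) (cong (_* (ℤ.+ 1 / suc d)) (sym (ι-* 11 (suc d))))))))
       (mulˡ (0≤ι (11 ℕ.* suc d)) r≤ε)

  -- The cube of κ = 8 + M₁: the bound on the maximum degree is cubed so that no cube root has to be
  -- formed.
  Kᶜ : ℕ
  Kᶜ = (8 ℕ.+ M₁) ℕ.^ 3

  Kᶜ≥1 : 1 ℕ.≤ Kᶜ
  Kᶜ≥1 = ℕP.^-monoˡ-≤ 3 {1} {8 ℕ.+ M₁} (ℕ.s≤s ℕ.z≤n)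

  threshold : ∀ ε → Positive ε → ℕ
  threshold ε pos = 2 ℕ.^ k₀ ℕ.⊔ proj₁ (archimedean ε pos)

  beyond : ∀ ε pos n → threshold ε pos ℕ.≤ n → 1ℚ - ε ≤ processProb n (λ G → maxDegree G ℕ.^ 3 ℕ.≤ᵇ Kᶜ ℕ.* (n ℕ.* ⌊log₂ n ⌋))
  beyond ε pos n p = eventually n (ℕP.≤-trans (ℕP.m≤m⊔n (2 ℕ.^ k₀) (proj₁ (archimedean ε pos))) p) ε
    (proj₂ (archimedean ε pos) n (ℕP.≤-trans (ℕP.m≤n⊔m (2 ℕ.^ k₀) (proj₁ (archimedean ε pos))) p))

open import Data.Nat using (ℕ; _≤_; _*_; _^_; _≤ᵇ_)
open import Data.Nat.Logarithm using (⌊log₂_⌋)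
open import Data.Product using (Σ; _×_; _,_)
open import Data.Rational using (ℚ; Positive; 1ℚ) renaming (_≤_ to _≤ℚ_; _-_ to _-ℚ_)

theorem1p1 : Σ ℕ (λ K → (1 ≤ K) × ((ε : ℚ) → Positive ε → Σ ℕ (λ N → (n : ℕ) → N ≤ n →
    (1ℚ -ℚ ε) ≤ℚ processProb n (λ G → maxDegree G ^ 3 ≤ᵇ K * (n * ⌊log₂ n ⌋)))))
theorem1p1 = Development.Kᶜ , Development.Kᶜ≥1 , λ ε pos → Development.threshold ε pos , Development.beyond ε pos
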